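{- Let $G$ be a finite graph whose vertex set $V$ is partitioned into $V_1 \sqcup V_2 \sqcup \dots \sqcup V_m$. (a) Suppose there is a prime power $q \ge 2$ with $|V_j| \ge q-1$ for all $j$ and $|V| \ge (q-1)(m+2)+1$. Suppose further that after deleting the edges of some simple path from $G$, every vertex $v \in V$ satisfies $2N(v) + N^2(v) < q$ (computed in the graph with the path edges deleted). Then $G$ admits an almost fair splitting by $q$ independent sets. (b) Let $q \ge 2$ be a prime with $|V_j| \ge q-1$ for all $j$. Suppose $G$ has $(q-1)n+1$ vertices for some integer $n \ge m+1$ and is the edge-disjoint union of a path and pairwise vertex-disjoint cliques of size $q-1$. Then $G$ admits an almost fair splitting by $q$ independent sets.
   Context: For a vertex $v$, $N(v)$ denotes the number of neighbors of $v$, and $N^2(v)$ denotes the number of vertices at distance exactly two from $v$. A set of vertices is independent if it contains no two endpoints of an edge of $G$. Given the partition, pairwise disjoint sets $S_1, \dots, S_q \subseteq V$ form an almost fair splitting if $|S_i \cap V_j| \ge \lfloor \frac{|V_j|+1}{q} \rfloor - 1$ for all $i,j$ and $|V_j \setminus \bigcup_i S_i| \le q-1$ for all $j$. -}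

module Defs where

open import Data.Nat using (ℕ; zero; suc; _+_; _*_; _∸_; _^_; _≤_; _<_; _≥_)
open import Data.Nat.DivMod using (_/_)
open import Data.Nat.Primality using (Prime)
open import Data.Bool using (Bool; true; false; _∧_; _∨_; not)
open import Data.Fin using (Fin; zero; suc; inject₁; _≟_)
open import Data.Fin.Subset using (Subset; _∈_; _∩_; _─_; ⋃; ∣_∣)
open import Data.Vec using (tabulate)
import Data.List as List
open import Data.Product using (Σ; ∃; _×_; _,_)
open import Relation.Nullary using (¬_)
open import Relation.Nullary.Decidable using (⌊_⌋)
open import Relation.Binary.PropositionalEquality using (_≡_; _≢_)
open import Function using (_∘_; Injective)

record Graph (N : ℕ) : Set where
  field
    adj     : Fin N → Fin N → Bool
    sym     : ∀ u v → adj u v ≡ adj v u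
    irrefl  : ∀ v → adj v v ≡ false
open Graph public

anyFin : ∀ {k} → (Fin k → Bool) → Bool
anyFin {zero}  f = false
anyFin {suc k} f = f zero ∨ anyFin (f ∘ suc)

count : ∀ {k} → (Fin k → Bool) → ℕ
count {zero}  f = 0
count {suc k} f = (if f zero then 1 else 0) + count (f ∘ suc)
  where open import Data.Bool using (if_then_else_)

eqB : ∀ {N} → Fin N → Fin N → Bool
eqB u v = ⌊ u ≟ v ⌋

nbrCount : ∀ {N} → (Fin N → Fin N → Bool) → Fin N → ℕ
nbrCount a v = count (λ u → a v u)

dist2Count : ∀ {N} → (Fin N → Fin N → Bool) → Fin N → ℕ
dist2Count a v =
  count (λ u → not (eqB u v) ∧ not (a v u) ∧ anyFin (λ w → a v w ∧ a w u))

record SimplePath {N : ℕ} (G : Graph N) : Set where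
  field
    len   : ℕ
    vtx   : Fin (suc len) → Fin N
    inj   : Injective _≡_ _≡_ vtx
    steps : ∀ (i : Fin len) → adj G (vtx (inject₁ i)) (vtx (suc i)) ≡ true
open SimplePath public

pathEdge : ∀ {N} {G : Graph N} → SimplePath G → Fin N → Fin N → Bool
pathEdge P u v = anyFin (λ i →
  (eqB u (vtx P (inject₁ i)) ∧ eqB v (vtx P (suc i)))
  ∨ (eqB v (vtx P (inject₁ i)) ∧ eqB u (vtx P (suc i))))

deletePath : ∀ {N} (G : Graph N) → SimplePath G → Fin N → Fin N → Bool
deletePath G P u v = adj G u v ∧ not (pathEdge P u v)

partSet : ∀ {N m} → (Fin N → Fin m) → Fin m → Subset N
partSet part j = tabulate (λ v → eqB (part v) j)

IndependentSet : ∀ {N} → Graph N → Subset N → Set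
IndependentSet G S = ∀ u v → u ∈ S → v ∈ S → adj G u v ≡ false

PairwiseDisjoint : ∀ {N q} → (Fin q → Subset N) → Set
PairwiseDisjoint S = ∀ i i' v → v ∈ S i → v ∈ S i' → i ≡ i'

-- Almost fair splitting of the partition by q sets:
--   |S_i ∩ V_j| ≥ ⌊(|V_j|+1)/q⌋ - 1  (stated over ℕ as ⌊(|V_j|+1)/q⌋ ≤ |S_i ∩ V_j| + 1),
--   |V_j \ ⋃ S_i| ≤ q - 1.
AlmostFairSplitting : ∀ {N m} (part : Fin N → Fin m) (q : ℕ) .{{_ : Data.Nat.NonZero q}}
                      → (Fin q → Subset N) → Set
AlmostFairSplitting {N} {m} part q S =
  PairwiseDisjoint S
  × (∀ (i : Fin q) (j : Fin m) →
       (∣ partSet part j ∣ + 1) / q ≤ ∣ S i ∩ partSet part j ∣ + 1)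
  × (∀ (j : Fin m) →
       ∣ partSet part j ─ ⋃ (List.tabulate S) ∣ ≤ q ∸ 1)
  where import Data.Nat

AdmitsAFSIndep : ∀ {N m} (G : Graph N) (part : Fin N → Fin m) (q : ℕ) .{{_ : Data.Nat.NonZero q}} → Set
AdmitsAFSIndep G part q =
  Σ (Fin _ → Subset _) λ S → AlmostFairSplitting part q S × (∀ i → IndependentSet G (S i))
  where import Data.Nat

IsPrimePower : ℕ → Set
IsPrimePower q = Σ ℕ λ p → Σ ℕ λ k → Prime p × q ≡ p ^ suc k

IsPathPlusCliques : ∀ {N} (G : Graph N) → SimplePath G → (s t : ℕ) → (Fin t → Subset N) → Set
IsPathPlusCliques {N} G P s t C =
  (∀ c → ∣ C c ∣ ≡ s)
  × PairwiseDisjoint C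
  × (∀ u v → adj G u v ≡ (pathEdge P u v ∨ cliqueEdge u v))
  × (∀ u v → pathEdge P u v ≡ true → cliqueEdge u v ≡ false)
  where
    open import Data.Fin.Subset using () renaming (_∈_ to _∈'_)
    memB : Fin N → Subset N → Bool
    memB v S = Data.Vec.lookup S v
      where import Data.Vec
    cliqueEdge : Fin N → Fin N → Bool
    cliqueEdge u v = not (eqB u v) ∧ anyFin (λ c → memB u (C c) ∧ memB v (C c))

{-# OPTIONS --safe #-}

-- Order the vertices along the path, write q = p^k, and let (ℤ/p)^k act simply transitively on the
-- q colours.  Consider partial colourings in which conflicting vertices (joined by an edge off the
-- path) have different colours.  Let X = Σ ωᵢ (gᵢ - 1), where ω₁ = 1, ω₂, … are linearly independent over
-- F_p in a domain of characteristic p; then X^p = 0.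
--
-- Chains: there are chains c₀, …, c_{N-1} of partial colourings with ∂ c_n = ρ_n T_n c_{n-1}, where ρ_n ≠ 0
-- and T_n is X or X^(p-1) alternately.  In (a) the cycle T_n c_{n-1} is filled greedily: by
-- 2N(v) + N²(v) < q, deleting one coloured vertex at a time leaves a cone.  In (b) a clique of size
-- p - 1 carries rook placements in a (p - 1) × p board; the top-dimensional one gives an invariant
-- cycle, which is joined to what has been built before.
--
-- Labels: a flag of partial colourings gets a rank and a label.  If, in some class, the set of colours
-- reaching the threshold is neither empty nor everything at some step of the flag, the label is an
-- affine function on the colours derived from that set; otherwise it is the first colour, along the
-- path, of a thinned-out colouring, and the rank is its number of monochromatic runs.  Ranks grow
-- along flags, and equal rank forces equal label, unless a colouring with the desired properties
-- appears.  Ranks take fewer than N values, so without such a colouring every flag of N flags repeats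
-- a label.
--
-- Contradiction: there are cochains θ_n on label sequences, vanishing on sequences with a repetition,
-- with θ_{n+1} = d η_n and T_{n+1} η_n = κ_n θ_n, κ_n ≠ 0; the η_n exist because multiplication by a
-- label coordinate satisfies a Weyl relation with X.  Pulled back along the subdivision, θ_{N-1} has
-- non-zero value on c_{N-1}, while repeated labels would make it vanish.
module Submission where

open import Level using (0ℓ)
open import Algebra.Bundles using (CommutativeRing; Semiring)
import Algebra.Properties.Semiring.Mult as Mult
open import Data.Bool as Bool using (Bool; true; false; if_then_else_; _∧_; _∨_; not)
open import Data.Bool.ListAction using (any; all)
open import Data.Empty using (⊥-elim; ⊥)
open import Data.Fin as Fin using (zero; suc; toℕ; inject₁; Fin; fromℕ<)
open import Data.Fin.Permutation as Perm using (Permutation′)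
import Data.Fin.Permutation.Components as PC
import Data.Fin.Properties as Finₚ
open import Data.Integer as ℤ using (0ℤ; 1ℤ)
open import Data.Integer.Divisibility.Signed as ∣ using (∣⇒∣ᵤ)
import Data.Integer.Properties as ℤₚ
open import Data.List as List using (List; []; _∷_; _++_; length)
open import Data.List.Membership.Propositional.Properties using (∈-filter⁺; ∈-filter⁻)
import Data.List.Properties as Listₚ
import Data.List.Relation.Binary.Pointwise as LP
open import Data.List.Relation.Unary.All as All using (All; []; _∷_)
import Data.List.Relation.Unary.All.Properties as Allₚ
open import Data.List.Relation.Unary.AllPairs as AllPairs using (AllPairs; []; _∷_)
import Data.List.Relation.Unary.AllPairs.Properties as AllPairsₚ
open import Data.List.Relation.Unary.Any using (here; there)
import Data.List.Relation.Unary.Unique.Propositional.Properties as Uniqueₚ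
open import Data.Maybe as Maybe using (Maybe; just; nothing; is-just; maybe)
open import Data.Maybe.Properties using (just-injective)
open import Data.Nat as ℕ using (ℕ; zero; suc; _∸_; _<_; s≤s; z≤n; _/_; _≤_; _≡ᵇ_)
import Data.Nat.DivMod as ℕD
import Data.Nat.Divisibility as ℕ∣
open import Data.Nat.Primality using (Prime; euclidsLemma)
open import Data.Nat.Properties as ℕₚ using (+-cancelʳ-≤; +-cancelˡ-≤; +-mono-≤; +-monoʳ-≤; +-monoˡ-≤; m≤n+m; ≤-pred; ≤-refl; ≤-reflexive; ≤-trans; m≤m+n)
open import Data.Product using (Σ; _×_; _,_; proj₁; proj₂; ∃)
open import Data.Sum using (inj₁; inj₂; _⊎_)
open import Data.Unit using (⊤; tt)
open import Data.Vec as Vec using (Vec; []; _∷_; toList; lookup)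
import Data.Vec.Properties as Vecₚ
open import Data.Vec.Relation.Binary.Pointwise.Inductive as VP using (Pointwise; []; _∷_)
open import Function using (_∘_; case_of_)
open import Relation.Binary.PropositionalEquality as ≡ using (_≡_; cong; subst; _≢_; cong₂; subst₂)
open import Relation.Nullary using (¬_; yes; no; Dec)
open import Relation.Nullary.Decidable using (¬?; ⌊_⌋)

-- The single element X avoids this. On labels of slope χ its commutator with the constant term is
-- governed by Σ ωᵢ χᵢ, which is non-zero for every χ ≠ 0 because the ωᵢ are independent. Hence X
-- behaves like g - 1 for a generator g of a cyclic group of order p acting freely: ker X lies in im
-- X^(p-1) and ker X^(p-1) in im X, up to non-zero factors.
--
-- The count of ranks rests on N = 1 + α + m(q - 1). Thinning out leaves at least q - 1 vertices of
-- each class uncoloured, so at most α + 1 runs remain, and α + 1 only for a colouring as desired.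
-- The number of colours at the threshold takes at most q - 1 values strictly between 0 and q in
-- each class, which puts at most m(q - 1) ranks on top of α.
--
-- A label belongs to a flag and ranks compare a flag with its subflags; this is why the subdivision
-- is performed twice.

-- Integer-coefficient ring solver, binomial coefficients modulo a prime, Frobenius.

module RingPreliminaries where

  open import Data.Nat using (_!)
  open import Data.Nat.Primality using (prime⇒nonTrivial)
  open ℕ∣ using (_∣_; divides; ∣⇒≤; m∣m*n; ∣1⇒≡1)
  open ℕD using (m/n*n≡m)
  open import Data.Nat.Combinatorics using (_C_; nCk≡n!/k![n-k]!; nCn≡1; k![n∸k]!∣n!)
  open import Data.Fin using (fromℕ)
  open import Data.Integer using (ℤ; +_; -[1+_]; _⊖_; +[1+_])

  module ℤSolver (R : CommutativeRing 0ℓ 0ℓ) where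
    open CommutativeRing R hiding (zero)
    open import Algebra.Properties.Semiring.Mult semiring using (×-homo-+) renaming (_×_ to _⊠_)
    open import Algebra.Properties.Ring ring using (-0#≈0#; -‿distribˡ-*; -‿distribʳ-*; -‿involutive)
    open import Algebra.Properties.AbelianGroup +-abelianGroup using (⁻¹-∙-comm)
    open import Algebra.Solver.Ring.AlmostCommutativeRing using (fromCommutativeRing; _-Raw-AlmostCommutative⟶_)
    open import Relation.Binary.Reasoning.Setoid setoid

    fromℤ : ℤ → Carrier
    fromℤ (+ n)    = n ⊠ 1#
    fromℤ -[1+ n ] = - (suc n ⊠ 1#)

    private
      cancel-suc : ∀ a b → (1# + a) - (1# + b) ≈ a - b
      cancel-suc a b = begin
        (1# + a) - (1# + b)       ≈⟨ +-cong (+-comm _ _) (sym (⁻¹-∙-comm _ _)) ⟩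
        (a + 1#) + (- 1# + - b)   ≈⟨ +-assoc _ _ _ ⟩
        a + (1# + (- 1# + - b))   ≈⟨ +-congˡ (sym (+-assoc _ _ _)) ⟩
        a + ((1# - 1#) + - b)     ≈⟨ +-congˡ (+-congʳ (-‿inverseʳ 1#)) ⟩
        a + (0# + - b)            ≈⟨ +-congˡ (+-identityˡ _) ⟩
        a - b                     ∎

      fromℤ-⊖ : ∀ m n → fromℤ (m ⊖ n) ≈ (m ⊠ 1#) - (n ⊠ 1#)
      fromℤ-⊖ zero    zero    = sym (-‿inverseʳ 0#)
      fromℤ-⊖ zero    (suc n) = sym (+-identityˡ _)
      fromℤ-⊖ (suc m) zero    = sym (trans (+-congˡ -0#≈0#) (+-identityʳ _))
      fromℤ-⊖ (suc m) (suc n) = begin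
        fromℤ (suc m ⊖ suc n)           ≡⟨ cong fromℤ (ℤₚ.[1+m]⊖[1+n]≡m⊖n m n) ⟩
        fromℤ (m ⊖ n)                   ≈⟨ fromℤ-⊖ m n ⟩
        (m ⊠ 1#) - (n ⊠ 1#)             ≈⟨ cancel-suc _ _ ⟨
        (suc m ⊠ 1#) - (suc n ⊠ 1#)     ∎

      fromℤ-+ : ∀ i j → fromℤ (i ℤ.+ j) ≈ fromℤ i + fromℤ j
      fromℤ-+ (+ m)    (+ n)    = ×-homo-+ 1# m n
      fromℤ-+ (+ m)    -[1+ n ] = fromℤ-⊖ m (suc n)
      fromℤ-+ -[1+ m ] (+ n)    = trans (fromℤ-⊖ n (suc m)) (+-comm _ _)
      fromℤ-+ -[1+ m ] -[1+ n ] = trans (-‿cong (trans (reflexive (cong (λ k → suc k ⊠ 1#) (≡.sym (ℕₚ.+-suc m n)))) (×-homo-+ 1# (suc m) (suc n)))) (sym (⁻¹-∙-comm _ _))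

      fromℤ-neg : ∀ i → fromℤ (ℤ.- i) ≈ - fromℤ i
      fromℤ-neg (+ zero)  = sym -0#≈0#
      fromℤ-neg (+[1+ n ]) = refl
      fromℤ-neg -[1+ n ]  = sym (-‿involutive _)

      fromℤ-*⁺ : ∀ m j → fromℤ (+ m ℤ.* j) ≈ (m ⊠ 1#) * fromℤ j
      fromℤ-*⁺ zero    j = trans (reflexive (cong fromℤ (ℤₚ.*-zeroˡ j))) (sym (zeroˡ _))
      fromℤ-*⁺ (suc m) j = begin
        fromℤ (+ suc m ℤ.* j)             ≡⟨ cong fromℤ (ℤₚ.suc-* (+ m) j) ⟩
        fromℤ (j ℤ.+ + m ℤ.* j)           ≈⟨ fromℤ-+ j (+ m ℤ.* j) ⟩
        fromℤ j + fromℤ (+ m ℤ.* j)       ≈⟨ +-cong (sym (*-identityˡ _)) (fromℤ-*⁺ m j) ⟩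
        1# * fromℤ j + (m ⊠ 1#) * fromℤ j ≈⟨ distribʳ _ _ _ ⟨
        (suc m ⊠ 1#) * fromℤ j            ∎

      fromℤ-* : ∀ i j → fromℤ (i ℤ.* j) ≈ fromℤ i * fromℤ j
      fromℤ-* (+ m)    j = fromℤ-*⁺ m j
      fromℤ-* -[1+ m ] j = begin
        fromℤ (-[1+ m ] ℤ.* j)       ≡⟨ cong fromℤ (≡.sym (ℤₚ.neg-distribˡ-* (+ suc m) j)) ⟩
        fromℤ (ℤ.- (+ suc m ℤ.* j))  ≈⟨ fromℤ-neg (+ suc m ℤ.* j) ⟩
        - fromℤ (+ suc m ℤ.* j)      ≈⟨ -‿cong (fromℤ-*⁺ (suc m) j) ⟩
        - ((suc m ⊠ 1#) * fromℤ j)   ≈⟨ -‿distribˡ-* _ _ ⟩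
        fromℤ -[1+ m ] * fromℤ j     ∎

      -- Integers that coincide in `R` only because of its characteristic may be reported as
      -- different; this makes the solver incomplete but not unsound.
      weak≟ : ∀ i j → Maybe (fromℤ i ≈ fromℤ j)
      weak≟ i j with i ℤ.≟ j
      ... | yes i≡j = just (reflexive (cong fromℤ i≡j))
      ... | no  _   = nothing

      morphism : ℤ.+-*-rawRing -Raw-AlmostCommutative⟶ fromCommutativeRing R
      morphism = record
        { ⟦_⟧ = fromℤ ; +-homo = fromℤ-+ ; *-homo = fromℤ-* ; -‿homo = fromℤ-neg
        ; 0-homo = refl ; 1-homo = +-identityʳ 1# }

    open import Algebra.Solver.Ring ℤ.+-*-rawRing (fromCommutativeRing R) morphism weak≟ public
      using (solve; _:+_; _:*_; _:-_; :-_; _:=_; con)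

  prime∤! : ∀ {p} → Prime p → ∀ k → k < p → ¬ p ∣ k !
  prime∤! {p} pr zero    _   p∣1 = ℕ.nonTrivial⇒≢1 ⦃ prime⇒nonTrivial pr ⦄ (∣1⇒≡1 p∣1)
  prime∤! {p} pr (suc k) k<p p∣k with euclidsLemma (suc k) (k !) pr p∣k
  ... | inj₁ p∣1+k = ℕₚ.<⇒≱ k<p (∣⇒≤ p∣1+k)
  ... | inj₂ p∣k!  = prime∤! pr k (ℕₚ.<-trans (ℕₚ.n<1+n k) k<p) p∣k!

  -- The prime divides `p !`, which is the binomial coefficient times two factorials of smaller
  -- numbers, and it divides neither factorial.
  prime∣C : ∀ {p} → Prime p → ∀ k → 0 < k → k < p → p ∣ p C k
  prime∣C {suc p′} pr (suc k) _ k<p with euclidsLemma (suc p′ C suc k) (suc k ! ℕ.* (suc p′ ∸ suc k) !) pr p∣prod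
    where
    p∣prod : suc p′ ∣ (suc p′ C suc k) ℕ.* (suc k ! ℕ.* (suc p′ ∸ suc k) !)
    p∣prod = subst (suc p′ ∣_) (≡.sym (≡.trans
        (cong (ℕ._* (suc k ! ℕ.* (suc p′ ∸ suc k) !)) (nCk≡n!/k![n-k]! (ℕₚ.<⇒≤ k<p)))
        (m/n*n≡m {{ℕₚ._!*_!≢0 (suc k) (suc p′ ∸ suc k)}} (k![n∸k]!∣n! (ℕₚ.<⇒≤ k<p)))))
      (m∣m*n (p′ !))
  ... | inj₁ d = d
  ... | inj₂ d with euclidsLemma (suc k !) ((suc p′ ∸ suc k) !) pr d
  ...   | inj₁ d₁ = ⊥-elim (prime∤! pr (suc k) k<p d₁)
  ...   | inj₂ d₂ = ⊥-elim (prime∤! pr (p′ ∸ k) (s≤s (ℕₚ.m∸n≤m p′ k)) d₂)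

  module Frobenius (S : Semiring 0ℓ 0ℓ) {p : ℕ} (pr : Prime p)
    (char : ∀ x → Semiring._≈_ S (Mult._×_ S p x) (Semiring.0# S)) where
    open Semiring S hiding (zero)
    open import Algebra.Properties.Semiring.Mult S renaming (_×_ to _⊠_)
    open import Algebra.Properties.Semiring.Exp S
    open import Algebra.Properties.Semiring.Sum S using (sum; sum-init-last; sum-cong-≋; sum-replicate-zero)
    open import Relation.Binary.Reasoning.Setoid setoid
    import Algebra.Properties.Semiring.Binomial S as Binomial

    multiple≈0 : ∀ {n} x → p ∣ n → n ⊠ x ≈ 0#
    multiple≈0 x (divides c ≡.refl) = trans (×-congˡ (ℕₚ.*-comm c p)) (trans (sym (×-assocˡ x p c)) (char (c ⊠ x)))

    -- Multiplication in `S` need not commute, only `x` and `y` must; this is what allows the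
    -- identity to be used for operators.
    ^-distrib-+ : ∀ x y → x * y ≈ y * x → (x + y) ^ p ≈ x ^ p + y ^ p
    ^-distrib-+ x y xy = go p pr ≡.refl
      where
      open Binomial x y
      go : ∀ n → Prime n → n ≡ p → (x + y) ^ p ≈ x ^ p + y ^ p
      go (suc n) _ ≡.refl = begin
        (x + y) ^ suc n                                          ≈⟨ theorem xy (suc n) ⟩
        t zero + sum (λ i → t (suc i))                           ≈⟨ +-congˡ (sum-init-last (λ i → t (suc i))) ⟩
        t zero + (sum (λ i → t (suc (inject₁ i))) + t (fromℕ (suc n)))  ≈⟨ +-congˡ (+-congʳ (trans (sum-cong-≋ mid) (sum-replicate-zero n))) ⟩
        t zero + (0# + t (fromℕ (suc n)))                        ≈⟨ +-cong first (trans (+-identityˡ _) last) ⟩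
        y ^ suc n + x ^ suc n                                    ≈⟨ +-comm _ _ ⟩
        x ^ suc n + y ^ suc n                                    ∎
        where
        t = binomialTerm (suc n)
        first : t zero ≈ y ^ suc n
        first = trans (×-homo-1 _) (*-identityˡ _)
        last : t (fromℕ (suc n)) ≈ x ^ suc n
        last = begin
          (suc n C toℕ (fromℕ (suc n))) ⊠ (x ^ toℕ (fromℕ (suc n)) * y ^ (suc n ∸ toℕ (fromℕ (suc n))))
            ≡⟨ cong (λ k → (suc n C k) ⊠ (x ^ k * y ^ (suc n ∸ k))) (Finₚ.toℕ-fromℕ (suc n)) ⟩
          (suc n C suc n) ⊠ (x ^ suc n * y ^ (suc n ∸ suc n))
            ≡⟨ ≡.cong₂ (λ a b → a ⊠ (x ^ suc n * y ^ b)) (nCn≡1 (suc n)) (ℕₚ.n∸n≡0 (suc n)) ⟩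
          1 ⊠ (x ^ suc n * 1#) ≈⟨ trans (×-homo-1 _) (*-identityʳ _) ⟩
          x ^ suc n ∎
        mid : ∀ i → t (suc (inject₁ i)) ≈ 0#
        mid i = multiple≈0 _ (prime∣C pr (toℕ (suc (inject₁ i))) (s≤s z≤n)
                  (subst (λ k → suc k < suc n) (≡.sym (Finₚ.toℕ-inject₁ i)) (s≤s (Finₚ.toℕ<n i))))

-- Linear operators on function spaces and the Weyl relation.

module OperatorAlgebra where

  open RingPreliminaries

  iter : ∀ {A : Set} → ℕ → (A → A) → A → A
  iter zero    f a = a
  iter (suc n) f a = f (iter n f a)

  iter-shift : ∀ {A : Set} n (f : A → A) a → iter n f (f a) ≡ f (iter n f a)
  iter-shift zero    f a = ≡.refl
  iter-shift (suc n) f a = cong f (iter-shift n f a)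

  module Operators (R : CommutativeRing 0ℓ 0ℓ) (Ω : Set) where
    open CommutativeRing R hiding (zero)
    open ℤSolver R
    open import Relation.Binary.Reasoning.Setoid setoid

    Fn : Set
    Fn = Ω → Carrier

    infix 4 _≋_
    _≋_ : Fn → Fn → Set
    φ ≋ ψ = ∀ w → φ w ≈ ψ w

    _⊹_ : Fn → Fn → Fn
    (φ ⊹ ψ) w = φ w + ψ w

    _·_ : Carrier → Fn → Fn
    (r · φ) w = r * φ w

    record Op : Set where
      field
        app     : Fn → Fn
        app-≋   : ∀ {φ ψ} → φ ≋ ψ → app φ ≋ app ψ
        app-⊹   : ∀ φ ψ → app (φ ⊹ ψ) ≋ app φ ⊹ app ψ
        app-·   : ∀ r φ → app (r · φ) ≋ r · app φ
    open Op public

    app-0 : ∀ X {φ} → (∀ w → φ w ≈ 0#) → ∀ w → app X φ w ≈ 0#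
    app-0 X {φ} φ0 w = begin
      app X φ w          ≈⟨ app-≋ X {φ} {0# · φ} (λ v → trans (φ0 v) (sym (zeroˡ _))) w ⟩
      app X (0# · φ) w   ≈⟨ app-· X 0# φ w ⟩
      0# * app X φ w     ≈⟨ zeroˡ _ ⟩
      0#                 ∎

    private
      0ₒ 1ₒ : Op
      0ₒ = record { app = λ φ w → 0# ; app-≋ = λ _ _ → refl ; app-⊹ = λ _ _ _ → sym (+-identityˡ 0#) ; app-· = λ r _ _ → sym (zeroʳ r) }
      1ₒ = record { app = λ φ → φ ; app-≋ = λ e → e ; app-⊹ = λ _ _ _ → refl ; app-· = λ _ _ _ → refl }

      _+ₒ_ _*ₒ_ : Op → Op → Op
      X +ₒ Y = record
        { app = λ φ → app X φ ⊹ app Y φ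
        ; app-≋ = λ e w → +-cong (app-≋ X e w) (app-≋ Y e w)
        ; app-⊹ = λ φ ψ w → trans (+-cong (app-⊹ X φ ψ w) (app-⊹ Y φ ψ w))
                    (solve 4 (λ a b c d → ((a :+ b) :+ (c :+ d)) := ((a :+ c) :+ (b :+ d))) refl _ _ _ _)
        ; app-· = λ r φ w → trans (+-cong (app-· X r φ w) (app-· Y r φ w)) (sym (distribˡ r _ _)) }
      X *ₒ Y = record
        { app = λ φ → app X (app Y φ)
        ; app-≋ = λ e → app-≋ X (app-≋ Y e)
        ; app-⊹ = λ φ ψ w → trans (app-≋ X (app-⊹ Y φ ψ) w) (app-⊹ X _ _ w)
        ; app-· = λ r φ w → trans (app-≋ X (app-· Y r φ) w) (app-· X r _ w) }

    -- Addition and composition are packaged so that powers and the Frobenius identity become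
    -- available for operators.
    opSemiring : Semiring 0ℓ 0ℓ
    opSemiring = record
      { Carrier = Op
      ; _≈_ = λ X Y → ∀ φ → app X φ ≋ app Y φ
      ; _+_ = _+ₒ_ ; _*_ = _*ₒ_ ; 0# = 0ₒ ; 1# = 1ₒ
      ; isSemiring = record
        { isSemiringWithoutAnnihilatingZero = record
          { +-isCommutativeMonoid = record
            { isMonoid = record
              { isSemigroup = record
                { isMagma = record
                  { isEquivalence = record
                    { refl = λ _ _ → refl ; sym = λ e φ w → sym (e φ w) ; trans = λ e e′ φ w → trans (e φ w) (e′ φ w) }
                  ; ∙-cong = λ e e′ φ w → +-cong (e φ w) (e′ φ w) }
                ; assoc = λ _ _ _ _ _ → +-assoc _ _ _ }
              ; identity = (λ _ _ _ → +-identityˡ _) , (λ _ _ _ → +-identityʳ _) }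
            ; comm = λ _ _ _ _ → +-comm _ _ }
          ; *-cong = λ {X} {X′} {Y} {Y′} e e′ φ w → trans (e (app Y φ) w) (app-≋ X′ (e′ φ) w)
          ; *-assoc = λ _ _ _ _ _ → refl
          ; *-identity = (λ _ _ _ → refl) , (λ _ _ _ → refl)
          ; distrib = (λ X Y Z φ w → app-⊹ X _ _ w) , (λ _ _ _ _ _ → refl) }
        ; zero = (λ _ _ _ → refl) , (λ X φ w → app-0 X {λ _ → 0#} (λ _ → refl) w) } }

    open Semiring opSemiring public using () renaming (_+_ to _⊕_; _*_ to _⊛_; _≈_ to _≐_)
    open import Algebra.Properties.Semiring.Exp opSemiring public using () renaming (_^_ to _^ₒ_)

    ^ₒ-shift : ∀ X n φ → app (X ^ₒ n) (app X φ) ≋ app X (app (X ^ₒ n) φ)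
    ^ₒ-shift X zero    φ w = refl
    ^ₒ-shift X (suc n) φ w = app-≋ X (^ₒ-shift X n φ) w

    ^ₒ-comm : ∀ X Y → (∀ φ → app X (app Y φ) ≋ app Y (app X φ)) → ∀ n φ → app X (app (Y ^ₒ n) φ) ≋ app (Y ^ₒ n) (app X φ)
    ^ₒ-comm X Y c zero    φ w = refl
    ^ₒ-comm X Y c (suc n) φ w = trans (c _ w) (app-≋ Y (^ₒ-comm X Y c n φ) w)

    mulOp : Fn → Op
    mulOp a = record
      { app = λ φ w → a w * φ w
      ; app-≋ = λ e w → *-congˡ (e w)
      ; app-⊹ = λ φ ψ w → distribˡ _ _ _
      ; app-· = λ r φ w → solve 3 (λ a r f → (a :* (r :* f)) := (r :* (a :* f))) refl (a w) r (φ w) }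

    pullOp : (Ω → Ω) → Op
    pullOp h = record
      { app = λ φ w → φ (h w) ; app-≋ = λ e w → e (h w) ; app-⊹ = λ _ _ _ → refl ; app-· = λ _ _ _ → refl }

    sumOp : ∀ {n} → (Fin n → Op) → Op
    sumOp {zero}  X = 0ₒ
    sumOp {suc n} X = X zero ⊕ sumOp (X ∘ suc)

    sumOp-comm : ∀ {n} (X : Fin n → Op) Z → (∀ i φ → app Z (app (X i) φ) ≋ app (X i) (app Z φ)) →
                 ∀ φ → app Z (app (sumOp X) φ) ≋ app (sumOp X) (app Z φ)
    sumOp-comm {zero}  X Z c φ w = app-0 Z {λ _ → 0#} (λ _ → refl) w
    sumOp-comm {suc n} X Z c φ w = trans (app-⊹ Z _ _ w) (+-cong (c zero φ w) (sumOp-comm (X ∘ suc) Z (c ∘ suc) φ w))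

    -- In the application `Q` holds on the label sequences with a repetition; vanishing there has to
    -- survive every operator used to build the cochains.
    Preserves : (Ω → Set) → Op → Set
    Preserves Q X = ∀ {φ} → (∀ w → Q w → φ w ≈ 0#) → ∀ w → Q w → app X φ w ≈ 0#

    ⊕-preserves : ∀ {Q X Y} → Preserves Q X → Preserves Q Y → Preserves Q (X ⊕ Y)
    ⊕-preserves pX pY z w q = trans (+-cong (pX z w q) (pY z w q)) (+-identityˡ 0#)

    ^-preserves : ∀ {Q X} n → Preserves Q X → Preserves Q (X ^ₒ n)
    ^-preserves zero    pX z = z
    ^-preserves {Q} {X} (suc n) pX z = pX (^-preserves {Q} {X} n pX z)

    mul-preserves : ∀ {Q} a → Preserves Q (mulOp a)
    mul-preserves a z w q = trans (*-congˡ (z w q)) (zeroʳ _)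

    pull-preserves : ∀ {Q h} → (∀ w → Q w → Q (h w)) → Preserves Q (pullOp h)
    pull-preserves st z w q = z _ (st w q)

    sum-preserves : ∀ {Q n} {X : Fin n → Op} → (∀ i → Preserves Q (X i)) → Preserves Q (sumOp X)
    sum-preserves {n = zero}  p z w q = refl
    sum-preserves {Q} {suc n} {X} p z w q = ⊕-preserves {Q} {X zero} {sumOp (X ∘ suc)} (p zero) (sum-preserves {Q} {n} {X ∘ suc} (p ∘ suc)) z w q

    -- Exactness of an operator X with X^p = 0 from a Weyl relation [X,S] = D.
    module Weyl (X S : Op) (D : Carrier)
      (weyl : ∀ φ w → app X (app S φ) w ≈ app S (app X φ) w + D * φ w)
      (Q : Ω → Set) (pX : Preserves Q X) (pS : Preserves Q S) where

      open Mult semiring using () renaming (_×_ to _⊠_)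

      -- This is `j! D^j`, non-zero for `j < p` when `D` is a non-zero element of a domain of
      -- characteristic `p`.
      κ : ℕ → Carrier
      κ zero    = 1#
      κ (suc j) = ((suc j ⊠ 1#) * D) * κ j

      -- The commutator of `X^j` and `S` is `j D X^(j-1)`. It is applied to `X φ` so that no
      -- exponent `j - 1` has to be written.
      comm-power : ∀ j φ w → app (X ^ₒ j) (app S (app X φ)) w ≈ app S (app (X ^ₒ suc j) φ) w + ((j ⊠ 1#) * D) * app (X ^ₒ j) φ w
      comm-power zero    φ w = solve 3 (λ a D b → a := (a :+ (con (ℤ.+ 0) :* D) :* b)) refl _ D _
        where import Data.Integer as ℤ
      comm-power (suc j) φ w = begin
        app X (app (X ^ₒ j) (app S (app X φ))) w
          ≈⟨ app-≋ X (comm-power j φ) w ⟩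
        app X (app S (app (X ^ₒ suc j) φ) ⊹ (((j ⊠ 1#) * D) · app (X ^ₒ j) φ)) w
          ≈⟨ app-⊹ X _ _ w ⟩
        app X (app S (app (X ^ₒ suc j) φ)) w + app X (((j ⊠ 1#) * D) · app (X ^ₒ j) φ) w
          ≈⟨ +-cong (weyl _ w) (app-· X _ _ w) ⟩
        (app S (app (X ^ₒ suc (suc j)) φ) w + D * app (X ^ₒ suc j) φ w) + ((j ⊠ 1#) * D) * app (X ^ₒ suc j) φ w
          ≈⟨ solve 4 (λ a D b n → ((a :+ D :* b) :+ (n :* D) :* b) := (a :+ ((con (ℤ.+ 1) :+ n) :* D) :* b)) refl _ D _ (j ⊠ 1#) ⟩
        app S (app (X ^ₒ suc (suc j)) φ) w + (((1# + 0#) + j ⊠ 1#) * D) * app (X ^ₒ suc j) φ w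
          ≈⟨ +-congˡ (*-congʳ (*-congʳ (+-congʳ (+-identityʳ 1#)))) ⟩
        app S (app (X ^ₒ suc (suc j)) φ) w + ((suc j ⊠ 1#) * D) * app (X ^ₒ suc j) φ w ∎
        where import Data.Integer as ℤ

      -- On the kernel of `X` the operator `S` raises and `X` lowers: `X` turns `S^(i+1) φ` into
      -- `(i+1) D S^i φ`, so each of the `j` factors `X` removes one factor `S`.
      kernel⇒image^ : ∀ j φ → (∀ w → app X φ w ≈ 0#) → ∀ w → app (X ^ₒ j) (app (S ^ₒ j) φ) w ≈ κ j * φ w
      kernel⇒image^ zero    φ z w = sym (*-identityˡ _)
      kernel⇒image^ (suc j) φ z w = begin
        app (X ^ₒ suc j) (app (S ^ₒ suc j) φ) w          ≈⟨ ^ₒ-shift X j _ w ⟨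
        app (X ^ₒ j) (app X (app (S ^ₒ suc j) φ)) w      ≈⟨ app-≋ (X ^ₒ j) (step j) w ⟩
        app (X ^ₒ j) (((suc j ⊠ 1#) * D) · app (S ^ₒ j) φ) w ≈⟨ app-· (X ^ₒ j) _ _ w ⟩
        ((suc j ⊠ 1#) * D) * app (X ^ₒ j) (app (S ^ₒ j) φ) w ≈⟨ *-congˡ (kernel⇒image^ j φ z w) ⟩
        ((suc j ⊠ 1#) * D) * (κ j * φ w)                 ≈⟨ *-assoc _ _ _ ⟨
        κ (suc j) * φ w                                  ∎
        where
        import Data.Integer as ℤ
        step : ∀ i w → app X (app (S ^ₒ suc i) φ) w ≈ ((suc i ⊠ 1#) * D) * app (S ^ₒ i) φ w
        step zero    w = begin
          app X (app S φ) w             ≈⟨ weyl φ w ⟩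
          app S (app X φ) w + D * φ w   ≈⟨ +-congʳ (app-0 S z w) ⟩
          0# + D * φ w                  ≈⟨ solve 2 (λ D f → con (ℤ.+ 0) :+ D :* f := (con (ℤ.+ 1) :* D) :* f) refl D (φ w) ⟩
          (1 ⊠ 1# * D) * φ w            ∎
        step (suc i) w = begin
          app X (app S (app (S ^ₒ suc i) φ)) w
            ≈⟨ weyl _ w ⟩
          app S (app X (app (S ^ₒ suc i) φ)) w + D * app (S ^ₒ suc i) φ w
            ≈⟨ +-congʳ (trans (app-≋ S (step i) w) (app-· S _ _ w)) ⟩
          ((suc i ⊠ 1#) * D) * app (S ^ₒ suc i) φ w + D * app (S ^ₒ suc i) φ w
            ≈⟨ solve 3 (λ n D b → ((n :* D) :* b :+ D :* b) := (((con (ℤ.+ 1) :+ n) :* D) :* b)) refl (suc i ⊠ 1#) D _ ⟩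
          (((1# + 0#) + suc i ⊠ 1#) * D) * app (S ^ₒ suc i) φ w
            ≈⟨ *-congʳ (*-congʳ (+-congʳ (+-identityʳ 1#))) ⟩
          ((suc (suc i) ⊠ 1#) * D) * app (S ^ₒ suc i) φ w ∎

      -- Induction on the exponent. The candidate `S φ` has `X S φ = S X φ + D φ`; the unwanted
      -- `S X φ` is absorbed by a preimage of an auxiliary function killed by a smaller power of
      -- `X`.
      kernel^⇒image : ∀ j φ → (∀ w → app (X ^ₒ j) φ w ≈ 0#) → (∀ w → Q w → φ w ≈ 0#) →
                      Σ Fn λ η → (∀ w → app X η w ≈ κ j * φ w) × (∀ w → Q w → η w ≈ 0#)
      kernel^⇒image zero    φ z qφ = (λ _ → 0#) , (λ w → trans (app-0 X {λ _ → 0#} (λ _ → refl) w) (sym (trans (*-congˡ (z w)) (zeroʳ _)))) , (λ _ _ → refl)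
      kernel^⇒image (suc j) φ z qφ = (η₂ ⊹ (κ j · app S φ)) , eq , van
        where
        import Data.Integer as ℤ
        n = j ⊠ 1#
        -- `φ₂ = j D φ - S X φ`. By `comm-power` and `X^(j+1) φ = 0`, both terms become `j D X^j φ`
        -- under `X^j`, so they cancel.
        φ₂ : Fn
        φ₂ = ((n * D) · φ) ⊹ ((- 1#) · app S (app X φ))
        z₂ : ∀ w → app (X ^ₒ j) φ₂ w ≈ 0#
        z₂ w = begin
          app (X ^ₒ j) φ₂ w ≈⟨ app-⊹ (X ^ₒ j) _ _ w ⟩
          app (X ^ₒ j) ((n * D) · φ) w + app (X ^ₒ j) ((- 1#) · app S (app X φ)) w
            ≈⟨ +-cong (app-· (X ^ₒ j) _ _ w) (app-· (X ^ₒ j) _ _ w) ⟩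
          (n * D) * app (X ^ₒ j) φ w + (- 1#) * app (X ^ₒ j) (app S (app X φ)) w
            ≈⟨ +-congˡ (*-congˡ (trans (comm-power j φ w) (+-congʳ (app-0 S z w)))) ⟩
          (n * D) * app (X ^ₒ j) φ w + (- 1#) * (0# + (n * D) * app (X ^ₒ j) φ w)
            ≈⟨ +-congˡ (trans (*-congˡ (+-identityˡ _)) (-1*≈- _)) ⟩
          (n * D) * app (X ^ₒ j) φ w - (n * D) * app (X ^ₒ j) φ w
            ≈⟨ -‿inverseʳ _ ⟩
          0# ∎
          where open import Algebra.Properties.Ring ring using () renaming (-1*x≈-x to -1*≈-)
        q₂ : ∀ w → Q w → φ₂ w ≈ 0#
        q₂ w q = trans (+-cong (trans (*-congˡ (qφ w q)) (zeroʳ _)) (trans (*-congˡ (pS (pX qφ) w q)) (zeroʳ _))) (+-identityˡ 0#)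
        ih = kernel^⇒image j φ₂ z₂ q₂
        η₂ = proj₁ ih
        eq : ∀ w → app X (η₂ ⊹ (κ j · app S φ)) w ≈ κ (suc j) * φ w
        eq w = begin
          app X (η₂ ⊹ (κ j · app S φ)) w  ≈⟨ app-⊹ X _ _ w ⟩
          app X η₂ w + app X (κ j · app S φ) w ≈⟨ +-cong (proj₁ (proj₂ ih) w) (trans (app-· X _ _ w) (*-congˡ (weyl φ w))) ⟩
          κ j * ((n * D) * φ w + (- 1#) * app S (app X φ) w) + κ j * (app S (app X φ) w + D * φ w)
            ≈⟨ +-congʳ (*-congˡ (+-congˡ (-1*≈- _))) ⟩
          κ j * ((n * D) * φ w + - app S (app X φ) w) + κ j * (app S (app X φ) w + D * φ w)
            ≈⟨ solve 5 (λ k n D f s → (k :* ((n :* D) :* f :+ (:- s)) :+ k :* (s :+ D :* f)) := (((con (ℤ.+ 1) :+ n) :* D) :* k) :* f) refl (κ j) n D (φ w) (app S (app X φ) w) ⟩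
          ((((1# + 0#) + n) * D) * κ j) * φ w ≈⟨ *-congʳ (*-congʳ (*-congʳ (+-congʳ (+-identityʳ 1#)))) ⟩
          κ (suc j) * φ w ∎
          where open import Algebra.Properties.Ring ring using () renaming (-1*x≈-x to -1*≈-)
        van : ∀ w → Q w → (η₂ ⊹ (κ j · app S φ)) w ≈ 0#
        van w q = trans (+-cong (proj₂ (proj₂ ih) w q) (trans (*-congˡ (pS qφ w q)) (zeroʳ _))) (+-identityˡ 0#)

-- The operator X, its nilpotency and its Weyl partner.

module DifferenceOperators where

  open RingPreliminaries
  open OperatorAlgebra

  -- X stands for Σ ωᵢ (gᵢ - 1), acting on functions by pulling back along the gᵢ.
  module Difference (R : CommutativeRing 0ℓ 0ℓ) {k : ℕ} (ω : Fin k → CommutativeRing.Carrier R) where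
    open CommutativeRing R hiding (zero)

    module _ {Ω : Set} where
      open Operators R Ω public

      mono : Fn → (Ω → Ω) → Op
      mono a h = mulOp a ⊛ pullOp h

    opaque
      -- Each `gᵢ - 1` is a sum of two monomial operators, so that `p`-th powers can be computed
      -- monomial by monomial.
      diffOp : ∀ {Ω n} → (Fin n → Carrier) → (Fin n → Ω → Ω) → Op {Ω}
      diffOp ω g = sumOp (λ i → mono (λ _ → ω i) (g i) ⊕ mono (λ _ → - ω i) (λ w → w))

    X : ∀ {Ω} → (Fin k → Ω → Ω) → Op {Ω}
    X g = diffOp ω g

    opaque
      unfolding diffOp
      X-preserves : ∀ {Ω} (g : Fin k → Ω → Ω) {Q : Ω → Set} → (∀ i w → Q w → Q (g i w)) → Preserves Q (X g)
      X-preserves g {Q} st = sum-preserves {Q = Q} λ i →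
        ⊕-preserves {Q = Q} {X = mono (λ _ → ω i) (g i)} {Y = mono (λ _ → - ω i) (λ w → w)}
          (λ z → mul-preserves {Q = Q} _ (pull-preserves {Q = Q} (st i) z)) (λ z → mul-preserves {Q = Q} _ z)

      X-local : ∀ {Ω} (g : Fin k → Ω → Ω) {P : Ω → Set} → (∀ i w → P w → P (g i w)) →
                ∀ {φ ψ} → (∀ w → P w → φ w ≈ ψ w) → ∀ w → P w → app (X g) φ w ≈ app (X g) ψ w
      X-local {Ω} g {P} st {φ} {ψ} e w pw = go ω g st
        where
        go : ∀ {n} (ω : Fin n → Carrier) (g : Fin n → Ω → Ω) → (∀ i w → P w → P (g i w)) →
             app (diffOp ω g) φ w ≈
             app (diffOp ω g) ψ w
        go {zero}  ω g st = refl
        go {suc n} ω g st = +-cong (+-cong (*-congˡ (e _ (st zero w pw))) (*-congˡ (e w pw))) (go (ω ∘ suc) (g ∘ suc) (st ∘ suc))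

      X-const : ∀ {Ω} (g : Fin k → Ω → Ω) {φ : Ω → Carrier} → (∀ i w → φ (g i w) ≈ φ w) → ∀ w → app (X g) φ w ≈ 0#
      X-const {Ω} g {φ} inv w = go ω g inv
        where
        open ℤSolver R
        go : ∀ {n} (ω : Fin n → Carrier) (g : Fin n → Ω → Ω) → (∀ i w → φ (g i w) ≈ φ w) →
             app (diffOp ω g) φ w ≈ 0#
        go {zero}  ω g inv = refl
        go {suc n} ω g inv = trans (+-cong (trans (+-congʳ (*-congˡ (inv zero w)))
          (solve 2 (λ o f → (o :* f :+ (:- o) :* f) := con (ℤ.+ 0)) refl (ω zero) (φ w))) (go (ω ∘ suc) (g ∘ suc) (inv ∘ suc))) (+-identityˡ 0#)
          where import Data.Integer as ℤ

    module Natural {Ω Ω′ : Set} (g : Fin k → Ω → Ω) (g′ : Fin k → Ω′ → Ω′)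
      (L : (Ω′ → Carrier) → Ω → Carrier)
      (P : Ω → Set) (P-stable : ∀ i w → P w → P (g i w))
      (Good : (Ω′ → Carrier) → Set) (Good-X : ∀ {φ} → Good φ → Good (app (X g′) φ))
      (L-0 : ∀ w → P w → L (λ _ → 0#) w ≈ 0#)
      (L-≋ : ∀ {φ ψ} → φ ≋ ψ → ∀ w → P w → L φ w ≈ L ψ w)
      (L-⊹ : ∀ φ ψ w → P w → L (φ ⊹ ψ) w ≈ L φ w + L ψ w)
      (L-· : ∀ r φ w → P w → L (r · φ) w ≈ r * L φ w)
      (nat : ∀ i {φ} → Good φ → ∀ w → P w → L (φ ∘ g′ i) w ≈ L φ (g i w)) where

      opaque
        unfolding diffOp
        -- `X` is a linear combination of the `gᵢ` and the identity, so a linear map intertwining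
        -- the two actions intertwines the two `X`. It serves for coboundaries, label pull-backs,
        -- rook sums and slant products.
        X-natural : ∀ {φ} → Good φ → ∀ w → P w → L (app (X g′) φ) w ≈ app (X g) (L φ) w
        X-natural {φ} gd w pw = go ω g g′ (λ i → nat i gd w pw)
          where
          go : ∀ {n} (ω : Fin n → Carrier) (g : Fin n → Ω → Ω) (g′ : Fin n → Ω′ → Ω′) → (∀ i → L (φ ∘ g′ i) w ≈ L φ (g i w)) →
               L (app (diffOp ω g′) φ) w ≈
               app (diffOp ω g) (L φ) w
          go {zero}  ω g g′ nt = L-0 w pw
          go {suc n} ω g g′ nt = trans (L-⊹ _ _ w pw) (+-cong
            (trans (L-⊹ _ _ w pw) (+-cong (trans (L-· _ _ w pw) (*-congˡ (nt zero))) (L-· _ _ w pw)))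
            (go (ω ∘ suc) (g ∘ suc) (g′ ∘ suc) (nt ∘ suc)))

      X^-natural : ∀ n {φ} → Good φ → ∀ w → P w → L (app (X g′ ^ₒ n) φ) w ≈ app (X g ^ₒ n) (L φ) w
      X^-natural n gd = proj₂ (both n gd)
        where
        both : ∀ n {φ} → Good φ → Good (app (X g′ ^ₒ n) φ) × (∀ w → P w → L (app (X g′ ^ₒ n) φ) w ≈ app (X g ^ₒ n) (L φ) w)
        both zero    gd = gd , λ w _ → refl
        both (suc n) gd = Good-X (proj₁ (both n gd)) ,
          λ w pw → trans (X-natural (proj₁ (both n gd)) w pw) (X-local g P-stable (proj₂ (both n gd)) w pw)

  module FiniteSum (R : CommutativeRing 0ℓ 0ℓ) where
    open CommutativeRing R hiding (zero)

    sumR : ∀ {n} → (Fin n → Carrier) → Carrier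
    sumR {zero}  a = 0#
    sumR {suc n} a = a zero + sumR (a ∘ suc)

  module CharP (R : CommutativeRing 0ℓ 0ℓ) {p : ℕ} (pr : Prime p)
    (char : ∀ r → CommutativeRing._≈_ R (Mult._×_ (CommutativeRing.semiring R) p r) (CommutativeRing.0# R))
    {k : ℕ} (ω : Fin k → CommutativeRing.Carrier R) where
    open CommutativeRing R hiding (zero)
    open Difference R ω public
    open FiniteSum R public
    open Mult semiring using () renaming (_×_ to _⊠_)
    open import Algebra.Properties.Semiring.Exp semiring using (_^_; ^-congˡ)
    open import Relation.Binary.Reasoning.Setoid setoid
    module FR = Frobenius semiring pr char

    0^p≈0 : 0# ^ p ≈ 0#
    0^p≈0 = go p pr
      where
      go : ∀ n → Prime n → 0# ^ n ≈ 0#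
      go (suc n) _ = zeroˡ _

    -- Frobenius applied to `r - r`; this avoids a distinction between `p = 2` and odd `p`.
    -^p : ∀ r → r ^ p + (- r) ^ p ≈ 0#
    -^p r = trans (sym (FR.^-distrib-+ r (- r) (*-comm _ _))) (trans (^-congˡ p (-‿inverseʳ r)) 0^p≈0)

    sumR-^p : ∀ {n} (a : Fin n → Carrier) → sumR (λ i → a i ^ p) ≈ sumR a ^ p
    sumR-^p {zero}  a = sym 0^p≈0
    sumR-^p {suc n} a = trans (+-congˡ (sumR-^p (a ∘ suc))) (sym (FR.^-distrib-+ _ _ (*-comm _ _)))

    module _ {Ω : Set} where
      private
        module OM = Mult (opSemiring {Ω})

        ×-app : ∀ n (A : Op {Ω}) φ w → app {Ω} (n OM.× A) φ w ≈ n ⊠ app {Ω} A φ w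
        ×-app zero    A φ w = refl
        ×-app (suc n) A φ w = +-congˡ (×-app n A φ w)

      module FO = Frobenius (opSemiring {Ω}) pr (λ A φ w → trans (×-app p A φ w) (char _))

      sumOp-^p : ∀ {n} (A : Fin n → Op) → (∀ i j → (A i ⊛ A j) ≐ (A j ⊛ A i)) → (sumOp A ^ₒ p) ≐ sumOp (λ i → A i ^ₒ p)
      sumOp-^p {zero}  A c = go p pr
        where
        go : ∀ n → Prime n → (sumOp {Ω} {zero} A ^ₒ n) ≐ sumOp {Ω} {zero} (λ i → A i ^ₒ p)
        go (suc n) _ φ w = refl
      sumOp-^p {suc n} A c = λ φ w → trans (FO.^-distrib-+ (A zero) (sumOp (A ∘ suc)) (sumOp-comm (A ∘ suc) (A zero) (λ i → c zero (suc i))) φ w)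
        (+-congˡ (sumOp-^p (A ∘ suc) (λ i j → c (suc i) (suc j)) φ w))

      mono-^ : ∀ (a : Fn {Ω}) h → (∀ w → a (h w) ≈ a w) → ∀ n φ w → app (mono a h ^ₒ n) φ w ≈ a w ^ n * φ (iter n h w)
      mono-^ a h inv zero    φ w = sym (*-identityˡ _)
      mono-^ a h inv (suc n) φ w = begin
        a w * app (mono a h ^ₒ n) φ (h w)        ≈⟨ *-congˡ (mono-^ a h inv n φ (h w)) ⟩
        a w * (a (h w) ^ n * φ (iter n h (h w))) ≈⟨ *-congˡ (*-cong (^-congˡ n (inv w)) (reflexive (cong φ (iter-shift n h w)))) ⟩
        a w * (a w ^ n * φ (iter (suc n) h w))   ≈⟨ *-assoc _ _ _ ⟨
        a w ^ suc n * φ (iter (suc n) h w)       ∎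

      mono-comm : ∀ {a b : Fn {Ω}} {h h′} → (∀ w → a (h′ w) ≈ a w) → (∀ w → b (h w) ≈ b w) → (∀ w → h (h′ w) ≡ h′ (h w)) →
                  (mono a h ⊛ mono b h′) ≐ (mono b h′ ⊛ mono a h)
      mono-comm {a} {b} {h} {h′} ia ib c φ w = begin
        a w * (b (h w) * φ (h′ (h w)))  ≈⟨ *-congˡ (*-cong (ib w) (reflexive (cong φ (≡.sym (c w))))) ⟩
        a w * (b w * φ (h (h′ w)))      ≈⟨ solve 3 (λ a b f → a :* (b :* f) := b :* (a :* f)) refl _ _ _ ⟩
        b w * (a w * φ (h (h′ w)))      ≈⟨ *-congˡ (*-congʳ (ia w)) ⟨
        b w * (a (h′ w) * φ (h (h′ w))) ∎
        where open ℤSolver R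

    module Action {Ω : Set} (g : Fin k → Ω → Ω)
      (g-comm : ∀ i j w → g i (g j w) ≡ g j (g i w)) (g-per : ∀ i w → iter p (g i) w ≡ w) where

      private
        iter-id : ∀ n (w : Ω) → iter n (λ v → v) w ≡ w
        iter-id zero    w = ≡.refl
        iter-id (suc n) w = iter-id n w

        mono-^p : ∀ (a : Fn {Ω}) h → (∀ w → a (h w) ≈ a w) → (∀ w → iter p h w ≡ w) → ∀ φ w → app (mono a h ^ₒ p) φ w ≈ a w ^ p * φ w
        mono-^p a h inv per φ w = trans (mono-^ a h inv p φ w) (*-congˡ (reflexive (cong φ (per w))))

        swap⊕ : ∀ {A B C : Op {Ω}} → (C ⊛ A) ≐ (A ⊛ C) → (C ⊛ B) ≐ (B ⊛ C) → (C ⊛ (A ⊕ B)) ≐ ((A ⊕ B) ⊛ C)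
        swap⊕ {A} {B} {C} e e′ φ w = trans (app-⊹ C _ _ w) (+-cong (e φ w) (e′ φ w))

      opaque
        unfolding diffOp
        comm-X : (C : Op {Ω}) → (∀ i a → (C ⊛ mono (λ _ → a) (g i)) ≐ (mono (λ _ → a) (g i) ⊛ C)) → (C ⊛ X g) ≐ (X g ⊛ C)
        comm-X C c = sumOp-comm _ C λ i → swap⊕ {mono (λ _ → ω i) (g i)} {mono (λ _ → - ω i) (λ w → w)} {C} (c i (ω i)) (λ φ → app-· C (- ω i) φ)

        -- The summands commute, so the `p`-th power may be taken termwise: it is the sum of the
        -- `ωᵢ^p (gᵢ^p - 1)`, and each `gᵢ^p` is the identity.
        X^p≈0 : ∀ φ w → app (X g ^ₒ p) φ w ≈ 0#
        X^p≈0 φ w = trans (sumOp-^p A comm φ w) (go A each)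
          where
          A : Fin k → Op {Ω}
          A i = mono (λ _ → ω i) (g i) ⊕ mono (λ _ → - ω i) (λ w → w)
          comm : ∀ i j → (A i ⊛ A j) ≐ (A j ⊛ A i)
          comm i j = swap⊕ {mono (λ _ → ω j) (g j)} {mono (λ _ → - ω j) (λ w → w)} {A i}
            (λ φ w → sym (swap⊕ {mono (λ _ → ω i) (g i)} {mono (λ _ → - ω i) (λ w → w)} {mono (λ _ → ω j) (g j)}
              (mono-comm {h = g j} {h′ = g i} (λ _ → refl) (λ _ → refl) (g-comm j i)) (mono-comm {h = g j} {h′ = λ w → w} (λ _ → refl) (λ _ → refl) (λ _ → ≡.refl)) φ w))
            (λ φ w → app-· (A i) (- ω j) φ w)
          each : ∀ i φ w → app (A i ^ₒ p) φ w ≈ 0#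
          each i φ w = begin
            app (A i ^ₒ p) φ w
              ≈⟨ FO.^-distrib-+ (mono (λ _ → ω i) (g i)) (mono (λ _ → - ω i) (λ w → w)) (mono-comm {a = λ _ → ω i} {b = λ _ → - ω i} {h = g i} {h′ = λ w → w} (λ _ → refl) (λ _ → refl) (λ _ → ≡.refl)) φ w ⟩
            app (mono (λ _ → ω i) (g i) ^ₒ p) φ w + app (mono (λ _ → - ω i) (λ w → w) ^ₒ p) φ w
              ≈⟨ +-cong (mono-^p (λ _ → ω i) (g i) (λ _ → refl) (g-per i) φ w) (mono-^p (λ _ → - ω i) (λ w → w) (λ _ → refl) (iter-id p) φ w) ⟩
            ω i ^ p * φ w + (- ω i) ^ p * φ w   ≈⟨ distribʳ _ _ _ ⟨
            (ω i ^ p + (- ω i) ^ p) * φ w       ≈⟨ trans (*-congʳ (-^p (ω i))) (zeroˡ _) ⟩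
            0#                                  ∎
          go : ∀ {n} (A : Fin n → Op {Ω}) → (∀ i φ w → app (A i ^ₒ p) φ w ≈ 0#) → app (sumOp (λ i → A i ^ₒ p)) φ w ≈ 0#
          go {zero}  A e = refl
          go {suc n} A e = trans (+-cong (e zero φ w) (go (A ∘ suc) (e ∘ suc))) (+-identityˡ 0#)

      module _ (s : Fn) (b : Fin k → Fn) (b-inv : ∀ i j w → b i (g j w) ≈ b i w) (s-shift : ∀ i w → s (g i w) ≈ s w + b i w)
               (cof : Fn) (cof-inv : ∀ i w → cof (g i w) ≈ cof w) (D : Carrier)
               (cof-D : ∀ w → cof w * sumR (λ i → ω i * b i w) ^ p ≈ D) where
        private
          a : Fin k → Fn
          a i w = ω i * b i w
          a-inv : ∀ i j w → a i (g j w) ≈ a i w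
          a-inv i j w = *-congˡ (b-inv i j w)

          -- The commutator of `X` with multiplication by `s`. It commutes with `X` because the
          -- increments `b i` are invariant.
          U : Op
          U = sumOp (λ i → mono (a i) (g i))

          U-X : (X g ⊛ U) ≐ (U ⊛ X g)
          U-X φ w = sym (comm-X U (λ i c φ w → sym (sumOp-comm _ (mono (λ _ → c) (g i))
            (λ j φ w → mono-comm (λ _ → refl) (a-inv j i) (g-comm i j) φ w) φ w)) φ w)

          -- The translations disappear in the `p`-th power, which is therefore multiplication by a
          -- function.
          U^p : ∀ φ w → app (U ^ₒ p) φ w ≈ sumR (λ i → a i w) ^ p * φ w
          U^p φ w = trans (sumOp-^p _ (λ i j → mono-comm (a-inv i j) (a-inv j i) (g-comm i j)) φ w)
                    (trans (go a g (λ i → mono-^p (a i) (g i) (a-inv i i) (g-per i) φ w)) (*-congʳ (sumR-^p (λ i → a i w))))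
            where
            go : ∀ {n} (a : Fin n → Fn) (g : Fin n → Ω → Ω) → (∀ i → app (mono (a i) (g i) ^ₒ p) φ w ≈ a i w ^ p * φ w) →
                 app (sumOp (λ i → mono (a i) (g i) ^ₒ p)) φ w ≈ sumR (λ i → a i w ^ p) * φ w
            go {zero}  a g e = sym (zeroˡ _)
            go {suc n} a g e = trans (+-cong (e zero) (go (a ∘ suc) (g ∘ suc) (e ∘ suc))) (sym (distribʳ _ _ _))

          opaque
            unfolding diffOp
            commutator : ∀ φ w → app (X g) (λ v → s v * φ v) w ≈ s w * app (X g) φ w + app U φ w
            commutator φ w = go ω g b (λ i → s-shift i w)
              where
              open ℤSolver R
              go : ∀ {n} (ω : Fin n → Carrier) (g : Fin n → Ω → Ω) (b : Fin n → Fn) → (∀ i → s (g i w) ≈ s w + b i w) →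
                   app (diffOp ω g) (λ v → s v * φ v) w ≈
                   s w * app (diffOp ω g) φ w + app (sumOp (λ i → mono (λ w → ω i * b i w) (g i))) φ w
              go {zero}  ω g b sh = solve 1 (λ s → con (ℤ.+ 0) := s :* con (ℤ.+ 0) :+ con (ℤ.+ 0)) refl (s w)
                where import Data.Integer as ℤ
              go {suc n} ω g b sh = trans (+-cong (+-congʳ (*-congˡ (*-congʳ (sh zero)))) (go (ω ∘ suc) (g ∘ suc) (b ∘ suc) (sh ∘ suc)))
                (solve 7 (λ o s b f f′ r u → ((o :* ((s :+ b) :* f) :+ (:- o) :* (s :* f′)) :+ (s :* r :+ u)) :=
                                             (s :* ((o :* f :+ (:- o) :* f′) :+ r) :+ ((o :* b) :* f :+ u))) refl (ω zero) (s w) (b zero w) _ _ _ _)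

        -- For `p′ = p - 1` this is `cof U^(p-1) s`. Only the last factor fails to commute with `X`,
        -- so the commutator is `cof U^p`, and `cof` is what makes this function the constant `D`.
        S : ℕ → Op
        S p′ = mulOp cof ⊛ ((U ^ₒ p′) ⊛ mulOp s)

        S-weyl : ∀ p′ → p ≡ suc p′ → ∀ φ w → app (X g) (app (S p′) φ) w ≈ app (S p′) (app (X g) φ) w + D * φ w
        S-weyl p′ eq φ w = begin
          app (X g) (app (S p′) φ) w
            ≈⟨ comm-X (mulOp cof) (λ i c φ w → trans (*-congʳ (sym (cof-inv i w))) (solve 3 (λ a b f → a :* (b :* f) := b :* (a :* f)) refl _ _ _)) _ w ⟨
          cof w * app (X g) (app (U ^ₒ p′) (app (mulOp s) φ)) w
            ≈⟨ *-congˡ (^ₒ-comm (X g) U U-X p′ _ w) ⟩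
          cof w * app (U ^ₒ p′) (app (X g) (app (mulOp s) φ)) w
            ≈⟨ *-congˡ (app-≋ (U ^ₒ p′) (commutator φ) w) ⟩
          cof w * app (U ^ₒ p′) (app (mulOp s) (app (X g) φ) ⊹ app U φ) w
            ≈⟨ trans (*-congˡ (app-⊹ (U ^ₒ p′) _ _ w)) (distribˡ _ _ _) ⟩
          app (S p′) (app (X g) φ) w + cof w * app (U ^ₒ p′) (app U φ) w
            ≈⟨ +-congˡ (*-congˡ (trans (^ₒ-shift U p′ φ w) (trans (reflexive (cong (λ n → app (U ^ₒ n) φ w) (≡.sym eq))) (U^p φ w)))) ⟩
          app (S p′) (app (X g) φ) w + cof w * (sumR (λ i → a i w) ^ p * φ w)
            ≈⟨ +-congˡ (trans (sym (*-assoc _ _ _)) (*-congʳ (cof-D w))) ⟩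
          app (S p′) (app (X g) φ) w + D * φ w ∎
          where open ℤSolver R

        S-preserves : ∀ p′ {Q : Ω → Set} → (∀ i w → Q w → Q (g i w)) → Preserves Q (S p′)
        S-preserves p′ {Q} st {φ} z = mul-preserves {Q = Q} cof (^-preserves {Q = Q} {X = U} p′
          (sum-preserves {Q = Q} (λ i {ψ} z → mul-preserves {Q = Q} (a i) (pull-preserves {Q = Q} (st i) {ψ} z)))
          (mul-preserves {Q = Q} s {φ} z))

-- Alternating cochains, weighted coboundaries and barycentric subdivision.

module AlternatingCochains where

  open RingPreliminaries

  module _ {A : Set} where

    data Del : ∀ {n} → Vec A n → Vec A (suc n) → Set where
      here  : ∀ {n a} {v : Vec A n} → Del v (a ∷ v)
      there : ∀ {n a} {m : Vec A n} {v} → Del m v → Del (a ∷ m) (a ∷ v)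

    data Swap : ∀ {n} → Vec A n → Vec A n → Set where
      here  : ∀ {n a b} {v : Vec A n} → Swap (a ∷ b ∷ v) (b ∷ a ∷ v)
      there : ∀ {n a} {u v : Vec A n} → Swap u v → Swap (a ∷ u) (a ∷ v)

    -- f is a full flag of faces of l, largest first
    Flag : ∀ {n} → Vec (List A) n → Vec A n → Set
    Flag []      l = ⊤
    Flag (x ∷ f) l = (x ≡ toList l) × ∃ λ m → Del m l × Flag f m

  -- Faces occurring in a flag are never empty. Keeping this fact with the relation is what later
  -- excludes the default label.
  data NonEmpty {A : Set} (_~_ : A → A → Set) : List A → List A → Set where
    _∷_ : ∀ {a b x y} → a ~ b → LP.Pointwise _~_ x y → NonEmpty _~_ (a ∷ x) (b ∷ y)

  toList-rel : ∀ {A : Set} {_~_ : A → A → Set} {n} {u v : Vec A n} → Pointwise _~_ u v → LP.Pointwise _~_ (toList u) (toList v)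
  toList-rel []       = LP.[]
  toList-rel (r ∷ rs) = r LP.∷ toList-rel rs

  module Cochains (R : CommutativeRing 0ℓ 0ℓ) where
    open CommutativeRing R hiding (zero)
    open ℤSolver R
    open import Algebra.Properties.Ring ring using (-0#≈0#; -‿involutive; -‿distribʳ-*; x+x≈x⇒x≈0)
    open import Algebra.Properties.AbelianGroup +-abelianGroup using (⁻¹-∙-comm)
    open import Relation.Binary.Reasoning.Setoid setoid

    module _ {A : Set} where

      -- Exterior multiplication by the weight `w`. Weight one gives the coboundary; the indicator
      -- of a vertex gives the dual of contraction with that vertex. Vectors of length `n` are
      -- simplices of dimension `n - 1`, the empty one included, so the complex is augmented.
      δ : ∀ {n} → (A → Carrier) → (Vec A n → Carrier) → Vec A (suc n) → Carrier
      δ {zero}  w φ (a ∷ v) = w a * φ v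
      δ {suc n} w φ (a ∷ v) = w a * φ v - δ w (φ ∘ (a ∷_)) v

      d : ∀ {n} → (Vec A n → Carrier) → Vec A (suc n) → Carrier
      d = δ (λ _ → 1#)

      -- `Q` will be the existence of a colouring as desired: a term that does not vanish hands over
      -- such a colouring, so the conclusion is reached constructively.
      δ-either : ∀ {Q : Set} {n} w {φ ψ : Vec A n → Carrier} l → (∀ m → Del m l → Q ⊎ φ m ≈ ψ m) → Q ⊎ δ w φ l ≈ δ w ψ l
      δ-either {n = zero}  w (a ∷ v) e with e v here
      ... | inj₁ q = inj₁ q
      ... | inj₂ r = inj₂ (*-congˡ r)
      δ-either {n = suc n} w (a ∷ v) e with e v here
      ... | inj₁ q = inj₁ q
      ... | inj₂ r with δ-either w v (λ m dm → e (a ∷ m) (there dm))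
      ...   | inj₁ q  = inj₁ q
      ...   | inj₂ r′ = inj₂ (+-cong (*-congˡ r) (-‿cong r′))

      δ-local : ∀ {n} w {φ ψ : Vec A n → Carrier} l → (∀ m → Del m l → φ m ≈ ψ m) → δ w φ l ≈ δ w ψ l
      δ-local w l e with δ-either {⊥} w l (λ m dm → inj₂ (e m dm))
      ... | inj₂ r = r

      δ-cong : ∀ {n} w {φ ψ : Vec A n → Carrier} → (∀ m → φ m ≈ ψ m) → ∀ l → δ w φ l ≈ δ w ψ l
      δ-cong w e l = δ-local w l (λ m _ → e m)

      δ-+ : ∀ {n} w (φ ψ : Vec A n → Carrier) l → δ w (λ m → φ m + ψ m) l ≈ δ w φ l + δ w ψ l
      δ-+ {zero}  w φ ψ (a ∷ v) = distribˡ _ _ _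
      δ-+ {suc n} w φ ψ (a ∷ v) = trans (+-congˡ (-‿cong (δ-+ w (φ ∘ (a ∷_)) (ψ ∘ (a ∷_)) v)))
        (solve 5 (λ w x y s t → w :* (x :+ y) :- (s :+ t) := (w :* x :- s) :+ (w :* y :- t)) refl _ _ _ _ _)

      δ-* : ∀ {n} w r (φ : Vec A n → Carrier) l → δ w (λ m → r * φ m) l ≈ r * δ w φ l
      δ-* {zero}  w r φ (a ∷ v) = solve 3 (λ w r x → w :* (r :* x) := r :* (w :* x)) refl _ _ _
      δ-* {suc n} w r φ (a ∷ v) = trans (+-congˡ (-‿cong (δ-* w r (φ ∘ (a ∷_)) v)))
        (solve 4 (λ w r x s → w :* (r :* x) :- r :* s := r :* (w :* x :- s)) refl _ _ _ _)

      δ-0 : ∀ {n} w {φ : Vec A n → Carrier} l → (∀ m → Del m l → φ m ≈ 0#) → δ w φ l ≈ 0#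
      δ-0 {n} w {φ} l z = trans (δ-local w {φ} {λ m → 0# * φ m} l (λ m dm → trans (z m dm) (sym (zeroˡ _)))) (trans (δ-* w 0# φ l) (zeroˡ _))

      δ-neg : ∀ {n} w (φ : Vec A n → Carrier) l → δ w (λ m → - φ m) l ≈ - δ w φ l
      δ-neg w φ l = trans (δ-cong w (λ m → solve 1 (λ x → :- x := con (ℤ.- ℤ.1ℤ) :* x) refl (φ m)) l)
        (trans (δ-* w (- (1# + 0#)) φ l) (solve 1 (λ x → con (ℤ.- ℤ.1ℤ) :* x := :- x) refl _))

      private
        unfold : ∀ {n} w w′ (φ : Vec A (suc n) → Carrier) a v →
                 δ w (δ w′ φ) (a ∷ v) ≈ (w a * δ w′ φ v - w′ a * δ w φ v) + δ w (δ w′ (φ ∘ (a ∷_))) v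
        unfold w w′ φ a v = begin
          w a * δ w′ φ v - δ w (λ m → w′ a * φ m - δ w′ (φ ∘ (a ∷_)) m) v
            ≈⟨ +-congˡ (-‿cong (trans (δ-+ w _ _ v) (+-cong (δ-* w (w′ a) φ v) (δ-neg w _ v)))) ⟩
          w a * δ w′ φ v - (w′ a * δ w φ v - δ w (δ w′ (φ ∘ (a ∷_))) v)
            ≈⟨ solve 3 (λ x y z → x :- (y :- z) := (x :- y) :+ z) refl _ _ _ ⟩
          (w a * δ w′ φ v - w′ a * δ w φ v) + δ w (δ w′ (φ ∘ (a ∷_))) v ∎

      δδ-anti : ∀ {n} w w′ (φ : Vec A n → Carrier) l → δ w (δ w′ φ) l + δ w′ (δ w φ) l ≈ 0#
      δδ-anti {zero}  w w′ φ (a ∷ b ∷ []) = solve 5 (λ wa wb wa′ wb′ x → (wa :* (wb′ :* x) :- wb :* (wa′ :* x)) :+ (wa′ :* (wb :* x) :- wb′ :* (wa :* x)) := con ℤ.0ℤ) refl (w a) (w b) (w′ a) (w′ b) (φ [])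
      δδ-anti {suc n} w w′ φ (a ∷ v) = begin
        δ w (δ w′ φ) (a ∷ v) + δ w′ (δ w φ) (a ∷ v)  ≈⟨ +-cong (unfold w w′ φ a v) (unfold w′ w φ a v) ⟩
        _ ≈⟨ solve 4 (λ x y s t → ((x :- y) :+ s) :+ ((y :- x) :+ t) := s :+ t) refl _ _ _ _ ⟩
        δ w (δ w′ (φ ∘ (a ∷_))) v + δ w′ (δ w (φ ∘ (a ∷_))) v  ≈⟨ δδ-anti w w′ (φ ∘ (a ∷_)) v ⟩
        0# ∎

      -- Proved separately because anticommutation with `w = w′` only gives twice the expression,
      -- which says nothing in characteristic two.
      δδ≈0 : ∀ {n} w (φ : Vec A n → Carrier) l → δ w (δ w φ) l ≈ 0#
      δδ≈0 {zero}  w φ (a ∷ b ∷ []) = solve 3 (λ a b x → a :* (b :* x) :- b :* (a :* x) := con ℤ.0ℤ) refl (w a) (w b) (φ [])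
      δδ≈0 {suc n} w φ (a ∷ v) = begin
        δ w (δ w φ) (a ∷ v)  ≈⟨ unfold w w φ a v ⟩
        _                    ≈⟨ solve 2 (λ x s → (x :- x) :+ s := s) refl _ _ ⟩
        δ w (δ w (φ ∘ (a ∷_))) v ≈⟨ δδ≈0 w (φ ∘ (a ∷_)) v ⟩
        0# ∎

      -- Chains consist of ordered simplices and are not normalised by sorting; their boundaries are
      -- compared by evaluating cochains of this kind.
      Alt : ∀ {n} → (Vec A n → Carrier) → Set
      Alt φ = ∀ {l l′} → Swap l l′ → φ l′ ≈ - φ l

      Alt-∷ : ∀ {n} {φ : Vec A (suc n) → Carrier} a → Alt φ → Alt (φ ∘ (a ∷_))
      Alt-∷ a alt s = alt (there s)

      Alt-+ : ∀ {n} {φ ψ : Vec A n → Carrier} → Alt φ → Alt ψ → Alt (λ l → φ l + ψ l)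
      Alt-+ a b s = trans (+-cong (a s) (b s)) (⁻¹-∙-comm _ _)

      Alt-* : ∀ {n} {φ : Vec A n → Carrier} r → Alt φ → Alt (λ l → r * φ l)
      Alt-* r a s = trans (*-congˡ (a s)) (sym (-‿distribʳ-* _ _))

      δ-Alt : ∀ {n} w {φ : Vec A n → Carrier} → Alt φ → Alt (δ w φ)
      δ-Alt {zero} w alt {a ∷ []} (there ())
      δ-Alt {suc zero} w {φ} alt {a ∷ b ∷ []} here =
        solve 4 (λ wa wb x y → wb :* x :- wa :* y := :- (wa :* y :- wb :* x)) refl (w a) (w b) _ _
      δ-Alt {suc (suc n)} w {φ} alt {a ∷ b ∷ v} here = begin
        w b * φ (a ∷ v) - (w a * φ (b ∷ v) - δ w (λ m → φ (b ∷ a ∷ m)) v)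
          ≈⟨ +-congˡ (-‿cong (+-congˡ (-‿cong (trans (δ-cong w (λ m → alt (here {v = m})) v) (δ-neg w _ v))))) ⟩
        w b * φ (a ∷ v) - (w a * φ (b ∷ v) - - δ w (λ m → φ (a ∷ b ∷ m)) v)
          ≈⟨ solve 3 (λ x y z → x :- (y :- (:- z)) := :- (y :- (x :- z))) refl _ _ _ ⟩
        - (w a * φ (b ∷ v) - (w b * φ (a ∷ v) - δ w (λ m → φ (a ∷ b ∷ m)) v)) ∎
      δ-Alt {suc n} w {φ} alt {a ∷ u} {a ∷ v} (there s) = begin
        w a * φ v - δ w (φ ∘ (a ∷_)) v      ≈⟨ +-cong (*-congˡ (alt s)) (-‿cong (δ-Alt w (Alt-∷ a alt) s)) ⟩
        w a * (- φ u) - (- δ w (φ ∘ (a ∷_)) u) ≈⟨ solve 3 (λ w x y → w :* (:- x) :- (:- y) := :- (w :* x :- y)) refl _ _ _ ⟩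
        - (w a * φ u - δ w (φ ∘ (a ∷_)) u)  ∎

      δ-rel : ∀ {_~_ : A → A → Set} {n} {φ ψ : Vec A n → Carrier} → (∀ {m m′} → Pointwise _~_ m m′ → φ m ≈ ψ m′) →
              ∀ {l l′} → Pointwise _~_ l l′ → d φ l ≈ d ψ l′
      δ-rel {n = zero}  e (r ∷ rs) = *-congˡ (e rs)
      δ-rel {n = suc n} e (r ∷ rs) = +-cong (*-congˡ (e rs)) (-‿cong (δ-rel (λ q → e (r ∷ q)) rs))

      Swap-map : ∀ (h : A → A) {n} {l l′ : Vec A n} → Swap l l′ → Swap (Vec.map h l) (Vec.map h l′)
      Swap-map h here      = here
      Swap-map h (there s) = there (Swap-map h s)

    δ-map : ∀ {A B : Set} (h : A → B) {n} (φ : Vec B n → Carrier) l → d (φ ∘ Vec.map h) l ≈ d φ (Vec.map h l)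
    δ-map h {zero}  φ (a ∷ v) = refl
    δ-map h {suc n} φ (a ∷ v) = +-congˡ (-‿cong (δ-map h (φ ∘ (h a ∷_)) v))

    -- Dual of the barycentric subdivision, restricted to the faces accepted by chk.
    module Subdivision {A : Set} (chk : ∀ {n} → Vec A (suc n) → Bool) where

      -- The subdivision of a simplex is the cone with its barycentre `toList l` as apex over the
      -- subdivided boundary: the first entry of the flag is fixed, the rest ranges over flags of
      -- the facets.
      sd : ∀ {n} → (Vec (List A) n → Carrier) → Vec A n → Carrier
      sd {zero}  φ l = φ []
      sd {suc n} φ l = if chk l then d (sd (φ ∘ (toList l ∷_))) l else 0#

      sd-either : ∀ {Q : Set} {n} {φ ψ : Vec (List A) n → Carrier} l → (∀ f → Flag f l → Q ⊎ φ f ≈ ψ f) → Q ⊎ sd φ l ≈ sd ψ l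
      sd-either {n = zero}  [] e = e [] tt
      sd-either {n = suc n} l e with chk l
      ... | false = inj₂ refl
      ... | true  = δ-either _ l (λ m dm → sd-either m (λ f fl → e (toList l ∷ f) (≡.refl , m , dm , fl)))

      sd-local : ∀ {n} {φ ψ : Vec (List A) n → Carrier} l → (∀ f → Flag f l → φ f ≈ ψ f) → sd φ l ≈ sd ψ l
      sd-local l e with sd-either {⊥} l (λ f fl → inj₂ (e f fl))
      ... | inj₂ r = r

      sd-+ : ∀ {n} (φ ψ : Vec (List A) n → Carrier) l → sd (λ f → φ f + ψ f) l ≈ sd φ l + sd ψ l
      sd-+ {zero}  φ ψ l = refl
      sd-+ {suc n} φ ψ l with chk l
      ... | false = sym (+-identityˡ 0#)
      ... | true  = trans (δ-cong _ (sd-+ (φ ∘ (toList l ∷_)) (ψ ∘ (toList l ∷_))) l) (δ-+ _ _ _ l)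

      sd-* : ∀ {n} r (φ : Vec (List A) n → Carrier) l → sd (λ f → r * φ f) l ≈ r * sd φ l
      sd-* {zero}  r φ l = refl
      sd-* {suc n} r φ l with chk l
      ... | false = sym (zeroʳ r)
      ... | true  = trans (δ-cong _ (sd-* r (φ ∘ (toList l ∷_))) l) (δ-* _ r _ l)

      -- Splitting `d φ` at the first entry of a flag gives `sd φ` on the facets and, by induction,
      -- a double coboundary, which vanishes. Facets must again pass the test for the recursion to
      -- apply.
      sd-d : (∀ {n} (l : Vec A (suc (suc n))) m → Del m l → chk l ≡ true → chk m ≡ true) →
             ∀ {n} (φ : Vec (List A) n → Carrier) l → chk l ≡ true → sd (d φ) l ≈ d (sd φ) l
      sd-d her {zero}  φ (a ∷ []) c rewrite c = *-congˡ (*-identityˡ _)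
      sd-d her {suc n} φ l c = trans (reflexive (cong (λ b → if b then d (sd (d φ ∘ (toList l ∷_))) l else 0#) c)) (begin
        d (sd (λ f → 1# * φ f - d (φ ∘ (toList l ∷_)) f)) l
          ≈⟨ δ-local _ l (λ m dm → trans (sd-+ (λ f → 1# * φ f) (λ f → - dφ f) m) (+-cong (trans (sd-* 1# φ m) (*-identityˡ _))
               (trans (trans (sd-local {φ = λ f → - dφ f} {λ f → (- (1# + 0#)) * dφ f} m
                         (λ f _ → solve 1 (λ x → :- x := con (ℤ.- ℤ.1ℤ) :* x) refl (dφ f))) (sd-* _ dφ m))
                 (*-congˡ (sd-d her (φ ∘ (toList l ∷_)) m (her l m dm c)))))) ⟩
        d (λ m → sd φ m + (- (1# + 0#)) * d (sd (φ ∘ (toList l ∷_))) m) l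
          ≈⟨ trans (δ-+ _ _ _ l) (+-congˡ (δ-* _ _ _ l)) ⟩
        d (sd φ) l + (- (1# + 0#)) * d (d (sd (φ ∘ (toList l ∷_)))) l
          ≈⟨ trans (+-congˡ (trans (*-congˡ (δδ≈0 _ _ l)) (zeroʳ _))) (+-identityʳ _) ⟩
        d (sd φ) l ∎)
        where
        dφ : Vec (List A) (suc n) → Carrier
        dφ = d (φ ∘ (toList l ∷_))

      sd-rel : ∀ {_~_ : A → A → Set} → (∀ {n} {l l′ : Vec A (suc n)} → Pointwise _~_ l l′ → chk l ≡ chk l′) →
               ∀ {n} {φ ψ : Vec (List A) n → Carrier} → (∀ {f f′} → Pointwise (NonEmpty _~_) f f′ → φ f ≈ ψ f′) →
               ∀ {l l′} → Pointwise _~_ l l′ → sd φ l ≈ sd ψ l′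
      sd-rel ck {zero}  e rs = e []
      sd-rel ck {suc n} {φ} {ψ} e {l} {l′} (r ∷ rs) with chk l | chk l′ | ck (r ∷ rs)
      ... | false | false | _ = refl
      ... | true  | true  | _ = δ-rel (λ q → sd-rel ck (λ pf → e ((r ∷ toList-rel rs) ∷ pf)) q) (r ∷ rs)

      -- The sign comes from the outer `d`. The barycentre is a list and does change under a swap,
      -- so `φ` has to be insensitive to reordering inside its entries; that is the role of `≃`.
      sd-Alt : ∀ (_≃_ : List A → List A → Set) → (∀ {x} → x ≃ x) →
               (∀ {n} {l l′ : Vec A (suc n)} → Swap l l′ → chk l ≡ chk l′) →
               (∀ {n} {l l′ : Vec A (suc n)} → Swap l l′ → chk l ≡ true → toList l ≃ toList l′) →
               ∀ {n} {φ : Vec (List A) n → Carrier} → (∀ {f f′} → Pointwise _≃_ f f′ → φ f ≈ φ f′) → Alt (sd φ)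
      sd-Alt _≃_ rf ck sw {suc n} {φ} e {l} {l′} s with chk l in eq | chk l′ | ck s
      ... | false | false | _ = sym -0#≈0#
      ... | true  | true  | _ = trans
        (δ-cong _ (λ m → sd-local m (λ f _ → e {toList l′ ∷ f} {toList l ∷ f} (sym≃ ∷ VP.refl rf))) l′)
        (δ-Alt _ {sd (φ ∘ (toList l ∷_))} (sd-Alt _≃_ rf ck sw (λ pf → e (rf ∷ pf))) s)
        where
        flip : ∀ {n} {u v : Vec A n} → Swap u v → Swap v u
        flip here      = here
        flip (there s) = there (flip s)
        sym≃ : toList l′ ≃ toList l
        sym≃ = sw (flip s) (≡.trans (≡.sym (ck s)) eq)

-- Labels and the cochains detecting repeated labels.

module Obstructions where

  open RingPreliminaries
  open OperatorAlgebra
  open DifferenceOperators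
  open AlternatingCochains
  open import Data.Nat using (_%_)
  open ℕD using (_mod_; m%n%n≡m%n; m≡m%n+[m/n]*n; [m+kn]%n≡m%n; m<n⇒m%n≡m; %-distribˡ-+; m%n<n)
  open ℕ∣ using (divides)
  open import Data.List.Membership.Propositional using (_∈_)
  open import Data.List.Membership.Propositional.Properties using (∈-allFin; ∈-cartesianProductWith⁺)
  open import Relation.Nullary.Decidable using (recompute)

  module Residue (p : ℕ) .{{_ : ℕ.NonZero p}} where

    infixl 6 _⊞_
    _⊞_ : Fin p → Fin p → Fin p
    a ⊞ b = (toℕ a ℕ.+ toℕ b) mod p

    toℕ-mod : ∀ n → toℕ (n mod p) ≡ n % p
    toℕ-mod n = Finₚ.toℕ-fromℕ< (m%n<n n p)

    toℕ-% : ∀ (a : Fin p) → toℕ a % p ≡ toℕ a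
    toℕ-% a = m<n⇒m%n≡m (Finₚ.toℕ<n a)

    iter-⊞ : ∀ n a b → toℕ (iter n (_⊞ b) a) ≡ (toℕ a ℕ.+ n ℕ.* toℕ b) % p
    iter-⊞ zero    a b = ≡.trans (≡.sym (toℕ-% a)) (cong (_% p) (≡.sym (ℕₚ.+-identityʳ (toℕ a))))
    iter-⊞ (suc n) a b = begin
      toℕ (iter n (_⊞ b) a ⊞ b)                            ≡⟨ toℕ-mod _ ⟩
      (toℕ (iter n (_⊞ b) a) ℕ.+ toℕ b) % p                ≡⟨ cong (λ z → (z ℕ.+ toℕ b) % p) (iter-⊞ n a b) ⟩
      ((toℕ a ℕ.+ n ℕ.* toℕ b) % p ℕ.+ toℕ b) % p          ≡⟨ %-distribˡ-+ ((toℕ a ℕ.+ n ℕ.* toℕ b) % p) (toℕ b) p ⟩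
      ((toℕ a ℕ.+ n ℕ.* toℕ b) % p % p ℕ.+ toℕ b % p) % p  ≡⟨ cong (λ z → (z ℕ.+ toℕ b % p) % p) (m%n%n≡m%n _ p) ⟩
      ((toℕ a ℕ.+ n ℕ.* toℕ b) % p ℕ.+ toℕ b % p) % p      ≡⟨ %-distribˡ-+ (toℕ a ℕ.+ n ℕ.* toℕ b) (toℕ b) p ⟨
      (toℕ a ℕ.+ n ℕ.* toℕ b ℕ.+ toℕ b) % p                ≡⟨ cong (_% p) (≡.trans (ℕₚ.+-assoc (toℕ a) _ _) (cong (toℕ a ℕ.+_) (ℕₚ.+-comm (n ℕ.* toℕ b) (toℕ b)))) ⟩
      (toℕ a ℕ.+ suc n ℕ.* toℕ b) % p                      ∎
      where open ≡.≡-Reasoning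

    ⊞-period : ∀ a b → iter p (_⊞ b) a ≡ a
    ⊞-period a b = Finₚ.toℕ-injective (≡.trans (iter-⊞ p a b) (≡.trans (cong (λ z → (toℕ a ℕ.+ z) % p) (ℕₚ.*-comm p (toℕ b)))
      (≡.trans ([m+kn]%n≡m%n (toℕ a) (toℕ b) p) (toℕ-% a))))

    ⊞-swap : ∀ a b c → a ⊞ b ⊞ c ≡ a ⊞ c ⊞ b
    ⊞-swap a b c = Finₚ.toℕ-injective (≡.trans (flat b c) (≡.trans (cong (_% p) (≡.trans (ℕₚ.+-assoc (toℕ a) _ _)
        (≡.trans (cong (toℕ a ℕ.+_) (ℕₚ.+-comm (toℕ b) (toℕ c))) (≡.sym (ℕₚ.+-assoc (toℕ a) _ _))))) (≡.sym (flat c b))))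
      where
      open ≡.≡-Reasoning
      flat : ∀ b c → toℕ (a ⊞ b ⊞ c) ≡ (toℕ a ℕ.+ toℕ b ℕ.+ toℕ c) % p
      flat b c = begin
        toℕ (a ⊞ b ⊞ c)                                  ≡⟨ toℕ-mod _ ⟩
        (toℕ (a ⊞ b) ℕ.+ toℕ c) % p                      ≡⟨ cong (λ z → (z ℕ.+ toℕ c) % p) (toℕ-mod _) ⟩
        ((toℕ a ℕ.+ toℕ b) % p ℕ.+ toℕ c) % p            ≡⟨ %-distribˡ-+ ((toℕ a ℕ.+ toℕ b) % p) (toℕ c) p ⟩
        ((toℕ a ℕ.+ toℕ b) % p % p ℕ.+ toℕ c % p) % p    ≡⟨ cong (λ z → (z ℕ.+ toℕ c % p) % p) (m%n%n≡m%n _ p) ⟩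
        ((toℕ a ℕ.+ toℕ b) % p ℕ.+ toℕ c % p) % p        ≡⟨ %-distribˡ-+ (toℕ a ℕ.+ toℕ b) (toℕ c) p ⟨
        (toℕ a ℕ.+ toℕ b ℕ.+ toℕ c) % p                  ∎

  map-comm : ∀ {A : Set} {f h : A → A} → (∀ a → f (h a) ≡ h (f a)) → ∀ {n} (v : Vec A n) → Vec.map f (Vec.map h v) ≡ Vec.map h (Vec.map f v)
  map-comm c []      = ≡.refl
  map-comm c (a ∷ v) = ≡.cong₂ _∷_ (c a) (map-comm c v)

  iter-map : ∀ {A : Set} {f : A → A} m → (∀ a → iter m f a ≡ a) → ∀ {n} (v : Vec A n) → iter m (Vec.map f) v ≡ v
  iter-map {A} {f} m c v = ≡.trans (go m v) (≡.trans (Vecₚ.map-cong c v) (Vecₚ.map-id v))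
    where
    go : ∀ m {n} (v : Vec A n) → iter m (Vec.map f) v ≡ Vec.map (iter m f) v
    go zero    v = ≡.sym (Vecₚ.map-id v)
    go (suc m) v = ≡.trans (cong (Vec.map f) (go m v)) (≡.sym (Vecₚ.map-∘ f (iter m f) v))

  -- Only neighbours are compared: a repetition arises when the rank fails to grow in one step of a
  -- flag, and for equal neighbours two terms of a coboundary cancel.
  data Deg {Y : Set} : ∀ {n} → Vec Y n → Set where
    here  : ∀ {n y} {v : Vec Y n} → Deg (y ∷ y ∷ v)
    there : ∀ {n y} {v : Vec Y n} → Deg v → Deg (y ∷ v)

  Deg-map : ∀ {Y : Set} (f : Y → Y) {n} {v : Vec Y n} → Deg v → Deg (Vec.map f v)
  Deg-map f here      = here
  Deg-map f (there q) = there (Deg-map f q)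

  -- X^(p-1) and X alternate, as in the periodic resolution of a cyclic group of order p.
  expo : ℕ → ℕ → ℕ
  expo p₁ zero          = p₁
  expo p₁ (suc zero)    = 1
  expo p₁ (suc (suc n)) = expo p₁ n

  expo-alternates : ∀ p₁ n → (expo p₁ n ≡ p₁ × expo p₁ (suc n) ≡ 1) ⊎ (expo p₁ n ≡ 1 × expo p₁ (suc n) ≡ p₁)
  expo-alternates p₁ zero          = inj₁ (≡.refl , ≡.refl)
  expo-alternates p₁ (suc zero)    = inj₂ (≡.refl , ≡.refl)
  expo-alternates p₁ (suc (suc n)) = expo-alternates p₁ n

  zeros : ∀ {p₁ k} → Vec (Fin (suc p₁)) k
  zeros = Vec.replicate _ zero

  module Labels (p₁ k : ℕ) where
    open Residue (suc p₁)

    -- A non-constant affine function on (ℤ/p)^k, given by its slope `χ` and a constant term `s`; a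
    -- translation changes the constant term by a component of the slope. Irrelevance of `nz` makes
    -- labels with equal data equal.
    record Y : Set where
      constructor mkY
      field
        χ   : Vec (Fin (suc p₁)) k
        s   : Fin (suc p₁)
        .nz : χ ≢ zeros
    open Y public

    gY : Fin k → Y → Y
    gY i (mkY χ s nz) = mkY χ (s ⊞ lookup χ i) nz

    gY-comm : ∀ i j y → gY i (gY j y) ≡ gY j (gY i y)
    gY-comm i j (mkY χ s nz) = cong (λ z → mkY χ z nz) (⊞-swap s (lookup χ j) (lookup χ i))

    gY-period : ∀ i y → iter (suc p₁) (gY i) y ≡ y
    gY-period i (mkY χ s nz) = ≡.trans (go (suc p₁)) (cong (λ z → mkY χ z nz) (⊞-period s (lookup χ i)))
      where
      go : ∀ n → iter n (gY i) (mkY χ s nz) ≡ mkY χ (iter n (_⊞ lookup χ i) s) nz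
      go zero    = ≡.refl
      go (suc n) = cong (gY i) (go n)

  -- A domain of characteristic `p`, with non-vanishing given positively by `NZ` so that products
  -- can be handled without deciding equality. `NZ-ω` is linear independence of the `ωᵢ` over the
  -- prime field; `ω₀` makes X equal to `g - 1` when `k = 1`, which the treatment of cliques relies
  -- on.
  record Coefficients (p₁ k : ℕ) : Set₁ where
    field
      ring : CommutativeRing 0ℓ 0ℓ
    open CommutativeRing ring public hiding (zero; ring)
    private
      module M = Mult semiring
    field
      isPrime : Prime (suc p₁)
      char    : ∀ r → (suc p₁ M.× r) ≈ 0#
      ω       : Fin k → Carrier
      ω₀      : ∀ i → toℕ i ≡ 0 → ω i ≈ 1#
      NZ      : Carrier → Set
      NZ⇒≉0   : ∀ {r} → NZ r → ¬ r ≈ 0#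
      NZ-≈    : ∀ {r r′} → r ≈ r′ → NZ r → NZ r′
      NZ-*    : ∀ {r r′} → NZ r → NZ r′ → NZ (r * r′)
      NZ-1    : NZ 1#
      NZ-ℕ    : ∀ j → 0 ℕ.< j → j ℕ.< suc p₁ → NZ (j M.× 1#)
    open CharP ring isPrime char ω public
    field
      NZ-ω    : ∀ (χ : Vec (Fin (suc p₁)) k) → χ ≢ zeros → NZ (sumR (λ i → ω i * (toℕ (lookup χ i) M.× 1#)))

  module Obstruction {p₁ k : ℕ} (K : Coefficients p₁ k) where
    open Coefficients K
    open Cochains ring
    open Labels p₁ k public
    open Mult semiring using (×-homo-+; ×-congʳ; ×-congˡ; ×-assocˡ) renaming (_×_ to _⊠_)
    open import Algebra.Properties.Semiring.Exp semiring using (_^_)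
    open import Relation.Binary.Reasoning.Setoid setoid
    open Residue (suc p₁)

    toR : Fin (suc p₁) → Carrier
    toR a = toℕ a ⊠ 1#

    toR-⊞ : ∀ a b → toR (a ⊞ b) ≈ toR a + toR b
    toR-⊞ a b = begin
      toℕ (a ⊞ b) ⊠ 1#            ≡⟨ cong (_⊠ 1#) (toℕ-mod n) ⟩
      (n % suc p₁) ⊠ 1#           ≈⟨ +-identityʳ _ ⟨
      (n % suc p₁) ⊠ 1# + 0#      ≈⟨ +-congˡ (FR.multiple≈0 1# (divides (n / suc p₁) ≡.refl)) ⟨
      (n % suc p₁) ⊠ 1# + ((n / suc p₁) ℕ.* suc p₁) ⊠ 1# ≈⟨ ×-homo-+ 1# (n % suc p₁) _ ⟨
      (n % suc p₁ ℕ.+ (n / suc p₁) ℕ.* suc p₁) ⊠ 1# ≡⟨ cong (_⊠ 1#) (m≡m%n+[m/n]*n n (suc p₁)) ⟨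
      n ⊠ 1#                      ≈⟨ ×-homo-+ 1# (toℕ a) (toℕ b) ⟩
      toR a + toR b               ∎
      where n = toℕ a ℕ.+ toℕ b

    private
      _≟χ_ : (χ χ′ : Vec (Fin (suc p₁)) k) → Dec (χ ≡ χ′)
      _≟χ_ = Vecₚ.≡-dec Fin._≟_

      Λ : Vec (Fin (suc p₁)) k → Carrier
      Λ χ = sumR (λ i → ω i * toR (lookup χ i)) ^ suc p₁

      -- At the zero vector `Λ` would vanish; it is replaced by 1 to keep the product over all
      -- vectors non-zero.
      factor : Vec (Fin (suc p₁)) k → Carrier
      factor χ with χ ≟χ zeros
      ... | yes _ = 1#
      ... | no  _ = Λ χ

      factor-Λ : ∀ χ → χ ≢ zeros → factor χ ≡ Λ χ
      factor-Λ χ χ≢0 with χ ≟χ zeros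
      ... | yes e = ⊥-elim (χ≢0 e)
      ... | no  _ = ≡.refl

      NZ-^ : ∀ {r} n → NZ r → NZ (r ^ n)
      NZ-^ zero    z = NZ-1
      NZ-^ (suc n) z = NZ-* z (NZ-^ n z)

      NZ-factor : ∀ χ → NZ (factor χ)
      NZ-factor χ with χ ≟χ zeros
      ... | yes _ = NZ-1
      ... | no χ≢0 = NZ-^ (suc p₁) (NZ-ω χ χ≢0)

      prod : List (Vec (Fin (suc p₁)) k) → Carrier
      prod []       = 1#
      prod (χ ∷ xs) = factor χ * prod xs

      cofactor : ∀ {χ xs} → χ ∈ xs → Σ Carrier λ c → c * factor χ ≈ prod xs
      cofactor {xs = χ ∷ xs} (here ≡.refl) = prod xs , *-comm _ _
      cofactor {xs = χ ∷ xs} (there m) with cofactor m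
      ... | c , e = factor χ * c , trans (*-assoc _ _ _) (*-congˡ e)

      allVecs : ∀ n → List (Vec (Fin (suc p₁)) n)
      allVecs zero    = [] ∷ []
      allVecs (suc n) = List.cartesianProductWith _∷_ (List.allFin (suc p₁)) (allVecs n)

      ∈-allVecs : ∀ {n} (v : Vec (Fin (suc p₁)) n) → v ∈ allVecs n
      ∈-allVecs []      = here ≡.refl
      ∈-allVecs (a ∷ v) = ∈-cartesianProductWith⁺ _∷_ (∈-allFin a) (∈-allVecs v)

      -- A Weyl relation needs the same scalar on all label sequences, whereas the `p`-th power of
      -- `U` yields `Λ χ`, which depends on the slope. The product over all slopes is a common
      -- multiple, and `cofactor` supplies the missing factor.
      D : Carrier
      D = prod (allVecs k)

      NZ-D : NZ D
      NZ-D = go (allVecs k)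
        where
        go : ∀ xs → NZ (prod xs)
        go []       = NZ-1
        go (χ ∷ xs) = NZ-* (NZ-factor χ) (go xs)

    G : ∀ {n} → Fin k → Vec Y n → Vec Y n
    G i = Vec.map (gY i)

    T : ∀ {Ω : Set} → (Fin k → Ω → Ω) → ℕ → Op {Ω}
    T g n = X g ^ₒ expo p₁ n

    private
      -- The multiplier is the constant term of the first label of a sequence. Slopes are unchanged
      -- by the action, so its increment and the cofactor are invariant.
      module W (n : ℕ) where
        open Action {Vec Y (suc n)} G (λ i j → map-comm (gY-comm i j)) (λ i → iter-map (suc p₁) (gY-period i)) public

        b : Fin k → Fn {Vec Y (suc n)}
        b i (y ∷ _) = toR (lookup (χ y) i)
        sv cof : Fn {Vec Y (suc n)}
        sv (y ∷ _) = toR (s y)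
        cof (y ∷ _) = proj₁ (cofactor (∈-allVecs (χ y)))

        private
          b-inv : ∀ i j w → b i (G j w) ≈ b i w
          b-inv i j (y ∷ _) = refl

          sv-shift : ∀ i w → sv (G i w) ≈ sv w + b i w
          sv-shift i (y ∷ _) = toR-⊞ (s y) (lookup (χ y) i)

          cof-inv : ∀ i w → cof (G i w) ≈ cof w
          cof-inv i (y ∷ _) = refl

          cofD : ∀ w → cof w * sumR (λ i → ω i * b i w) ^ suc p₁ ≈ D
          cofD (mkY c _ nz ∷ _) = trans (*-congˡ (reflexive (≡.sym (factor-Λ c (recompute (¬? (c ≟χ zeros)) nz))))) (proj₂ (cofactor (∈-allVecs c)))

        Sop : Op {Vec Y (suc n)}
        Sop = S sv b b-inv sv-shift cof cof-inv D cofD p₁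

        Sop-preserves : Preserves Deg Sop
        Sop-preserves = S-preserves sv b b-inv sv-shift cof cof-inv D cofD p₁ (λ i w → Deg-map (gY i))

        Sop-weyl : ∀ φ w → app (X G) (app Sop φ) w ≈ app Sop (app (X G) φ) w + D * φ w
        Sop-weyl = S-weyl sv b b-inv sv-shift cof cof-inv D cofD p₁ ≡.refl

        open Weyl (X G) Sop D Sop-weyl Deg (X-preserves G (λ i w → Deg-map (gY i))) Sop-preserves public

        NZ-κ : ∀ j → j ℕ.≤ p₁ → NZ (κ j)
        NZ-κ zero    _  = NZ-1
        NZ-κ (suc j) le = NZ-* (NZ-* (NZ-ℕ (suc j) (s≤s z≤n) (s≤s le)) NZ-D) (NZ-κ j (ℕₚ.<⇒≤ le))

    VanishesOnDeg : ∀ {n} → (Vec Y n → Carrier) → Set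
    VanishesOnDeg φ = ∀ v → Deg v → φ v ≈ 0#

    private
      Lift : ∀ n → ℕ → (Vec Y (suc n) → Carrier) → Set
      Lift n e φ = Σ (Vec Y (suc n) → Carrier) λ η → Σ Carrier λ κ → NZ κ × (∀ v → app (X G ^ₒ e) η v ≈ κ * φ v) × VanishesOnDeg η

      -- The two halves of exactness: the kernel of `X^(p-1)` lies in the image of `X`, and the
      -- kernel of `X` in the image of `X^(p-1)`, each up to the factor `κ`.
      lift : ∀ n e e′ → (e ≡ p₁ × e′ ≡ 1) ⊎ (e ≡ 1 × e′ ≡ p₁) → (φ : Vec Y (suc n) → Carrier) →
             (∀ v → app (X G ^ₒ e) φ v ≈ 0#) → VanishesOnDeg φ → Lift n e′ φ
      lift n e e′ (inj₁ (≡.refl , ≡.refl)) φ z van =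
        let η , eq , vη = W.kernel^⇒image n p₁ φ z van in η , W.κ n p₁ , W.NZ-κ n p₁ ℕₚ.≤-refl , eq , vη
      lift n e e′ (inj₂ (≡.refl , ≡.refl)) φ z van =
        app (W.Sop n ^ₒ p₁) φ , W.κ n p₁ , W.NZ-κ n p₁ ℕₚ.≤-refl , W.kernel⇒image^ n p₁ φ z ,
        ^-preserves {Q = Deg} {X = W.Sop n} p₁ (W.Sop-preserves n) van

      -- The terms omitting one of two equal neighbours cancel, and every other term still contains
      -- both.
      d-vanishes : ∀ {n} {φ : Vec Y n → Carrier} → VanishesOnDeg φ → VanishesOnDeg (d φ)
      d-vanishes {zero} van (y ∷ []) (there ())
      d-vanishes {suc zero} {φ} van (y ∷ y ∷ []) here = -‿inverseʳ _
      d-vanishes {suc (suc n)} {φ} van (y ∷ y ∷ v) here = begin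
        1# * φ (y ∷ v) - (1# * φ (y ∷ v) - d (λ m → φ (y ∷ y ∷ m)) v) ≈⟨ +-congˡ (-‿cong (+-congˡ (-‿cong (δ-0 _ v (λ m _ → van _ here))))) ⟩
        1# * φ (y ∷ v) - (1# * φ (y ∷ v) - 0#) ≈⟨ solve 1 (λ x → x :- (x :- con ℤ.0ℤ) := con ℤ.0ℤ) refl _ ⟩
        0# ∎
        where
        open ℤSolver ring
        import Data.Integer as ℤ
      d-vanishes {suc n} {φ} van (y ∷ v) (there q) = trans (+-cong (*-congˡ (van v q)) (-‿cong (d-vanishes (λ m qm → van (y ∷ m) (there qm)) v q)))
        (trans (+-cong (zeroʳ _) -0#≈0#) (+-identityˡ 0#))
        where open import Algebra.Properties.Ring (CommutativeRing.ring ring) using (-0#≈0#)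

      d-X^ : ∀ {n} m (φ : Vec Y n → Carrier) v → d (app (X G ^ₒ m) φ) v ≈ app (X G ^ₒ m) (d φ) v
      d-X^ m φ v = Natural.X^-natural G G d (λ _ → ⊤) (λ _ _ _ → tt) (λ _ → ⊤) (λ _ → tt)
        (λ w _ → δ-0 _ w (λ _ _ → refl)) (λ e w _ → δ-cong _ e w) (λ φ ψ w _ → δ-+ _ φ ψ w) (λ r φ w _ → δ-* _ r φ w)
        (λ i {φ} _ w _ → δ-map (gY i) φ w) m tt v tt

    record Stage (n : ℕ) : Set where
      field
        θ       : Vec Y (suc n) → Carrier
        θ-T     : ∀ v → app (T G n) θ v ≈ 0#
        θ-d     : ∀ v → d θ v ≈ 0#
        θ-van   : VanishesOnDeg θ
      lifted : Lift n (expo p₁ (suc n)) θ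
      lifted = lift n (expo p₁ n) (expo p₁ (suc n)) (expo-alternates p₁ n) θ θ-T θ-van
      η : Vec Y (suc n) → Carrier
      η = proj₁ lifted
      κ : Carrier
      κ = proj₁ (proj₂ lifted)
      κ-NZ : NZ κ
      κ-NZ = proj₁ (proj₂ (proj₂ lifted))
      η-T : ∀ v → app (T G (suc n)) η v ≈ κ * θ v
      η-T = proj₁ (proj₂ (proj₂ (proj₂ lifted)))
      η-van : VanishesOnDeg η
      η-van = proj₂ (proj₂ (proj₂ (proj₂ lifted)))

    stage : ∀ n → Stage n
    stage zero = record
      -- The constant 1 on single labels; it is killed by `X`, hence by `X^(p-1)` since `p - 1` is
      -- positive.
      { θ = d (λ _ → 1#)
      ; θ-T = λ v → X^-const p₁ p₁≥1 v
      ; θ-d = λ v → δδ≈0 _ _ v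
      ; θ-van = λ { (y ∷ []) (there ()) } }
      where
      open import Data.Nat.Primality using (prime⇒nonTrivial)
      p₁≥1 : 1 ℕ.≤ p₁
      p₁≥1 = ℕ.s≤s⁻¹ (ℕ.nonTrivial⇒n>1 (suc p₁) {{prime⇒nonTrivial isPrime}})
      X^-const : ∀ n → 1 ℕ.≤ n → ∀ v → app (X G ^ₒ n) (d (λ _ → 1#)) v ≈ 0#
      X^-const (suc n) _ v = trans (sym (^ₒ-shift (X G) n _ v)) (app-0 (X G ^ₒ n) (X-const G (λ i → λ { (y ∷ []) → refl })) v)
    stage (suc n) = record
      { θ = d η
      -- The operator commutes with `d` and turns `η` into `κ θ`, which is a cocycle.
      ; θ-T = λ v → trans (sym (d-X^ (expo p₁ (suc n)) η v)) (trans (δ-cong _ η-T v) (trans (δ-* _ κ θ v) (trans (*-congˡ (θ-d v)) (zeroʳ _))))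
      ; θ-d = λ v → δδ≈0 _ _ v
      ; θ-van = d-vanishes η-van }
      where open Stage (stage n)

-- Chains, their evaluation, and the pairing with obstruction cochains.

module ChainPairings where

  open RingPreliminaries
  open OperatorAlgebra
  open DifferenceOperators
  open AlternatingCochains
  open Obstructions

  module Chains {p₁ k : ℕ} (K : Coefficients p₁ k) where
    open Coefficients K
    open Cochains ring
    open Obstruction K
    open ℤSolver ring
    open import Relation.Binary.Reasoning.Setoid setoid

    Chain : Set → Set
    Chain B = List (Carrier × B)

    Support : ∀ {B : Set} → (B → Set) → Chain B → Set
    Support P = All (P ∘ proj₂)

    ev : ∀ {B : Set} → Chain B → (B → Carrier) → Carrier
    ev []            φ = 0#
    ev ((r , x) ∷ c) φ = r * φ x + ev c φ

    module _ {B : Set} where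

      ev-local : ∀ {P : B → Set} {c : Chain B} → Support P c → ∀ {φ ψ} → (∀ x → P x → φ x ≈ ψ x) → ev c φ ≈ ev c ψ
      ev-local []       e = refl
      ev-local (p ∷ ps) e = +-cong (*-congˡ (e _ p)) (ev-local ps e)

      ev-cong : ∀ (c : Chain B) {φ ψ} → (∀ x → φ x ≈ ψ x) → ev c φ ≈ ev c ψ
      ev-cong []      e = refl
      ev-cong (x ∷ c) e = +-cong (*-congˡ (e _)) (ev-cong c e)

      ev-either : ∀ {Q : Set} {P : B → Set} {c : Chain B} → Support P c → ∀ {φ} → (∀ x → P x → Q ⊎ φ x ≈ 0#) → Q ⊎ ev c φ ≈ 0#
      ev-either []       e = inj₂ refl
      ev-either (p ∷ ps) e with e _ p
      ... | inj₁ q = inj₁ q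
      ... | inj₂ z with ev-either ps e
      ...   | inj₁ q  = inj₁ q
      ...   | inj₂ z′ = inj₂ (trans (+-cong (trans (*-congˡ z) (zeroʳ _)) z′) (+-identityˡ 0#))

      ev-+ : ∀ (c : Chain B) φ ψ → ev c (λ x → φ x + ψ x) ≈ ev c φ + ev c ψ
      ev-+ []            φ ψ = sym (+-identityˡ 0#)
      ev-+ ((r , x) ∷ c) φ ψ = trans (+-congˡ (ev-+ c φ ψ))
        (solve 5 (λ r a b s t → r :* (a :+ b) :+ (s :+ t) := (r :* a :+ s) :+ (r :* b :+ t)) refl _ _ _ _ _)

      ev-* : ∀ (c : Chain B) a φ → ev c (λ x → a * φ x) ≈ a * ev c φ
      ev-* []            a φ = sym (zeroʳ a)
      ev-* ((r , x) ∷ c) a φ = trans (+-congˡ (ev-* c a φ))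
        (solve 4 (λ r a b s → r :* (a :* b) :+ a :* s := a :* (r :* b :+ s)) refl _ _ _ _)

      ev-0 : ∀ (c : Chain B) {φ} → (∀ x → φ x ≈ 0#) → ev c φ ≈ 0#
      ev-0 []      z = refl
      ev-0 (x ∷ c) z = trans (+-cong (trans (*-congˡ (z _)) (zeroʳ _)) (ev-0 c z)) (+-identityˡ 0#)

      ev-neg : ∀ (c : Chain B) φ → ev c (λ x → - φ x) ≈ - ev c φ
      ev-neg []            φ = sym -0#≈0#
        where open import Algebra.Properties.Ring (CommutativeRing.ring ring) using (-0#≈0#)
      ev-neg ((r , x) ∷ c) φ = trans (+-congˡ (ev-neg c φ)) (solve 3 (λ r a s → r :* (:- a) :+ (:- s) := :- (r :* a :+ s)) refl _ _ _)

      ev-++ : ∀ (c c′ : Chain B) φ → ev (c ++ c′) φ ≈ ev c φ + ev c′ φ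
      ev-++ []      c′ φ = sym (+-identityˡ _)
      ev-++ (x ∷ c) c′ φ = trans (+-congˡ (ev-++ c c′ φ)) (sym (+-assoc _ _ _))

      scale : Carrier → Chain B → Chain B
      scale a = List.map (λ (r , x) → a * r , x)

      ev-scale : ∀ a (c : Chain B) φ → ev (scale a c) φ ≈ a * ev c φ
      ev-scale a []            φ = sym (zeroʳ a)
      ev-scale a ((r , x) ∷ c) φ = trans (+-congˡ (ev-scale a c φ))
        (solve 4 (λ r a b s → (a :* r) :* b :+ a :* s := a :* (r :* b :+ s)) refl _ _ _ _)

      scale-support : ∀ {P : B → Set} a {c : Chain B} → Support P c → Support P (scale a c)
      scale-support a []       = []
      scale-support a (p ∷ ps) = p ∷ scale-support a ps

      ++-support : ∀ {P : B → Set} {c c′ : Chain B} → Support P c → Support P c′ → Support P (c ++ c′)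
      ++-support []       ps = ps
      ++-support (q ∷ qs) ps = q ∷ ++-support qs ps

    push : ∀ {B B′ : Set} → (B → B′) → Chain B → Chain B′
    push f = List.map (λ (r , x) → r , f x)

    ev-push : ∀ {B B′ : Set} (f : B → B′) (c : Chain B) φ → ev (push f c) φ ≈ ev c (φ ∘ f)
    ev-push f []      φ = refl
    ev-push f (x ∷ c) φ = +-congˡ (ev-push f c φ)

    push-support : ∀ {B B′ : Set} {P : B → Set} {P′ : B′ → Set} (f : B → B′) → (∀ x → P x → P′ (f x)) → ∀ {c} → Support P c → Support P′ (push f c)
    push-support f e []       = []
    push-support f e (p ∷ ps) = e _ p ∷ push-support f e ps

    bind : ∀ {B B′ : Set} → Chain B → (B → Chain B′) → Chain B′
    bind []            f = []
    bind ((r , x) ∷ c) f = scale r (f x) ++ bind c f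

    ev-bind : ∀ {B B′ : Set} (c : Chain B) (f : B → Chain B′) φ → ev (bind c f) φ ≈ ev c (λ x → ev (f x) φ)
    ev-bind []            f φ = refl
    ev-bind ((r , x) ∷ c) f φ = trans (ev-++ (scale r (f x)) (bind c f) φ) (+-cong (ev-scale r (f x) φ) (ev-bind c f φ))

    bind-support : ∀ {B B′ : Set} {P : B → Set} {P′ : B′ → Set} {f : B → Chain B′} {c} → Support P c → (∀ x → P x → Support P′ (f x)) → Support P′ (bind c f)
    bind-support []       e = []
    bind-support {c = (r , x) ∷ c} (p ∷ ps) e = ++-support (scale-support r (e x p)) (bind-support ps e)

    module ChainAction {B : Set} (g : Fin k → B → B) where

      diff-chain : ∀ {n} → (Fin n → Carrier) → (Fin n → B → B) → Chain B → Chain B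
      diff-chain {zero}  ω g c = []
      diff-chain {suc n} ω g c = (scale (ω zero) (push (g zero) c) ++ scale (- ω zero) c) ++ diff-chain (ω ∘ suc) (g ∘ suc) c

      opaque
        unfolding diffOp
        ev-diff : ∀ {n} (ω : Fin n → Carrier) (g : Fin n → B → B) c φ → ev (diff-chain ω g c) φ ≈ ev c (app (diffOp ω g) φ)
        ev-diff {zero}  ω g c φ = sym (ev-0 c (λ _ → refl))
        ev-diff {suc n} ω g c φ = begin
          ev (diff-chain ω g c) φ
            ≈⟨ ev-++ (scale (ω zero) (push (g zero) c) ++ scale (- ω zero) c) _ φ ⟩
          ev (scale (ω zero) (push (g zero) c) ++ scale (- ω zero) c) φ + ev (diff-chain (ω ∘ suc) (g ∘ suc) c) φ
            ≈⟨ +-cong (ev-++ (scale (ω zero) (push (g zero) c)) _ φ) (ev-diff (ω ∘ suc) (g ∘ suc) c φ) ⟩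
          (ev (scale (ω zero) (push (g zero) c)) φ + ev (scale (- ω zero) c) φ) + ev c (app (diffOp (ω ∘ suc) (g ∘ suc)) φ)
            ≈⟨ +-congʳ (+-cong (trans (ev-scale (ω zero) (push (g zero) c) φ) (*-congˡ (ev-push (g zero) c φ))) (ev-scale (- ω zero) c φ)) ⟩
          (ω zero * ev c (φ ∘ g zero) + (- ω zero) * ev c φ) + ev c (app (diffOp (ω ∘ suc) (g ∘ suc)) φ)
            ≈⟨ +-congʳ (trans (+-cong (sym (ev-* c _ _)) (sym (ev-* c _ _))) (sym (ev-+ c _ _))) ⟩
          ev c (λ x → ω zero * φ (g zero x) + (- ω zero) * φ x) + ev c (app (diffOp (ω ∘ suc) (g ∘ suc)) φ)
            ≈⟨ ev-+ c _ _ ⟨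
          ev c (app (diffOp ω g) φ) ∎

      X-chain : Chain B → Chain B
      X-chain = diff-chain ω g

      ev-X : ∀ c φ → ev (X-chain c) φ ≈ ev c (app (X g) φ)
      ev-X = ev-diff ω g

      X-support : ∀ {P : B → Set} → (∀ i x → P x → P (g i x)) → ∀ {c} → Support P c → Support P (X-chain c)
      X-support {P} st {c} sp = go ω g st
        where
        go : ∀ {n} (ω : Fin n → Carrier) (g : Fin n → B → B) → (∀ i x → P x → P (g i x)) → Support P (diff-chain ω g c)
        go {zero}  ω g st = []
        go {suc n} ω g st = ++-support (++-support (scale-support _ (push-support (g zero) (st zero) sp)) (scale-support _ sp)) (go (ω ∘ suc) (g ∘ suc) (st ∘ suc))

      X^-chain : ℕ → Chain B → Chain B
      X^-chain zero    c = c
      X^-chain (suc n) c = X^-chain n (X-chain c)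

      ev-X^ : ∀ n c φ → ev (X^-chain n c) φ ≈ ev c (app (X g ^ₒ n) φ)
      ev-X^ zero    c φ = refl
      ev-X^ (suc n) c φ = trans (ev-X^ n (X-chain c) φ) (ev-X c _)

      X^-support : ∀ {P : B → Set} → (∀ i x → P x → P (g i x)) → ∀ n {c} → Support P c → Support P (X^-chain n c)
      X^-support st zero    sp = sp
      X^-support st (suc n) sp = X^-support st n (X-support st sp)

    module Reaching {A : Set} (g : Fin k → A → A) (P : ∀ {n} → Vec A n → Set) where

      gV : ∀ {n} → Fin k → Vec A n → Vec A n
      gV i = Vec.map (g i)

      -- c is the top of a sequence c₀, …, cₙ = c of chains with ∂ c₀ = ρ₀ and ∂ cⱼ = ρⱼ Tⱼ cⱼ₋₁, tested on alternating cochains.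
      Reach : ∀ n → Chain (Vec A (suc n)) → Set
      Reach zero    c = Support P c × Σ Carrier λ ρ → NZ ρ × (∀ (φ : Vec A 0 → Carrier) → ev c (d φ) ≈ ρ * φ [])
      Reach (suc n) c = Support P c × Σ (Chain (Vec A (suc n))) λ c′ → Σ Carrier λ ρ → NZ ρ × Reach n c′ ×
                        (∀ {φ : Vec A (suc n) → Carrier} → Alt φ → ev c (d φ) ≈ ρ * ev c′ (app (T gV (suc n)) φ))

      Reach⇒Support : ∀ n {c} → Reach n c → Support P c
      Reach⇒Support zero    = proj₁
      Reach⇒Support (suc n) = proj₁

      opaque
        unfolding diffOp
        Alt-diffOp : ∀ {m n} (ω : Fin m → Carrier) (g : Fin m → A → A) {φ : Vec A n → Carrier} → Alt φ → Alt (app (diffOp ω (λ i → Vec.map (g i))) φ)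
        Alt-diffOp {zero}  ω g alt s = sym -0#≈0#
          where open import Algebra.Properties.Ring (CommutativeRing.ring ring) using (-0#≈0#)
        Alt-diffOp {suc m} ω g alt s = Alt-+ (Alt-+ (Alt-* (ω zero) (λ s → alt (Swap-map (g zero) s))) (Alt-* (- ω zero) alt)) (Alt-diffOp (ω ∘ suc) (g ∘ suc) alt) s

      Alt-X : ∀ {n} {φ : Vec A n → Carrier} → Alt φ → Alt (app (X gV) φ)
      Alt-X = Alt-diffOp ω g

      Alt-X^ : ∀ {n} {φ : Vec A n → Carrier} → Alt φ → ∀ m → Alt (app (X gV ^ₒ m) φ)
      Alt-X^ alt zero    = alt
      Alt-X^ alt (suc m) = Alt-X (Alt-X^ alt m)

      module Pairing
        (P-stable : ∀ {n} i (v : Vec A n) → P v → P (gV i v))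
        (L : ∀ {n} → (Vec Y n → Carrier) → Vec A n → Carrier)
        (L-[] : ∀ φ → L {0} φ [] ≈ φ [])
        (L-cong : ∀ {n} {φ ψ : Vec Y n → Carrier} → (∀ v → φ v ≈ ψ v) → ∀ l → L φ l ≈ L ψ l)
        (L-+ : ∀ {n} (φ ψ : Vec Y n → Carrier) l → L (λ v → φ v + ψ v) l ≈ L φ l + L ψ l)
        (L-* : ∀ {n} r (φ : Vec Y n → Carrier) l → L (λ v → r * φ v) l ≈ r * L φ l)
        (L-Alt : ∀ {n} (φ : Vec Y n → Carrier) → Alt (L φ))
        (L-d : ∀ {n} (φ : Vec Y n → Carrier) l → P l → L (d φ) l ≈ d (L φ) l)
        (L-g : ∀ {n} i (φ : Vec Y n → Carrier) l → P l → L (φ ∘ G i) l ≈ L φ (gV i l)) where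

        open Stage

        -- `L` is the pull-back along labels. Since `θ` is a coboundary `d η`, one passes to the
        -- boundary of `c`, moves the operator T from the chain to `η`, and finds `κ θ` one degree
        -- lower; each degree contributes only non-zero factors.
        pairing : ∀ n {c} → Reach n c → NZ (ev c (L (θ (stage n))))
        pairing zero {c} (sp , ρ , nz , e) = NZ-≈ (sym (begin
          ev c (L (d (λ _ → 1#)))   ≈⟨ ev-local sp (L-d _) ⟩
          ev c (d (L (λ _ → 1#)))   ≈⟨ e _ ⟩
          ρ * L (λ _ → 1#) []       ≈⟨ *-congˡ (L-[] _) ⟩
          ρ * 1#                    ≈⟨ *-identityʳ ρ ⟩
          ρ                         ∎)) nz
        pairing (suc n) {c} (sp , c′ , ρ , nz , r , e) = NZ-≈ (sym (begin
          ev c (L (d (η st)))                                 ≈⟨ ev-local sp (L-d _) ⟩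
          ev c (d (L (η st)))                                 ≈⟨ e (L-Alt _) ⟩
          ρ * ev c′ (app (T gV (suc n)) (L (η st)))           ≈⟨ *-congˡ (ev-local (Reach⇒Support n r) (λ l pl →
            N.X^-natural (expo p₁ (suc n)) tt l pl)) ⟨
          ρ * ev c′ (L (app (T G (suc n)) (η st)))            ≈⟨ *-congˡ (ev-cong c′ (λ l → trans (L-cong (η-T st) l) (L-* _ _ l))) ⟩
          ρ * ev c′ (λ l → κ st * L (θ st) l)                 ≈⟨ *-congˡ (ev-* c′ _ _) ⟩
          ρ * (κ st * ev c′ (L (θ st)))                       ∎)) (NZ-* nz (NZ-* (κ-NZ st) (pairing n r)))
          where
          st = stage n
          module N = Natural gV G L P P-stable (λ _ → ⊤) (λ _ → tt)
            (λ w _ → trans (L-cong (λ _ → sym (zeroˡ 0#)) w) (trans (L-* 0# (λ _ → 0#) w) (zeroˡ _)))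
            (λ e w _ → L-cong e w) (λ φ ψ w _ → L-+ φ ψ w) (λ r φ w _ → L-* r φ w) (λ i {φ} _ w pw → L-g i φ w pw)

-- Counting, sums with equality cases, and monochromatic runs.

module Counting where

  open import Defs hiding (sym)
  open import Data.Nat using (_+_; _*_)
  open ℕₚ using (*-zeroʳ; +-0-commutativeMonoid; <⇒≱; suc-injective; ≤-antisym)
  open import Data.Nat.Solver using (module +-*-Solver)
  open import Data.Fin.Permutation using (permutation)
  open ≡ using (refl; sym; trans)

  open +-*-Solver using (solve; _:+_; _:*_; _:=_; con)

  ∧-true : ∀ {a b} → a ∧ b ≡ true → a ≡ true × b ≡ true
  ∧-true {true} {true} _ = refl , refl

  ∧-intro : ∀ {a b} → a ≡ true → b ≡ true → a ∧ b ≡ true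
  ∧-intro refl refl = refl

  ∨-true : ∀ {a b} → a ∨ b ≡ true → a ≡ true ⊎ b ≡ true
  ∨-true {true}  _ = inj₁ refl
  ∨-true {false} e = inj₂ e

  ∨-introʳ : ∀ {a b} → b ≡ true → a ∨ b ≡ true
  ∨-introʳ {true}  _ = refl
  ∨-introʳ {false} e = e

  ∨-introˡ : ∀ {a b} → a ≡ true → a ∨ b ≡ true
  ∨-introˡ refl = refl

  not-true : ∀ {a} → not a ≡ true → a ≡ false
  not-true {false} _ = refl

  not-intro : ∀ {a} → a ≡ false → not a ≡ true
  not-intro refl = refl

  true≢false : ∀ {a} → a ≡ true → a ≡ false → ⊥
  true≢false refl ()

  ¬true⇒false : ∀ {a} → (a ≡ true → ⊥) → a ≡ false
  ¬true⇒false {true}  h = ⊥-elim (h refl)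
  ¬true⇒false {false} h = refl

  bool : ∀ a → a ≡ true ⊎ a ≡ false
  bool true  = inj₁ refl
  bool false = inj₂ refl

  bool-ext : ∀ {a b} → (a ≡ true → b ≡ true) → (b ≡ true → a ≡ true) → a ≡ b
  bool-ext {true}  {b}     f g = sym (f refl)
  bool-ext {false} {false} f g = refl
  bool-ext {false} {true}  f g = g refl

  eqB-true : ∀ {n} {u v : Fin n} → eqB u v ≡ true → u ≡ v
  eqB-true {u = u} {v} e with u Fin.≟ v
  ... | yes p = p
  eqB-true () | no _

  eqB-refl : ∀ {n} (u : Fin n) → eqB u u ≡ true
  eqB-refl u with u Fin.≟ u
  ... | yes _ = refl
  ... | no ¬p = ⊥-elim (¬p refl)

  eqB-false : ∀ {n} {u v : Fin n} → u ≢ v → eqB u v ≡ false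
  eqB-false h = ¬true⇒false (h ∘ eqB-true)

  anyFin-true : ∀ {n} {f : Fin n → Bool} → anyFin f ≡ true → ∃ λ i → f i ≡ true
  anyFin-true {suc n} {f} e with ∨-true {f zero} e
  ... | inj₁ p = zero , p
  ... | inj₂ p = let i , q = anyFin-true p in suc i , q

  anyFin-intro : ∀ {n} (f : Fin n → Bool) i → f i ≡ true → anyFin f ≡ true
  anyFin-intro f zero    e = ∨-introˡ e
  anyFin-intro f (suc i) e = ∨-introʳ {f zero} (anyFin-intro (f ∘ suc) i e)

  anyFin-cong : ∀ {n} {f g : Fin n → Bool} → (∀ i → f i ≡ g i) → anyFin f ≡ anyFin g
  anyFin-cong {zero}  e = refl
  anyFin-cong {suc n} e = cong₂ _∨_ (e zero) (anyFin-cong (e ∘ suc))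

  least : ∀ {n} (f : Fin n → Bool) i → f i ≡ true → ∃ λ j → f j ≡ true × (∀ u → u Fin.< j → f u ≡ false)
  least {suc n} f i e with f zero in e₀
  ... | true  = zero , e₀ , λ _ ()
  least {suc n} f zero    e | false = ⊥-elim (true≢false e e₀)
  least {suc n} f (suc i) e | false with least (f ∘ suc) i e
  ... | j , fj , mn = suc j , fj , λ { zero _ → e₀ ; (suc u) (s≤s lt) → mn u lt }

  𝟙 : Bool → ℕ
  𝟙 b = if b then 1 else 0

  𝟙-mono : ∀ {a b} → (a ≡ true → b ≡ true) → 𝟙 a ≤ 𝟙 b
  𝟙-mono {false} h = z≤n
  𝟙-mono {true}  h = subst (λ b → 1 ≤ 𝟙 b) (sym (h refl)) ≤-refl

  count-cong : ∀ {n} {f g : Fin n → Bool} → (∀ i → f i ≡ g i) → count f ≡ count g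
  count-cong {zero}  e = refl
  count-cong {suc n} e = cong₂ _+_ (cong 𝟙 (e zero)) (count-cong (e ∘ suc))

  count-mono : ∀ {n} {f g : Fin n → Bool} → (∀ i → f i ≡ true → g i ≡ true) → count f ≤ count g
  count-mono {zero}  h = z≤n
  count-mono {suc n} h = +-mono-≤ (𝟙-mono (h zero)) (count-mono (h ∘ suc))

  count-cover : ∀ {n} {f g h : Fin n → Bool} → (∀ i → f i ≡ true → g i ≡ true ⊎ h i ≡ true) → count f ≤ count g + count h
  count-cover {zero}  c = z≤n
  count-cover {suc n} {f} {g} {h} c = subst (𝟙 (f zero) + count (f ∘ suc) ≤_)
    (solve 4 (λ a b c d → (a :+ b) :+ (c :+ d) := (a :+ c) :+ (b :+ d)) refl (𝟙 (g zero)) (𝟙 (h zero)) (count (g ∘ suc)) (count (h ∘ suc)))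
    (+-mono-≤ (aux (f zero) (g zero) (h zero) (c zero)) (count-cover (c ∘ suc)))
    where
    aux : ∀ a b c → (a ≡ true → b ≡ true ⊎ c ≡ true) → 𝟙 a ≤ 𝟙 b + 𝟙 c
    aux false b c e = z≤n
    aux true  b c e with e refl
    ... | inj₁ refl = s≤s z≤n
    ... | inj₂ refl = m≤n+m 1 (𝟙 b)

  count-split : ∀ {n} (f g : Fin n → Bool) → count (λ i → f i ∧ g i) + count (λ i → f i ∧ not (g i)) ≡ count f
  count-split {zero}  f g = refl
  count-split {suc n} f g = trans
    (solve 4 (λ a b c d → (a :+ b) :+ (c :+ d) := (a :+ c) :+ (b :+ d)) refl (𝟙 (f zero ∧ g zero)) _ (𝟙 (f zero ∧ not (g zero))) _)
    (cong₂ _+_ (aux (f zero) (g zero)) (count-split (f ∘ suc) (g ∘ suc)))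
    where
    aux : ∀ a b → 𝟙 (a ∧ b) + 𝟙 (a ∧ not b) ≡ 𝟙 a
    aux true  true  = refl
    aux true  false = refl
    aux false b     = refl

  count-pos : ∀ {n} (f : Fin n → Bool) i → f i ≡ true → 1 ≤ count f
  count-pos f zero    e = subst (λ b → 1 ≤ 𝟙 b + count (f ∘ suc)) (sym e) (s≤s z≤n)
  count-pos f (suc i) e = ≤-trans (count-pos (f ∘ suc) i e) (m≤n+m _ (𝟙 (f zero)))

  count-find : ∀ {n} (f : Fin n → Bool) → 1 ≤ count f → ∃ λ i → f i ≡ true
  count-find {suc n} f h with f zero in e
  ... | true  = zero , e
  ... | false = let i , p = count-find (f ∘ suc) h in suc i , p

  count-none : ∀ {n} (f : Fin n → Bool) → (∀ i → f i ≡ false) → count f ≡ 0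
  count-none {zero}  f h = refl
  count-none {suc n} f h = cong₂ _+_ (cong 𝟙 (h zero)) (count-none (f ∘ suc) (h ∘ suc))

  count-≤1 : ∀ {n} (f : Fin n → Bool) → (∀ i j → f i ≡ true → f j ≡ true → i ≡ j) → count f ≤ 1
  count-≤1 {zero}  f u = z≤n
  count-≤1 {suc n} f u with f zero in e
  ... | true  = s≤s (≤-reflexive (count-none (f ∘ suc) (λ i → ¬true⇒false λ p → case u zero (suc i) e p of λ ())))
  ... | false = count-≤1 (f ∘ suc) (λ i j p r → Finₚ.suc-injective (u (suc i) (suc j) p r))

  count≤n : ∀ {n} (f : Fin n → Bool) → count f ≤ n
  count≤n {zero}  f = z≤n
  count≤n {suc n} f = +-mono-≤ (𝟙≤1 (f zero)) (count≤n (f ∘ suc))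
    where
    𝟙≤1 : ∀ b → 𝟙 b ≤ 1
    𝟙≤1 true  = ≤-refl
    𝟙≤1 false = z≤n

  count-full : ∀ {n} (f : Fin n → Bool) → (∀ i → f i ≡ true) → count f ≡ n
  count-full {zero}  f h = refl
  count-full {suc n} f h = cong₂ _+_ (cong 𝟙 (h zero)) (count-full (f ∘ suc) (h ∘ suc))

  count-⊆-≡ : ∀ {n} {f g : Fin n → Bool} → (∀ i → f i ≡ true → g i ≡ true) → count g ≤ count f → ∀ i → f i ≡ g i
  count-⊆-≡ {suc n} {f} {g} s le = λ { zero → hd ; (suc i) → count-⊆-≡ {f = f ∘ suc} (s ∘ suc) tl i }
    where
    tl′ : count (f ∘ suc) ≤ count (g ∘ suc)
    tl′ = count-mono (s ∘ suc)
    hd : f zero ≡ g zero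
    hd = bool-ext (s zero) λ gz → ¬¬ (λ fz → <⇒≱ (≤-trans (s≤s (subst (λ b → 𝟙 b + count (f ∘ suc) ≤ count (g ∘ suc)) (sym fz) tl′))
           (≤-reflexive (cong (λ b → 𝟙 b + count (g ∘ suc)) (sym gz)))) le)
      where
      ¬¬ : (f zero ≡ false → ⊥) → f zero ≡ true
      ¬¬ h with f zero
      ... | true  = refl
      ... | false = ⊥-elim (h refl)
    tl : count (g ∘ suc) ≤ count (f ∘ suc)
    tl = +-cancelˡ-≤ (𝟙 (g zero)) _ _ (subst (λ b → 𝟙 (g zero) + count (g ∘ suc) ≤ 𝟙 b + count (f ∘ suc)) hd le)

  sumF : ∀ {n} → (Fin n → ℕ) → ℕ
  sumF {zero}  a = 0
  sumF {suc n} a = a zero + sumF (a ∘ suc)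

  sumF-cong : ∀ {n} {a b : Fin n → ℕ} → (∀ i → a i ≡ b i) → sumF a ≡ sumF b
  sumF-cong {zero}  e = refl
  sumF-cong {suc n} e = cong₂ _+_ (e zero) (sumF-cong (e ∘ suc))

  sumF-mono : ∀ {n} {a b : Fin n → ℕ} → (∀ i → a i ≤ b i) → sumF a ≤ sumF b
  sumF-mono {zero}  h = z≤n
  sumF-mono {suc n} h = +-mono-≤ (h zero) (sumF-mono (h ∘ suc))

  sumF-+ : ∀ {n} (a b : Fin n → ℕ) → sumF (λ i → a i + b i) ≡ sumF a + sumF b
  sumF-+ {zero}  a b = refl
  sumF-+ {suc n} a b = trans (cong ((a zero + b zero) +_) (sumF-+ (a ∘ suc) (b ∘ suc)))
    (solve 4 (λ a b c d → (a :+ b) :+ (c :+ d) := (a :+ c) :+ (b :+ d)) refl (a zero) (b zero) _ _)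

  sumF-const : ∀ n c → sumF {n} (λ _ → c) ≡ n * c
  sumF-const zero    c = refl
  sumF-const (suc n) c = cong (c +_) (sumF-const n c)

  sumF-tight : ∀ {n} {a b : Fin n → ℕ} → (∀ i → a i ≤ b i) → sumF b ≤ sumF a → ∀ i → a i ≡ b i
  sumF-tight {suc n} {a} {b} h le = λ { zero → hd ; (suc i) → sumF-tight (h ∘ suc) tl i }
    where
    hd : a zero ≡ b zero
    hd = ≤-antisym (h zero) (+-cancelʳ-≤ (sumF (b ∘ suc)) (b zero) (a zero) (≤-trans le (+-monoʳ-≤ (a zero) (sumF-mono (h ∘ suc)))))
    tl : sumF (b ∘ suc) ≤ sumF (a ∘ suc)
    tl = +-cancelˡ-≤ (b zero) _ _ (subst (λ z → b zero + sumF (b ∘ suc) ≤ z + sumF (a ∘ suc)) hd le)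

  hasCol : ∀ {q} → Fin q → Maybe (Fin q) → Bool
  hasCol c nothing   = false
  hasCol c (just c′) = eqB c′ c

  hasCol-just : ∀ {q} {c : Fin q} {m} → hasCol c m ≡ true → m ≡ just c
  hasCol-just {m = just c′} e = cong just (eqB-true e)

  just-hasCol : ∀ {q} {c : Fin q} {m} → m ≡ just c → hasCol c m ≡ true
  just-hasCol {c = c} refl = eqB-refl c

  is-just-elim : ∀ {A : Set} {m : Maybe A} → is-just m ≡ true → ∃ λ a → m ≡ just a
  is-just-elim {m = just a} _ = a , refl

  is-just-intro : ∀ {A : Set} {m : Maybe A} {a} → m ≡ just a → is-just m ≡ true
  is-just-intro refl = refl

  private
    sum-indicator : ∀ {q} (c : Fin q) → sumF (λ i → 𝟙 (eqB c i)) ≡ 1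
    sum-indicator {suc q} zero    = cong suc (trans (sumF-cong {q} {b = λ _ → 0} (λ i → cong 𝟙 (eqB-false {u = zero} {suc i} λ ()))) (trans (sumF-const q 0) (*-zeroʳ q)))
    sum-indicator {suc q} (suc c) = trans (cong₂ _+_ (cong 𝟙 (eqB-false {u = suc c} {zero} λ ())) (sumF-cong (λ i → cong 𝟙 (eqB-suc c i)))) (sum-indicator c)
      where
      eqB-suc : ∀ {q} (c i : Fin q) → eqB (suc c) (suc i) ≡ eqB c i
      eqB-suc c i = bool-ext (λ e → subst (λ z → eqB c z ≡ true) (Finₚ.suc-injective (eqB-true e)) (eqB-refl c))
                             (λ e → subst (λ z → eqB (suc c) (suc z) ≡ true) (eqB-true e) (eqB-refl (suc c)))

  count-fibres : ∀ {n q} (κ : Fin n → Maybe (Fin q)) → count (is-just ∘ κ) ≡ sumF (λ c → count (λ v → hasCol c (κ v)))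
  count-fibres {zero}  {q} κ = sym (trans (sumF-const q 0) (*-zeroʳ q))
  count-fibres {suc n} {q} κ = trans (cong₂ _+_ (aux (κ zero)) (count-fibres (κ ∘ suc))) (sym (sumF-+ (λ c → 𝟙 (hasCol c (κ zero))) _))
    where
    aux : ∀ m → 𝟙 (is-just m) ≡ sumF (λ c → 𝟙 (hasCol c m))
    aux nothing  = sym (trans (sumF-const q 0) (*-zeroʳ q))
    aux (just c) = sym (sum-indicator c)

  count-classes : ∀ {n m} (part : Fin n → Fin m) (f : Fin n → Bool) → count f ≡ sumF (λ j → count (λ v → eqB (part v) j ∧ f v))
  count-classes part f = trans (count-cong (λ v → e₁ (f v))) (trans (count-fibres κ) (sumF-cong (λ j → count-cong (λ v → e₂ j v (f v)))))
    where
    κ′ : Bool → _ → Maybe _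
    κ′ b v = if b then just (part v) else nothing
    κ : _ → Maybe _
    κ v = κ′ (f v) v
    e₁ : ∀ b {v} → b ≡ is-just (κ′ b v)
    e₁ true  = refl
    e₁ false = refl
    e₂ : ∀ j v b → hasCol j (κ′ b v) ≡ eqB (part v) j ∧ b
    e₂ j v true  with eqB (part v) j
    ... | true  = refl
    ... | false = refl
    e₂ j v false with eqB (part v) j
    ... | true  = refl
    ... | false = refl

  count-permute : ∀ {n} (σ τ : Fin n → Fin n) → (∀ i → σ (τ i) ≡ i) → (∀ i → τ (σ i) ≡ i) → ∀ f → count (f ∘ σ) ≡ count f
  count-permute σ τ στ τσ f = trans (asSum (f ∘ σ)) (trans (sym (sum-permute (𝟙 ∘ f) π)) (sym (asSum f)))
    where
    open import Algebra.Properties.CommutativeMonoid.Sum +-0-commutativeMonoid using (sum; sum-permute)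
    π : Permutation′ _
    π = permutation σ τ στ τσ
    asSum : ∀ {n} (f : Fin n → Bool) → count f ≡ sum (𝟙 ∘ f)
    asSum {zero}  f = refl
    asSum {suc n} f = cong (𝟙 (f zero) +_) (asSum (f ∘ suc))

  -- Number of maximal monochromatic runs, started after a letter of colour a.
  module Runs {q : ℕ} where

    change : Maybe (Fin q) → Fin q → ℕ
    change a c = 𝟙 (not (hasCol c a))

    runs : ∀ {n} → Maybe (Fin q) → (Fin n → Maybe (Fin q)) → ℕ
    runs′ : ∀ {n} → Maybe (Fin q) → Maybe (Fin q) → (Fin n → Maybe (Fin q)) → ℕ
    runs {zero}  a f = 0
    runs {suc n} a f = runs′ a (f zero) (f ∘ suc)
    runs′ a nothing  f = runs a f
    runs′ a (just c) f = change a c + runs (just c) f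

    first : ∀ {n} → (Fin n → Maybe (Fin q)) → Maybe (Fin q)
    first {zero}  f = nothing
    first {suc n} f = Maybe._<∣>_ (f zero) (first (f ∘ suc))

    _⊑_ : ∀ {n} → (Fin n → Maybe (Fin q)) → (Fin n → Maybe (Fin q)) → Set
    f ⊑ g = ∀ v {c} → f v ≡ just c → g v ≡ just c

    change≤1 : ∀ a c → change a c ≤ 1
    change≤1 a c with hasCol c a
    ... | true  = z≤n
    ... | false = ≤-refl

    change-same : ∀ c → change (just c) c ≡ 0
    change-same c rewrite eqB-refl c = refl

    -- The preceding colour only decides whether the first coloured letter opens a run.
    runs-lip : ∀ {n} a b (f : Fin n → Maybe (Fin q)) → runs a f ≤ 1 + runs b f
    runs-lip {zero}  a b f = z≤n
    runs-lip {suc n} a b f with f zero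
    ... | nothing = runs-lip a b (f ∘ suc)
    ... | just c  = +-mono-≤ (change≤1 a c) (m≤n+m _ (change b c))

    -- An inserted letter that changes the colour opens a run itself, and this pays for the at most
    -- one run lost behind it.
    runs-mono : ∀ {n} a {f g : Fin n → Maybe (Fin q)} → f ⊑ g → runs a f ≤ runs a g
    runs-mono {zero}  a s = z≤n
    runs-mono {suc n} a {f} {g} s with f zero in ef | g zero in eg
    ... | just c  | nothing = ⊥-elim (case trans (sym eg) (s zero ef) of λ ())
    ... | just c  | just c′ with trans (sym eg) (s zero ef)
    ...   | refl = +-monoʳ-≤ (change a c) (runs-mono (just c) (λ v → s (suc v)))
    runs-mono {suc n} a {f} {g} s | nothing | nothing = runs-mono a (λ v → s (suc v))
    runs-mono {suc n} a {f} {g} s | nothing | just c  with hasCol c a in ea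
    ... | true  rewrite hasCol-just {m = a} ea = runs-mono (just c) (λ v → s (suc v))
    ... | false = ≤-trans (runs-lip a (just c) (f ∘ suc)) (s≤s (runs-mono (just c) (λ v → s (suc v))))

    runs≤count : ∀ {n} a (f : Fin n → Maybe (Fin q)) → runs a f ≤ count (is-just ∘ f)
    runs≤count {zero}  a f = z≤n
    runs≤count {suc n} a f with f zero
    ... | nothing = runs≤count a (f ∘ suc)
    ... | just c  = +-mono-≤ (change≤1 a c) (runs≤count (just c) (f ∘ suc))

    runs-pos : ∀ {n} (f : Fin n → Maybe (Fin q)) v {c} → f v ≡ just c → 1 ≤ runs nothing f
    runs-pos {suc n} f v e with f zero in e₀
    ... | just c = s≤s z≤n
    runs-pos {suc n} f zero    e | nothing = ⊥-elim (case trans (sym e₀) e of λ ())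
    runs-pos {suc n} f (suc v) e | nothing = runs-pos (f ∘ suc) v e

    first-just : ∀ {n} (f : Fin n → Maybe (Fin q)) v {c} → f v ≡ just c → ∃ λ c′ → first f ≡ just c′
    first-just {suc n} f v e with f zero in e₀
    ... | just c = c , refl
    first-just {suc n} f zero    e | nothing = ⊥-elim (case trans (sym e₀) e of λ ())
    first-just {suc n} f (suc v) e | nothing = first-just (f ∘ suc) v e

    private
      runs-first : ∀ {n} c c′ (f : Fin n → Maybe (Fin q)) → first f ≡ just c′ → c ≢ c′ → runs (just c) f ≡ runs nothing f
      runs-first {suc n} c c′ f e ne with f zero
      ... | nothing = runs-first c c′ (f ∘ suc) e ne
      runs-first {suc n} c c′ f refl ne | just .c′ rewrite eqB-false ne = refl

    -- If `g` began with another colour, that beginning would be a run in addition to all those of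
    -- `f`.
    first-tight : ∀ {n} {f g : Fin n → Maybe (Fin q)} → f ⊑ g → ∀ {c} → first f ≡ just c → runs nothing f ≡ runs nothing g → first g ≡ just c
    first-tight {suc n} {f} {g} s {c} e eq with f zero in ef | g zero in eg
    ... | just c₁ | nothing = ⊥-elim (case trans (sym eg) (s zero ef) of λ ())
    ... | just c₁ | just c₂ = trans (trans (sym eg) (s zero ef)) e
    ... | nothing | nothing = first-tight (λ v → s (suc v)) e eq
    ... | nothing | just c₂ with c₂ Fin.≟ c
    ...   | yes refl = refl
    ...   | no ne = ⊥-elim (<⇒≱ (≤-trans (s≤s (subst (_≤ runs (just c₂) (g ∘ suc)) (runs-first c₂ c (f ∘ suc) e ne) (runs-mono (just c₂) (λ v → s (suc v))))) ≤-refl)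
                                 (≤-reflexive (sym eq)))

    -- With as many runs as coloured letters, every coloured letter opens its own run.
    runs-tight : ∀ {n} a (f : Fin n → Maybe (Fin q)) → count (is-just ∘ f) ≤ runs a f →
                 ∀ u v {c} → Fin.toℕ v ≡ suc (Fin.toℕ u) → f u ≡ just c → f v ≡ just c → ⊥
    runs-tight {suc n} a f le u v e fu fv with f zero in e₀
    runs-tight {suc n} a f le zero    (suc v) e fu fv | nothing = case trans (sym e₀) fu of λ ()
    runs-tight {suc n} a f le (suc u) (suc v) e fu fv | nothing = runs-tight a (f ∘ suc) le u v (suc-injective e) fu fv
    runs-tight {suc n} a f le (suc u) (suc v) e fu fv | just c₀ = runs-tight (just c₀) (f ∘ suc)
      (≤-pred (≤-trans le (+-monoˡ-≤ _ (change≤1 a c₀)))) u v (suc-injective e) fu fv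
    runs-tight {suc (suc n)} a f le zero (suc zero) e fu fv | just c₀ with trans (sym e₀) fu
    ... | refl with f (suc zero)
    runs-tight {suc (suc n)} a f le zero (suc zero) e fu refl | just c₀ | refl | just .c₀ =
      <⇒≱ (s≤s (runs≤count (just c₀) (λ i → f (suc (suc i))))) (≤-pred (≤-trans le (+-mono-≤ (change≤1 a c₀)
        (≤-reflexive (cong (_+ runs (just c₀) (λ i → f (suc (suc i)))) (change-same c₀))))))

-- Residues, translations of the colours, and affine labels.

module TranslationLabels where

  open RingPreliminaries
  open OperatorAlgebra
  open DifferenceOperators
  open Obstructions
  open import Data.Integer using (ℤ; +_; _+_; _-_; _*_; -_)
  open import Data.Integer.DivMod using (_%ℕ_; _/ℕ_; a≡a%ℕn+[a/ℕn]*n; n%ℕd<d)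
  open import Data.Integer.Divisibility.Signed using (_∣_; divides; ∣m∣n⇒∣m+n; ∣m⇒∣-m; ∣n⇒∣m*n; ∣m⇒∣m*n)
  open import Data.Integer.Solver using (module +-*-Solver)
  open import Data.Fin using (combine; remQuot)
  open import Data.Vec using (updateAt)
  open ≡ using (refl; sym; trans; module ≡-Reasoning)

  open +-*-Solver using (solve; _:+_; _:*_; _:-_; :-_; _:=_; con)

  module Modulo (p : ℕ) where

    infix 4 _≈_
    record _≈_ (a b : ℤ) : Set where
      constructor mod
      field div : + p ∣ (a - b)
    open _≈_ public

    private
      via : ∀ {x y} → x ≡ y → + p ∣ x → + p ∣ y
      via refl h = h

    ≡⇒≈ : ∀ {a b} → a ≡ b → a ≈ b
    ≡⇒≈ {a} refl = mod (divides 0ℤ (ℤₚ.+-inverseʳ a))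

    ≈-sym : ∀ {a b} → a ≈ b → b ≈ a
    ≈-sym {a} {b} (mod h) = mod (via (solve 2 (λ a b → :- (a :- b) := b :- a) refl a b) (∣m⇒∣-m h))

    ≈-trans : ∀ {a b c} → a ≈ b → b ≈ c → a ≈ c
    ≈-trans {a} {b} {c} (mod h) (mod h′) = mod (via (solve 3 (λ a b c → (a :- b) :+ (b :- c) := a :- c) refl a b c) (∣m∣n⇒∣m+n h h′))

    +-cong′ : ∀ {a b c d} → a ≈ b → c ≈ d → a + c ≈ b + d
    +-cong′ {a} {b} {c} {d} (mod h) (mod h′) = mod (via (solve 4 (λ a b c d → (a :- b) :+ (c :- d) := (a :+ c) :- (b :+ d)) refl a b c d) (∣m∣n⇒∣m+n h h′))

    *-cong′ : ∀ {a b c d} → a ≈ b → c ≈ d → a * c ≈ b * d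
    *-cong′ {a} {b} {c} {d} (mod h) (mod h′) = mod (via (solve 4 (λ a b c d → (a :- b) :* c :+ b :* (c :- d) := a :* c :- b :* d) refl a b c d) (∣m∣n⇒∣m+n (∣m⇒∣m*n c h) (∣n⇒∣m*n b h′)))

    neg-cong : ∀ {a b} → a ≈ b → - a ≈ - b
    neg-cong {a} {b} (mod h) = mod (via (solve 2 (λ a b → :- (a :- b) := (:- a) :- (:- b)) refl a b) (∣m⇒∣-m h))

    _≈?_ : ∀ a b → Dec (a ≈ b)
    a ≈? b with (+ p) ∣.∣? (a - b)
    ... | yes h = yes (mod h)
    ... | no ¬h = no (¬h ∘ div)

    ℤ/p : CommutativeRing 0ℓ 0ℓ
    ℤ/p = record
      { Carrier = ℤ ; _≈_ = _≈_ ; _+_ = _+_ ; _*_ = _*_ ; -_ = -_ ; 0# = 0ℤ ; 1# = 1ℤ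
      ; isCommutativeRing = record
        { isRing = record
          { +-isAbelianGroup = record
            { isGroup = record
              { isMonoid = record
                { isSemigroup = record
                  { isMagma = record
                    { isEquivalence = record { refl = ≡⇒≈ refl ; sym = ≈-sym ; trans = ≈-trans }
                    ; ∙-cong = +-cong′ }
                  ; assoc = λ a b c → ≡⇒≈ (ℤₚ.+-assoc a b c) }
                ; identity = (λ a → ≡⇒≈ (ℤₚ.+-identityˡ a)) , (λ a → ≡⇒≈ (ℤₚ.+-identityʳ a)) }
              ; inverse = (λ a → ≡⇒≈ (ℤₚ.+-inverseˡ a)) , (λ a → ≡⇒≈ (ℤₚ.+-inverseʳ a))
              ; ⁻¹-cong = neg-cong }
            ; comm = λ a b → ≡⇒≈ (ℤₚ.+-comm a b) }
          ; *-cong = *-cong′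
          ; *-assoc = λ a b c → ≡⇒≈ (ℤₚ.*-assoc a b c)
          ; *-identity = (λ a → ≡⇒≈ (ℤₚ.*-identityˡ a)) , (λ a → ≡⇒≈ (ℤₚ.*-identityʳ a))
          ; distrib = (λ a b c → ≡⇒≈ (ℤₚ.*-distribˡ-+ a b c)) , (λ a b c → ≡⇒≈ (ℤₚ.*-distribʳ-+ a b c)) }
        ; *-comm = λ a b → ≡⇒≈ (ℤₚ.*-comm a b) } }

    open Mult (CommutativeRing.semiring ℤ/p) using () renaming (_×_ to _⊠_)

    ⊠-* : ∀ n a → n ⊠ a ≡ + n * a
    ⊠-* zero    a = sym (ℤₚ.*-zeroˡ a)
    ⊠-* (suc n) a = trans (cong (_+_ a) (⊠-* n a)) (sym (ℤₚ.suc-* (+ n) a))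

    ℤ/p-char : ∀ a → p ⊠ a ≈ 0ℤ
    ℤ/p-char a = ≈-trans (≡⇒≈ (⊠-* p a)) (mod (divides a (solve 2 (λ p a → p :* a :- con 0ℤ := a :* p) refl (+ p) a)))

  module Residues (p₁ : ℕ) where
    open Modulo (suc p₁) public
    open Residue (suc p₁) public

    ι : Fin (suc p₁) → ℤ
    ι a = + toℕ a

    ≈-unique : ∀ {m n} → m ℕ.< suc p₁ → n ℕ.< suc p₁ → + m ≈ + n → m ≡ n
    ≈-unique {m} {n} m<p n<p (mod h) = ℤₚ.+-injective (ℤₚ.i-j≡0⇒i≡j (+ m) (+ n) (ℤₚ.∣i∣≡0⇒i≡0 abs0))
      where
      bound : ℤ.∣ + m - + n ∣ ℕ.< suc p₁
      bound = ℕₚ.≤-<-trans (ℕₚ.≤-trans (ℕₚ.≤-reflexive (cong ℤ.∣_∣ (ℤₚ.m-n≡m⊖n m n))) (ℤₚ.∣m⊝n∣≤m⊔n m n)) (ℕₚ.⊔-lub m<p n<p)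
      abs0 : ℤ.∣ + m - + n ∣ ≡ 0
      abs0 with ℤ.∣ + m - + n ∣ | ∣⇒∣ᵤ h | bound
      ... | zero  | _ | _ = refl
      ... | suc z | d | b = ⊥-elim (ℕₚ.<⇒≱ b (ℕ∣.∣⇒≤ d))

    ι-injective : ∀ {a b} → ι a ≈ ι b → a ≡ b
    ι-injective {a} {b} h = Finₚ.toℕ-injective (≈-unique (Finₚ.toℕ<n a) (Finₚ.toℕ<n b) h)

    ι-⊞ : ∀ a b → ι (a ⊞ b) ≈ ι a + ι b
    ι-⊞ a b = mod (divides (- (+ (n ℕ./ suc p₁)))
      (trans (cong (λ z → + z - + n) (toℕ-mod n))
      (trans (cong (λ z → + (n ℕ.% suc p₁) - z) (trans (cong +_ (ℕD.m≡m%n+[m/n]*n n (suc p₁))) (cong (λ z → + (n ℕ.% suc p₁) + z) (ℤₚ.pos-* (n ℕ./ suc p₁) (suc p₁)))))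
        (solve 3 (λ r d p → r :- (r :+ d :* p) := (:- d) :* p) refl (+ (n ℕ.% suc p₁)) (+ (n ℕ./ suc p₁)) (+ suc p₁)))))
      where n = toℕ a ℕ.+ toℕ b

    residue : ℤ → Fin (suc p₁)
    residue a = fromℕ< (n%ℕd<d a (suc p₁))

    ι-residue : ∀ a → ι (residue a) ≈ a
    ι-residue a = mod (divides (- (a /ℕ suc p₁))
      (trans (cong₂ (λ x y → + x - y) (Finₚ.toℕ-fromℕ< (n%ℕd<d a (suc p₁))) (a≡a%ℕn+[a/ℕn]*n a (suc p₁)))
        (solve 3 (λ r d p → r :- (r :+ d :* p) := (:- d) :* p) refl (+ (a %ℕ suc p₁)) (a /ℕ suc p₁) (+ suc p₁))))

    residue-cong : ∀ {a b} → a ≈ b → residue a ≡ residue b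
    residue-cong {a} {b} e = ι-injective (≈-trans (ι-residue a) (≈-trans e (≈-sym (ι-residue b))))

    residue-+ : ∀ a b → residue (a + b) ≡ residue a ⊞ residue b
    residue-+ a b = ι-injective (≈-trans (ι-residue (a + b)) (≈-sym (≈-trans (ι-⊞ (residue a) (residue b)) (+-cong′ (ι-residue a) (ι-residue b)))))

    ⊞-identityʳ : ∀ a → a ⊞ zero ≡ a
    ⊞-identityʳ a = ι-injective (≈-trans (ι-⊞ a zero) (≡⇒≈ (ℤₚ.+-identityʳ (ι a))))

  module Colours (p₁ k : ℕ) (2≤p : 2 ℕ.≤ suc p₁) where
    open Residues p₁

    one : Fin (suc p₁)
    one = fromℕ< 2≤p

    one≢0 : one ≢ zero
    one≢0 e = case trans (sym (Finₚ.toℕ-fromℕ< 2≤p)) (cong toℕ e) of λ ()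
      where open import Function using (case_of_)

    private
      enc : ∀ {k} → Vec (Fin (suc p₁)) k → Fin (suc p₁ ℕ.^ k)
      enc []      = zero
      enc (a ∷ v) = combine a (enc v)

      dec : ∀ {k} → Fin (suc p₁ ℕ.^ k) → Vec (Fin (suc p₁)) k
      dec {zero}  c = []
      dec {suc k} c = proj₁ (remQuot {suc p₁} (suc p₁ ℕ.^ k) c) ∷ dec (proj₂ (remQuot {suc p₁} (suc p₁ ℕ.^ k) c))

      dec-enc : ∀ {k} (v : Vec (Fin (suc p₁)) k) → dec (enc v) ≡ v
      dec-enc []      = refl
      dec-enc {suc k} (a ∷ v) = trans (cong (λ r → proj₁ r ∷ dec (proj₂ r)) (Finₚ.remQuot-combine a (enc v))) (cong (a ∷_) (dec-enc v))

      enc-dec : ∀ {k} (c : Fin (suc p₁ ℕ.^ k)) → enc {k} (dec c) ≡ c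
      enc-dec {zero}  zero = refl
      enc-dec {suc k} c = trans (cong (combine (proj₁ (remQuot {suc p₁} (suc p₁ ℕ.^ k) c))) (enc-dec {k} _)) (Finₚ.combine-remQuot {suc p₁} (suc p₁ ℕ.^ k) c)

      tr : ∀ {k} → Fin k → Vec (Fin (suc p₁)) k → Vec (Fin (suc p₁)) k
      tr i v = updateAt v i (_⊞ one)

      tr-comm : ∀ {k} i j (v : Vec (Fin (suc p₁)) k) → tr i (tr j v) ≡ tr j (tr i v)
      tr-comm i j v with i Fin.≟ j
      ... | yes refl = refl
      ... | no i≢j = Vecₚ.updateAt-commutes i j i≢j v

      tr-iter : ∀ {k} i n (v : Vec (Fin (suc p₁)) k) → iter n (tr i) v ≡ updateAt v i (iter n (_⊞ one))
      tr-iter i zero    v = sym (Vecₚ.updateAt-id i v)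
      tr-iter i (suc n) v = trans (cong (tr i) (tr-iter i n v)) (Vecₚ.updateAt-updateAt i v)

    q : ℕ
    q = suc p₁ ℕ.^ k

    coord : Fin q → Fin k → Fin (suc p₁)
    coord c i = lookup (dec {k} c) i

    g : Fin k → Fin q → Fin q
    g i c = enc {k} (tr {k} i (dec {k} c))

    coord-g : ∀ i c → coord (g i c) i ≡ coord c i ⊞ one
    coord-g i c = trans (cong (λ v → lookup v i) (dec-enc {k} (tr {k} i (dec {k} c)))) (Vecₚ.lookup∘updateAt i (dec {k} c))

    coord-g′ : ∀ {i j} → j ≢ i → ∀ c → coord (g i c) j ≡ coord c j
    coord-g′ {i} {j} j≢i c = trans (cong (λ v → lookup v j) (dec-enc {k} (tr {k} i (dec {k} c)))) (Vecₚ.lookup∘updateAt′ j i j≢i (dec {k} c))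

    g-comm : ∀ i j c → g i (g j c) ≡ g j (g i c)
    g-comm i j c = cong (enc {k}) (trans (cong (tr {k} i) (dec-enc {k} (tr {k} j (dec {k} c)))) (trans (tr-comm i j (dec {k} c)) (sym (cong (tr {k} j) (dec-enc {k} (tr {k} i (dec {k} c)))))))

    g-period : ∀ i c → iter (suc p₁) (g i) c ≡ c
    g-period i c = trans (go (suc p₁)) (trans (cong (enc {k}) (trans (tr-iter i (suc p₁) (dec {k} c))
        (Vecₚ.updateAt-id-local i (dec {k} c) (⊞-period _ one)))) (enc-dec {k} c))
      where
      go : ∀ n → iter n (g i) c ≡ enc {k} (iter n (tr {k} i) (dec {k} c))
      go zero    = sym (enc-dec {k} c)
      go (suc n) = trans (cong (g i) (go n)) (cong (enc {k} ∘ tr {k} i) (dec-enc {k} (iter n (tr {k} i) (dec {k} c))))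

    base : Fin q
    base = enc {k} (Vec.replicate k zero)

    transitive : (P : Fin q → Set) → (∀ i c → P c → P (g i c)) → P base → ∀ c → P c
    transitive P st pb c = subst P (enc-dec {k} c) (go (λ v → P (enc {k} v)) (λ i v pv → subst P (cong (enc {k} ∘ tr {k} i) (dec-enc {k} v)) (st i (enc {k} v) pv)) pb (dec {k} c))
      where
      go : ∀ {k} (P : Vec (Fin (suc p₁)) k → Set) → (∀ i v → P v → P (tr i v)) → P (Vec.replicate k zero) → ∀ v → P v
      go P st pb []      = pb
      go P st pb (a ∷ v) = subst (λ z → P (z ∷ v)) reach (up (toℕ a))
        where
        step : P (zero ∷ v)
        step = go (λ w → P (zero ∷ w)) (λ i w → st (suc i) (zero ∷ w)) pb v
        up : ∀ n → P (iter n (_⊞ one) zero ∷ v)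
        up zero    = step
        up (suc n) = st zero (iter n (_⊞ one) zero ∷ v) (up n)
        reach : iter (toℕ a) (_⊞ one) zero ≡ a
        reach = Finₚ.toℕ-injective (trans (iter-⊞ (toℕ a) zero one)
          (trans (cong (λ z → (toℕ a ℕ.* z) ℕ.% suc p₁) (Finₚ.toℕ-fromℕ< 2≤p)) (trans (cong (ℕ._% suc p₁) (ℕₚ.*-identityʳ (toℕ a))) (toℕ-% a))))

  -- All that is used about the identification of the colours with (ℤ/p)^k. Transitivity takes the
  -- form of an induction principle along the `g i`.
  record Translations (p₁ k q : ℕ) : Set₁ where
    open Residue (suc p₁)
    field
      one        : Fin (suc p₁)
      one≢0      : one ≢ zero
      coord      : Fin q → Fin k → Fin (suc p₁)
      g          : Fin k → Fin q → Fin q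
      coord-g    : ∀ i c → coord (g i c) i ≡ coord c i ⊞ one
      coord-g′   : ∀ {i j} → j ≢ i → ∀ c → coord (g i c) j ≡ coord c j
      g-comm     : ∀ i j c → g i (g j c) ≡ g j (g i c)
      g-period   : ∀ i c → iter (suc p₁) (g i) c ≡ c
      base       : Fin q
      transitive : (P : Fin q → Set) → (∀ i c → P c → P (g i c)) → P base → ∀ c → P c

    g⁻¹ : Fin k → Fin q → Fin q
    g⁻¹ i = iter p₁ (g i)

    g-g⁻¹ : ∀ i c → g i (g⁻¹ i c) ≡ c
    g-g⁻¹ = g-period

    g⁻¹-g : ∀ i c → g⁻¹ i (g i c) ≡ c
    g⁻¹-g i c = trans (iter-shift p₁ (g i) c) (g-period i c)

    g-injective : ∀ i {a b} → g i a ≡ g i b → a ≡ b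
    g-injective i {a} {b} e = trans (sym (g⁻¹-g i a)) (trans (cong (g⁻¹ i) e) (g⁻¹-g i b))

  translations : ∀ p₁ k → 2 ℕ.≤ suc p₁ → Translations p₁ k (suc p₁ ℕ.^ k)
  translations p₁ k 2≤p = record
    { one = one ; one≢0 = one≢0 ; coord = coord ; g = g ; coord-g = coord-g ; coord-g′ = coord-g′
    ; g-comm = g-comm ; g-period = g-period ; base = base ; transitive = transitive }
    where open Colours p₁ k 2≤p

  -- Equivariant labelling of the non-constant functions on the colours: take
  -- differences along the gᵢ as long as the result is not constant; what remains is affine.
  module AffineLabel {p₁ k₁ q : ℕ} (pr : Prime (suc p₁)) (TR : Translations p₁ (suc k₁) q) where
    private
      k = suc k₁
    open Residues p₁ public
    open Translations TR public
    open Labels p₁ k public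

    Δ : Fin k → (Fin q → ℤ) → Fin q → ℤ
    Δ i f c = f (g i c) - f c

    Const : (Fin q → ℤ) → Set
    Const f = ∀ c → f c ≈ f base

    const? : ∀ f → Dec (Const f)
    const? f = Finₚ.all? (λ c → f c ≈? f base)

    Δ-cong : ∀ i {f f′} → (∀ c → f c ≈ f′ c) → ∀ c → Δ i f c ≈ Δ i f′ c
    Δ-cong i e c = +-cong′ (e (g i c)) (neg-cong (e c))

    -- A single difference operator is the operator X for one generator with weight 1 over ℤ/p, so
    -- its nilpotency has been shown.
    Δ^p≈0 : ∀ i f c → iter (suc p₁) (Δ i) f c ≈ 0ℤ
    Δ^p≈0 i f c = ≈-trans (same (suc p₁) c) (X^p≈0 f c)
      where
      open CharP ℤ/p pr ℤ/p-char {1} (λ _ → 1ℤ)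
      open Action {Fin q} (λ _ → g i) (λ _ _ _ → refl) (λ _ → g-period i)
      opaque
        unfolding diffOp
        Δ-X : ∀ f c → Δ i f c ≡ app (X {Fin q} (λ _ → g i)) f c
        Δ-X f c = solve 2 (λ a b → a :- b := (con 1ℤ :* a :+ con (- 1ℤ) :* b) :+ con 0ℤ) refl (f (g i c)) (f c)
      same : ∀ n c → iter n (Δ i) f c ≈ app (X {Fin q} (λ _ → g i) ^ₒ n) f c
      same zero    c = ≡⇒≈ refl
      same (suc n) c = ≈-trans (Δ-cong i (same n) c) (≡⇒≈ (Δ-X _ c))

    choose : ∀ {P A : Set} → Dec P → A → A → A
    choose (yes _) a b = a
    choose (no _)  a b = b

    choose-elim : ∀ {P A : Set} (Q : A → Set) (d : Dec P) {a b} → (P → Q a) → (¬ P → Q b) → Q (choose d a b)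
    choose-elim Q (yes p) h h′ = h p
    choose-elim Q (no ¬p) h h′ = h′ ¬p

    -- The number is fuel. With `p` units it cannot run out on a non-constant function, because the
    -- `p`-th difference vanishes.
    reduce : Fin k → ℕ → (Fin q → ℤ) → Fin q → ℤ
    reduce i zero    f = f
    reduce i (suc n) f = choose (const? (Δ i f)) f (reduce i n (Δ i f))

    reduceAll : List (Fin k) → (Fin q → ℤ) → Fin q → ℤ
    reduceAll []       f = f
    reduceAll (i ∷ is) f = reduceAll is (reduce i (suc p₁) f)

    private
      reduce-nonconst : ∀ i n f → ¬ Const f → ¬ Const (reduce i n f)
      reduce-nonconst i zero    f nc = nc
      reduce-nonconst i (suc n) f nc = choose-elim (λ h → ¬ Const h) (const? (Δ i f)) (λ _ → nc) (reduce-nonconst i n (Δ i f))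

      reduce-const : ∀ i n f → (∀ c → iter n (Δ i) f c ≈ 0ℤ) → ¬ Const f → Const (Δ i (reduce i n f))
      reduce-const i zero    f z nc = ⊥-elim (nc (λ c → ≈-trans (z c) (≈-sym (z base))))
      reduce-const i (suc n) f z nc = choose-elim (λ h → Const (Δ i h)) (const? (Δ i f)) (λ c → c)
        (reduce-const i n (Δ i f) (λ c → subst (λ h → h c ≈ 0ℤ) (sym (iter-shift n (Δ i) f)) (z c)))

      Δ-Const : ∀ i f → Const f → Const (Δ i f)
      Δ-Const i f cf c = +-cong′ (≈-trans (cf (g i c)) (≈-sym (cf (g i base)))) (neg-cong (cf c))

      Δ-comm : ∀ i j f c → Δ i (Δ j f) c ≡ Δ j (Δ i f) c
      Δ-comm i j f c rewrite g-comm i j c = solve 4 (λ a b c d → (a :- b) :- (c :- d) := (a :- c) :- (b :- d)) refl (f (g j (g i c))) (f (g i c)) (f (g j c)) (f c)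

      -- Differences in different directions commute, so treating one direction does not undo what
      -- was achieved in another.
      keep-const : ∀ i j n f → Const (Δ j f) → Const (Δ j (reduce i n f))
      keep-const i j zero    f cf = cf
      keep-const i j (suc n) f cf = choose-elim (λ h → Const (Δ j h)) (const? (Δ i f)) (λ _ → cf) λ _ →
        keep-const i j n (Δ i f) (λ c → ≈-trans (≡⇒≈ (Δ-comm j i f c)) (≈-trans (Δ-Const i (Δ j f) cf c) (≡⇒≈ (Δ-comm i j f base))))

      keep-all : ∀ is j f → Const (Δ j f) → Const (Δ j (reduceAll is f))
      keep-all []       j f cf = cf
      keep-all (i ∷ is) j f cf = keep-all is j _ (keep-const i j (suc p₁) f cf)

      all-nonconst : ∀ is f → ¬ Const f → ¬ Const (reduceAll is f)
      all-nonconst []       f nc = nc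
      all-nonconst (i ∷ is) f nc = all-nonconst is _ (reduce-nonconst i (suc p₁) f nc)

      open import Data.List.Membership.Propositional using (_∈_)
      open import Data.List.Membership.Propositional.Properties using (∈-allFin)
      open import Data.List.Relation.Unary.Any using (here; there)

      all-affine : ∀ is f → ¬ Const f → ∀ {j} → j ∈ is → Const (Δ j (reduceAll is f))
      all-affine (i ∷ is) f nc (here refl) = keep-all is i _ (reduce-const i (suc p₁) f (Δ^p≈0 i f) nc)
      all-affine (i ∷ is) f nc (there m)   = all-affine is _ (reduce-nonconst i (suc p₁) f nc) m

    affine : (Fin q → ℤ) → Fin q → ℤ
    affine = reduceAll (List.allFin k)

    slope : (Fin q → ℤ) → Vec (Fin (suc p₁)) k
    slope u = Vec.tabulate (λ i → residue (Δ i u base))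

    unit : Vec (Fin (suc p₁)) k
    unit = one ∷ zeros

    .unit≢0 : unit ≢ zeros
    unit≢0 e = one≢0 (Vecₚ.∷-injectiveˡ e)

    -- A default value. It is moved by the action, so equivariance requires that it never be the
    -- label of a flag of non-empty colourings.
    junk : Y
    junk = mkY unit zero unit≢0

    mkLabel : ∀ χ → Fin (suc p₁) → Dec (χ ≡ zeros) → Y
    mkLabel χ s (yes _) = junk
    mkLabel χ s (no nz) = mkY χ s nz

    opaque
      -- With the minus sign, transporting a function along `g i` adds the `i`-th slope to the
      -- constant term, in agreement with `gY`.
      label : (Fin q → ℤ) → Y
      label f = mkLabel (slope (affine f)) (residue (- affine f base)) (Vecₚ.≡-dec Fin._≟_ (slope (affine f)) zeros)

    private
      -- An affine function of slope zero is invariant under all `g i`, hence constant by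
      -- transitivity, while the reduction never produces a constant.
      slope≢0 : ∀ f → ¬ Const f → slope (affine f) ≢ zeros
      slope≢0 f nc e = all-nonconst (List.allFin k) f nc (transitive (λ c → affine f c ≈ affine f base)
          (λ i c h → ≈-trans (step i c) h) (≡⇒≈ refl))
        where
        u = affine f
        Δ0 : ∀ i → Δ i u base ≈ 0ℤ
        Δ0 i = ≈-trans (≈-sym (ι-residue _)) (≡⇒≈ (cong ι (trans (sym (Vecₚ.lookup∘tabulate (λ i → residue (Δ i u base)) i)) (trans (cong (λ v → lookup v i) e) (Vecₚ.lookup-replicate i zero)))))
        step : ∀ i c → u (g i c) ≈ u c
        step i c = ≈-trans (≡⇒≈ (solve 2 (λ a b → a := (a :- b) :+ b) refl (u (g i c)) (u c)))
          (≈-trans (+-cong′ (≈-trans (all-affine (List.allFin k) f nc (∈-allFin i) c) (Δ0 i)) (≡⇒≈ (refl {x = u c}))) (≡⇒≈ (ℤₚ.+-identityˡ (u c))))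

    -- A common interface for two uses: the identity, which shows that labels do not depend on how
    -- data are represented, and the `g i`, which give equivariance.
    record Sym : Set where
      field
        σ     : Fin q → Fin q
        σ⁻¹   : Fin q → Fin q
        σσ⁻¹  : ∀ c → σ (σ⁻¹ c) ≡ c
        σ⁻¹σ  : ∀ c → σ⁻¹ (σ c) ≡ c
        σ-g   : ∀ i c → σ (g i c) ≡ g i (σ c)
        σY    : Y → Y
        σY-affine : ∀ u u′ → (∀ i → Const (Δ i u)) → (∀ i → Const (Δ i u′)) → (∀ c → u′ (σ c) ≈ u c) →
                    ∀ .nz → σY (mkY (slope u) (residue (- u base)) nz) ≡ mkY (slope u) (residue (- u′ base)) nz
        σY-unit   : ∀ c → σY (mkY unit (coord c zero) unit≢0) ≡ mkY unit (coord (σ c) zero) unit≢0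

    -- The slope is the first unit vector, so the first coordinate of the colour takes the part of
    -- the constant term and changes under translations as required.
    colourLabel : Fin q → Y
    colourLabel c = mkY unit (coord c zero) unit≢0

    idSym : Sym
    idSym = record
      { σ = λ c → c ; σ⁻¹ = λ c → c ; σσ⁻¹ = λ _ → refl ; σ⁻¹σ = λ _ → refl ; σ-g = λ _ _ → refl ; σY = λ y → y
      ; σY-affine = λ u u′ _ _ e nz → cong (λ z → mkY (slope u) z nz) (residue-cong (neg-cong (≈-sym (e base))))
      ; σY-unit = λ _ → refl }

    gSym : Fin k → Sym
    gSym i = record
      { σ = g i ; σ⁻¹ = g⁻¹ i ; σσ⁻¹ = g-g⁻¹ i ; σ⁻¹σ = g⁻¹-g i ; σ-g = λ j c → g-comm i j c ; σY = gY i
      ; σY-affine = λ u u′ cu cu′ e nz → cong (λ z → mkY (slope u) z nz) (begin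
          residue (- u base) ⊞ lookup (slope u) i     ≡⟨ cong (residue (- u base) ⊞_) (Vecₚ.lookup∘tabulate (λ i → residue (Δ i u base)) i) ⟩
          residue (- u base) ⊞ residue (Δ i u base)   ≡⟨ residue-+ (- u base) (Δ i u base) ⟨
          residue (- u base + Δ i u base)             ≡⟨ residue-cong (≈-trans (+-cong′ (neg-cong (≈-sym (e base))) (≈-trans (≈-sym (Δ-rel u u′ e base)) (cu′ i (g i base))))
                                                           (≡⇒≈ (solve 2 (λ a b → (:- a) :+ (a :- b) := :- b) refl (u′ (g i base)) (u′ base)))) ⟩
          residue (- u′ base)                         ∎)
      ; σY-unit = λ c → cong (λ z → mkY unit z unit≢0) (first i c) }
      where
      open ≡-Reasoning
      Δ-rel : ∀ u u′ → (∀ c → u′ (g i c) ≈ u c) → ∀ c → Δ i u′ (g i c) ≈ Δ i u c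
      Δ-rel u u′ e c = +-cong′ (e (g i c)) (neg-cong (e c))
      first : ∀ i c → coord c zero ⊞ lookup unit i ≡ coord (g i c) zero
      first zero    c = sym (coord-g zero c)
      first (suc i) c = trans (cong (coord c zero ⊞_) (Vecₚ.lookup-replicate i zero)) (trans (⊞-identityʳ _) (sym (coord-g′ (λ ()) c)))

    module _ (S : Sym) where
      open Sym S

      private
        Δ-σ : ∀ i f f′ → (∀ c → f′ (σ c) ≈ f c) → ∀ c → Δ i f′ (σ c) ≈ Δ i f c
        Δ-σ i f f′ e c = +-cong′ (≈-trans (≡⇒≈ (cong f′ (sym (σ-g i c)))) (e (g i c))) (neg-cong (e c))

        const-σ : ∀ f f′ → (∀ c → f′ (σ c) ≈ f c) → Const f → Const f′
        const-σ f f′ e cf c = ≈-trans (back c) (≈-trans (cf _) (≈-trans (≈-sym (cf _)) (≈-sym (back base))))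
          where
          back : ∀ c → f′ c ≈ f (σ⁻¹ c)
          back c = ≈-trans (≡⇒≈ (cong f′ (sym (σσ⁻¹ c)))) (e (σ⁻¹ c))

        const-σ′ : ∀ f f′ → (∀ c → f′ (σ c) ≈ f c) → Const f′ → Const f
        const-σ′ f f′ e cf c = ≈-trans (≈-sym (e c)) (≈-trans (cf _) (≈-trans (≈-sym (cf _)) (e base)))

        reduce-σ : ∀ i n f f′ → (∀ c → f′ (σ c) ≈ f c) → ∀ c → reduce i n f′ (σ c) ≈ reduce i n f c
        reduce-σ i zero    f f′ e c = e c
        reduce-σ i (suc n) f f′ e c = choose-elim (λ (h : Fin q → ℤ) → h (σ c) ≈ choose (const? (Δ i f)) f (reduce i n (Δ i f)) c) (const? (Δ i f′))
          (λ a → choose-elim (λ (h : Fin q → ℤ) → f′ (σ c) ≈ h c) (const? (Δ i f)) (λ _ → e c) (λ ¬a → ⊥-elim (¬a (const-σ′ _ _ (Δ-σ i f f′ e) a))))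
          (λ ¬a → choose-elim (λ (h : Fin q → ℤ) → reduce i n (Δ i f′) (σ c) ≈ h c) (const? (Δ i f)) (λ a → ⊥-elim (¬a (const-σ _ _ (Δ-σ i f f′ e) a)))
            (λ _ → reduce-σ i n _ _ (Δ-σ i f f′ e) c))

        reduceAll-σ : ∀ is f f′ → (∀ c → f′ (σ c) ≈ f c) → ∀ c → reduceAll is f′ (σ c) ≈ reduceAll is f c
        reduceAll-σ []       f f′ e = e
        reduceAll-σ (i ∷ is) f f′ e = reduceAll-σ is _ _ (reduce-σ i (suc p₁) f f′ e)

      opaque
        unfolding label
        label-σ : ∀ f f′ → ¬ Const f → (∀ c → f′ (σ c) ≈ f c) → label f′ ≡ σY (label f)
        label-σ f f′ nc e = trans (mk-no _ (slope≢0 f′ (nc ∘ const-σ′ f f′ e))) (trans (mk-cong sl)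
            (trans (sym (σY-affine u u′ au au′ eu (slope≢0 f nc))) (sym (cong σY (mk-no _ (slope≢0 f nc))))))
          where
          u u′ : Fin q → ℤ
          u  = affine f
          u′ = affine f′
          eu : ∀ c → u′ (σ c) ≈ u c
          eu = reduceAll-σ (List.allFin k) f f′ e
          au : ∀ i → Const (Δ i u)
          au i = all-affine (List.allFin k) f nc (∈-allFin i)
          au′ : ∀ i → Const (Δ i u′)
          au′ i = all-affine (List.allFin k) f′ (nc ∘ const-σ′ f f′ e) (∈-allFin i)
          sl : slope u′ ≡ slope u
          sl = Vecₚ.tabulate-cong (λ i → residue-cong (≈-trans (≈-sym (au′ i (σ base))) (Δ-σ i u u′ eu base)))
          mk-cong : ∀ {χ χ′ s} .{nz nz′} → χ ≡ χ′ → mkY χ s nz ≡ mkY χ′ s nz′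
          mk-cong refl = refl
          mk-no : ∀ {χ s} d → (nz : χ ≢ zeros) → mkLabel χ s d ≡ mkY χ s nz
          mk-no (yes z) nz = ⊥-elim (nz z)
          mk-no (no _)  nz = refl

-- Labels of flags of partial colourings and their equivariance.

module FlagLabellings where

  open import Defs hiding (sym)
  open AlternatingCochains using (NonEmpty; _∷_)
  open Obstructions
  open Counting
  open TranslationLabels
  open import Data.Nat using (_≤ᵇ_)
  open import Data.Nat.Primality using (prime⇒nonTrivial)
  open import Data.Integer using (ℤ)
  open ≡ using (refl; sym; trans)

  any-rel : ∀ {A : Set} {_~_ : A → A → Set} {P P′ : A → Bool} → (∀ {a a′} → a ~ a′ → P a ≡ P′ a′) →
            ∀ {x x′} → LP.Pointwise _~_ x x′ → any P x ≡ any P′ x′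
  any-rel e LP.[]       = refl
  any-rel e (r LP.∷ rs) = cong₂ _∨_ (e r) (any-rel e rs)

  all-rel : ∀ {A : Set} {_~_ : A → A → Set} {P P′ : A → Bool} → (∀ {a a′} → a ~ a′ → P a ≡ P′ a′) →
            ∀ {x x′} → LP.Pointwise _~_ x x′ → all P x ≡ all P′ x′
  all-rel e LP.[]       = refl
  all-rel e (r LP.∷ rs) = cong₂ _∧_ (e r) (all-rel e rs)

  firstFin : ∀ {n} → (Fin n → Bool) → Maybe (Fin n)
  firstFin {zero}  f = nothing
  firstFin {suc n} f = if f zero then just zero else Maybe.map suc (firstFin (f ∘ suc))

  firstFin-cong : ∀ {n} {f f′ : Fin n → Bool} → (∀ i → f i ≡ f′ i) → firstFin f ≡ firstFin f′
  firstFin-cong {zero}  e = refl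
  firstFin-cong {suc n} e = cong₂ (λ b m → if b then just zero else Maybe.map suc m) (e zero) (firstFin-cong (e ∘ suc))

  firstFin-just : ∀ {n} {f : Fin n → Bool} {i} → firstFin f ≡ just i → f i ≡ true
  firstFin-just {suc n} {f} e with f zero in e₀
  firstFin-just {suc n} {f} refl | true = e₀
  ... | false with firstFin (f ∘ suc) in e₁
  firstFin-just {suc n} {f} refl | false | just i = firstFin-just {f = f ∘ suc} e₁

  firstFin-nothing : ∀ {n} {f : Fin n → Bool} → firstFin f ≡ nothing → ∀ i → f i ≡ false
  firstFin-nothing {suc n} {f} e i with f zero in e₀ | firstFin (f ∘ suc) in e₁
  firstFin-nothing {suc n} {f} e zero    | false | nothing = e₀
  firstFin-nothing {suc n} {f} e (suc i) | false | nothing = firstFin-nothing {f = f ∘ suc} e₁ i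

  module FlagLabels {p₁ k₁ q : ℕ} (pr : Prime (suc p₁)) (TR : Translations p₁ (suc k₁) q)
    {N m : ℕ} (part : Fin N → Fin m) (thr : Fin m → ℕ) where
    open AffineLabel pr TR renaming (label to affineLabel; label-σ to affineLabel-σ; _≈_ to _≈ₚ_)
    open Runs {q} using (first)

    Entry : Set
    Entry = Fin N × Fin q

    col : List Entry → Fin N → Maybe (Fin q)
    col []            v = nothing
    col ((w , c) ∷ x) v = if eqB w v then just c else col x v

    coloured : List Entry → Fin N → Bool
    coloured x v = is-just (col x v)

    cnt : Fin m → List Entry → Fin q → ℕ
    cnt j x c = count (λ v → eqB (part v) j ∧ hasCol c (col x v))

    over : Fin m → List Entry → Fin q → Bool
    over j x c = thr j ≤ᵇ cnt j x c

    sz : Fin m → List Entry → ℕ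
    sz j x = count (over j x)

    emp full mixed : Fin m → List Entry → Bool
    emp   j x = sz j x ≡ᵇ 0
    full  j x = sz j x ≡ᵇ q
    mixed j x = not (emp j x) ∧ not (full j x)

    top : List (List Entry) → List Entry
    top []      = []
    top (x ∷ _) = x

    -- The vertices of a class entering a flag together at the step where all colours become overfull.
    inT : List (List Entry) → Fin N → Bool
    inT c v = coloured (top c) v ∧ (any (full (part v)) c ∧
      (all (λ x → not (full (part v) x) ∨ coloured x v) c ∧ all (λ x → not (emp (part v) x) ∨ not (coloured x v)) c))

    later : List (List Entry) → Fin N → Fin N → Bool
    later c v u = ⌊ u Fin.<? v ⌋ ∧ (eqB (part u) (part v) ∧ inT c u)

    -- In each class only the first vertex of `inT` stays: enough are discarded to bound the number
    -- of runs, and yet some coloured vertex survives.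
    keep : List (List Entry) → Fin N → Bool
    keep c v = not (inT c v) ∨ not (anyFin (later c v))

    y : List (List Entry) → Fin N → Maybe (Fin q)
    y c v = if keep c v then col (top c) v else nothing

    -- Flags list the largest face first, so this is the smallest mixed face. It is consulted only
    -- when there is one.
    lastMixed : Fin m → List (List Entry) → List Entry
    lastMixed j []      = []
    lastMixed j (x ∷ c) = if any (mixed j) c then lastMixed j c else x

    indicator : (Fin q → Bool) → Fin q → ℤ
    indicator f c = if f c then 1ℤ else 0ℤ

    firstMixed : List (List Entry) → Maybe (Fin m)
    firstMixed c = firstFin (λ j → any (mixed j) c)

    labelAt : Maybe (Fin m) → List (List Entry) → Y
    labelAt (just j) c = affineLabel (indicator (over j (lastMixed j c)))
    labelAt nothing  c = maybe colourLabel junk (first (y c))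

    flagLabel : List (List Entry) → Y
    flagLabel c = labelAt (firstMixed c) c

    ≡ᵇ-true : ∀ {a b} → (a ≡ᵇ b) ≡ true → a ≡ b
    ≡ᵇ-true {a} {b} e = ℕₚ.≡ᵇ⇒≡ a b (subst Data.Bool.T (sym e) _)
      where import Data.Bool

    ≡ᵇ-refl : ∀ {a b} → a ≡ b → (a ≡ᵇ b) ≡ true
    ≡ᵇ-refl {zero}  refl = refl
    ≡ᵇ-refl {suc a} refl = ≡ᵇ-refl {a} refl

    ≤ᵇ-true : ∀ {a b} → (a ≤ᵇ b) ≡ true → a ≤ b
    ≤ᵇ-true {a} {b} e = ℕₚ.≤ᵇ⇒≤ a b (subst Data.Bool.T (sym e) _)
      where import Data.Bool

    ≤ᵇ-intro : ∀ {a b} → a ≤ b → (a ≤ᵇ b) ≡ true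
    ≤ᵇ-intro {a} {b} le with a ≤ᵇ b | ℕₚ.≤⇒≤ᵇ le
    ... | true | _ = refl

    over⇒≤ : ∀ j x a → over j x a ≡ true → thr j ≤ cnt j x a
    over⇒≤ j x a = ≤ᵇ-true {thr j} {cnt j x a}

    ≤⇒over : ∀ j x a → thr j ≤ cnt j x a → over j x a ≡ true
    ≤⇒over j x a = ≤ᵇ-intro {thr j} {cnt j x a}

    mixed⇒nonconst : ∀ j x → mixed j x ≡ true → ¬ Const (indicator (over j x))
    mixed⇒nonconst j x mx cst with ∧-true {not (emp j x)} mx
    ... | ne , nf with bool (over j x base)
    ...   | inj₁ b = true≢false (≡ᵇ-refl (count-full (over j x) (λ c → same c b))) (not-true nf)
      where
      same : ∀ c → over j x base ≡ true → over j x c ≡ true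
      same c b with over j x c in e
      ... | true  = refl
      ... | false = ⊥-elim (case ≈-unique {0} {1} (s≤s z≤n) 2≤p (subst₂ _≈ₚ_ (cong (λ z → if z then 1ℤ else 0ℤ) e) (cong (λ z → if z then 1ℤ else 0ℤ) b) (cst c)) of λ ())
        where
        open import Function using (case_of_)
        2≤p = ℕ.nonTrivial⇒n>1 (suc p₁) {{prime⇒nonTrivial pr}}
    ...   | inj₂ b = true≢false (≡ᵇ-refl (count-none (over j x) same)) (not-true ne)
      where
      same : ∀ c → over j x c ≡ false
      same c with over j x c in e
      ... | false = refl
      ... | true  = ⊥-elim (case ≈-unique {1} {0} 2≤p (s≤s z≤n) (subst₂ _≈ₚ_ (cong (λ z → if z then 1ℤ else 0ℤ) e) (cong (λ z → if z then 1ℤ else 0ℤ) b) (cst c)) of λ ())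
        where
        open import Function using (case_of_)
        2≤p = ℕ.nonTrivial⇒n>1 (suc p₁) {{prime⇒nonTrivial pr}}

    lastMixed-mixed : ∀ j c → any (mixed j) c ≡ true → mixed j (lastMixed j c) ≡ true
    lastMixed-mixed j (x ∷ c) e with any (mixed j) c in e₁
    ... | true  = lastMixed-mixed j c e₁
    ... | false with ∨-true {mixed j x} e
    ...   | inj₁ p = p
    ...   | inj₂ ()

    -- If `v` itself is discarded, it lies in `inT`, and then the first vertex of `inT` in its class
    -- is kept.
    y-nonempty : ∀ c v {a} → col (top c) v ≡ just a → ∃ λ u → ∃ λ b → y c u ≡ just b
    y-nonempty c v {a} e with keep c v in ek
    ... | true  = v , a , trans (cong (λ b → if b then col (top c) v else nothing) ek) e
    ... | false with least (λ u → eqB (part u) (part v) ∧ inT c u) v (∧-intro (eqB-refl (part v)) (inTv (inT c v) ek))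
      where
      inTv : ∀ b {b′} → not b ∨ b′ ≡ false → b ≡ true
      inTv true _ = refl
    ...   | u , eu , mn with ∧-true {eqB (part u) (part v)} eu
    ...     | pu , tu with is-just-elim {m = col (top c) u} (proj₁ (∧-true {coloured (top c) u} tu))
    ...       | b , cu = u , b , trans (cong (λ z → if z then col (top c) u else nothing) (∨-introʳ {not (inT c u)} (not-intro none))) cu
      where
      none : anyFin (later c u) ≡ false
      none = ¬true⇒false λ h → let w , hw = anyFin-true {f = later c u} h
                                   lt , r  = ∧-true {⌊ w Fin.<? u ⌋} hw
                                   pw , tw = ∧-true {eqB (part w) (part u)} r
                               in true≢false (∧-intro (subst (λ z → eqB (part w) z ≡ true) (eqB-true pu) pw) tw) (mn w (lt→ w u lt))
        where
        lt→ : ∀ (w u : Fin N) → ⌊ w Fin.<? u ⌋ ≡ true → w Fin.< u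
        lt→ w u h with w Fin.<? u
        ... | yes p = p

    module Equivariance (S : Sym) where
      open Sym S

      record Related (x x′ : List Entry) : Set where
        constructor related
        field at : ∀ v → col x′ v ≡ Maybe.map σ (col x v)
      open Related public

      private
        σ-inj : ∀ {a b} → σ a ≡ σ b → a ≡ b
        σ-inj {a} {b} e = trans (sym (σ⁻¹σ a)) (trans (cong σ⁻¹ e) (σ⁻¹σ b))

        hasCol-σ : ∀ c mc → hasCol (σ c) (Maybe.map σ mc) ≡ hasCol c mc
        hasCol-σ c nothing  = refl
        hasCol-σ c (just a) = bool-ext (λ e → subst (λ z → eqB a z ≡ true) (σ-inj (eqB-true e)) (eqB-refl a))
                                       (λ e → subst (λ z → eqB (σ a) (σ z) ≡ true) (eqB-true e) (eqB-refl (σ a)))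

        is-just-map : ∀ (mc : Maybe (Fin q)) → is-just (Maybe.map σ mc) ≡ is-just mc
        is-just-map nothing  = refl
        is-just-map (just _) = refl

      module _ {x x′} (r : Related x x′) where
        over-σ : ∀ j c → over j x′ (σ c) ≡ over j x c
        over-σ j c = cong (thr j ≤ᵇ_) (count-cong (λ v → cong (eqB (part v) j ∧_) (trans (cong (hasCol (σ c)) (at r v)) (hasCol-σ c (col x v)))))

        sz-σ : ∀ j → sz j x ≡ sz j x′
        sz-σ j = trans (count-cong (λ c → sym (over-σ j c))) (count-permute σ σ⁻¹ σσ⁻¹ σ⁻¹σ (over j x′))

        full-σ : ∀ j → full j x ≡ full j x′
        full-σ j = cong (_≡ᵇ q) (sz-σ j)

        emp-σ : ∀ j → emp j x ≡ emp j x′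
        emp-σ j = cong (_≡ᵇ 0) (sz-σ j)

        mixed-σ : ∀ j → mixed j x ≡ mixed j x′
        mixed-σ j = cong₂ (λ a b → not a ∧ not b) (emp-σ j) (full-σ j)

        coloured-σ : ∀ v → coloured x v ≡ coloured x′ v
        coloured-σ v = sym (trans (cong is-just (at r v)) (is-just-map (col x v)))

      top-rel : ∀ {c c′} → LP.Pointwise Related c c′ → Related (top c) (top c′)
      top-rel LP.[]      = related (λ v → refl)
      top-rel (r LP.∷ _) = r

      module _ {c c′} (rs : LP.Pointwise Related c c′) where
        top-σ : Related (top c) (top c′)
        top-σ = top-rel rs

        inT-σ : ∀ v → inT c v ≡ inT c′ v
        inT-σ v = cong₂ _∧_ (coloured-σ top-σ v) (cong₂ _∧_ (any-rel (λ r → full-σ r (part v)) rs)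
          (cong₂ _∧_ (all-rel (λ r → cong₂ (λ a b → not a ∨ b) (full-σ r (part v)) (coloured-σ r v)) rs)
                     (all-rel (λ r → cong₂ (λ a b → not a ∨ not b) (emp-σ r (part v)) (coloured-σ r v)) rs)))

        y-σ : ∀ v → y c′ v ≡ Maybe.map σ (y c v)
        y-σ v = trans (cong₂ (λ b m → if b then m else nothing) (sym keep-σ) (at top-σ v)) (if-map (keep c v))
          where
          keep-σ : keep c v ≡ keep c′ v
          keep-σ = cong₂ (λ a b → not a ∨ not b) (inT-σ v) (anyFin-cong (λ u → cong (λ z → ⌊ u Fin.<? v ⌋ ∧ (eqB (part u) (part v) ∧ z)) (inT-σ u)))
          if-map : ∀ b → (if b then Maybe.map σ (col (top c) v) else nothing) ≡ Maybe.map σ (if b then col (top c) v else nothing)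
          if-map true  = refl
          if-map false = refl

      first-σ : ∀ {n} (f f′ : Fin n → Maybe (Fin q)) → (∀ v → f′ v ≡ Maybe.map σ (f v)) → first f′ ≡ Maybe.map σ (first f)
      first-σ {zero}  f f′ e = refl
      first-σ {suc n} f f′ e = trans (cong₂ Maybe._<∣>_ (e zero) (first-σ (f ∘ suc) (f′ ∘ suc) (e ∘ suc))) (alt (f zero))
        where
        alt : ∀ mc → (Maybe.map σ mc Maybe.<∣> Maybe.map σ (first (f ∘ suc))) ≡ Maybe.map σ (mc Maybe.<∣> first (f ∘ suc))
        alt nothing  = refl
        alt (just _) = refl

      lastMixed-σ : ∀ j {c c′} → LP.Pointwise Related c c′ → Related (lastMixed j c) (lastMixed j c′)
      lastMixed-σ j LP.[] = related (λ v → refl)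
      lastMixed-σ j {x ∷ c} {x′ ∷ c′} (r LP.∷ rs) = go _ _ (any-rel {P = mixed j} (λ r → mixed-σ r j) rs)
        where
        go : ∀ b b′ → b ≡ b′ → Related (if b then lastMixed j c else x) (if b′ then lastMixed j c′ else x′)
        go true  .true  refl = lastMixed-σ j rs
        go false .false refl = r

      -- The side condition concerns the default label: it holds trivially for the identity, and for
      -- translations because some vertex stays coloured.
      flagLabel-σ : ∀ {c c′} → LP.Pointwise Related c c′ → (first (y c) ≡ nothing → σY junk ≡ junk) → flagLabel c′ ≡ σY (flagLabel c)
      flagLabel-σ {c} {c′} rs hj = trans (cong (λ z → labelAt z c′) (sym same)) (go (firstMixed c) refl)
        where
        same : firstMixed c ≡ firstMixed c′
        same = firstFin-cong (λ j → any-rel (λ r → mixed-σ r j) rs)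
        go : ∀ mj → firstMixed c ≡ mj → labelAt mj c′ ≡ σY (labelAt mj c)
        go (just j) e = affineLabel-σ S _ _ (mixed⇒nonconst j (lastMixed j c) (lastMixed-mixed j c (firstFin-just {f = λ j → any (mixed j) c} e)))
          (λ a → ≡⇒≈ (cong (λ b → if b then 1ℤ else 0ℤ) (over-σ (lastMixed-σ j rs) j a)))
        go nothing e = go′ (first (y c)) _ (first-σ (y c) (y c′) (y-σ rs)) hj
          where
          go′ : ∀ a b → b ≡ Maybe.map σ a → (a ≡ nothing → σY junk ≡ junk) → maybe colourLabel junk b ≡ σY (maybe colourLabel junk a)
          go′ nothing  _ refl h = sym (h refl)
          go′ (just a) _ refl _ = sym (σY-unit a)

-- Ranks of flags, monotonicity, and the extraction of a good colouring.

module RankComparison where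

  open import Defs hiding (sym)
  open AlternatingCochains using (Del; Flag; here; there)
  open Obstructions
  open Counting
  open TranslationLabels
  open FlagLabellings
  open import Data.Nat using (_+_; _*_)
  open ℕₚ using (module ≤-Reasoning)
  open import Data.Nat.Solver using (module +-*-Solver)
  open import Data.List.Membership.Propositional using (_∈_)
  open import Relation.Binary.Definitions using (tri<; tri≈; tri>)
  open ≡ using (refl; sym; trans)

  open +-*-Solver using (solve; _:+_; _:*_; _:=_; con)

  module _ {A : Set} (P : A → Bool) where

    any-true : ∀ c → any P c ≡ true → ∃ λ x → x ∈ c × P x ≡ true
    any-true (x ∷ c) e with ∨-true {P x} e
    ... | inj₁ p = x , here refl , p
    ... | inj₂ p = let z , m , pz = any-true c p in z , there m , pz

    any-intro : ∀ {c x} → x ∈ c → P x ≡ true → any P c ≡ true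
    any-intro (here refl) p = ∨-introˡ p
    any-intro {z ∷ c} (there m) p = ∨-introʳ {P z} (any-intro m p)

    any-false : ∀ {c x} → any P c ≡ false → x ∈ c → P x ≡ false
    any-false e m = ¬true⇒false λ p → true≢false (any-intro m p) e

    all-elim : ∀ {c x} → all P c ≡ true → x ∈ c → P x ≡ true
    all-elim {z ∷ c} e (here refl) = proj₁ (∧-true e)
    all-elim {z ∷ c} e (there m)   = all-elim (proj₂ (∧-true {P z} e)) m

    all-intro : ∀ c → (∀ x → x ∈ c → P x ≡ true) → all P c ≡ true
    all-intro []      h = refl
    all-intro (x ∷ c) h = ∧-intro (h x (here refl)) (all-intro c (λ z m → h z (there m)))

  module Ranks {p₁ k₁ q₁ : ℕ} (pr : Prime (suc p₁)) (TR : Translations p₁ (suc k₁) (suc q₁))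
    {N m : ℕ} (part : Fin N → Fin m) (thr : Fin m → ℕ) (conf : Fin N → Fin N → Bool) (α : ℕ)
    (N≡ : N ≡ suc (α + m * q₁))
    (thr≥1 : ∀ j → 1 ≤ thr j) (thr≤ : ∀ j → suc q₁ * thr j ≤ suc (count (λ v → eqB (part v) j))) where

    private
      q = suc q₁
    open AffineLabel pr TR using (idSym; junk; Y; colourLabel; base; ≡⇒≈) renaming (label to affineLabel; label-σ to affineLabel-σ)
    open FlagLabels pr TR part thr public
    open Runs {q}

    record Good : Set where
      field
        z           : Fin N → Maybe (Fin q)
        independent : ∀ u v {a} → conf u v ≡ true → z u ≡ just a → z v ≡ just a → ⊥
        consecutive : ∀ u v {a} → toℕ v ≡ suc (toℕ u) → z u ≡ just a → z v ≡ just a → ⊥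
        fair        : ∀ j a → thr j ≤ suc (count (λ v → eqB (part v) j ∧ hasCol a (z v)))
        missing     : ∀ j → count (λ v → eqB (part v) j ∧ not (is-just (z v))) ≤ q₁

    record Sub (x′ x : List Entry) : Set where
      constructor sub
      field below : ∀ {v a} → col x′ v ≡ just a → col x v ≡ just a
    open Sub public

    Sub-refl : ∀ {x} → Sub x x
    Sub-refl = sub λ e → e

    Sub-coloured : ∀ {x′ x v} → Sub x′ x → coloured x′ v ≡ true → coloured x v ≡ true
    Sub-coloured {x′} {x} {v} s e = let a , p = is-just-elim {m = col x′ v} e in is-just-intro (below s p)

    Nested : List (List Entry) → Set
    Nested = AllPairs (λ x x′ → Sub x′ x)

    record Valid (x : List Entry) : Set where
      field
        proper    : ∀ u v {a} → conf u v ≡ true → col x u ≡ just a → col x v ≡ just a → ⊥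
        nonempty  : ∃ λ v → ∃ λ a → col x v ≡ just a
    open Valid public

    top-sub : ∀ {c x} → Nested c → x ∈ c → Sub x (top c)
    top-sub (ps ∷ _) (here refl) = Sub-refl
    top-sub (ps ∷ _) (there m)   = All.lookup ps m

    smallest : ∀ (P : List Entry → Bool) {c} → Nested c → any P c ≡ true → ∃ λ x → x ∈ c × P x ≡ true × (∀ {x′} → x′ ∈ c → P x′ ≡ true → Sub x x′)
    smallest P {x ∷ c} (ps ∷ n) e with any P c in e₁
    ... | true  = let z , m , pz , mn = smallest P n e₁ in
                  z , there m , pz , λ { (here refl) _ → All.lookup ps m ; (there m′) p → mn m′ p }
    ... | false with ∨-true {P x} e
    ...   | inj₁ px = x , here refl , px , λ { (here refl) _ → Sub-refl ; (there m′) p → ⊥-elim (true≢false p (any-false P e₁ m′)) }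
    ...   | inj₂ ()

    -- The empty colouring stands in when no face qualifies. It colours nothing, so it stays below
    -- every positive threshold.
    largest : ∀ (P : List Entry → Bool) {c} → Nested c → ∃ λ x → (x ≡ [] ⊎ (x ∈ c × P x ≡ true)) × (∀ {x′} → x′ ∈ c → P x′ ≡ true → Sub x′ x)
    largest P {[]}    n = [] , inj₁ refl , λ ()
    largest P {x ∷ c} (ps ∷ n) with P x in px
    ... | true  = x , inj₂ (here refl , px) , λ { (here refl) _ → Sub-refl ; (there m) _ → All.lookup ps m }
    ... | false with largest P n
    ...   | z , w , mx = z , (case w of λ { (inj₁ e) → inj₁ e ; (inj₂ (m , p)) → inj₂ (there m , p) }) ,
                         λ { (here refl) p → ⊥-elim (true≢false p px) ; (there m) p → mx m p }

    cnt-mono : ∀ {x′ x} → Sub x′ x → ∀ j a → cnt j x′ a ≤ cnt j x a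
    cnt-mono s j a = count-mono λ v h → let p , c = ∧-true {eqB (part v) j} h in ∧-intro p (just-hasCol (below s (hasCol-just c)))

    over-mono : ∀ {x′ x} → Sub x′ x → ∀ j a → over j x′ a ≡ true → over j x a ≡ true
    over-mono {x′} {x} s j a h = ≤⇒over j x a (≤-trans (over⇒≤ j x′ a h) (cnt-mono s j a))

    full⇒over : ∀ j x → full j x ≡ true → ∀ a → thr j ≤ cnt j x a
    full⇒over j x f a = over⇒≤ j x a (trans (count-⊆-≡ {f = over j x} {g = λ _ → true} (λ _ _ → refl)
      (≤-reflexive (trans (count-full {q} (λ _ → true) (λ _ → refl)) (sym (≡ᵇ-true {sz j x} {q} f)))) a) refl)

    emp⇒under : ∀ j x → emp j x ≡ true → ∀ a → cnt j x a < thr j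
    emp⇒under j x e a = ℕₚ.≰⇒> λ le → ℕₚ.<⇒≱ (count-pos (over j x) a (≤⇒over j x a le)) (≤-reflexive (≡ᵇ-true {sz j x} {0} e))

    nc : Fin m → ℕ
    nc j = count (λ v → eqB (part v) j)

    class-fibres : ∀ j (f : Fin N → Maybe (Fin q)) →
      count (λ v → eqB (part v) j ∧ is-just (f v)) ≡ sumF (λ a → count (λ v → eqB (part v) j ∧ hasCol a (f v)))
    class-fibres j f = trans (count-cong (λ v → e₁ (eqB (part v) j) (f v))) (trans (count-fibres κ) (sumF-cong (λ a → count-cong (λ v → e₂ a (eqB (part v) j) (f v)))))
      where
      κ′ : Bool → Maybe (Fin q) → Maybe (Fin q)
      κ′ b x = if b then x else nothing
      κ : Fin N → Maybe (Fin q)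
      κ v = κ′ (eqB (part v) j) (f v)
      e₁ : ∀ b x → b ∧ is-just x ≡ is-just (κ′ b x)
      e₁ true  x = refl
      e₁ false x = refl
      e₂ : ∀ a b x → hasCol a (κ′ b x) ≡ b ∧ hasCol a x
      e₂ a true  x = refl
      e₂ a false x = refl

    y⊑top : ∀ c {v a} → y c v ≡ just a → col (top c) v ≡ just a
    y⊑top c {v} e with keep c v
    ... | true = e

    y-keep : ∀ c {v} → keep c v ≡ true → y c v ≡ col (top c) v
    y-keep c {v} e = cong (λ b → if b then col (top c) v else nothing) e

    Cy : List (List Entry) → Fin m → ℕ
    Cy c j = count (λ v → eqB (part v) j ∧ is-just (y c v))

    ay : List (List Entry) → Fin m → Fin q → ℕ
    ay c j a = count (λ v → eqB (part v) j ∧ hasCol a (y c v))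

    Unmixed : List (List Entry) → Set
    Unmixed c = ∀ j → any (mixed j) c ≡ false

    unmixed-cases : ∀ c → Unmixed c → ∀ j {x} → x ∈ c → full j x ≡ true ⊎ emp j x ≡ true
    unmixed-cases c u j {x} m with bool (full j x) | bool (emp j x)
    ... | inj₁ f | _      = inj₁ f
    ... | _      | inj₁ e = inj₂ e
    ... | inj₂ f | inj₂ e = ⊥-elim (true≢false (∧-intro (not-intro e) (not-intro f)) (any-false (mixed j) (u j) m))

    module _ {x₀ : List Entry} {c₀ : List (List Entry)} (nest : Nested (x₀ ∷ c₀)) (unm : Unmixed (x₀ ∷ c₀)) (j : Fin m) where

      private
        c : List (List Entry)
        c = x₀ ∷ c₀

        -- Every colour stays below the threshold even in the largest face, so at most `q (thr - 1)`
        -- vertices of the class are coloured, and `thr≤` bounds this by `nc - (q - 1)`. Equality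
        -- forces `thr - 1` vertices of each colour.
        noFull : any (full j) c ≡ false → (Cy c j + q₁ ≤ nc j) × (nc j ≤ Cy c j + q₁ → ∀ a → thr j ≤ suc (ay c j a))
        noFull nf = bound , λ le a → subst (_≤ suc (ay c j a)) (sym et) (tight le a)
          where
          t = ℕ.pred (thr j)
          et : thr j ≡ suc t
          et = sym (ℕₚ.suc-pred (thr j) {{ℕ.>-nonZero (thr≥1 j)}})
          ay≤ : ∀ a → ay c j a ≤ t
          ay≤ a = ≤-pred (subst (suc (ay c j a) ≤_) et (≤-trans (s≤s (count-mono λ v h → let p , e = ∧-true {eqB (part v) j} h in
                    ∧-intro p (just-hasCol (y⊑top c (hasCol-just e))))) (emp⇒under j x₀ empty a)))
            where
            empty : emp j x₀ ≡ true
            empty with unmixed-cases c unm j {x₀} (here refl)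
            ... | inj₁ f = ⊥-elim (true≢false (any-intro (full j) {c} (here refl) f) nf)
            ... | inj₂ e = e
          Cy≡ : Cy c j ≡ sumF (ay c j)
          Cy≡ = class-fibres j (y c)
          qt : q * t + q₁ ≤ nc j
          qt = ≤-pred (≤-trans (≤-reflexive (solve 2 (λ q₁ t → con 1 :+ ((con 1 :+ q₁) :* t :+ q₁) := (con 1 :+ q₁) :* (con 1 :+ t)) refl q₁ t))
                               (subst (λ z → q * z ≤ suc (nc j)) et (thr≤ j)))
          bound : Cy c j + q₁ ≤ nc j
          bound = ≤-trans (+-monoˡ-≤ q₁ (≤-trans (≤-reflexive Cy≡) (≤-trans (sumF-mono ay≤) (≤-reflexive (sumF-const q t))))) qt
          tight : nc j ≤ Cy c j + q₁ → ∀ a → suc t ≤ suc (ay c j a)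
          tight le a = s≤s (≤-reflexive (sym (sumF-tight ay≤ (≤-trans (≤-reflexive (sumF-const q t))
                         (+-cancelʳ-≤ q₁ (q * t) _ (≤-trans qt (≤-trans le (≤-reflexive (cong (_+ q₁) Cy≡)))))) a)))

        -- Between the largest face `xe` with no colour at the threshold and the smallest face `xf`
        -- with all of them there, every colour gains a vertex. These at least `q` vertices lie in
        -- `inT`, and at most one of them is kept.
        withFull : any (full j) c ≡ true → (Cy c j + q₁ ≤ nc j) × (nc j ≤ Cy c j + q₁ → ∀ a → thr j ≤ suc (ay c j a))
        withFull af = bound , tight
          where
          sm = smallest (full j) nest af
          xf = proj₁ sm
          xf∈ : xf ∈ c
          xf∈ = proj₁ (proj₂ sm)
          xf-full : full j xf ≡ true
          xf-full = proj₁ (proj₂ (proj₂ sm))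
          xf-min : ∀ {x′} → x′ ∈ c → full j x′ ≡ true → Sub xf x′
          xf-min = proj₂ (proj₂ (proj₂ sm))
          lg = largest (emp j) nest
          xe = proj₁ lg
          xe-max : ∀ {x′} → x′ ∈ c → emp j x′ ≡ true → Sub x′ xe
          xe-max = proj₂ (proj₂ lg)
          xe-under : ∀ a → cnt j xe a < thr j
          xe-under a with proj₁ (proj₂ lg)
          ... | inj₁ e = subst (λ z → cnt j z a < thr j) (sym e) (≤-trans (s≤s (≤-reflexive (count-none (λ v → eqB (part v) j ∧ false) (λ v → ∧-false (eqB (part v) j))))) (thr≥1 j))
            where
            ∧-false : ∀ b → b ∧ false ≡ false
            ∧-false true  = refl
            ∧-false false = refl
          ... | inj₂ (m , e) = emp⇒under j xe e a
          xe-top : Sub xe x₀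
          xe-top with proj₁ (proj₂ lg)
          ... | inj₁ e = subst (λ z → Sub z x₀) (sym e) (sub λ ())
          ... | inj₂ (m , _) = top-sub nest m
          xe-notT : ∀ {v} → part v ≡ j → coloured xe v ≡ true → inT c v ≡ false
          xe-notT {v} refl cv with proj₁ (proj₂ lg)
          ... | inj₁ e = ⊥-elim (true≢false cv (cong (λ z → coloured z v) e))
          ... | inj₂ (m , e) = ¬true⇒false λ t → let _ , t₁ = ∧-true {coloured x₀ v} t
                                                     _ , t₂ = ∧-true {any (full (part v)) c} t₁
                                                     _ , t₃ = ∧-true {all (λ x → not (full (part v) x) ∨ coloured x v) c} t₂
                                                 in case ∨-true {not (emp (part v) xe)} (all-elim (λ x → not (emp (part v) x) ∨ not (coloured x v)) t₃ m) of λ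
                                                    { (inj₁ h) → true≢false e (not-true h) ; (inj₂ h) → true≢false cv (not-true h) }
          inT-intro : ∀ {v} → part v ≡ j → coloured xf v ≡ true → coloured xe v ≡ false → inT c v ≡ true
          inT-intro {v} refl cf ce = ∧-intro (Sub-coloured (top-sub nest xf∈) cf) (∧-intro af (∧-intro
            (all-intro _ c (λ x m → case bool (full (part v) x) of λ
               { (inj₁ f) → ∨-introʳ {not (full (part v) x)} (Sub-coloured (xf-min m f) cf) ; (inj₂ f) → ∨-introˡ (not-intro f) }))
            (all-intro _ c (λ x m → case bool (emp (part v) x) of λ
               { (inj₁ e) → ∨-introʳ {not (emp (part v) x)} (not-intro (¬true⇒false λ h → true≢false (Sub-coloured (xe-max m e) h) ce))
               ; (inj₂ e) → ∨-introˡ (not-intro e) }))))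
          fT : Fin N → Maybe (Fin q)
          fT v = if inT c v then col xf v else nothing
          tA : Fin q → ℕ
          tA a = count (λ v → eqB (part v) j ∧ hasCol a (fT v))
          tcnt : ℕ
          tcnt = count (λ v → eqB (part v) j ∧ inT c v)
          cover : ∀ a → cnt j xf a ≤ tA a + cnt j xe a
          cover a = count-cover λ v h → let p , e = ∧-true {eqB (part v) j} h
                                            cf = hasCol-just {m = col xf v} e in
            case bool (coloured xe v) of λ
              { (inj₂ ce) → inj₁ (∧-intro p (just-hasCol (trans (cong (λ b → if b then col xf v else nothing) (inT-intro (eqB-true p) (is-just-intro cf) ce)) cf)))
              ; (inj₁ ce) → let b , eb = is-just-elim {m = col xe v} ce in
                  inj₂ (∧-intro p (just-hasCol (trans eb (trans (sym (below xe-top eb)) (below (top-sub nest xf∈) cf))))) }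
          tA≥1 : ∀ a → 1 ≤ tA a
          tA≥1 a = +-cancelʳ-≤ (cnt j xe a) 1 (tA a) (≤-trans (xe-under a) (≤-trans (full⇒over j xf xf-full a) (cover a)))
          ΣtA≤ : sumF tA ≤ tcnt
          ΣtA≤ = ≤-trans (≤-reflexive (sym (class-fibres j fT))) (count-mono λ v h → let p , e = ∧-true {eqB (part v) j} h in ∧-intro p (if-just (inT c v) e))
            where
            if-just : ∀ b {x : Maybe (Fin q)} → is-just (if b then x else nothing) ≡ true → b ≡ true
            if-just true _ = refl
          q≤tcnt : q ≤ tcnt
          q≤tcnt = ≤-trans (≤-reflexive (sym (trans (sumF-const q 1) (ℕₚ.*-identityʳ q)))) (≤-trans (sumF-mono tA≥1) ΣtA≤)
          fst : Fin N → Bool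
          fst v = eqB (part v) j ∧ (inT c v ∧ not (anyFin (later c v)))
          fst-clash : ∀ u v → u Fin.< v → fst u ≡ true → fst v ≡ true → ⊥
          fst-clash u v lt hu hv = let pu , tu = ∧-true {eqB (part u) j} hu
                                       pv , tv = ∧-true {eqB (part v) j} hv
                                   in true≢false (anyFin-intro (later c v) u (∧-intro (lt→ u v lt) (∧-intro
                                        (subst (λ z → eqB (part u) z ≡ true) (sym (eqB-true pv)) pu) (proj₁ (∧-true {inT c u} tu)))))
                                        (not-true (proj₂ (∧-true {inT c v} tv)))
            where
            lt→ : ∀ (w u : Fin N) → w Fin.< u → ⌊ w Fin.<? u ⌋ ≡ true
            lt→ w u h with w Fin.<? u
            ... | yes _ = refl
            ... | no ¬p = ⊥-elim (¬p h)
          fst-unique : ∀ u v → fst u ≡ true → fst v ≡ true → u ≡ v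
          fst-unique u v hu hv with Finₚ.<-cmp u v
          ... | tri≈ _ e _  = e
          ... | tri< lt _ _ = ⊥-elim (fst-clash u v lt hu hv)
          ... | tri> _ _ gt = ⊥-elim (fst-clash v u gt hv hu)
          Cy≤ : Cy c j ≤ count (λ v → eqB (part v) j ∧ not (inT c v)) + count fst
          Cy≤ = count-cover λ v h → let p , e = ∧-true {eqB (part v) j} h in kept v p (keep c v) refl e
            where
            kept : ∀ v → eqB (part v) j ≡ true → ∀ b → keep c v ≡ b → is-just (if b then col x₀ v else nothing) ≡ true →
                   eqB (part v) j ∧ not (inT c v) ≡ true ⊎ fst v ≡ true
            kept v p true ek _ with bool (inT c v)
            ... | inj₂ f = inj₁ (∧-intro p (not-intro f))
            ... | inj₁ t with ∨-true {not (inT c v)} ek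
            ...   | inj₁ h = ⊥-elim (true≢false t (not-true h))
            ...   | inj₂ h = inj₂ (∧-intro p (∧-intro t h))
          Cy+t≤ : Cy c j + tcnt ≤ suc (nc j)
          Cy+t≤ = ≤-trans (+-monoˡ-≤ tcnt (≤-trans Cy≤ (+-monoʳ-≤ _ (count-≤1 fst fst-unique))))
                    (≤-reflexive (trans (solve 2 (λ a t → (a :+ con 1) :+ t := con 1 :+ (t :+ a)) refl _ tcnt) (cong suc (count-split (λ v → eqB (part v) j) (inT c)))))
          bound : Cy c j + q₁ ≤ nc j
          bound = ≤-pred (≤-trans (≤-reflexive (sym (ℕₚ.+-suc (Cy c j) q₁))) (≤-trans (+-monoʳ-≤ (Cy c j) q≤tcnt) Cy+t≤))
          -- Equality leaves room for exactly one new vertex of each colour, so each colour has at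
          -- least `thr - 1` vertices already in `xe`, and none of those is discarded.
          tight : nc j ≤ Cy c j + q₁ → ∀ a → thr j ≤ suc (ay c j a)
          tight le a = begin
            thr j                  ≤⟨ full⇒over j xf xf-full a ⟩
            cnt j xf a             ≤⟨ cover a ⟩
            tA a + cnt j xe a      ≡⟨ cong (_+ cnt j xe a) (sym (sumF-tight tA≥1 (≤-trans ΣtA≤ (≤-trans tcnt≤q (≤-reflexive (sym (trans (sumF-const q 1) (ℕₚ.*-identityʳ q)))))) a)) ⟩
            suc (cnt j xe a)       ≤⟨ s≤s (count-mono λ v h → let p , e = ∧-true {eqB (part v) j} h
                                                                  ce = hasCol-just {m = col xe v} e in
                                        ∧-intro p (just-hasCol (trans (y-keep c {v} (∨-introˡ (not-intro (xe-notT (eqB-true p) (is-just-intro ce))))) (below xe-top ce)))) ⟩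
            suc (ay c j a)         ∎
            where
            open ≤-Reasoning
            tcnt≤q : tcnt ≤ q
            tcnt≤q = +-cancelˡ-≤ (Cy c j) tcnt q (≤-trans Cy+t≤ (≤-trans (s≤s le) (≤-reflexive (sym (ℕₚ.+-suc (Cy c j) q₁)))))

      classBound : (Cy c j + q₁ ≤ nc j) × (nc j ≤ Cy c j + q₁ → ∀ a → thr j ≤ suc (ay c j a))
      classBound with bool (any (full j) c)
      ... | inj₁ f  = withFull f
      ... | inj₂ nf = noFull nf

    -- The class bounds add up to at most `α + 1` vertices coloured by `y`. More than `α` runs
    -- therefore make all class bounds equalities, which gives fairness, and make every run a single
    -- vertex, which separates consecutive vertices.
    good-or-small : ∀ {x₀ c₀} → Nested (x₀ ∷ c₀) → All Valid (x₀ ∷ c₀) → Unmixed (x₀ ∷ c₀) → Good ⊎ runs nothing (y (x₀ ∷ c₀)) ≤ α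
    good-or-small {x₀} {c₀} nest val unm with runs nothing (y (x₀ ∷ c₀)) ℕ.≤? α
    ... | yes le = inj₂ le
    ... | no ¬le = inj₁ record
      { z = y c
      ; independent = λ u v cf e e′ → proper (All.head val) u v cf (y⊑top c e) (y⊑top c e′)
      ; consecutive = runs-tight nothing (y c) (≤-trans total≤ big)
      ; fair = λ j a → proj₂ (classBound nest unm j) (≤-reflexive (sym (tight j))) a
      ; missing = λ j → +-cancelˡ-≤ (Cy c j) _ _ (≤-reflexive (trans (count-split (λ v → eqB (part v) j) (λ v → is-just (y c v))) (sym (tight j)))) }
      where
      c = x₀ ∷ c₀
      big : suc α ≤ runs nothing (y c)
      big = ℕₚ.≰⇒> ¬le
      ΣCy : count (is-just ∘ y c) ≡ sumF (Cy c)
      ΣCy = count-classes part (is-just ∘ y c)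
      Σnc : sumF nc ≡ N
      Σnc = trans (sumF-cong (λ j → count-cong (λ v → sym (∧-id (eqB (part v) j))))) (trans (sym (count-classes part (λ _ → true))) (count-full (λ _ → true) (λ _ → refl)))
        where
        ∧-id : ∀ b → b ∧ true ≡ b
        ∧-id true  = refl
        ∧-id false = refl
      Σ+ : sumF (λ j → Cy c j + q₁) ≡ count (is-just ∘ y c) + m * q₁
      Σ+ = trans (sumF-+ (Cy c) (λ _ → q₁)) (cong₂ _+_ (sym ΣCy) (sumF-const m q₁))
      tight : ∀ j → Cy c j + q₁ ≡ nc j
      tight = sumF-tight (λ j → proj₁ (classBound nest unm j)) (≤-trans (≤-reflexive (trans Σnc N≡))
        (≤-trans (+-monoˡ-≤ (m * q₁) (≤-trans big (runs≤count nothing (y c)))) (≤-reflexive (sym Σ+))))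
      total≤ : count (is-just ∘ y c) ≤ suc α
      total≤ = +-cancelʳ-≤ (m * q₁) _ (suc α) (≤-trans (≤-reflexive (sym Σ+)) (≤-trans (sumF-mono (λ j → proj₁ (classBound nest unm j))) (≤-reflexive (trans Σnc N≡))))

    -- The index `s` stands for the size `s + 1`, so exactly the sizes strictly between 0 and `q`
    -- are recorded.
    bit : List (List Entry) → Fin m → Fin q₁ → Bool
    bit c j s = any (λ x → sz j x ≡ᵇ suc (toℕ s)) c

    mixedRank : List (List Entry) → ℕ
    mixedRank c = sumF (λ j → count (bit c j))

    rankAt : Maybe (Fin m) → List (List Entry) → ℕ
    rankAt (just _) c = α + mixedRank c
    rankAt nothing  c = runs nothing (y c)

    rank : List (List Entry) → ℕ
    rank c = rankAt (firstMixed c) c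

    bit⇒mixed : ∀ c j s → bit c j s ≡ true → any (mixed j) c ≡ true
    bit⇒mixed c j s b = let x , m , e = any-true (λ x → sz j x ≡ᵇ suc (toℕ s)) c b in
      any-intro (mixed j) {c} {x} m (∧-intro (not-intro (¬true⇒false λ h → case trans (sym (≡ᵇ-true {sz j x} {suc (toℕ s)} e)) (≡ᵇ-true {sz j x} {0} h) of λ ()))
        (not-intro (¬true⇒false λ h → ℕₚ.<⇒≢ (s≤s (Finₚ.toℕ<n s)) (trans (sym (≡ᵇ-true {sz j x} {suc (toℕ s)} e)) (≡ᵇ-true {sz j x} {q} h)))))

    mixed⇒size : ∀ j x → mixed j x ≡ true → ∃ λ (s : Fin q₁) → sz j x ≡ suc (toℕ s)
    mixed⇒size j x mx with ∧-true {not (emp j x)} mx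
    ... | ne , nf with sz j x | count≤n (over j x)
    ...   | zero  | _ = case ne of λ ()
    ...   | suc s | le = Fin.fromℕ< s<q₁ , cong suc (sym (Finₚ.toℕ-fromℕ< s<q₁))
      where
      s<q₁ : s < q₁
      s<q₁ = ℕₚ.≤∧≢⇒< (≤-pred le) λ { refl → true≢false (≡ᵇ-refl {suc s} refl) (not-true nf) }

    mixed⇒bit : ∀ {c} j {x} → x ∈ c → mixed j x ≡ true → ∃ λ s → sz j x ≡ suc (toℕ s) × bit c j s ≡ true
    mixed⇒bit {c} j {x} m mx = let s , e = mixed⇒size j x mx in s , e , any-intro (λ x → sz j x ≡ᵇ suc (toℕ s)) m (≡ᵇ-refl {sz j x} {suc (toℕ s)} e)

    mixedRank-pos : ∀ {c} j → any (mixed j) c ≡ true → 1 ≤ mixedRank c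
    mixedRank-pos {c} j e = let z , z∈ , mz = any-true (mixed j) c e
                                s , _ , b = mixed⇒bit j z∈ mz
                            in ≤-trans (count-pos (bit c j) s b) (sum-≥ j)
      where
      sum-≥ : ∀ {n} {a : Fin n → ℕ} i → a i ≤ sumF a
      sum-≥ {suc n} {a} zero    = m≤m+n _ _
      sum-≥ {suc n} {a} (suc i) = ≤-trans (sum-≥ i) (m≤n+m _ (a zero))

    lastMixed-∈ : ∀ j {c} → any (mixed j) c ≡ true → lastMixed j c ∈ c
    lastMixed-∈ j {x ∷ c} e with any (mixed j) c in e₁
    ... | true  = there (lastMixed-∈ j e₁)
    ... | false = here refl

    lastMixed-min : ∀ j {c} → Nested c → any (mixed j) c ≡ true → ∀ {x} → x ∈ c → mixed j x ≡ true → Sub (lastMixed j c) x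
    lastMixed-min j {z ∷ c} (ps ∷ n) e {x} m mx with any (mixed j) c in e₁
    lastMixed-min j {z ∷ c} (ps ∷ n) e (here refl) mx | true  = All.lookup ps (lastMixed-∈ j e₁)
    lastMixed-min j {z ∷ c} (ps ∷ n) e (there m)   mx | true  = lastMixed-min j n e₁ m mx
    lastMixed-min j {z ∷ c} (ps ∷ n) e (here refl) mx | false = Sub-refl
    lastMixed-min j {z ∷ c} (ps ∷ n) e (there m)   mx | false = ⊥-elim (true≢false mx (any-false (mixed j) e₁ m))

    sz-mono : ∀ {x x′} j → Sub x x′ → sz j x ≤ sz j x′
    sz-mono j s = count-mono (over-mono s j)

    -- A larger flag imposes more conditions, so its `inT` is smaller and a first element of the old
    -- set, if still present, is first in the new one. If the smaller flag has no full face, its top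
    -- face is empty in the sense of `emp`, and vertices coloured there are outside `inT` of the
    -- larger flag.
    y-mono : ∀ {c c′} → Nested c → Nested c′ → (∀ {x} → x ∈ c′ → x ∈ c) → Unmixed c → top c′ ∈ c′ → y c′ ⊑ y c
    y-mono {c} {c′} n n′ inc unm t∈ v {a} e = trans (y-keep c {v} kc) (below (top-sub n (inc t∈)) ct)
      where
      ct : col (top c′) v ≡ just a
      ct = y⊑top c′ e
      kc′ : keep c′ v ≡ true
      kc′ with keep c′ v
      ... | true = refl
      kc′ | false = case e of λ ()
      shrink : ∀ u → any (full (part u)) c′ ≡ true → inT c u ≡ true → inT c′ u ≡ true
      shrink u af t = let _ , t₁ = ∧-true {coloured (top c) u} t
                          _ , t₂ = ∧-true {any (full (part u)) c} t₁
                          t₃ , t₄ = ∧-true {all (λ x → not (full (part u) x) ∨ coloured x u) c} t₂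
                          x , m , fx = any-true (full (part u)) c′ af
                          cx : coloured x u ≡ true
                          cx = case ∨-true {not (full (part u) x)} (all-elim (λ x → not (full (part u) x) ∨ coloured x u) t₃ (inc m)) of λ
                                 { (inj₁ h) → ⊥-elim (true≢false fx (not-true h)) ; (inj₂ h) → h }
                      in ∧-intro (Sub-coloured (top-sub n′ m) cx) (∧-intro af (∧-intro
                           (all-intro _ c′ (λ x m → all-elim (λ x → not (full (part u) x) ∨ coloured x u) t₃ (inc m)))
                           (all-intro _ c′ (λ x m → all-elim (λ x → not (emp (part u) x) ∨ not (coloured x u)) t₄ (inc m)))))
      kc : keep c v ≡ true
      kc with bool (inT c v)
      ... | inj₂ f = ∨-introˡ (not-intro f)
      ... | inj₁ t with bool (any (full (part v)) c′)
      ...   | inj₁ af = ∨-introʳ {not (inT c v)} (not-intro (¬true⇒false λ h →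
                let u , hu = anyFin-true {f = later c v} h
                    lt , r = ∧-true {⌊ u Fin.<? v ⌋} hu
                    pu , tu = ∧-true {eqB (part u) (part v)} r
                in case ∨-true {not (inT c′ v)} kc′ of λ
                   { (inj₁ nt) → true≢false (shrink v af t) (not-true nt)
                   ; (inj₂ nl) → true≢false (anyFin-intro (later c′ v) u (∧-intro lt (∧-intro pu
                       (shrink u (subst (λ j → any (full j) c′ ≡ true) (sym (eqB-true pu)) af) tu)))) (not-true nl) }))
      ...   | inj₂ nf = ⊥-elim (
                let _ , t₁ = ∧-true {coloured (top c) v} t
                    _ , t₂ = ∧-true {any (full (part v)) c} t₁
                    _ , t₄ = ∧-true {all (λ x → not (full (part v) x) ∨ coloured x v) c} t₂
                    et : emp (part v) (top c′) ≡ true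
                    et = case unmixed-cases c unm (part v) {top c′} (inc t∈) of λ
                           { (inj₁ f) → ⊥-elim (true≢false (any-intro (full (part v)) t∈ f) nf) ; (inj₂ h) → h }
                in case ∨-true {not (emp (part v) (top c′))} (all-elim (λ x → not (emp (part v) x) ∨ not (coloured x v)) t₄ (inc t∈)) of λ
                   { (inj₁ h) → true≢false et (not-true h) ; (inj₂ h) → true≢false (is-just-intro ct) (not-true h) })

    mixedRank-mono : ∀ {c c′} → (∀ {x} → x ∈ c′ → x ∈ c) → ∀ j s → bit c′ j s ≡ true → bit c j s ≡ true
    mixedRank-mono {c} {c′} inc j s b = let x , m , e = any-true (λ x → sz j x ≡ᵇ suc (toℕ s)) c′ b in any-intro (λ x → sz j x ≡ᵇ suc (toℕ s)) (inc m) e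

    any-mono : ∀ {P : List Entry → Bool} {c c′} → (∀ {x} → x ∈ c′ → x ∈ c) → any P c′ ≡ true → any P c ≡ true
    any-mono {P} {c} {c′} inc e = let x , m , px = any-true P c′ e in any-intro P (inc m) px

    bits-≡ : ∀ c c′ → (∀ {x} → x ∈ c′ → x ∈ c) → mixedRank c ≤ mixedRank c′ → ∀ j s → bit c′ j s ≡ bit c j s
    bits-≡ c c′ inc le j = count-⊆-≡ {f = bit c′ j} {bit c j} (mixedRank-mono {c} {c′} inc j)
      (≤-reflexive (sym (sumF-tight {a = λ j → count (bit c′ j)} {λ j → count (bit c j)} (λ j → count-mono (mixedRank-mono {c} {c′} inc j)) le j)))

    -- The smallest mixed face of the larger flag lies below that of the smaller one. As both flags
    -- show the same sizes, the smaller flag has a mixed face of that minimal size too, so the two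
    -- sets of colours at the threshold are nested and equally large.
    mixedLabel-≡ : ∀ c c′ j → Nested c → Nested c′ → (∀ {x} → x ∈ c′ → x ∈ c) → any (mixed j) c ≡ true → any (mixed j) c′ ≡ true →
                   (∀ s → bit c′ j s ≡ bit c j s) → labelAt (just j) c ≡ labelAt (just j) c′
    mixedLabel-≡ c c′ j n n′ inc aj aj′ bitEq = affineLabel-σ idSym (indicator (over j L′)) (indicator (over j L)) (mixed⇒nonconst j L′ mL′)
        (λ a → ≡⇒≈ (cong (λ b → if b then 1ℤ else 0ℤ) (overEq a)))
      where
      L = lastMixed j c
      L′ = lastMixed j c′
      mL : mixed j L ≡ true
      mL = lastMixed-mixed j c aj
      mL′ : mixed j L′ ≡ true
      mL′ = lastMixed-mixed j c′ aj′
      L⊆L′ : Sub L L′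
      L⊆L′ = lastMixed-min j {c} n aj {L′} (inc (lastMixed-∈ j {c′} aj′)) mL′
      szEq : sz j L′ ≤ sz j L
      szEq = let s , es , b = mixed⇒bit {c} j {L} (lastMixed-∈ j {c} aj) mL
                 w , w∈ , ew = any-true (λ x → sz j x ≡ᵇ suc (toℕ s)) c′ (trans (bitEq s) b)
                 sw : sz j w ≡ sz j L
                 sw = trans (≡ᵇ-true {sz j w} {suc (toℕ s)} ew) (sym es)
             in ≤-trans (sz-mono {L′} {w} j (lastMixed-min j {c′} n′ aj′ {w} w∈ (subst (λ z → not (z ≡ᵇ 0) ∧ not (z ≡ᵇ q) ≡ true) (sym sw) mL))) (≤-reflexive sw)
      overEq : ∀ a → over j L a ≡ over j L′ a
      overEq = count-⊆-≡ {f = over j L} {over j L′} (over-mono L⊆L′ j) szEq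

    -- The offset `α` puts every flag with a mixed face strictly above all flags without one, unless
    -- a good colouring appears; within either kind equality of ranks leaves no freedom for the
    -- label.
    compare : ∀ {x c₀ x′ c₀′} (let c = x ∷ c₀) (let c′ = x′ ∷ c₀′) → Nested c → Nested c′ → All Valid c′ →
              (∀ {x} → x ∈ c′ → x ∈ c) → Good ⊎ (rank c′ ≤ rank c × (rank c ≡ rank c′ → flagLabel c ≡ flagLabel c′))
    compare {x} {c₀} {x′} {c₀′} n n′ v′ inc = go (firstMixed c) (firstMixed c′) refl refl
      where
      c = x ∷ c₀
      c′ = x′ ∷ c₀′
      Res : Maybe (Fin m) → Maybe (Fin m) → Set
      Res a b = Good ⊎ (rankAt b c′ ≤ rankAt a c × (rankAt a c ≡ rankAt b c′ → labelAt a c ≡ labelAt b c′))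
      go : ∀ a b → firstMixed c ≡ a → firstMixed c′ ≡ b → Res a b
      go nothing (just j) e e′ = ⊥-elim (true≢false (any-mono {mixed j} {c} {c′} inc (firstFin-just {f = λ j → any (mixed j) c′} e′)) (firstFin-nothing {f = λ j → any (mixed j) c} e j))
      go nothing nothing e e′ = inj₂ (runs-mono nothing mono , λ eq →
          let u , b , yu = y-nonempty c′ (proj₁ ne) (proj₂ (proj₂ ne))
              a , fa = first-just (y c′) u yu
          in trans (cong (maybe colourLabel junk) (first-tight mono fa (sym eq))) (cong (maybe colourLabel junk) (sym fa)))
        where
        mono : y c′ ⊑ y c
        mono = y-mono n n′ inc (firstFin-nothing {f = λ j → any (mixed j) c} e) (here refl)
        ne : ∃ λ v → ∃ λ a → col x′ v ≡ just a
        ne = nonempty (All.head v′)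
      go (just j) nothing e e′ with good-or-small n′ v′ (firstFin-nothing {f = λ j → any (mixed j) c′} e′)
      ... | inj₁ gd = inj₁ gd
      ... | inj₂ le = inj₂ (≤-trans le (m≤m+n α _) , λ eq → ⊥-elim (ℕₚ.<⇒≢ (≤-trans (s≤s le) (≤-trans (≤-reflexive (ℕₚ.+-comm 1 α)) (+-monoʳ-≤ α pos))) (sym eq)))
        where
        pos : 1 ≤ mixedRank c
        pos = mixedRank-pos {c} j (firstFin-just {f = λ j → any (mixed j) c} e)
      go (just j) (just j′) e e′ = inj₂ (+-monoʳ-≤ α (sumF-mono (λ j → count-mono (mixedRank-mono {c} {c′} inc j))) , same)
        where
        same : α + mixedRank c ≡ α + mixedRank c′ → labelAt (just j) c ≡ labelAt (just j′) c′
        same eq = trans (mixedLabel-≡ c c′ j n n′ inc aj (trans (sym (anyEq j)) aj) (bitEq j)) (cong (λ z → labelAt z c′) (trans (sym e) (trans (firstFin-cong anyEq) e′)))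
          where
          bitEq : ∀ j s → bit c′ j s ≡ bit c j s
          bitEq = bits-≡ c c′ inc (≤-reflexive (ℕₚ.+-cancelˡ-≡ α _ _ eq))
          anyEq : ∀ j → any (mixed j) c ≡ any (mixed j) c′
          anyEq j = bool-ext (λ h → let z , z∈ , mz = any-true (mixed j) c h
                                        s , _ , b = mixed⇒bit {c} j {z} z∈ mz
                                    in bit⇒mixed c′ j s (trans (bitEq j s) b)) (any-mono {mixed j} {c} {c′} inc)
          aj : any (mixed j) c ≡ true
          aj = firstFin-just {f = λ j → any (mixed j) c} e

    rank-pos : ∀ {x c₀} → All Valid (x ∷ c₀) → 1 ≤ rank (x ∷ c₀)
    rank-pos {x} {c₀} v = go (firstMixed (x ∷ c₀)) refl
      where
      c = x ∷ c₀
      go : ∀ a → firstMixed c ≡ a → 1 ≤ rankAt a c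
      go nothing e = let u , b , yu = y-nonempty c (proj₁ (nonempty (All.head v))) (proj₂ (proj₂ (nonempty (All.head v)))) in runs-pos (y c) u yu
      go (just j) e = ≤-trans (mixedRank-pos {c} j (firstFin-just {f = λ j → any (mixed j) c} e)) (m≤n+m _ α)

    rank-small : ∀ {x c₀} → Nested (x ∷ c₀) → All Valid (x ∷ c₀) → Good ⊎ rank (x ∷ c₀) < N
    rank-small {x} {c₀} n v = go (firstMixed (x ∷ c₀)) refl
      where
      c = x ∷ c₀
      go : ∀ a → firstMixed c ≡ a → Good ⊎ rankAt a c < N
      go nothing e with good-or-small n v (firstFin-nothing {f = λ j → any (mixed j) c} e)
      ... | inj₁ gd = inj₁ gd
      ... | inj₂ le = inj₂ (≤-trans (s≤s (≤-trans le (m≤m+n α (m * q₁)))) (≤-reflexive (sym N≡)))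
      go (just j) e = inj₂ (≤-trans (s≤s (+-monoʳ-≤ α (≤-trans (sumF-mono (λ j → count≤n (bit c j))) (≤-reflexive (sumF-const m q₁))))) (≤-reflexive (sym N≡)))

    Del-∈ : ∀ {A : Set} {n} {f′ : Vec A n} {f : Vec A (suc n)} → Del f′ f → ∀ {x} → x ∈ toList f′ → x ∈ toList f
    Del-∈ here      m           = there m
    Del-∈ (there d) (here refl) = here refl
    Del-∈ (there d) (there m)   = there (Del-∈ d m)

    Del-All : ∀ {A : Set} {P : A → Set} {n} {f′ : Vec A n} {f : Vec A (suc n)} → Del f′ f → All P (toList f) → All P (toList f′)
    Del-All here      (p ∷ ps) = ps
    Del-All (there d) (p ∷ ps) = p ∷ Del-All d ps

    Del-Nested : ∀ {n} {f′ : Vec (List Entry) n} {f} → Del f′ f → Nested (toList f) → Nested (toList f′)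
    Del-Nested here      (p ∷ ps) = ps
    Del-Nested (there d) (p ∷ ps) = Del-All d p ∷ Del-Nested d ps

    -- Along the subflags from smallest to largest the rank starts at 1 or more; each step raises it
    -- or repeats the label of the step before.
    descent : ∀ {n} (f : Vec (List Entry) (suc n)) (ff : Vec (List (List Entry)) (suc n)) → Flag ff f → Nested (toList f) → All Valid (toList f) →
              Good ⊎ (Deg (Vec.map flagLabel ff) ⊎ suc n ≤ rank (toList f))
    descent {zero}  (x ∷ []) (c ∷ []) (refl , _) n v = inj₂ (inj₂ (rank-pos v))
    descent {suc n} (x ∷ f) (c ∷ c′ ∷ ff) (refl , m , dl , fl@(e′ , _)) nest val with descent m (c′ ∷ ff) fl (Del-Nested dl nest) (Del-All dl val)
    ... | inj₁ gd = inj₁ gd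
    ... | inj₂ (inj₁ dg) = inj₂ (inj₁ (there dg))
    ... | inj₂ (inj₂ le) = step m dl e′ le
      where
      step : ∀ m → Del m (x ∷ f) → c′ ≡ toList m → suc n ≤ rank (toList m) → Good ⊎ (Deg (Vec.map flagLabel (toList (x ∷ f) ∷ c′ ∷ ff)) ⊎ suc (suc n) ≤ rank (toList (x ∷ f)))
      step (x′ ∷ m) dl refl le with compare nest (Del-Nested dl nest) (Del-All dl val) (Del-∈ dl)
      ... | inj₁ gd = inj₁ gd
      ... | inj₂ (le′ , lab) with rank (toList (x ∷ f)) ℕ.≟ rank (toList (x′ ∷ m))
      ...   | yes eq = inj₂ (inj₁ (subst (λ l → Deg (l ∷ flagLabel (toList (x′ ∷ m)) ∷ Vec.map flagLabel ff)) (sym (lab eq)) here))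
      ...   | no ne  = inj₂ (inj₂ (≤-trans (s≤s le) (ℕₚ.≤∧≢⇒< le′ (λ e → ne (sym e)))))

    good-or-degenerate : ∀ {n} → suc n ≡ N → (f : Vec (List Entry) (suc n)) (ff : Vec (List (List Entry)) (suc n)) → Flag ff f →
                         Nested (toList f) → All Valid (toList f) → Good ⊎ Deg (Vec.map flagLabel ff)
    good-or-degenerate e f@(_ ∷ _) ff fl n v with descent f ff fl n v
    ... | inj₁ gd = inj₁ gd
    ... | inj₂ (inj₁ dg) = inj₂ dg
    ... | inj₂ (inj₂ le) with rank-small n v
    ...   | inj₁ gd = inj₁ gd
    ...   | inj₂ lt = ⊥-elim (ℕₚ.<⇒≱ lt (subst (_≤ rank (toList f)) e le))

-- The complex of partial colourings and the pull-back of the obstruction.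

module Colourings where

  open import Defs hiding (sym)
  open OperatorAlgebra
  open AlternatingCochains
  open Obstructions
  open ChainPairings
  open Counting
  open TranslationLabels
  open FlagLabellings
  open RankComparison
  open import Data.List.Membership.Propositional using (_∈_)
  open import Data.Maybe.Properties using (map-id)
  open ≡ using (refl; sym; trans)

  Compatible : ∀ {N q} → (Fin N → Fin N → Bool) → Fin N × Fin q → Fin N × Fin q → Set
  Compatible conf (v , a) (w , b) = v ≢ w × (conf v w ≡ true → a ≢ b)

  -- partial colourings, as lists of distinct coloured vertices
  Colouring : ∀ {N q} → (Fin N → Fin N → Bool) → ∀ {n} → Vec (Fin N × Fin q) n → Set
  Colouring conf l = AllPairs (Compatible conf) (toList l)

  move : ∀ {N q k} → (Fin k → Fin q → Fin q) → Fin k → Fin N × Fin q → Fin N × Fin q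
  move g i (v , a) = v , g i a

  module _ {N q k : ℕ} {g : Fin k → Fin q → Fin q} where

    move-comm : (∀ i j a → g i (g j a) ≡ g j (g i a)) → ∀ i j (e : Fin N × Fin q) → move g i (move g j e) ≡ move g j (move g i e)
    move-comm comm i j (v , a) = cong (v ,_) (comm i j a)

    move-period : ∀ m → (∀ i a → iter m (g i) a ≡ a) → ∀ i (e : Fin N × Fin q) → iter m (move g i) e ≡ e
    move-period m per i (v , a) = trans (go m) (cong (v ,_) (per i a))
      where
      go : ∀ m → iter m (move g i) (v , a) ≡ (v , iter m (g i) a)
      go zero    = refl
      go (suc m) = cong (move g i) (go m)

  module _ {p₁ k q N : ℕ} (TR : Translations p₁ k q) (conf : Fin N → Fin N → Bool) where
    open Translations TR

    Colouring-move : ∀ {n} i (l : Vec (Fin N × Fin q) n) → Colouring conf l → Colouring conf (Vec.map (move g i) l)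
    Colouring-move i l cl = subst (AllPairs (Compatible conf)) (sym (Vecₚ.toList-map (move g i) l))
      (AllPairsₚ.map⁺ (AllPairs.map (λ (ne , pr) → ne , λ c e → pr c (g-injective i e)) cl))

  module Distinct {N q : ℕ} where

    clashes : Fin N × Fin q → List (Fin N × Fin q) → Bool
    clashes (v , _) = any (λ (w , _) → eqB v w)

    -- `col` reads off the first entry of a vertex, so a list determines a colouring independently
    -- of its order only if no vertex is repeated. Subdividing such lists only keeps the pull-back
    -- alternating on all lists.
    distinct : ∀ {n} → Vec (Fin N × Fin q) n → Bool
    distinct []      = true
    distinct (a ∷ l) = not (clashes a (toList l)) ∧ distinct l

    distinct-Del : ∀ {n} (l : Vec (Fin N × Fin q) (suc n)) m → Del m l → distinct l ≡ true → distinct m ≡ true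
    distinct-Del (a ∷ l) .l here e = proj₂ (∧-true {not (clashes a (toList l))} e)
    distinct-Del (a ∷ l) (.a ∷ m) (there d) e with ∧-true {not (clashes a (toList l))} e
    ... | na , dl = ∧-intro (not-intro (¬true⇒false λ h → true≢false (mono d h) (not-true na))) (distinct-Del l m d dl)
      where
      mono : ∀ {n} {l : Vec (Fin N × Fin q) (suc n)} {m} → Del m l → clashes a (toList m) ≡ true → clashes a (toList l) ≡ true
      mono (here {a = b}) h = ∨-introʳ {eqB (proj₁ a) (proj₁ b)} h
      mono (there {a = b} {m} d) h with ∨-true {eqB (proj₁ a) (proj₁ b)} h
      ... | inj₁ p = ∨-introˡ p
      ... | inj₂ p = ∨-introʳ {eqB (proj₁ a) (proj₁ b)} (mono d p)

    eqB-comm : ∀ (u v : Fin N) → eqB u v ≡ eqB v u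
    eqB-comm u v = bool-ext (λ e → subst (λ z → eqB z u ≡ true) (eqB-true e) (eqB-refl u)) (λ e → subst (λ z → eqB z v ≡ true) (eqB-true e) (eqB-refl v))

    clashes-Swap : ∀ a {n} {l l′ : Vec (Fin N × Fin q) n} → Swap l l′ → clashes a (toList l) ≡ clashes a (toList l′)
    clashes-Swap a (here {a = b} {b = c} {v}) = swap∨ (eqB (proj₁ a) (proj₁ b)) (eqB (proj₁ a) (proj₁ c)) (clashes a (toList v))
      where
      swap∨ : ∀ p r s → p ∨ (r ∨ s) ≡ r ∨ (p ∨ s)
      swap∨ true  true  s = refl
      swap∨ true  false s = refl
      swap∨ false true  s = refl
      swap∨ false false s = refl
    clashes-Swap a (there {a = b} s) = cong (eqB (proj₁ a) (proj₁ b) ∨_) (clashes-Swap a s)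

    distinct-Swap : ∀ {n} {l l′ : Vec (Fin N × Fin q) n} → Swap l l′ → distinct l ≡ distinct l′
    distinct-Swap (here {a = a} {b} {v}) = trans (aux (eqB (proj₁ a) (proj₁ b)) (clashes a (toList v)) (clashes b (toList v)) (distinct v))
      (cong (λ z → not (z ∨ clashes b (toList v)) ∧ (not (clashes a (toList v)) ∧ distinct v)) (eqB-comm (proj₁ a) (proj₁ b)))
      where
      aux : ∀ e p r d → not (e ∨ p) ∧ (not r ∧ d) ≡ not (e ∨ r) ∧ (not p ∧ d)
      aux true  p     r     d = refl
      aux false true  true  d = refl
      aux false true  false d = refl
      aux false false true  d = refl
      aux false false false d = refl
    distinct-Swap (there {a = a} s) = cong₂ (λ x y → not x ∧ y) (clashes-Swap a s) (distinct-Swap s)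

    distinct-rel : ∀ {_~_ : Fin N × Fin q → Fin N × Fin q → Set} → (∀ {a b} → a ~ b → proj₁ a ≡ proj₁ b) →
                   ∀ {n} {l l′ : Vec (Fin N × Fin q) n} → Pointwise _~_ l l′ → distinct l ≡ distinct l′
    distinct-rel {_~_} same []       = refl
    distinct-rel {_~_} same (r ∷ rs) = cong₂ (λ x y → not x ∧ y) (clash r (toList-rel rs)) (distinct-rel same rs)
      where
      clash : ∀ {a b x y} → a ~ b → LP.Pointwise _~_ x y → clashes a x ≡ clashes b y
      clash r LP.[]       = refl
      clash r (s LP.∷ ss) = cong₂ _∨_ (cong₂ eqB (same r) (same s)) (clash r ss)

    Colouring⇒distinct : ∀ {conf n} (l : Vec (Fin N × Fin q) n) → Colouring conf l → distinct l ≡ true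
    Colouring⇒distinct []      _        = refl
    Colouring⇒distinct {conf} (a ∷ l) (p ∷ ps) = ∧-intro (not-intro (none (toList l) p)) (Colouring⇒distinct l ps)
      where
      none : ∀ x → All (Compatible conf a) x → clashes a x ≡ false
      none []      []       = refl
      none (b ∷ x) (c ∷ cs) = trans (cong (_∨ clashes a x) (eqB-false (proj₁ c))) (none x cs)

  module Assemble {p₁ k₁ q₁ : ℕ} (K : Coefficients p₁ (suc k₁)) (TR : Translations p₁ (suc k₁) (suc q₁))
    {N m : ℕ} (part : Fin N → Fin m) (thr : Fin m → ℕ) (conf : Fin N → Fin N → Bool)
    (conf-sym : ∀ u v → conf u v ≡ conf v u) (conf-irr : ∀ v → conf v v ≡ false) (α : ℕ)
    (N≡ : N ≡ suc (α ℕ.+ m ℕ.* q₁))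
    (thr≥1 : ∀ j → 1 ≤ thr j) (thr≤ : ∀ j → suc q₁ ℕ.* thr j ≤ suc (count (λ v → eqB (part v) j))) where

    open Coefficients K hiding (refl; sym; trans)
    private
      module ≈ = Coefficients K
      module AL = AffineLabel isPrime TR
    open Cochains ring
    open Obstruction K
    open Chains K
    open Ranks isPrime TR part thr conf α N≡ thr≥1 thr≤
    open Distinct {N} {suc q₁}
    open Translations TR using (g)

    gE : Fin (suc k₁) → Entry → Entry
    gE = move g

    open Reaching gE (Colouring conf) public

    private
      module S₁ = Subdivision {Entry} distinct
      module S₂ = Subdivision {List Entry} (λ _ → true)

      -- The inner subdivision has flags of colourings as simplices and the outer passes from
      -- colourings to such flags; the vertices that receive labels are thus flags themselves.
      L : ∀ {n} → (Vec Y n → Carrier) → Vec Entry n → Carrier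
      L φ = S₁.sd (S₂.sd (φ ∘ Vec.map flagLabel))

      col-Swap : ∀ {n} {l l′ : Vec Entry n} → Swap l l′ → distinct l ≡ true → ∀ v → col (toList l′) v ≡ col (toList l) v
      col-Swap (here {a = u , a} {b = w , b} {r}) dl v with eqB u v in eu | eqB w v in ew
      ... | false | false = refl
      ... | false | true  = refl
      ... | true  | false = refl
      ... | true  | true  = ⊥-elim (true≢false (proj₁ (∧-true {not (clashes (u , a) ((w , b) ∷ toList r))} dl))
                              (cong not (∨-introˡ (subst (λ z → eqB z w ≡ true) (trans (eqB-true ew) (sym (eqB-true eu))) (eqB-refl w)))))
      col-Swap (there {a = u , a} {l} s) dl v with eqB u v
      ... | true  = refl
      ... | false = col-Swap s (proj₂ (∧-true {not (clashes (u , a) (toList l))} dl)) v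

      module Id = Equivariance AL.idSym

      L-Alt : ∀ {n} (φ : Vec Y n → Carrier) → Alt (L φ)
      L-Alt φ = S₁.sd-Alt Id.Related (λ {x} → Id.related λ v → sym (map-id (col x v))) distinct-Swap
        (λ {_} {l} s dl → Id.related λ v → trans (col-Swap s dl v) (sym (map-id (col (toList l) v))))
        (λ {f} {f′} rs → S₂.sd-rel (λ _ → refl) (λ {ff} {ff′} rr → ≈.reflexive (cong φ (labels rr))) rs)
        where
        labels : ∀ {n} {ff ff′ : Vec (List (List Entry)) n} → Pointwise (NonEmpty Id.Related) ff ff′ → Vec.map flagLabel ff ≡ Vec.map flagLabel ff′
        labels []              = refl
        labels ((r ∷ rs) ∷ ps) = cong₂ _∷_ (sym (Id.flagLabel-σ (r LP.∷ rs) (λ _ → refl))) (labels ps)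

      L-g : ∀ {n} i (φ : Vec Y n → Carrier) l → L (φ ∘ G i) l ≈ L φ (gV i l)
      L-g i φ l = S₁.sd-rel {_~_ = λ a a′ → a′ ≡ gE i a} (distinct-rel λ { refl → refl })
        (λ {f} {f′} rs → S₂.sd-rel {_~_ = R₂} (λ _ → refl) (λ {ff} {ff′} rr → ≈.reflexive (cong φ (labels rr))) (lift₁ rs))
        (self l)
        where
        module E = Equivariance (AL.gSym i)
        -- The relation carries a coloured vertex along, which guarantees a first colour and so
        -- keeps `junk` out.
        R₂ : List Entry → List Entry → Set
        R₂ x x′ = E.Related x x′ × ∃ λ v → ∃ λ a → col x v ≡ just a
        self : ∀ {n} (l : Vec Entry n) → Pointwise (λ a a′ → a′ ≡ gE i a) l (gV i l)
        self []      = []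
        self (a ∷ l) = refl ∷ self l
        col-g : ∀ {x x′} → LP.Pointwise (λ a a′ → a′ ≡ gE i a) x x′ → ∀ v → col x′ v ≡ Maybe.map (g i) (col x v)
        col-g LP.[] v = refl
        col-g {(u , a) ∷ x} (refl LP.∷ rs) v with eqB u v
        ... | true  = refl
        ... | false = col-g rs v
        lift₁ : ∀ {n} {f f′ : Vec (List Entry) n} → Pointwise (NonEmpty (λ a a′ → a′ ≡ gE i a)) f f′ → Pointwise R₂ f f′
        lift₁ [] = []
        lift₁ (_∷_ {x = (u , a) ∷ x} (r ∷ rs) ps) = (E.related (col-g (r LP.∷ rs)) , u , a , cong (λ b → if b then just a else col x u) (eqB-refl u)) ∷ lift₁ ps
        labels : ∀ {n} {ff ff′ : Vec (List (List Entry)) n} → Pointwise (NonEmpty R₂) ff ff′ → G i (Vec.map flagLabel ff) ≡ Vec.map flagLabel ff′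
        labels [] = refl
        labels (_∷_ {x = c} ((r , v , a , e) ∷ rs) ps) = cong₂ _∷_ (sym (E.flagLabel-σ (r LP.∷ LP.map proj₁ rs)
          (λ nothing-first → let u , b , yu = y-nonempty c v e
                                 b′ , fb = Runs.first-just (y c) u yu in case trans (sym nothing-first) fb of λ ()))) (labels ps)

      L-d : ∀ {n} (φ : Vec Y n → Carrier) l → Colouring conf l → L (d φ) l ≈ d (L φ) l
      L-d φ l cl = ≈.trans (S₁.sd-local l (λ f _ → ≈.trans (S₂.sd-local f (λ ff _ → ≈.sym (δ-map flagLabel φ ff))) (S₂.sd-d (λ _ _ _ _ → refl) (φ ∘ Vec.map flagLabel) f refl)))
        (S₁.sd-d distinct-Del (S₂.sd (φ ∘ Vec.map flagLabel)) l (Colouring⇒distinct l cl))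

    private
      col-∈ : ∀ {x v a} → col x v ≡ just a → (v , a) ∈ x
      col-∈ {(u , b) ∷ x} {v} e with eqB u v in eu
      ... | false = there (col-∈ e)
      ... | true  = here (cong₂ _,_ (sym (eqB-true eu)) (sym (just-injective e)))

      ∈-compatible : ∀ {x : List Entry} {a b} → AllPairs (Compatible conf) x → a ∈ x → b ∈ x → a ≡ b ⊎ (Compatible conf a b ⊎ Compatible conf b a)
      ∈-compatible (p ∷ ps) (here refl) (here refl) = inj₁ refl
      ∈-compatible (p ∷ ps) (here refl) (there m)   = inj₂ (inj₁ (All.lookup p m))
      ∈-compatible (p ∷ ps) (there m)   (here refl) = inj₂ (inj₂ (All.lookup p m))
      ∈-compatible (p ∷ ps) (there m)   (there m′)  = ∈-compatible ps m m′

      valid : ∀ {n} (l : Vec Entry (suc n)) → Colouring conf l → Valid (toList l)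
      valid ((u , a) ∷ l) cl = record
        { proper = λ v w {b} cf ev ew → case ∈-compatible cl (col-∈ ev) (col-∈ ew) of λ
            { (inj₁ e) → true≢false (subst (λ z → conf v z ≡ true) (sym (cong proj₁ e)) cf) (conf-irr v)
            ; (inj₂ (inj₁ (_ , h))) → h cf refl
            ; (inj₂ (inj₂ (_ , h))) → h (trans (conf-sym w v) cf) refl }
        ; nonempty = u , a , cong (λ b → if b then just a else col (toList l) u) (eqB-refl u) }

      Del-Colouring : ∀ {n} {l : Vec Entry (suc n)} {m} → Del m l → Colouring conf l → Colouring conf m
      Del-Colouring here      (p ∷ ps) = ps
      Del-Colouring (there d) (p ∷ ps) = Del-All d p ∷ Del-Colouring d ps

      Del-Sub : ∀ {n} {l : Vec Entry (suc n)} {m} → Del m l → Colouring conf l → Sub (toList m) (toList l)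
      Del-Sub (here {a = u , a} {l}) (p ∷ ps) = sub λ {v} {b} e →
        trans (cong (λ t → if t then just a else col (toList l) v) (eqB-false {u = u} {v} λ { refl → proj₁ (All.lookup p (col-∈ {toList l} e)) refl })) e
      Del-Sub (there {a = u , a} {m} {l} d) (p ∷ ps) = sub (λ {v} {b} → ext v b (eqB u v))
        where
        ext : ∀ v b t → (if t then just a else col (toList m) v) ≡ just b → (if t then just a else col (toList l) v) ≡ just b
        ext v b true  e = e
        ext v b false e = below (Del-Sub d ps) e

      flag-nested : ∀ {n} (f : Vec (List Entry) n) (l : Vec Entry n) → Flag f l → Colouring conf l →
                    Nested (toList f) × All Valid (toList f) × All (λ x → Sub x (toList l)) (toList f)
      flag-nested [] [] _ _ = [] , [] , []
      flag-nested (x ∷ f) l@(_ ∷ _) (refl , m , dl , fl) cl with flag-nested f m fl (Del-Colouring dl cl)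
      ... | n , v , s = s′ ∷ n , valid l cl ∷ v , Sub-refl ∷ s′
        where
        s′ : All (λ x → Sub x (toList l)) (toList f)
        s′ = All.map (λ h → sub λ e → below (Del-Sub dl cl) (below h e)) s

      module Pair = Pairing (Colouring-move TR conf) L (λ _ → ≈.refl)
        (λ e l → S₁.sd-local l (λ f _ → S₂.sd-local f (λ ff _ → e _)))
        (λ φ ψ l → ≈.trans (S₁.sd-local l (λ f _ → S₂.sd-+ _ _ f)) (S₁.sd-+ _ _ l))
        (λ r φ l → ≈.trans (S₁.sd-local l (λ f _ → S₂.sd-* r _ f)) (S₁.sd-* r _ l))
        L-Alt L-d (λ i φ l _ → L-g i φ l)

    -- Every term of the evaluation either produces a good colouring or vanishes through a repeated
    -- label; if all vanished, the pairing would be zero.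
    good-from-chain : ∀ {n} → suc n ≡ N → ∀ {c} → Reach n c → Good
    good-from-chain {n} e {c} r with ev-either (Reach⇒Support n r) {L (Stage.θ (stage n))} vanish
      where
      vanish : ∀ l → Colouring conf l → Good ⊎ L (Stage.θ (stage n)) l ≈ 0#
      -- Zero is written as `0# * 0#` so that homogeneity of `sd` shows its pull-back to be zero.
      vanish l cl with S₁.sd-either {ψ = λ _ → 0# * 0#} l (λ f fl → inner f fl)
        where
        inner : ∀ f → Flag f l → Good ⊎ S₂.sd (Stage.θ (stage n) ∘ Vec.map flagLabel) f ≈ 0# * 0#
        inner f fl with S₂.sd-either {ψ = λ _ → 0# * 0#} f (λ ff ffl → case good-or-degenerate e f ff ffl (proj₁ nv) (proj₁ (proj₂ nv)) of λ
                          { (inj₁ gd) → inj₁ gd ; (inj₂ dg) → inj₂ (≈.trans (Stage.θ-van (stage n) _ dg) (≈.sym (zeroˡ 0#))) })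
          where nv = flag-nested f l fl cl
        ... | inj₁ gd = inj₁ gd
        ... | inj₂ z  = inj₂ (≈.trans z (≈.trans (S₂.sd-* 0# (λ _ → 0#) f) (≈.trans (zeroˡ _) (≈.sym (zeroˡ 0#)))))
      ... | inj₁ gd = inj₁ gd
      ... | inj₂ z  = inj₂ (≈.trans z (≈.trans (S₁.sd-* 0# (λ _ → 0#) l) (zeroˡ _)))
    ... | inj₁ gd = gd
    ... | inj₂ z  = ⊥-elim (NZ⇒≉0 (Pair.pairing n r) z)

-- Cycles from the operators T, and filling by links, deletions and cones.

module ChainFilling where

  open import Defs hiding (sym)
  open RingPreliminaries
  open OperatorAlgebra
  open DifferenceOperators
  open AlternatingCochains
  open Obstructions
  open ChainPairings
  open Counting
  open TranslationLabels
  open Colourings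
  open import Data.List.Membership.Propositional using (_∈_)

  module Cycles {p₁ k : ℕ} (K : Coefficients p₁ k) {A : Set} (g : Fin k → A → A)
    (g-comm : ∀ i j a → g i (g j a) ≡ g j (g i a)) (g-per : ∀ i a → iter (suc p₁) (g i) a ≡ a)
    (P : ∀ {n} → Vec A n → Set) where
    open Coefficients K
    open Cochains ring
    open Obstruction K using (T)
    open Chains K
    open Reaching g P
    open import Relation.Binary.Reasoning.Setoid setoid

    open import Algebra.Properties.Semiring.Exp as Exp using ()

    private
      X^p-zero : ∀ {n} (φ : Vec A n → Carrier) v → app (X gV ^ₒ suc p₁) φ v ≈ 0#
      X^p-zero = Action.X^p≈0 gV (λ i j → map-comm (g-comm i j)) (λ i → iter-map (suc p₁) (g-per i))

      expo-sum : ∀ n → expo p₁ n ℕ.+ expo p₁ (suc n) ≡ suc p₁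
      expo-sum n with expo-alternates p₁ n
      ... | inj₁ (e , e′) = ≡.trans (≡.cong₂ ℕ._+_ e e′) (ℕₚ.+-comm p₁ 1)
      ... | inj₂ (e , e′) = ≡.cong₂ ℕ._+_ e e′

    T-T : ∀ {n} m (φ : Vec A n → Carrier) v → app (T gV m) (app (T gV (suc m)) φ) v ≈ 0#
    T-T m φ v = trans (sym (Exp.^-homo-* opSemiring (X gV) (expo p₁ m) (expo p₁ (suc m)) φ v))
      (trans (reflexive (≡.cong (λ e → app (X gV ^ₒ e) φ v) (expo-sum m))) (X^p-zero φ v))

    d-T : ∀ {n} m (φ : Vec A n → Carrier) v → d (app (T gV m) φ) v ≈ app (T gV m) (d φ) v
    d-T m φ v = Natural.X^-natural gV gV d (λ _ → ⊤) (λ _ _ _ → tt) (λ _ → ⊤) (λ _ → tt)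
      (λ w _ → δ-0 _ w (λ _ _ → refl)) (λ e w _ → δ-cong _ e w) (λ φ ψ w _ → δ-+ _ φ ψ w) (λ r φ w _ → δ-* _ r φ w)
      (λ i {φ} _ w _ → δ-map (g i) φ w) (expo p₁ m) tt v tt

    T-chain : ∀ {n} → ℕ → Chain (Vec A n) → Chain (Vec A n)
    T-chain m = ChainAction.X^-chain gV (expo p₁ m)

    ev-T : ∀ {n} m (c : Chain (Vec A n)) φ → ev (T-chain m c) φ ≈ ev c (app (T gV m) φ)
    ev-T m = ChainAction.ev-X^ gV (expo p₁ m)

    -- Taking the boundary twice brings two consecutive operators together, whose product is `X^p`.
    -- In degree zero the boundary is a multiple of the empty simplex, which all `g i` fix.
    reach-cycle : ∀ n {c} → Reach n c → ∀ {φ : Vec A n → Carrier} → Alt φ → ev (T-chain (suc n) c) (d φ) ≈ 0#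
    reach-cycle n {c} r {φ} alt = trans (ev-T (suc n) c (d φ)) (trans (ev-cong c (λ l → sym (d-T (suc n) φ l))) (go n r alt))
      where
      go : ∀ n {c} → Reach n c → ∀ {φ : Vec A n → Carrier} → Alt φ → ev c (d (app (T gV (suc n)) φ)) ≈ 0#
      go zero {c} (_ , ρ , _ , e) {φ} alt = trans (e _) (trans (*-congˡ (X-const gV (λ i → λ { [] → refl }) [])) (zeroʳ ρ))
      go (suc n) (_ , c′ , ρ , _ , _ , e) {φ} alt = trans (e (Alt-X^ alt (expo p₁ (suc (suc n)))))
        (trans (*-congˡ (ev-0 c′ (λ l → T-T (suc n) φ l))) (zeroʳ ρ))

  module Filling {p₁ k q : ℕ} (K : Coefficients p₁ k) {N : ℕ} (conf : Fin N → Fin N → Bool)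
    (conf-sym : ∀ u v → conf u v ≡ conf v u) (conf-irr : ∀ v → conf v v ≡ false) where
    open Coefficients K
    open Cochains ring
    open Chains K
    open ℤSolver ring
    open import Relation.Binary.Reasoning.Setoid setoid
    open import Algebra.Properties.Ring (CommutativeRing.ring ring) using (-0#≈0#; -1*x≈-x) renaming (-‿distribˡ-* to neg-distribˡ)

    Entry : Set
    Entry = Fin N × Fin q

    _≟E_ : (a b : Entry) → Dec (a ≡ b)
    _≟E_ = ≡-dec Fin._≟_ Fin._≟_
      where open import Data.Product.Properties using (≡-dec)

    Sup : (Entry → Bool) → ∀ {n} → Vec Entry n → Set
    Sup C l = All (λ a → C a ≡ true) (toList l) × Colouring conf l

    is : Entry → Entry → Carrier
    is e a with a ≟E e
    ... | yes _ = 1#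
    ... | no _  = 0#

    is-refl : ∀ e → is e e ≈ 1#
    is-refl e with e ≟E e
    ... | yes _ = refl
    ... | no ¬p = ⊥-elim (¬p ≡.refl)

    is-≢ : ∀ {e a} → a ≢ e → is e a ≈ 0#
    is-≢ {e} {a} ne with a ≟E e
    ... | yes p = ⊥-elim (ne p)
    ... | no _  = refl

    δ-absent : ∀ e {n} (Ψ : Vec Entry n → Carrier) l → All (_≢ e) (toList l) → δ (is e) Ψ l ≈ 0#
    δ-absent e {zero}  Ψ (a ∷ [])  (ne ∷ _)  = trans (*-congʳ (is-≢ ne)) (zeroˡ _)
    δ-absent e {suc n} Ψ (a ∷ l) (ne ∷ nes) = trans (+-cong (trans (*-congʳ (is-≢ ne)) (zeroˡ _)) (-‿cong (δ-absent e (Ψ ∘ (a ∷_)) l nes)))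
      (trans (+-identityˡ _) -0#≈0#)

    compat-sym : ∀ {a b : Entry} → Compatible conf a b → Compatible conf b a
    compat-sym {v , _} {w , _} (ne , h) = (λ e → ne (≡.sym e)) , λ c e → h (≡.trans (conf-sym v w) c) (≡.sym e)

    -- the position of e in l, with the sign of moving it to the front
    record Pulled (e : Entry) {n} (l : Vec Entry (suc n)) : Set where
      field
        sgn    : Carrier
        rest   : Vec Entry n
        front  : ∀ {φ : Vec Entry (suc n) → Carrier} → Alt φ → φ l ≈ sgn * φ (e ∷ rest)
        coeff  : ∀ (Ψ : Vec Entry n → Carrier) → δ (is e) Ψ l ≈ sgn * Ψ rest
        member : e ∈ toList l
        inside : ∀ {a} → a ∈ toList rest → a ∈ toList l
        compat : All (Compatible conf e) (toList rest)
        colour : Colouring conf rest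
    open Pulled

    pull : ∀ e {n} (l : Vec Entry (suc n)) → Colouring conf l → All (_≢ e) (toList l) ⊎ Pulled e l
    pull e (a ∷ l) (p ∷ ps) with a ≟E e
    pull e {n} (a ∷ l) (p ∷ ps) | yes ≡.refl = inj₂ record
      { sgn = 1# ; rest = l ; front = λ _ → sym (*-identityˡ _) ; coeff = coeff′ l p
      ; member = here ≡.refl ; inside = there ; compat = p ; colour = ps }
      where
      absent : ∀ x → All (Compatible conf e) x → All (_≢ e) x
      absent x = All.map λ (ne , _) eq → ne (≡.cong proj₁ (≡.sym eq))
      coeff′ : ∀ {n} (l : Vec Entry n) → All (Compatible conf e) (toList l) → (Ψ : Vec Entry n → Carrier) → δ (is e) Ψ (e ∷ l) ≈ 1# * Ψ l
      coeff′ []      _ Ψ = *-congʳ (is-refl e)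
      coeff′ (b ∷ l) p Ψ = trans (+-cong (*-congʳ (is-refl e)) (-‿cong (δ-absent e (Ψ ∘ (e ∷_)) (b ∷ l) (absent _ p))))
        (trans (+-congˡ -0#≈0#) (+-identityʳ _))
    pull e {zero}  (a ∷ []) (p ∷ ps) | no ne = inj₁ (ne ∷ [])
    pull e {suc n} (a ∷ l)  (p ∷ ps) | no ne with pull e l ps
    ... | inj₁ ab = inj₁ (ne ∷ ab)
    ... | inj₂ pl = inj₂ record
      { sgn = - sgn pl
      ; rest = a ∷ rest pl
      ; front = λ {φ} alt → trans (front pl (Alt-∷ a alt)) (trans (*-congˡ (alt (here {a = e} {b = a} {v = rest pl})))
          (solve 2 (λ s x → s :* (:- x) := (:- s) :* x) refl _ _))
      ; coeff = λ Ψ → trans (+-cong (trans (*-congʳ (is-≢ ne)) (zeroˡ _)) (-‿cong (coeff pl (Ψ ∘ (a ∷_)))))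
          (trans (+-identityˡ _) (neg-distribˡ _ _))
      ; member = there (member pl)
      ; inside = λ { (here eq) → here eq ; (there m) → there (inside pl m) }
      ; compat = compat-sym (All.lookup p (member pl)) ∷ compat pl
      ; colour = All.tabulate (λ m → All.lookup p (inside pl m)) ∷ colour pl }

    _∖_ : (Entry → Bool) → Entry → Entry → Bool
    (C ∖ e) a = C a ∧ not ⌊ a ≟E e ⌋

    link : (Entry → Bool) → Entry → Entry → Bool
    link C (u , c) (w , b) = C (w , b) ∧ (not (eqB w u) ∧ not (conf w u ∧ eqB b c))

    ∖-intro : ∀ C {e a} → C a ≡ true → a ≢ e → (C ∖ e) a ≡ true
    ∖-intro C {e} {a} ca ne with a ≟E e
    ... | yes p = ⊥-elim (ne p)
    ... | no _  = ∧-intro ca ≡.refl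

    ∖-elim : ∀ C {e a} → (C ∖ e) a ≡ true → C a ≡ true × a ≢ e
    ∖-elim C {e} {a} h with a ≟E e
    ... | yes p = ⊥-elim (case proj₂ (∧-true {C a} h) of λ ())
    ... | no ne = proj₁ (∧-true {C a} h) , ne

    link-intro : ∀ C {e a} → C a ≡ true → Compatible conf e a → link C e a ≡ true
    link-intro C {u , c} {w , b} ca (ne , h) = ∧-intro ca (∧-intro (not-intro (eqB-false λ e → ne (≡.sym e)))
      (not-intro (¬true⇒false λ t → let x , y = ∧-true {conf w u} t in h (≡.trans (conf-sym u w) x) (≡.sym (eqB-true y)))))

    link-elim : ∀ C {e a} → link C e a ≡ true → C a ≡ true × Compatible conf e a
    link-elim C {u , c} {w , b} h = let x , y = ∧-true {C (w , b)} h
                                        z , t = ∧-true {not (eqB w u)} y in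
      x , (λ e → true≢false (≡.subst (λ r → eqB w r ≡ true) (≡.sym e) (eqB-refl w)) (not-true z)) ,
      λ cf e → true≢false (∧-intro (≡.trans (conf-sym w u) cf) (≡.subst (λ r → eqB b r ≡ true) (≡.sym e) (eqB-refl b))) (not-true t)

    compat⇒≢ : ∀ {e a : Entry} → Compatible conf e a → a ≢ e
    compat⇒≢ (ne , _) eq = ne (≡.cong proj₁ (≡.sym eq))

    Sup-mono : ∀ {C C′ : Entry → Bool} {n} {l : Vec Entry n} → (∀ a → C a ≡ true → C′ a ≡ true) → Sup C l → Sup C′ l
    Sup-mono h (al , cl) = All.map (h _) al , cl

    -- z = e·a + b with a in the link of e and b avoiding e
    record Split (C : Entry → Bool) (e : Entry) {n} (z : Chain (Vec Entry (suc n))) : Set where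
      field
        a  : Chain (Vec Entry n)
        b  : Chain (Vec Entry (suc n))
        aS : Support (Sup (link C e)) a
        bS : Support (Sup (C ∖ e)) b
        sum   : ∀ {φ : Vec Entry (suc n) → Carrier} → Alt φ → ev z φ ≈ ev a (φ ∘ (e ∷_)) + ev b φ
        deriv : ∀ (Ψ : Vec Entry n → Carrier) → ev z (δ (is e) Ψ) ≈ ev a Ψ

    split : ∀ C e {n} {z : Chain (Vec Entry (suc n))} → Support (Sup C) z → Split C e z
    split C e [] = record { a = [] ; b = [] ; aS = [] ; bS = [] ; sum = λ _ → sym (+-identityˡ 0#) ; deriv = λ _ → refl }
    split C e {z = (r , l) ∷ z} ((al , cl) ∷ zs) with split C e zs | pull e l cl
    ... | sp | inj₁ ab = record
      { a = a ; b = (r , l) ∷ b ; aS = aS ; bS = (allow l al ab , cl) ∷ bS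
      ; sum = λ alt → trans (+-congˡ (sum alt)) (solve 3 (λ x y t → x :+ (y :+ t) := y :+ (x :+ t)) refl _ _ _)
      ; deriv = λ Ψ → trans (+-cong (trans (*-congˡ (δ-absent e Ψ l ab)) (zeroʳ r)) (deriv Ψ)) (+-identityˡ _) }
      where
      open Split sp
      allow : ∀ {n} (l : Vec Entry n) → All (λ a → C a ≡ true) (toList l) → All (_≢ e) (toList l) → All (λ a → (C ∖ e) a ≡ true) (toList l)
      allow []      []       []       = []
      allow (_ ∷ l) (p ∷ ps) (q ∷ qs) = ∖-intro C p q ∷ allow l ps qs
    ... | sp | inj₂ pl = record
      { a = (r * sgn pl , rest pl) ∷ a ; b = b
      ; aS = (All.tabulate (λ m → link-intro C (All.lookup al (inside pl m)) (All.lookup (compat pl) m)) , colour pl) ∷ aS ; bS = bS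
      ; sum = λ alt → trans (+-cong (*-congˡ (front pl alt)) (sum alt)) (solve 5 (λ r s x y t → r :* (s :* x) :+ (y :+ t) := ((r :* s) :* x :+ y) :+ t) refl _ _ _ _ _)
      ; deriv = λ Ψ → +-cong (trans (*-congˡ (coeff pl Ψ)) (sym (*-assoc _ _ _))) (deriv Ψ) }
      where open Split sp

    -- Vanishing of reduced homology in one degree, for the colourings with entries in `C`. In the
    -- lowest degree the chains are multiples of the empty simplex and there is no cycle condition.
    FillAt : (Entry → Bool) → ℕ → Set
    FillAt C zero    = (z : Chain (Vec Entry 0)) → Support (Sup C) z → Σ (Chain (Vec Entry 1)) λ w → Support (Sup C) w ×
                       (∀ {φ : Vec Entry 0 → Carrier} → Alt φ → ev w (d φ) ≈ ev z φ)
    FillAt C (suc n) = (z : Chain (Vec Entry (suc n))) → Support (Sup C) z → (∀ {φ : Vec Entry n → Carrier} → Alt φ → ev z (d φ) ≈ 0#) →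
                       Σ (Chain (Vec Entry (suc (suc n)))) λ w → Support (Sup C) w × (∀ {φ : Vec Entry (suc n) → Carrier} → Alt φ → ev w (d φ) ≈ ev z φ)

    fill₀ : ∀ C {e} → C e ≡ true → FillAt C 0
    fill₀ C {e} ce z zs = push (e ∷_) z , push-support (e ∷_) (λ { [] _ → (ce ∷ []) , ([] ∷ []) }) zs ,
      λ {φ} _ → trans (ev-push (e ∷_) z (d φ)) (ev-cong z (λ { [] → *-identityˡ _ }))

    private
      d-cons : ∀ e {n} (c : Chain (Vec Entry (suc n))) (φ : Vec Entry (suc n) → Carrier) → ev (push (e ∷_) c) (d φ) ≈ ev c φ - ev c (d (φ ∘ (e ∷_)))
      d-cons e c φ = begin
        ev (push (e ∷_) c) (d φ)                                ≈⟨ ev-push (e ∷_) c (d φ) ⟩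
        ev c (λ l → 1# * φ l - d (φ ∘ (e ∷_)) l)                ≈⟨ ev-+ c _ _ ⟩
        ev c (λ l → 1# * φ l) + ev c (λ l → - d (φ ∘ (e ∷_)) l) ≈⟨ +-cong (ev-cong c (λ l → *-identityˡ _)) (ev-neg c _) ⟩
        ev c φ - ev c (d (φ ∘ (e ∷_)))                          ∎

      -- The part `a` is the contraction of `z` with `e`, and contraction anticommutes with the
      -- boundary.
      deriv-cycle : ∀ C e {n} {z : Chain (Vec Entry (suc (suc n)))} (sp : Split C e z) →
                    (∀ {φ : Vec Entry (suc n) → Carrier} → Alt φ → ev z (d φ) ≈ 0#) → ∀ {ψ : Vec Entry n → Carrier} → Alt ψ → ev (Split.a sp) (d ψ) ≈ 0#
      deriv-cycle C e {z = z} sp cyc {ψ} alt = begin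
        ev a (d ψ)                                   ≈⟨ deriv (d ψ) ⟨
        ev z (δ (is e) (d ψ))                        ≈⟨ +-identityʳ _ ⟨
        ev z (δ (is e) (d ψ)) + 0#                   ≈⟨ +-congˡ (cyc (δ-Alt (is e) alt)) ⟨
        ev z (δ (is e) (d ψ)) + ev z (d (δ (is e) ψ)) ≈⟨ ev-+ z _ _ ⟨
        ev z (λ l → δ (is e) (d ψ) l + d (δ (is e) ψ) l) ≈⟨ ev-0 z (λ l → δδ-anti (is e) _ ψ l) ⟩
        0#                                           ∎
        where open Split sp

      fill-link : ∀ C e n → FillAt (link C e) n → ∀ {z : Chain (Vec Entry (suc n))} (sp : Split C e z) →
                  (∀ {φ : Vec Entry n → Carrier} → Alt φ → ev z (d φ) ≈ 0#) →
                  Σ (Chain (Vec Entry (suc n))) λ w → Support (Sup (link C e)) w × (∀ {φ : Vec Entry n → Carrier} → Alt φ → ev w (d φ) ≈ ev (Split.a sp) φ)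
      fill-link C e zero    f sp cyc = f (Split.a sp) (Split.aS sp)
      fill-link C e (suc n) f sp cyc = f (Split.a sp) (Split.aS sp) (deriv-cycle C e sp cyc)

    -- Mayer-Vietoris at chain level. Write `z = e·a + b` and fill `a` by `a′` in the link. Then
    -- `z + ∂(e·a′)` equals `b + a′`, a cycle avoiding `e`; if `w` fills it, `w - e·a′` fills `z`.
    fill-remove : ∀ C e n → C e ≡ true → FillAt (link C e) n → FillAt (C ∖ e) (suc n) → FillAt C (suc n)
    fill-remove C e n ce fl fr z zs cyc = w ++ scale (- 1#) (push (e ∷_) a′) , wS , eq
      where
      sp = split C e zs
      open Split sp
      fa = fill-link C e n fl sp cyc
      a′ = proj₁ fa
      z′ : Chain (Vec Entry (suc n))
      z′ = b ++ a′
      z′S : Support (Sup (C ∖ e)) z′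
      z′S = ++-support bS (All.map (Sup-mono (λ x h → let p , c = link-elim C h in ∖-intro C p (compat⇒≢ c))) (proj₁ (proj₂ fa)))
      z′-ev : ∀ {φ : Vec Entry (suc n) → Carrier} → Alt φ → ev z′ φ ≈ ev z φ + ev (push (e ∷_) a′) (d φ)
      z′-ev {φ} alt = begin
        ev z′ φ                                                ≈⟨ ev-++ b a′ φ ⟩
        ev b φ + ev a′ φ                                       ≈⟨ solve 3 (λ b a x → b :+ a := (x :+ b) :+ (a :- x)) refl _ _ (ev a (φ ∘ (e ∷_))) ⟩
        (ev a (φ ∘ (e ∷_)) + ev b φ) + (ev a′ φ - ev a (φ ∘ (e ∷_))) ≈⟨ +-cong (sum alt) (trans (d-cons e a′ φ) (+-congˡ (-‿cong (proj₂ (proj₂ fa) (Alt-∷ e alt))))) ⟨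
        ev z φ + ev (push (e ∷_) a′) (d φ)                     ∎
      fw = fr z′ z′S (λ {φ} alt → trans (z′-ev (δ-Alt _ alt)) (trans (+-cong (cyc alt) (ev-0 (push (e ∷_) a′) (δδ≈0 _ φ))) (+-identityˡ 0#)))
      w = proj₁ fw
      wS : Support (Sup C) (w ++ scale (- 1#) (push (e ∷_) a′))
      wS = ++-support (All.map (Sup-mono (λ x h → proj₁ (∖-elim C h))) (proj₁ (proj₂ fw)))
        (scale-support (- 1#) (push-support (e ∷_) (λ l (al , cl) → (ce ∷ All.map (proj₁ ∘ link-elim C) al) , (All.map (proj₂ ∘ link-elim C) al ∷ cl)) (proj₁ (proj₂ fa))))
      eq : ∀ {φ : Vec Entry (suc n) → Carrier} → Alt φ → ev (w ++ scale (- 1#) (push (e ∷_) a′)) (d φ) ≈ ev z φ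
      eq {φ} alt = begin
        ev (w ++ scale (- 1#) (push (e ∷_) a′)) (d φ)           ≈⟨ ev-++ w _ (d φ) ⟩
        ev w (d φ) + ev (scale (- 1#) (push (e ∷_) a′)) (d φ)   ≈⟨ +-cong (trans (proj₂ (proj₂ fw) alt) (z′-ev alt)) (trans (ev-scale (- 1#) (push (e ∷_) a′) (d φ)) (-1*x≈-x _)) ⟩
        (ev z φ + ev (push (e ∷_) a′) (d φ)) - ev (push (e ∷_) a′) (d φ) ≈⟨ solve 2 (λ x y → (x :+ y) :- y := x) refl _ _ ⟩
        ev z φ                                                  ∎

    -- For a cycle `z = e·a + b` the part without `e` gives `∂b = -a`, so `∂(e·b) = b + e·a`.
    fill-cone : ∀ C e n → C e ≡ true → (∀ a → C a ≡ true → a ≢ e → Compatible conf e a) → FillAt C (suc n)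
    fill-cone C e n ce cmp z zs cyc = push (e ∷_) b ,
        push-support (e ∷_) (λ l (al , cl) → (ce ∷ All.map (λ h → proj₁ (∖-elim C h)) al) , (All.map (λ {x} h → let p , ne = ∖-elim C h in cmp x p ne) al ∷ cl)) bS ,
        λ {φ} alt → begin
          ev (push (e ∷_) b) (d φ)                ≈⟨ d-cons e b φ ⟩
          ev b φ - ev b (d (φ ∘ (e ∷_)))          ≈⟨ +-congˡ (-‿cong (b-boundary (Alt-∷ e alt))) ⟩
          ev b φ - - ev a (φ ∘ (e ∷_))            ≈⟨ solve 2 (λ x y → x :- (:- y) := y :+ x) refl _ _ ⟩
          ev a (φ ∘ (e ∷_)) + ev b φ              ≈⟨ sum alt ⟨
          ev z φ                                  ∎
      where
      sp = split C e zs
      open Split sp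
      a-part : ∀ n {z : Chain (Vec Entry (suc n))} (sp : Split C e z) → (∀ {φ : Vec Entry n → Carrier} → Alt φ → ev z (d φ) ≈ 0#) →
               ∀ {ψ : Vec Entry n → Carrier} → Alt ψ → ev (Split.a sp) (λ l → d ψ (e ∷ l)) ≈ ev (Split.a sp) ψ
      a-part zero    sp cyc {ψ} alt = ev-cong (Split.a sp) (λ { [] → *-identityˡ _ })
      a-part (suc n) sp cyc {ψ} alt = begin
        ev (Split.a sp) (λ l → 1# * ψ l - d (ψ ∘ (e ∷_)) l)   ≈⟨ trans (ev-+ (Split.a sp) _ _) (+-cong (ev-cong (Split.a sp) (λ l → *-identityˡ _)) (ev-neg (Split.a sp) _)) ⟩
        ev (Split.a sp) ψ - ev (Split.a sp) (d (ψ ∘ (e ∷_)))  ≈⟨ +-congˡ (trans (-‿cong (deriv-cycle C e sp cyc (Alt-∷ e alt))) -0#≈0#) ⟩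
        ev (Split.a sp) ψ + 0#                                ≈⟨ +-identityʳ _ ⟩
        ev (Split.a sp) ψ                                     ∎
      b-boundary : ∀ {ψ : Vec Entry n → Carrier} → Alt ψ → ev b (d ψ) ≈ - ev a ψ
      b-boundary {ψ} alt = begin
        ev b (d ψ)                                       ≈⟨ solve 2 (λ b a → b := (a :+ b) :- a) refl _ (ev a ψ) ⟩
        (ev a ψ + ev b (d ψ)) - ev a ψ                   ≈⟨ +-congʳ (trans (+-congʳ (sym (a-part n sp cyc alt))) (trans (sym (sum (δ-Alt _ alt))) (cyc alt))) ⟩
        0# - ev a ψ                                      ≈⟨ +-identityˡ _ ⟩
        - ev a ψ                                         ∎

    fill-ext : ∀ {C C′} n → (∀ a → C a ≡ C′ a) → FillAt C n → FillAt C′ n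
    fill-ext zero    h f z zs = let w , ws , e = f z (All.map (Sup-mono (λ a p → ≡.trans (h a) p)) zs) in w , All.map (Sup-mono (λ a p → ≡.trans (≡.sym (h a)) p)) ws , e
    fill-ext (suc n) h f z zs cyc = let w , ws , e = f z (All.map (Sup-mono (λ a p → ≡.trans (h a) p)) zs) cyc in w , All.map (Sup-mono (λ a p → ≡.trans (≡.sym (h a)) p)) ws , e

    _∖∖_ : (Entry → Bool) → List Entry → Entry → Bool
    C ∖∖ []       = C
    C ∖∖ (e ∷ es) = (C ∖ e) ∖∖ es

    ∖∖-intro : ∀ C es {a} → C a ≡ true → ¬ a ∈ es → (C ∖∖ es) a ≡ true
    ∖∖-intro C []       ca na = ca
    ∖∖-intro C (e ∷ es) ca na = ∖∖-intro (C ∖ e) es (∖-intro C ca (λ eq → na (here eq))) (na ∘ there)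

    ∖∖-elim : ∀ C es {a} → (C ∖∖ es) a ≡ true → C a ≡ true × ¬ a ∈ es
    ∖∖-elim C []       h = h , λ ()
    ∖∖-elim C (e ∷ es) h = let p , na = ∖∖-elim (C ∖ e) es h
                               q , ne = ∖-elim C p in q , λ { (here eq) → ne eq ; (there m) → na m }

    -- When the turn of `e` comes, some members of `es` are already gone. The hypothesis is
    -- therefore quantified over all intermediate `C′`, which miss nothing of `C` outside `es`.
    fill-removeAll : ∀ es C n →
      (∀ C′ e → e ∈ es → C′ e ≡ true → (∀ a → C′ a ≡ true → C a ≡ true) → (∀ a → C a ≡ true → C′ a ≡ true ⊎ a ∈ es) → FillAt (link C′ e) n) →
      FillAt (C ∖∖ es) (suc n) → FillAt C (suc n)
    fill-removeAll []       C n h f = f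
    fill-removeAll (e ∷ es) C n h f with bool (C e)
    ... | inj₁ ce = fill-remove C e n ce (h C e (here ≡.refl) ce (λ _ p → p) (λ _ p → inj₁ p)) rec
      where
      rec = fill-removeAll es (C ∖ e) n (λ C′ e′ m ce′ sub cov → h C′ e′ (there m) ce′ (λ a p → proj₁ (∖-elim C (sub a p)))
              (λ a p → case a ≟E e of λ { (yes eq) → inj₂ (here eq) ; (no ne) → case cov a (∖-intro C p ne) of λ { (inj₁ x) → inj₁ x ; (inj₂ x) → inj₂ (there x) } })) f
    ... | inj₂ ce = fill-ext (suc n) same rec
      where
      same : ∀ a → (C ∖ e) a ≡ C a
      same a = bool-ext (λ p → proj₁ (∖-elim C p)) (λ p → ∖-intro C p (λ { ≡.refl → true≢false p ce }))
      rec = fill-removeAll es (C ∖ e) n (λ C′ e′ m ce′ sub cov → h C′ e′ (there m) ce′ (λ a p → proj₁ (∖-elim C (sub a p)))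
              (λ a p → case a ≟E e of λ { (yes eq) → inj₂ (here eq) ; (no ne) → case cov a (∖-intro C p ne) of λ { (inj₁ x) → inj₁ x ; (inj₂ x) → inj₂ (there x) } })) f

-- Greedy filling under the degree condition.

module SparseConflicts where

  open import Defs hiding (sym)
  open OperatorAlgebra
  open AlternatingCochains
  open Obstructions
  open ChainPairings
  open Counting
  open TranslationLabels
  open Colourings
  open ChainFilling
  open import Data.Nat.Solver using (module +-*-Solver)
  open import Data.List.Membership.Propositional using (_∈_)
  open import Data.List.Membership.Propositional.Properties using (∈-map⁺; ∈-map⁻; ∈-allFin)
  open ≡ using (refl; sym; trans)

  open +-*-Solver using (solve; _:+_; _:=_; con)

  sumF-drop : ∀ {n} {a b : Fin n → ℕ} u → (∀ i → a i ≤ b i) → a u ≡ 0 → sumF a ℕ.+ b u ≤ sumF b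
  sumF-drop {suc n} {a} {b} zero h z = ≤-trans (≤-reflexive (trans (cong (λ t → (t ℕ.+ sumF (a ∘ suc)) ℕ.+ b zero) z) (ℕₚ.+-comm _ (b zero)))) (+-monoʳ-≤ (b zero) (sumF-mono (h ∘ suc)))
  sumF-drop {suc n} {a} {b} (suc u) h z = ≤-trans (≤-reflexive (ℕₚ.+-assoc (a zero) _ _)) (+-mono-≤ (h zero) (sumF-drop u (h ∘ suc) z))

  count-eqB≤1 : ∀ {n} (c : Fin n) → count (λ a → eqB a c) ≤ 1
  count-eqB≤1 c = count-≤1 (λ a → eqB a c) λ i j p r → trans (eqB-true p) (sym (eqB-true r))

  count-lose : ∀ {n} {f g : Fin n → Bool} c → (∀ a → f a ≡ true → a ≢ c → g a ≡ true) → count f ≤ suc (count g)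
  count-lose {f = f} {g} c h = ≤-trans (count-cover {h = λ a → eqB a c} λ a fa → case bool (eqB a c) of λ
      { (inj₁ e) → inj₂ e ; (inj₂ e) → inj₁ (h a fa λ { refl → true≢false (eqB-refl a) e }) })
    (≤-trans (+-monoʳ-≤ (count g) (count-eqB≤1 c)) (≤-reflexive (ℕₚ.+-comm (count g) 1)))

  module Greedy {p₁ k q : ℕ} (K : Coefficients p₁ k) {N : ℕ} (conf : Fin N → Fin N → Bool)
    (conf-sym : ∀ u v → conf u v ≡ conf v u) (conf-irr : ∀ v → conf v v ≡ false)
    (wt : Fin N → Fin N → ℕ)
    (wt-adj : ∀ u v → conf u v ≡ true → 2 ≤ wt u v)
    (wt-dist2 : ∀ u w v → conf u w ≡ true → conf w v ≡ true → u ≢ v → 1 ≤ wt u v) where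

    open Filling {q = q} K conf conf-sym conf-irr

    W : (Fin N → Bool) → Fin N → ℕ
    W act v = sumF (λ u → if act u ∧ not (eqB u v) then wt v u else 0)

    -- The greedy invariant: each active vertex has more colours left than the total weight of the
    -- other active vertices, and weights are chosen to dominate the losses those vertices can
    -- cause.
    record Rich (C : Entry → Bool) (act : Fin N → Bool) : Set where
      field
        active : ∀ v c → C (v , c) ≡ true → act v ≡ true
        rich   : ∀ v → act v ≡ true → W act v < count (λ c → C (v , c))
    open Rich

    drop : (Fin N → Bool) → Fin N → Fin N → Bool
    drop act u v = act v ∧ not (eqB v u)

    drop-count : ∀ act u {n} → suc n ≤ count act → n ≤ count (drop act u)
    drop-count act u le = ≤-pred (≤-trans le (count-lose u (λ v av ne → ∧-intro av (not-intro (eqB-false ne)))))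

    W-drop : ∀ act u w → act u ≡ true → u ≢ w → W (drop act u) w ℕ.+ wt w u ≤ W act w
    W-drop act u w au ne = ≤-trans (≤-reflexive (cong (W (drop act u) w ℕ.+_) (sym at-u))) (sumF-drop u le zero-u)
      where
      a b : Fin N → ℕ
      a v = if drop act u v ∧ not (eqB v w) then wt w v else 0
      b v = if act v ∧ not (eqB v w) then wt w v else 0
      at-u : b u ≡ wt w u
      at-u rewrite au | eqB-false ne = refl
      zero-u : a u ≡ 0
      zero-u rewrite au | eqB-refl u = refl
      le : ∀ v → a v ≤ b v
      le v with act v | eqB v u | eqB v w
      ... | true  | true  | _     = z≤n
      ... | true  | false | true  = z≤n
      ... | true  | false | false = ≤-refl
      ... | false | _     | _     = z≤n

    -- Rich is inherited by links: the loss of a colour at w is paid for by the weight of the removed vertex.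
    private
      rich-link : ∀ {C act} → Rich C act → ∀ C′ u c → act u ≡ true → (∀ a → C′ a ≡ true → C a ≡ true) →
                  (∀ w → act w ≡ true → w ≢ u → count (λ b → C (w , b)) ≤ count (λ b → link C′ (u , c) (w , b)) ℕ.+ wt w u) →
                  Rich (link C′ (u , c)) (drop act u)
      rich-link {C} {act} R C′ u c au sub loss = record
        { active = λ v b h → let p , cmp = link-elim C′ h in ∧-intro (active R v b (sub _ p)) (not-intro (eqB-false λ e → proj₁ cmp (sym e)))
        ; rich = λ w aw → let aw′ , nu = ∧-true {act w} aw
                              w≢u : w ≢ u
                              w≢u e = true≢false (subst (λ z → eqB w z ≡ true) e (eqB-refl w)) (not-true nu)
                          in +-cancelʳ-≤ (wt w u) _ _ (≤-trans (s≤s (W-drop act u w au (λ e → w≢u (sym e)))) (≤-trans (rich R w aw′) (loss w aw′ w≢u))) }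

    -- Choose an active `v` with an available colour `c₀`. Once all entries incompatible with
    -- `(v , c₀)` are removed, a cone with this apex remains; the links met on the way have one
    -- active vertex fewer and are again rich.
    fill : ∀ n C act → Rich C act → n ≤ count act → ∀ m → m < n → FillAt C m
    fill (suc n) C act R le m lt = go m lt
      where
      v = proj₁ (count-find act (≤-trans (s≤s z≤n) le))
      av : act v ≡ true
      av = proj₂ (count-find act (≤-trans (s≤s z≤n) le))
      found = count-find (λ c → C (v , c)) (≤-trans (s≤s z≤n) (rich R v av))
      c₀ = proj₁ found
      -- The entries incompatible with the apex: neighbours of `v` in colour `c₀`, and `v` in
      -- another colour. The former go away first, so links of the latter also miss them.
      E₁ E₂ : List Entry
      E₁ = List.map (λ u → u , c₀) (List.filter (λ u → conf u v Data.Bool.≟ true) (List.allFin N))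
        where import Data.Bool
      E₂ = List.map (λ c → v , c) (List.filter (λ c → ¬? (c Fin.≟ c₀)) (List.allFin q))
      in-E₁ : ∀ {u} → conf u v ≡ true → (u , c₀) ∈ E₁
      in-E₁ {u} cf = ∈-map⁺ _ (∈-filter⁺ _ (∈-allFin u) cf)
      out-E₁ : ∀ {a} → a ∈ E₁ → proj₂ a ≡ c₀ × conf (proj₁ a) v ≡ true
      out-E₁ m = case ∈-map⁻ _ m of λ { (u , mu , refl) → refl , proj₂ (∈-filter⁻ (λ u → conf u v Data.Bool.≟ true) {xs = List.allFin N} mu) }
        where import Data.Bool
      in-E₂ : ∀ {c} → c ≢ c₀ → (v , c) ∈ E₂
      in-E₂ {c} ne = ∈-map⁺ _ (∈-filter⁺ _ (∈-allFin c) ne)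
      out-E₂ : ∀ {a} → a ∈ E₂ → proj₁ a ≡ v × proj₂ a ≢ c₀
      out-E₂ m = case ∈-map⁻ _ m of λ { (c , mc , refl) → refl , proj₂ (∈-filter⁻ (λ c → ¬? (c Fin.≟ c₀)) {xs = List.allFin q} mc) }
      go : ∀ m → m < suc n → FillAt C m
      go zero    _  = fill₀ C (proj₂ found)
      go (suc m) (s≤s lt) = fill-removeAll E₁ C m stage₁ (fill-removeAll E₂ (C ∖∖ E₁) m stage₂ last)
        where
        ih : ∀ C′ u c → act u ≡ true → Rich (link C′ (u , c)) (drop act u) → FillAt (link C′ (u , c)) m
        ih C′ u c au R′ = fill n (link C′ (u , c)) (drop act u) R′ (drop-count act u le) m lt
        stage₁ : ∀ C′ e → e ∈ E₁ → C′ e ≡ true → (∀ a → C′ a ≡ true → C a ≡ true) → (∀ a → C a ≡ true → C′ a ≡ true ⊎ a ∈ E₁) → FillAt (link C′ e) m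
        stage₁ C′ (u , c) e∈ ce sub cov with out-E₁ e∈
        ... | refl , uv = ih C′ u c au (rich-link R C′ u c au sub loss)
          where
          au : act u ≡ true
          au = active R u c (sub _ ce)
          loss : ∀ w → act w ≡ true → w ≢ u → count (λ b → C (w , b)) ≤ count (λ b → link C′ (u , c) (w , b)) ℕ.+ wt w u
          -- Both possible causes, the link of `(u , c₀)` and earlier removals at neighbours of `v`,
          -- cost `w` the same colour `c₀`. Such a `w` is adjacent to `u` or has the common
          -- neighbour `v` with it, so weight 1 suffices.
          loss w aw w≢u = case bool (conf w u ∨ conf w v) of λ
            { (inj₁ near) → ≤-trans (count-lose c (λ b cb b≢c → link-intro C′ (keepC b cb b≢c) ((λ e → w≢u (sym e)) , λ _ e → b≢c (sym e))))
                (≤-trans (≤-reflexive (ℕₚ.+-comm 1 _)) (+-monoʳ-≤ _ (wt≥1 near)))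
            ; (inj₂ far) → ≤-trans (count-mono λ b cb → link-intro C′ (keepFar far b cb)
                ((λ e → w≢u (sym e)) , λ cf _ → true≢false (∨-introˡ {b = conf w v} (trans (conf-sym w u) cf)) far)) (m≤m+n _ _) }
            where
            keepC : ∀ b → C (w , b) ≡ true → b ≢ c → C′ (w , b) ≡ true
            keepC b cb b≢c = case cov _ cb of λ { (inj₁ h) → h ; (inj₂ h) → ⊥-elim (b≢c (proj₁ (out-E₁ h))) }
            keepFar : conf w u ∨ conf w v ≡ false → ∀ b → C (w , b) ≡ true → C′ (w , b) ≡ true
            keepFar far b cb = case cov _ cb of λ { (inj₁ h) → h ; (inj₂ h) → ⊥-elim (true≢false (∨-introʳ {conf w u} (proj₂ (out-E₁ h))) far) }
            wt≥1 : conf w u ∨ conf w v ≡ true → 1 ≤ wt w u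
            wt≥1 near with ∨-true {conf w u} near
            ... | inj₁ h = ≤-trans (s≤s z≤n) (wt-adj w u h)
            ... | inj₂ h = wt-dist2 w v u h (trans (conf-sym v u) uv) w≢u
        stage₂ : ∀ C′ e → e ∈ E₂ → C′ e ≡ true → (∀ a → C′ a ≡ true → (C ∖∖ E₁) a ≡ true) → (∀ a → (C ∖∖ E₁) a ≡ true → C′ a ≡ true ⊎ a ∈ E₂) → FillAt (link C′ e) m
        stage₂ C′ (u , c) e∈ ce sub cov with out-E₂ e∈
        ... | refl , c≢c₀ = ih C′ v c av (rich-link R C′ v c av (λ a h → proj₁ (∖∖-elim C E₁ (sub a h))) loss)
          where
          loss : ∀ w → act w ≡ true → w ≢ v → count (λ b → C (w , b)) ≤ count (λ b → link C′ (v , c) (w , b)) ℕ.+ wt w v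
          -- A neighbour of `v` loses two colours, `c₀` through the earlier removals and `c` through
          -- the link; this is the origin of the factor 2 for neighbours.
          loss w aw w≢v = case bool (conf w v) of λ
            { (inj₁ near) → ≤-trans (count-lose {g = λ b → C (w , b) ∧ not (eqB b c₀)} c₀ (λ b cb ne → ∧-intro cb (not-intro (eqB-false ne))))
                (≤-trans (s≤s (count-lose c (λ b h b≢c → let cb , nb = ∧-true {C (w , b)} h in
                  link-intro C′ (kept b cb λ { refl → true≢false (eqB-refl b) (not-true nb) }) ((λ e → w≢v (sym e)) , λ _ e → b≢c (sym e)))))
                (≤-trans (≤-reflexive (ℕₚ.+-comm 2 _)) (+-monoʳ-≤ _ (wt-adj w v near))))
            ; (inj₂ far) → ≤-trans (count-mono λ b cb → link-intro C′ (keptFar far b cb)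
                ((λ e → w≢v (sym e)) , λ cf _ → true≢false (trans (conf-sym w v) cf) far)) (m≤m+n _ _) }
            where
            back : ∀ b → C (w , b) ≡ true → ¬ (w , b) ∈ E₁ → C′ (w , b) ≡ true
            back b cb ne = case cov _ (∖∖-intro C E₁ cb ne) of λ { (inj₁ h) → h ; (inj₂ h) → ⊥-elim (w≢v (proj₁ (out-E₂ h))) }
            kept : ∀ b → C (w , b) ≡ true → b ≢ c₀ → C′ (w , b) ≡ true
            kept b cb ne = back b cb (λ h → ne (proj₁ (out-E₁ h)))
            keptFar : conf w v ≡ false → ∀ b → C (w , b) ≡ true → C′ (w , b) ≡ true
            keptFar far b cb = back b cb (λ h → true≢false (proj₂ (out-E₁ h)) far)
        last : FillAt ((C ∖∖ E₁) ∖∖ E₂) (suc m)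
        last = fill-cone _ (v , c₀) m
          (∖∖-intro (C ∖∖ E₁) E₂ (∖∖-intro C E₁ (proj₂ found) (λ h → true≢false (proj₂ (out-E₁ h)) (conf-irr v))) (λ h → proj₂ (out-E₂ h) refl))
          (λ { (w , b) h ne → let h₁ , n₂ = ∖∖-elim (C ∖∖ E₁) E₂ h
                                  _ , n₁ = ∖∖-elim C E₁ h₁ in
               (λ { refl → n₂ (in-E₂ (λ { refl → ne refl })) }) , λ { cf refl → n₁ (in-E₁ (trans (conf-sym w v) cf)) } })

    open Coefficients K using (Carrier; _≈_; NZ; NZ-1; 1#; +-identityʳ; *-identityˡ) renaming (trans to ≈-trans; *-congˡ to ≈-*-congˡ; sym to ≈-sym)
    module _ (TR : Translations p₁ k q) (total : ∀ v → sumF (λ u → if not (eqB u v) then wt v u else 0) < q) where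
      open Translations TR
      open Chains K
      open Cochains (Coefficients.ring K)
      private
        P : ∀ {n} → Vec (Fin N × Fin q) n → Set
        P = Colouring conf
      open Reaching (move {N} g) P
      open Cycles K (move {N} g) (move-comm {g = g} g-comm) (move-period {g = g} (suc p₁) g-period) P
        public

      private
        allRich : Rich (λ _ → true) (λ _ → true)
        allRich = record { active = λ _ _ _ → refl ; rich = λ v _ → ≤-trans (total v) (≤-reflexive (sym (count-full (λ _ → true) (λ _ → refl)))) }

      reach : Fin N → Fin q → ∀ n → n < N → ∃ λ c → Reach n c
      reach v₀ a₀ zero    _  = ((1# , (v₀ , a₀) ∷ []) ∷ []) , (([] ∷ []) ∷ []) , 1# , NZ-1 ,
        λ φ → ≈-trans (+-identityʳ _) (≈-*-congˡ (*-identityˡ _))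
      reach v₀ a₀ (suc n) lt = w , All.map proj₂ wS , c , 1# , NZ-1 , r ,
          λ alt → ≈-trans (we alt) (≈-trans (ev-T (suc n) c _) (≈-sym (*-identityˡ _)))
        where
        prev = reach v₀ a₀ n (ℕₚ.<⇒≤ lt)
        c = proj₁ prev
        r = proj₂ prev
        filled = fill N (λ _ → true) (λ _ → true) allRich (≤-reflexive (sym (count-full (λ _ → true) (λ _ → refl)))) (suc n) lt
          (T-chain (suc n) c) (All.map (λ cl → All.tabulate (λ _ → refl) , cl) (ChainAction.X^-support gV (Colouring-move TR conf) (expo p₁ (suc n)) (Reach⇒Support n r)))
          (reach-cycle n r)
        w = proj₁ filled
        wS = proj₁ (proj₂ filled)
        we = proj₂ (proj₂ filled)

-- Formal power series over the prime field as coefficients.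

module SeriesCoefficients where

  open RingPreliminaries
  open DifferenceOperators
  open Obstructions
  open TranslationLabels
  open import Data.Nat.Primality using (prime⇒nonTrivial)
  open import Data.Integer using (ℤ; +_)
  open import Data.Integer.Divisibility.Signed using (∣ᵤ⇒∣)

  module PowerSeries (S : CommutativeRing 0ℓ 0ℓ) where
    open CommutativeRing S hiding (zero)
    open ℤSolver S
    open import Relation.Binary.Reasoning.Setoid setoid

    Series : Set
    Series = ℕ → Carrier

    infix 4 _≋_
    _≋_ : Series → Series → Set
    f ≋ g = ∀ n → f n ≈ g n

    infixl 7 _⊛_
    _⊛_ : Series → Series → Series
    (f ⊛ g) zero    = f 0 * g 0
    (f ⊛ g) (suc n) = f 0 * g (suc n) + ((f ∘ suc) ⊛ g) n

    unit : Series
    unit zero    = 1#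
    unit (suc n) = 0#

    ⊛-cong : ∀ {f f′ g g′} → f ≋ f′ → g ≋ g′ → (f ⊛ g) ≋ (f′ ⊛ g′)
    ⊛-cong e e′ zero    = *-cong (e 0) (e′ 0)
    ⊛-cong e e′ (suc n) = +-cong (*-cong (e 0) (e′ (suc n))) (⊛-cong (e ∘ suc) e′ n)

    ⊛-distribʳ : ∀ h f g n → ((λ k → f k + g k) ⊛ h) n ≈ (f ⊛ h) n + (g ⊛ h) n
    ⊛-distribʳ h f g zero    = distribʳ _ _ _
    ⊛-distribʳ h f g (suc n) = trans (+-congˡ (⊛-distribʳ h (f ∘ suc) (g ∘ suc) n))
      (solve 5 (λ a b c x y → (a :+ b) :* c :+ (x :+ y) := (a :* c :+ x) :+ (b :* c :+ y)) refl _ _ _ _ _)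

    ⊛-scale : ∀ a f g n → ((λ k → a * f k) ⊛ g) n ≈ a * (f ⊛ g) n
    ⊛-scale a f g zero    = *-assoc _ _ _
    ⊛-scale a f g (suc n) = trans (+-congˡ (⊛-scale a (f ∘ suc) g n)) (solve 4 (λ a b c x → (a :* b) :* c :+ a :* x := a :* (b :* c :+ x)) refl _ _ _ _)

    ⊛-assoc : ∀ f g h n → ((f ⊛ g) ⊛ h) n ≈ (f ⊛ (g ⊛ h)) n
    ⊛-assoc f g h zero    = *-assoc _ _ _
    ⊛-assoc f g h (suc n) = begin
      (f 0 * g 0) * h (suc n) + ((λ k → f 0 * g (suc k) + ((f ∘ suc) ⊛ g) k) ⊛ h) n
        ≈⟨ +-congˡ (trans (⊛-distribʳ h _ _ n) (+-cong (⊛-scale (f 0) (g ∘ suc) h n) (⊛-assoc (f ∘ suc) g h n))) ⟩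
      (f 0 * g 0) * h (suc n) + (f 0 * ((g ∘ suc) ⊛ h) n + ((f ∘ suc) ⊛ (g ⊛ h)) n)
        ≈⟨ solve 5 (λ a b c x y → (a :* b) :* c :+ (a :* x :+ y) := a :* (b :* c :+ x) :+ y) refl _ _ _ _ _ ⟩
      f 0 * (g 0 * h (suc n) + ((g ∘ suc) ⊛ h) n) + ((f ∘ suc) ⊛ (g ⊛ h)) n ∎

    ⊛-unfoldʳ : ∀ f g n → (f ⊛ g) (suc n) ≈ (f ⊛ (g ∘ suc)) n + f (suc n) * g 0
    ⊛-unfoldʳ f g zero    = refl
    ⊛-unfoldʳ f g (suc n) = trans (+-congˡ (⊛-unfoldʳ (f ∘ suc) g n)) (sym (+-assoc _ _ _))

    ⊛-comm : ∀ f g n → (f ⊛ g) n ≈ (g ⊛ f) n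
    ⊛-comm f g zero    = *-comm _ _
    ⊛-comm f g (suc n) = begin
      f 0 * g (suc n) + ((f ∘ suc) ⊛ g) n   ≈⟨ +-cong (*-comm _ _) (⊛-comm (f ∘ suc) g n) ⟩
      g (suc n) * f 0 + (g ⊛ (f ∘ suc)) n   ≈⟨ +-comm _ _ ⟩
      (g ⊛ (f ∘ suc)) n + g (suc n) * f 0   ≈⟨ ⊛-unfoldʳ g f n ⟨
      (g ⊛ f) (suc n)                       ∎

    ⊛-zeroˡ : ∀ f g → (∀ n → f n ≈ 0#) → ∀ n → (f ⊛ g) n ≈ 0#
    ⊛-zeroˡ f g z zero    = trans (*-congʳ (z 0)) (zeroˡ _)
    ⊛-zeroˡ f g z (suc n) = trans (+-cong (trans (*-congʳ (z 0)) (zeroˡ _)) (⊛-zeroˡ (f ∘ suc) g (z ∘ suc) n)) (+-identityˡ 0#)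

    ⊛-constˡ : ∀ f g → (∀ n → f (suc n) ≈ 0#) → ∀ n → (f ⊛ g) n ≈ f 0 * g n
    ⊛-constˡ f g z zero    = refl
    ⊛-constˡ f g z (suc n) = trans (+-congˡ (⊛-zeroˡ (f ∘ suc) g z n)) (+-identityʳ _)

    ⊛-identityˡ : ∀ f n → (unit ⊛ f) n ≈ f n
    ⊛-identityˡ f n = trans (⊛-constˡ unit f (λ _ → refl) n) (*-identityˡ _)

    powerSeries : CommutativeRing 0ℓ 0ℓ
    powerSeries = record
      { Carrier = Series ; _≈_ = _≋_ ; _+_ = λ f g n → f n + g n ; _*_ = _⊛_ ; -_ = λ f n → - f n ; 0# = λ _ → 0# ; 1# = unit
      ; isCommutativeRing = record
        { isRing = record
          { +-isAbelianGroup = record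
            { isGroup = record
              { isMonoid = record
                { isSemigroup = record
                  { isMagma = record
                    { isEquivalence = record { refl = λ _ → refl ; sym = λ e n → sym (e n) ; trans = λ e e′ n → trans (e n) (e′ n) }
                    ; ∙-cong = λ e e′ n → +-cong (e n) (e′ n) }
                  ; assoc = λ _ _ _ _ → +-assoc _ _ _ }
                ; identity = (λ _ _ → +-identityˡ _) , (λ _ _ → +-identityʳ _) }
              ; inverse = (λ _ _ → -‿inverseˡ _) , (λ _ _ → -‿inverseʳ _)
              ; ⁻¹-cong = λ e n → -‿cong (e n) }
            ; comm = λ _ _ _ → +-comm _ _ }
          ; *-cong = ⊛-cong
          ; *-assoc = ⊛-assoc
          ; *-identity = ⊛-identityˡ , λ f n → trans (⊛-comm f unit n) (⊛-identityˡ f n)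
          ; distrib = (λ f g h n → trans (⊛-comm f _ n) (trans (⊛-distribʳ f g h n) (+-cong (⊛-comm g f n) (⊛-comm h f n)))) , ⊛-distribʳ }
        ; *-comm = ⊛-comm } }

  module _ {p₁ : ℕ} (pr : Prime (suc p₁)) where
    open Residues p₁
    open PowerSeries ℤ/p
    private
      module P = CommutativeRing powerSeries
      module Z = CommutativeRing ℤ/p
      module PM = Mult P.semiring
      module ZM = Mult Z.semiring

    -- the first non-zero coefficient is a unit
    data Lead : Series → Set where
      here  : ∀ {f} → ¬ f 0 ≈ 0ℤ → Lead f
      there : ∀ {f} → f 0 ≈ 0ℤ → Lead (f ∘ suc) → Lead f

    private
      ≈0⇒∣ : ∀ {a} → a ≈ 0ℤ → (+ suc p₁) Data.Integer.Divisibility.Signed.∣ a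
      ≈0⇒∣ {a} (mod h) = ≡.subst ((+ suc p₁) Data.Integer.Divisibility.Signed.∣_) (ℤₚ.+-identityʳ a) h

      ∣⇒≈0 : ∀ {a} → (+ suc p₁) Data.Integer.Divisibility.Signed.∣ a → a ≈ 0ℤ
      ∣⇒≈0 {a} h = mod (≡.subst ((+ suc p₁) Data.Integer.Divisibility.Signed.∣_) (≡.sym (ℤₚ.+-identityʳ a)) h)

      domain : ∀ {a b} → ¬ a ≈ 0ℤ → ¬ b ≈ 0ℤ → ¬ (a ℤ.* b) ≈ 0ℤ
      domain {a} {b} na nb h with euclidsLemma ℤ.∣ a ∣ ℤ.∣ b ∣ pr (≡.subst (suc p₁ Data.Nat.Divisibility.∣_) (ℤₚ.abs-* a b) (∣⇒∣ᵤ (≈0⇒∣ h)))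
        where import Data.Nat.Divisibility
      ... | inj₁ d = na (∣⇒≈0 (∣ᵤ⇒∣ d))
      ... | inj₂ d = nb (∣⇒≈0 (∣ᵤ⇒∣ d))

      Lead-≋ : ∀ {f g} → f ≋ g → Lead f → Lead g
      Lead-≋ e (here nz)    = here (λ z → nz (≈-trans (e 0) z))
      Lead-≋ e (there z ld) = there (≈-trans (≈-sym (e 0)) z) (Lead-≋ (e ∘ suc) ld)

      *≈0ʳ : ∀ a b → b ≈ 0ℤ → (a ℤ.* b) ≈ 0ℤ
      *≈0ʳ a b z = ≈-trans (*-cong′ {a} {a} {b} {0ℤ} (≡⇒≈ ≡.refl) z) (≡⇒≈ (ℤₚ.*-zeroʳ a))

      *≈0ˡ : ∀ a b → a ≈ 0ℤ → (a ℤ.* b) ≈ 0ℤ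
      *≈0ˡ a b z = ≈-trans (*-cong′ {a} {0ℤ} {b} {b} z (≡⇒≈ ≡.refl)) (≡⇒≈ (ℤₚ.*-zeroˡ b))

      +≈0ʳ : ∀ a b → b ≈ 0ℤ → (a ℤ.+ b) ≈ a
      +≈0ʳ a b z = ≈-trans (+-cong′ {a} {a} {b} {0ℤ} (≡⇒≈ ≡.refl) z) (≡⇒≈ (ℤₚ.+-identityʳ a))

      +≈0ˡ : ∀ a b → a ≈ 0ℤ → (a ℤ.+ b) ≈ b
      +≈0ˡ a b z = ≈-trans (+-cong′ {a} {0ℤ} {b} {b} z (≡⇒≈ ≡.refl)) (≡⇒≈ (ℤₚ.+-identityˡ b))

      -- Leading coefficients multiply, and their product is non-zero by Euclid's lemma.
      Lead-* : ∀ {f g} → Lead f → Lead g → Lead (f ⊛ g)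
      Lead-*ʳ : ∀ {f g} → ¬ f 0 ≈ 0ℤ → Lead g → Lead (f ⊛ g)
      Lead-*ʳ nf (here ng) = here (domain nf ng)
      Lead-*ʳ {f} {g} nf (there z ld) = there (*≈0ʳ (f 0) (g 0) z)
        (Lead-≋ (λ n → ≈-sym (≈-trans (⊛-unfoldʳ f g n) (+≈0ʳ _ _ (*≈0ʳ (f (suc n)) (g 0) z)))) (Lead-*ʳ {f} {g ∘ suc} nf ld))
      Lead-* (here nf) lg = Lead-*ʳ nf lg
      Lead-* {f} {g} (there z lf) lg = there (*≈0ˡ (f 0) (g 0) z)
        (Lead-≋ (λ n → ≈-sym (+≈0ˡ _ _ (*≈0ˡ (f 0) (g (suc n)) z))) (Lead-* {f ∘ suc} {g} lf lg))

      Lead⇒≉0 : ∀ {f} → Lead f → ¬ f ≋ (λ _ → 0ℤ)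
      Lead⇒≉0 (here nz)    e = nz (e 0)
      Lead⇒≉0 (there _ ld) e = Lead⇒≉0 ld (e ∘ suc)

      ⊠-at : ∀ n f k → (n PM.× f) k ≡ n ZM.× f k
      ⊠-at zero    f k = ≡.refl
      ⊠-at (suc n) f k = ≡.cong (λ z → f k ℤ.+ z) (⊠-at n f k)

      ⊠1-0 : ∀ n → (n PM.× unit) 0 ≡ + n
      ⊠1-0 n = ≡.trans (⊠-at n unit 0) (≡.trans (⊠-* n 1ℤ) (ℤₚ.*-identityʳ (+ n)))

      ⊠1-suc : ∀ n k → (n PM.× unit) (suc k) ≡ 0ℤ
      ⊠1-suc n k = ≡.trans (⊠-at n unit (suc k)) (≡.trans (⊠-* n 0ℤ) (ℤₚ.*-zeroʳ (+ n)))

      2≤p : 2 ℕ.≤ suc p₁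
      2≤p = ℕ.nonTrivial⇒n>1 (suc p₁) {{prime⇒nonTrivial pr}}

      pos≉0 : ∀ j → 0 ℕ.< j → j ℕ.< suc p₁ → ¬ (+ j) ≈ 0ℤ
      pos≉0 (suc j) _ lt h = case ≈-unique lt (s≤s z≤n) h of λ ()

      -- The monomial `t^i`.
      tᵢ : ∀ {k} → Fin k → Series
      tᵢ i n = if n ≡ᵇ toℕ i then 1ℤ else 0ℤ

      term : ∀ {k} (i : Fin k) a n → (tᵢ i ⊛ (a PM.× unit)) n ≈ tᵢ i n ℤ.* + a
      term i a n = Z.trans (⊛-comm (tᵢ i) (a PM.× unit) n) (Z.trans (⊛-constˡ (a PM.× unit) (tᵢ i) (λ n → ≡⇒≈ (⊠1-suc a n)) n)
        (≡⇒≈ (≡.trans (≡.cong (ℤ._* tᵢ i n) (⊠1-0 a)) (ℤₚ.*-comm (+ a) (tᵢ i n)))))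

    -- Distinct monomials are independent over the prime field for every `k`, so no irreducible
    -- polynomial has to be found.
    coefficients : ∀ k → Coefficients p₁ k
    coefficients k = record
      { ring = powerSeries
      ; isPrime = pr
      ; char = λ f n → ≈-trans (≡⇒≈ (⊠-at (suc p₁) f n)) (ℤ/p-char (f n))
      ; ω = tᵢ
      ; ω₀ = λ i e → λ { zero → ≡⇒≈ (≡.cong (λ z → if 0 ≡ᵇ z then 1ℤ else 0ℤ) e) ; (suc n) → ≡⇒≈ (≡.cong (λ z → if suc n ≡ᵇ z then 1ℤ else 0ℤ) e) }
      ; NZ = Lead
      ; NZ⇒≉0 = Lead⇒≉0
      ; NZ-≈ = Lead-≋
      ; NZ-* = Lead-*
      ; NZ-1 = here (pos≉0 1 (s≤s z≤n) 2≤p)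
      ; NZ-ℕ = λ j 0<j j<p → here (λ h → pos≉0 j 0<j j<p (≈-trans (≡⇒≈ (≡.sym (⊠1-0 j))) h))
      ; NZ-ω = λ χ χ≢0 → lead k χ _ (coef χ) χ≢0 }
      where
      open FiniteSum powerSeries using (sumR)
      lead : ∀ k (χ : Vec (Fin (suc p₁)) k) F → (∀ i → F (toℕ i) ≈ ι (lookup χ i)) → χ ≢ zeros → Lead F
      lead zero    []      F e χ≢0 = ⊥-elim (χ≢0 ≡.refl)
      lead (suc k) (a ∷ χ) F e χ≢0 with a Fin.≟ zero
      ... | yes ≡.refl = there (e zero) (lead k χ (F ∘ suc) (e ∘ suc) (λ z → χ≢0 (≡.cong (zero ∷_) z)))
      ... | no a≢0 = here (λ z → a≢0 (ι-injective (≈-trans (≈-sym (e zero)) z)))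
      tail-0 : ∀ {k} (t : Fin k → Series) (χ : Vec (Fin (suc p₁)) k) n → (∀ i → t i n ≈ 0ℤ) →
               (∀ i a → (t i ⊛ (a PM.× unit)) n ≈ t i n ℤ.* + a) → sumR (λ i → t i ⊛ (toℕ (lookup χ i) PM.× unit)) n ≈ 0ℤ
      tail-0 {zero}  t χ n z tm = ≡⇒≈ ≡.refl
      tail-0 {suc k} t (a ∷ χ) n z tm = Z.trans (Z.+-cong (Z.trans (tm zero (toℕ a)) (Z.trans (Z.*-congʳ (z zero)) (Z.zeroˡ (+ toℕ a)))) (tail-0 (t ∘ suc) χ n (z ∘ suc) (tm ∘ suc))) (Z.+-identityˡ 0ℤ)
      pick : ∀ {k} (t : Fin k → Series) (χ : Vec (Fin (suc p₁)) k) n i → (∀ j a → (t j ⊛ (a PM.× unit)) n ≈ t j n ℤ.* + a) →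
             t i n ≈ 1ℤ → (∀ j → j ≢ i → t j n ≈ 0ℤ) → sumR (λ i → t i ⊛ (toℕ (lookup χ i) PM.× unit)) n ≈ ι (lookup χ i)
      pick t (a ∷ χ) n zero tm o z = Z.trans (Z.+-cong (Z.trans (tm zero (toℕ a)) (Z.trans (Z.*-congʳ o) (Z.*-identityˡ (+ toℕ a))))
        (tail-0 (t ∘ suc) χ n (λ j → z (suc j) (λ ())) (tm ∘ suc))) (Z.+-identityʳ (+ toℕ a))
      pick t (a ∷ χ) n (suc i) tm o z = Z.trans (Z.+-cong (Z.trans (tm zero (toℕ a)) (Z.trans (Z.*-congʳ (z zero (λ ()))) (Z.zeroˡ (+ toℕ a))))
        (pick (t ∘ suc) χ n i (tm ∘ suc) o (λ j j≢i → z (suc j) (j≢i ∘ Finₚ.suc-injective)))) (Z.+-identityˡ (ι (lookup χ i)))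
      refl-≡ᵇ : ∀ n → (n ≡ᵇ n) ≡ true
      refl-≡ᵇ zero    = ≡.refl
      refl-≡ᵇ (suc n) = refl-≡ᵇ n
      ≢-≡ᵇ : ∀ m n → m ≢ n → (m ≡ᵇ n) ≡ false
      ≢-≡ᵇ zero    zero    h = ⊥-elim (h ≡.refl)
      ≢-≡ᵇ zero    (suc n) h = ≡.refl
      ≢-≡ᵇ (suc m) zero    h = ≡.refl
      ≢-≡ᵇ (suc m) (suc n) h = ≢-≡ᵇ m n (h ∘ ≡.cong suc)
      -- The combination is the polynomial with coefficient vector `χ`, so a non-zero `χ` provides a
      -- leading term.
      coef : ∀ (χ : Vec (Fin (suc p₁)) k) i → sumR (λ i → tᵢ i ⊛ (toℕ (lookup χ i) PM.× unit)) (toℕ i) ≈ ι (lookup χ i)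
      coef χ i = pick tᵢ χ (toℕ i) i (λ j a → term j a (toℕ i)) (≡⇒≈ (≡.cong (λ b → if b then 1ℤ else 0ℤ) (refl-≡ᵇ (toℕ i))))
        (λ j j≢i → ≡⇒≈ (≡.cong (λ b → if b then 1ℤ else 0ℤ) (≢-≡ᵇ (toℕ i) (toℕ j) (λ e → j≢i (Finₚ.toℕ-injective (≡.sym e))))))

-- Sums over rook placements and their boundary.

module RookPlacements where

  open import Defs hiding (sym)
  open RingPreliminaries
  open OperatorAlgebra
  open AlternatingCochains
  open Obstructions
  open ChainPairings
  open Counting
  open TranslationLabels
  open Colourings
  open ChainFilling
  open import Data.List.Membership.Propositional using (_∈_)

  module _ {A : Set} where

    selects : List A → List (A × List A)
    selects []       = []
    selects (x ∷ xs) = (x , xs) ∷ List.map (λ (y , ys) → y , x ∷ ys) (selects xs)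

    selects-length : ∀ xs {y ys} → (y , ys) ∈ selects xs → suc (length ys) ≡ length xs
    selects-length (x ∷ xs) (here ≡.refl) = ≡.refl
    selects-length (x ∷ xs) (there m) with ∈-map⁻ _ m
      where open import Data.List.Membership.Propositional.Properties using (∈-map⁻)
    ... | (y , ys) , m′ , ≡.refl = ≡.cong suc (selects-length xs m′)

    selects-∈ : ∀ xs {y ys} → (y , ys) ∈ selects xs → y ∈ xs × (∀ {z} → z ∈ ys → z ∈ xs)
    selects-∈ (x ∷ xs) (here ≡.refl) = here ≡.refl , there
    selects-∈ (x ∷ xs) (there m) with ∈-map⁻ _ m
      where open import Data.List.Membership.Propositional.Properties using (∈-map⁻)
    ... | (y , ys) , m′ , ≡.refl = let p , q = selects-∈ xs m′ in there p , λ { (here e) → here e ; (there z) → there (q z) }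

    selects-Unique : ∀ xs {y ys} → AllPairs _≢_ xs → (y , ys) ∈ selects xs → AllPairs _≢_ ys × All (y ≢_) ys
    selects-Unique (x ∷ xs) (p ∷ ps) (here ≡.refl) = ps , p
    selects-Unique (x ∷ xs) (p ∷ ps) (there m) with ∈-map⁻ _ m
      where open import Data.List.Membership.Propositional.Properties using (∈-map⁻)
    ... | (y , ys) , m′ , ≡.refl = let u , n = selects-Unique xs ps m′
                                       y∈ , inc = selects-∈ xs m′ in
      (All.tabulate (λ z∈ → All.lookup p (inc z∈)) ∷ u) , ((λ e → All.lookup p y∈ (≡.sym e)) ∷ n)

  module Spread {p₁ k : ℕ} (K : Coefficients p₁ k) {N q : ℕ} where
    open Coefficients K
    open Cochains ring
    open Chains K
    open ℤSolver ring
    open Mult semiring using (×-homo-+) renaming (_×_ to _⊠_)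
    open import Relation.Binary.Reasoning.Setoid setoid
    open import Algebra.Properties.Ring (CommutativeRing.ring ring) using (-0#≈0#)
    open import Algebra.Properties.AbelianGroup +-abelianGroup using (⁻¹-∙-comm)

    -- The trivial component lets colours serve as entries of a colouring problem without conflicts,
    -- whose simplices are the sets of distinct colours; the filling results then apply to columns
    -- too.
    Colour Entry : Set
    Colour = Fin q × Fin 1
    Entry  = Fin N × Fin q

    ∑ : ∀ {B : Set} → List B → (B → Carrier) → Carrier
    ∑ []       f = 0#
    ∑ (x ∷ xs) f = f x + ∑ xs f

    ∑-local : ∀ {B : Set} (xs : List B) {f h} → (∀ x → x ∈ xs → f x ≈ h x) → ∑ xs f ≈ ∑ xs h
    ∑-local []       e = refl
    ∑-local (x ∷ xs) e = +-cong (e x (here ≡.refl)) (∑-local xs (λ z m → e z (there m)))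

    ∑-cong : ∀ {B : Set} (xs : List B) {f h} → (∀ x → f x ≈ h x) → ∑ xs f ≈ ∑ xs h
    ∑-cong xs e = ∑-local xs (λ x _ → e x)

    ∑-map : ∀ {B B′ : Set} (m : B → B′) xs f → ∑ (List.map m xs) f ≈ ∑ xs (f ∘ m)
    ∑-map m []       f = refl
    ∑-map m (x ∷ xs) f = +-congˡ (∑-map m xs f)

    ∑-+ : ∀ {B : Set} (xs : List B) f h → ∑ xs (λ x → f x + h x) ≈ ∑ xs f + ∑ xs h
    ∑-+ []       f h = sym (+-identityˡ 0#)
    ∑-+ (x ∷ xs) f h = trans (+-congˡ (∑-+ xs f h)) (solve 4 (λ a b c d → (a :+ b) :+ (c :+ d) := (a :+ c) :+ (b :+ d)) refl _ _ _ _)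

    ∑-* : ∀ {B : Set} (xs : List B) r f → ∑ xs (λ x → r * f x) ≈ r * ∑ xs f
    ∑-* []       r f = sym (zeroʳ r)
    ∑-* (x ∷ xs) r f = trans (+-congˡ (∑-* xs r f)) (sym (distribˡ _ _ _))

    ∑-neg : ∀ {B : Set} (xs : List B) f → ∑ xs (λ x → - f x) ≈ - ∑ xs f
    ∑-neg []       f = sym -0#≈0#
    ∑-neg (x ∷ xs) f = trans (+-congˡ (∑-neg xs f)) (⁻¹-∙-comm _ _)

    ∑-const : ∀ {B : Set} (xs : List B) r → ∑ xs (λ _ → r) ≈ (length xs ⊠ 1#) * r
    ∑-const []       r = sym (zeroˡ r)
    ∑-const (x ∷ xs) r = trans (+-cong (sym (*-identityˡ r)) (∑-const xs r)) (sym (distribʳ r 1# _))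

    d-∑ : ∀ {B A : Set} (xs : List B) {n} (φ : B → Vec A n → Carrier) l → d (λ m → ∑ xs (λ x → φ x m)) l ≈ ∑ xs (λ x → d (φ x) l)
    d-∑ []       φ l = δ-0 _ l (λ _ _ → refl)
    d-∑ (x ∷ xs) φ l = trans (δ-+ _ (φ x) _ l) (+-congˡ (d-∑ xs φ l))

    -- Selecting twice runs through the ordered pairs of different positions, a symmetric set, and
    -- the remainder does not depend on the order of the pair.
    ∑-swap : ∀ {B : Set} (xs : List B) (F : B → B → List B → Carrier) →
             ∑ (selects xs) (λ (r , ys) → ∑ (selects ys) (λ (r′ , zs) → F r r′ zs)) ≈
             ∑ (selects xs) (λ (r , ys) → ∑ (selects ys) (λ (r′ , zs) → F r′ r zs))
    ∑-swap []       F = refl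
    ∑-swap (x ∷ xs) F = begin
      P F + ∑ (List.map (λ (y , ys) → y , x ∷ ys) (selects xs)) (λ (r , ys) → ∑ (selects ys) (λ (r′ , zs) → F r r′ zs))
        ≈⟨ +-congˡ (unfold F) ⟩
      P F + (P F′ + rest F)
        ≈⟨ +-congˡ (+-congˡ (∑-swap xs (λ y z zs → F y z (x ∷ zs)))) ⟩
      P F + (P F′ + rest F′)
        ≈⟨ solve 3 (λ a b c → a :+ (b :+ c) := b :+ (a :+ c)) refl _ _ _ ⟩
      P F′ + (P F + rest F′)
        ≈⟨ +-congˡ (unfold F′) ⟨
      P F′ + ∑ (List.map (λ (y , ys) → y , x ∷ ys) (selects xs)) (λ (r , ys) → ∑ (selects ys) (λ (r′ , zs) → F r′ r zs)) ∎
      where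
      F′ : _ → _ → _ → Carrier
      F′ r r′ zs = F r′ r zs
      P : (_ → _ → _ → Carrier) → Carrier
      P F = ∑ (selects xs) (λ (r′ , zs) → F x r′ zs)
      rest : (_ → _ → _ → Carrier) → Carrier
      rest F = ∑ (selects xs) (λ (y , ys) → ∑ (selects ys) (λ (z , zs) → F y z (x ∷ zs)))
      unfold : ∀ F → ∑ (List.map (λ (y , ys) → y , x ∷ ys) (selects xs)) (λ (r , ys) → ∑ (selects ys) (λ (r′ , zs) → F r r′ zs)) ≈
               ∑ (selects xs) (λ (r′ , zs) → F r′ x zs) + rest F
      unfold F = trans (∑-map _ (selects xs) _) (trans (∑-cong (selects xs) (λ (y , ys) → +-congˡ (∑-map _ (selects ys) _))) (∑-+ (selects xs) _ _))

    -- Sum over all injective assignments of the vertices in S to a list of colours.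
    Sp : List (Fin N) → ∀ {n} → (Vec Entry n → Carrier) → Vec Colour n → Carrier
    Sp S φ []            = φ []
    Sp S φ ((c , _) ∷ l) = ∑ (selects S) (λ (r , S′) → Sp S′ (φ ∘ ((r , c) ∷_)) l)

    Sp-cong : ∀ S {n} {φ ψ : Vec Entry n → Carrier} → (∀ v → φ v ≈ ψ v) → ∀ l → Sp S φ l ≈ Sp S ψ l
    Sp-cong S e []            = e []
    Sp-cong S e ((c , _) ∷ l) = ∑-cong (selects S) (λ (r , S′) → Sp-cong S′ (λ v → e _) l)

    Sp-+ : ∀ S {n} (φ ψ : Vec Entry n → Carrier) l → Sp S (λ v → φ v + ψ v) l ≈ Sp S φ l + Sp S ψ l
    Sp-+ S φ ψ []            = refl
    Sp-+ S φ ψ ((c , _) ∷ l) = trans (∑-cong (selects S) (λ (r , S′) → Sp-+ S′ _ _ l)) (∑-+ (selects S) _ _)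

    Sp-* : ∀ S {n} a (φ : Vec Entry n → Carrier) l → Sp S (λ v → a * φ v) l ≈ a * Sp S φ l
    Sp-* S a φ []            = refl
    Sp-* S a φ ((c , _) ∷ l) = trans (∑-cong (selects S) (λ (r , S′) → Sp-* S′ a _ l)) (∑-* (selects S) a _)

    Sp-neg : ∀ S {n} (φ : Vec Entry n → Carrier) l → Sp S (λ v → - φ v) l ≈ - Sp S φ l
    Sp-neg S φ []            = refl
    Sp-neg S φ ((c , _) ∷ l) = trans (∑-cong (selects S) (λ (r , S′) → Sp-neg S′ _ l)) (∑-neg (selects S) _)

    Sp-move : ∀ (h : Fin q → Fin q) S {n} (φ : Vec Entry n → Carrier) l →
              Sp S (φ ∘ Vec.map (λ (v , a) → v , h a)) l ≈ Sp S φ (Vec.map (λ (c , z) → h c , z) l)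
    Sp-move h S φ []            = refl
    Sp-move h S φ ((c , _) ∷ l) = ∑-cong (selects S) (λ (r , S′) → Sp-move h S′ _ l)

    Sp-Alt : ∀ S {n} {φ : Vec Entry n → Carrier} → Alt φ → Alt (Sp S φ)
    Sp-Alt S {φ = φ} alt {(a , _) ∷ (b , _) ∷ v} here = begin
      ∑ (selects S) (λ (r , S₁) → ∑ (selects S₁) (λ (r′ , S₂) → Sp S₂ (λ m → φ ((r , b) ∷ (r′ , a) ∷ m)) v))
        ≈⟨ ∑-swap S (λ r r′ S₂ → Sp S₂ (λ m → φ ((r , b) ∷ (r′ , a) ∷ m)) v) ⟩
      ∑ (selects S) (λ (r , S₁) → ∑ (selects S₁) (λ (r′ , S₂) → Sp S₂ (λ m → φ ((r′ , b) ∷ (r , a) ∷ m)) v))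
        ≈⟨ ∑-cong (selects S) (λ (r , S₁) → trans (∑-cong (selects S₁) (λ (r′ , S₂) → trans (Sp-cong S₂ (λ m → alt (here {v = m})) v) (Sp-neg S₂ _ v))) (∑-neg (selects S₁) _)) ⟩
      ∑ (selects S) (λ (r , S₁) → - ∑ (selects S₁) (λ (r′ , S₂) → Sp S₂ (λ m → φ ((r , a) ∷ (r′ , b) ∷ m)) v))
        ≈⟨ ∑-neg (selects S) _ ⟩
      - ∑ (selects S) (λ (r , S₁) → ∑ (selects S₁) (λ (r′ , S₂) → Sp S₂ (λ m → φ ((r , a) ∷ (r′ , b) ∷ m)) v)) ∎
    Sp-Alt S alt (there {a = c , _} s) = trans (∑-cong (selects S) (λ (r , S′) → Sp-Alt S′ (Alt-∷ (r , c) alt) s)) (∑-neg (selects S) _)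

    -- A placement on `n` columns arises once for every row that it leaves free, and there are `t`
    -- of these.
    Sp-remove : ∀ S {n} t (φ : Vec Entry n → Carrier) l → length S ≡ n ℕ.+ t → ∑ (selects S) (λ (r , S′) → Sp S′ φ l) ≈ (t ⊠ 1#) * Sp S φ l
    Sp-remove S t φ [] e = trans (∑-const (selects S) (φ [])) (*-congʳ (reflexive (≡.cong (_⊠ 1#) (≡.trans (selects-count S) e))))
      where
      selects-count : ∀ S → length (selects S) ≡ length S
      selects-count []      = ≡.refl
      selects-count (x ∷ S) = ≡.cong suc (≡.trans (length-map _ (selects S)) (selects-count S))
        where open import Data.List.Properties using (length-map)
    Sp-remove S t φ ((c , z) ∷ l) e = begin
      ∑ (selects S) (λ (r , S₁) → ∑ (selects S₁) (λ (r′ , S₂) → Sp S₂ (φ ∘ ((r′ , c) ∷_)) l))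
        ≈⟨ ∑-swap S (λ r r′ S₂ → Sp S₂ (φ ∘ ((r′ , c) ∷_)) l) ⟩
      ∑ (selects S) (λ (r , S₁) → ∑ (selects S₁) (λ (r′ , S₂) → Sp S₂ (φ ∘ ((r , c) ∷_)) l))
        ≈⟨ ∑-local (selects S) (λ (r , S₁) m → Sp-remove S₁ t (φ ∘ ((r , c) ∷_)) l (ℕₚ.suc-injective (≡.trans (selects-length S m) e))) ⟩
      ∑ (selects S) (λ (r , S₁) → (t ⊠ 1#) * Sp S₁ (φ ∘ ((r , c) ∷_)) l)
        ≈⟨ ∑-* (selects S) _ _ ⟩
      (t ⊠ 1#) * Sp S φ ((c , z) ∷ l) ∎

    -- Deleting a column from a placement forgets the row used there, which could have been any of
    -- the `t` rows left free by the others.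
    Sp-d : ∀ S {n} t (φ : Vec Entry n → Carrier) l → length S ≡ n ℕ.+ t → Sp S (d φ) l ≈ (t ⊠ 1#) * d (Sp S φ) l
    Sp-d S {zero} t φ ((c , z) ∷ []) e = trans (Sp-remove S t (λ _ → 1# * φ []) [] e) refl
    Sp-d S {suc n} t φ ((c , z) ∷ l) e = begin
      ∑ (selects S) (λ (r , S′) → Sp S′ (λ m → 1# * φ m - d (φ ∘ ((r , c) ∷_)) m) l)
        ≈⟨ ∑-local (selects S) (λ (r , S′) m → trans (Sp-+ S′ _ _ l) (+-cong (trans (Sp-* S′ 1# φ l) (*-identityˡ _))
             (trans (Sp-neg S′ _ l) (-‿cong (Sp-d S′ t (φ ∘ ((r , c) ∷_)) l (ℕₚ.suc-injective (≡.trans (selects-length S m) e))))))) ⟩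
      ∑ (selects S) (λ (r , S′) → Sp S′ φ l + - ((t ⊠ 1#) * d (Sp S′ (φ ∘ ((r , c) ∷_))) l))
        ≈⟨ trans (∑-+ (selects S) _ _) (+-cong (Sp-remove S t φ l e) (trans (∑-neg (selects S) _) (-‿cong (trans (∑-* (selects S) _ _) (*-congˡ (sym (d-∑ (selects S) _ l))))))) ⟩
      (t ⊠ 1#) * Sp S φ l - (t ⊠ 1#) * d (λ m → Sp S φ ((c , z) ∷ m)) l
        ≈⟨ solve 3 (λ t a b → t :* a :- t :* b := t :* (a :- b)) refl _ _ _ ⟩
      (t ⊠ 1#) * (Sp S φ l - d (λ m → Sp S φ ((c , z) ∷ m)) l)
        ≈⟨ *-congˡ (+-congʳ (*-identityˡ _)) ⟨
      (t ⊠ 1#) * d (Sp S φ) ((c , z) ∷ l) ∎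

    spread : List (Fin N) → ∀ {n} → Vec Colour n → Chain (Vec Entry n)
    spread S []            = (1# , []) ∷ []
    spread S ((c , _) ∷ l) = List.concatMap (λ (r , S′) → push ((r , c) ∷_) (spread S′ l)) (selects S)

    ev-concatMap : ∀ {B B′ : Set} (f : B → Chain B′) xs φ → ev (List.concatMap f xs) φ ≈ ∑ xs (λ x → ev (f x) φ)
    ev-concatMap f []       φ = refl
    ev-concatMap f (x ∷ xs) φ = trans (ev-++ (f x) _ φ) (+-congˡ (ev-concatMap f xs φ))

    ev-spread : ∀ S {n} (l : Vec Colour n) φ → ev (spread S l) φ ≈ Sp S φ l
    ev-spread S []            φ = trans (+-identityʳ _) (*-identityˡ _)
    ev-spread S ((c , _) ∷ l) φ = trans (ev-concatMap (λ (r , S′) → push ((r , c) ∷_) (spread S′ l)) (selects S) φ)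
      (∑-cong (selects S) (λ (r , S′) → trans (ev-push _ (spread S′ l) φ) (ev-spread S′ l _)))

    concatMap-support : ∀ {B B′ : Set} {P : B′ → Set} {f : B → Chain B′} xs → (∀ x → x ∈ xs → Support P (f x)) → Support P (List.concatMap f xs)
    concatMap-support []       h = []
    concatMap-support (x ∷ xs) h = ++-support (h x (here ≡.refl)) (concatMap-support xs (λ z m → h z (there m)))

    spread-support : ∀ (conf : Fin N → Fin N → Bool) S → AllPairs _≢_ S → ∀ {n} (l : Vec Colour n) → Colouring (λ _ _ → false) l →
                     Support (λ l′ → Colouring conf l′ × All (λ a → proj₁ a ∈ S) (toList l′) × All (λ a → Σ (Fin 1) λ z → (proj₂ a , z) ∈ toList l) (toList l′)) (spread S l)
    spread-support conf S us []            _        = ([] , [] , []) ∷ []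
    spread-support conf S us ((c , z) ∷ l) (p ∷ ps) = concatMap-support (selects S) λ (r , S′) m →
      let r∈ , inc = selects-∈ S m
          us′ , r∉ = selects-Unique S us m
      in push-support ((r , c) ∷_) (λ l′ (cl , inS , inl) →
           (All.tabulate (λ a∈ → (All.lookup r∉ (All.lookup inS a∈)) ,
              λ _ e → proj₁ (All.lookup p (proj₂ (All.lookup inl a∈))) e) ∷ cl) ,
           (r∈ ∷ All.map inc inS) , ((z , here ≡.refl) ∷ All.map (λ (z′ , m′) → z′ , there m′) inl))
         (spread-support conf S′ us′ l ps)

-- Cliques of size p - 1: invariant cycles and joins.

module CliqueJoins where

  open import Defs hiding (sym)
  open RingPreliminaries
  open OperatorAlgebra
  open DifferenceOperators
  open AlternatingCochains
  open Obstructions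
  open ChainPairings
  open Counting
  open TranslationLabels
  open Colourings
  open ChainFilling
  open RookPlacements
  open ℕ∣ using (_∣_; ∣m∣n⇒∣m+n; ∣-refl)
  open import Data.Nat.Primality using (prime⇒irreducible)
  open import Data.List.Membership.Propositional using (_∈_)
  open import Data.List.Membership.Propositional.Properties using (∈-++⁺ˡ; ∈-++⁺ʳ; ∈-++⁻; ∈-allFin)
  open import Data.List.Membership.Propositional.Properties.WithK using (unique∧set⇒bag)
  open import Data.List.Relation.Binary.BagAndSetEquality using (∼bag⇒↭)
  open import Data.List.Relation.Binary.Permutation.Propositional.Properties using (↭-length)
  open import Function using (mk⇔)

  -- For odd `p` the shift `p - 1` is even and respects the alternation; for `p = 2` both exponents
  -- are 1.
  expo-shift : ∀ {p₁} → Prime (suc p₁) → ∀ n → expo p₁ (n ℕ.+ p₁) ≡ expo p₁ n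
  expo-shift {p₁} pr n = case parity p₁ of λ
      { (inj₁ h) → h n
      ; (inj₂ even) → case prime⇒irreducible pr even of λ
          { (inj₁ ()) ; (inj₂ ≡.refl) → ≡.trans (always1 (n ℕ.+ 1)) (≡.sym (always1 n)) } }
    where
    parity : ∀ m → (∀ n → expo p₁ (n ℕ.+ m) ≡ expo p₁ n) ⊎ 2 ∣ suc m
    parity zero          = inj₁ λ n → ≡.cong (expo p₁) (ℕₚ.+-identityʳ n)
    parity (suc zero)    = inj₂ ∣-refl
    parity (suc (suc m)) = case parity m of λ
      { (inj₁ h) → inj₁ λ n → ≡.trans (≡.cong (expo p₁) (≡.trans (ℕₚ.+-suc n (suc m)) (≡.cong suc (ℕₚ.+-suc n m)))) (h n)
      ; (inj₂ h) → inj₂ (∣m∣n⇒∣m+n ∣-refl h) }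
    always1 : ∀ n → expo 1 n ≡ 1
    always1 zero          = ≡.refl
    always1 (suc zero)    = ≡.refl
    always1 (suc (suc n)) = always1 n

  length-filter : ∀ {A : Set} {n} (f : A → Bool) (h : Fin n → A) → length (List.filter (λ v → f v Bool.≟ true) (List.tabulate h)) ≡ count (f ∘ h)
  length-filter {n = zero}  f h = ≡.refl
  length-filter {n = suc n} f h with f (h zero)
  ... | true  = ≡.cong suc (length-filter f (h ∘ suc))
  ... | false = length-filter f (h ∘ suc)

  enumeration-length : ∀ {N} (L : List (Fin N)) → AllPairs _≢_ L → (∀ v → v ∈ L) → length L ≡ N
  enumeration-length {N} L u c = ≡.trans (↭-length (∼bag⇒↭ (unique∧set⇒bag u (Uniqueₚ.allFin⁺ N) (mk⇔ (λ _ → ∈-allFin _) (λ _ → c _))))) (Listₚ.length-tabulate (λ i → i))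

  module Joins {p₂ : ℕ} (K : Coefficients (suc p₂) 1) (TR : Translations (suc p₂) 1 (suc (suc p₂))) {N : ℕ} (conf : Fin N → Fin N → Bool) where
    private
      p₁ q : ℕ
      p₁ = suc p₂
      q  = suc p₁
    open Coefficients K
    open Cochains ring
    open Obstruction K using (T)
    open Chains K
    open ℤSolver ring
    open Spread K {N} {q}
    open Translations TR using (g; g-comm; g-period; g-injective; base)
    open Mult semiring using () renaming (_×_ to _⊠_)
    open import Relation.Binary.Reasoning.Setoid setoid

    private
      gC : Fin 1 → Colour → Colour
      gC i (c , z) = g i c , z

      Simplex : ∀ {n} → Vec Colour n → Set
      Simplex = Colouring (λ _ _ → false)

      Simplex-move : ∀ {n} i (l : Vec Colour n) → Simplex l → Simplex (Vec.map (gC i) l)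
      Simplex-move i l cl = ≡.subst (AllPairs (Compatible (λ _ _ → false))) (≡.sym (Vecₚ.toList-map (gC i) l))
        (AllPairsₚ.map⁺ (AllPairs.map (λ (ne , _) → (λ e → ne (g-injective i e)) , λ ()) cl))

      gC-comm : ∀ i j c → gC i (gC j c) ≡ gC j (gC i c)
      gC-comm i j (c , z) = ≡.cong (_, z) (g-comm i j c)

      gC-period : ∀ i c → iter (suc p₁) (gC i) c ≡ c
      gC-period i (c , z) = ≡.trans (go (suc p₁)) (≡.cong (_, z) (g-period i c))
        where
        go : ∀ n → iter n (gC i) (c , z) ≡ (iter n (g i) c , z)
        go zero    = ≡.refl
        go (suc n) = ≡.cong (gC i) (go n)

      module RC = Reaching gC Simplex
      module CC = Cycles K gC gC-comm gC-period Simplex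
      module FC = Filling {q = 1} K {q} (λ _ _ → false) (λ _ _ → ≡.refl) (λ _ → ≡.refl)

      -- The columns span a full simplex, a cone with apex `base`, so every cycle of positive degree
      -- can be filled.
      simplex : ∀ n → ∃ λ c → RC.Reach n c
      simplex zero = ((1# , (base , zero) ∷ []) ∷ []) , (([] ∷ []) ∷ []) , 1# , NZ-1 , λ φ → trans (+-identityʳ _) (*-congˡ (*-identityˡ _))
      simplex (suc n) = w , All.map proj₂ (proj₁ (proj₂ filled)) , c , 1# , NZ-1 , r ,
          λ alt → trans (proj₂ (proj₂ filled) alt) (trans (CC.ev-T (suc n) c _) (sym (*-identityˡ _)))
        where
        c = proj₁ (simplex n)
        r = proj₂ (simplex n)
        filled = FC.fill-cone (λ _ → true) (base , zero) n ≡.refl (λ { (b , zero) _ ne → (λ { ≡.refl → ne ≡.refl }) , λ () })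
          (CC.T-chain (suc n) c) (All.map (λ cl → All.tabulate (λ _ → ≡.refl) , cl) (ChainAction.X^-support RC.gV Simplex-move (expo p₁ (suc n)) (RC.Reach⇒Support n r)))
          (CC.reach-cycle n r)
        w = proj₁ filled

    gE : ∀ {n} → Fin 1 → Vec Entry n → Vec Entry n
    gE i = Vec.map (move g i)

    Region : (Fin N → Set) → ∀ {n} → Vec Entry n → Set
    Region D l = Colouring conf l × All (D ∘ proj₁) (toList l)

    Region-mono : ∀ {D D′ : Fin N → Set} → (∀ {v} → D v → D′ v) → ∀ {n} (l : Vec Entry n) → Region D l → Region D′ l
    Region-mono h l (cl , al) = cl , All.map h al

    Region-move : ∀ D {n} i (l : Vec Entry n) → Region D l → Region D (gE i l)
    Region-move D i l (cl , al) = Colouring-move TR conf i l cl , ≡.subst (All (D ∘ proj₁)) (≡.sym (Vecₚ.toList-map (move g i) l)) (Allₚ.map⁺ al)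

    Reach : (Fin N → Set) → ∀ n → Chain (Vec Entry (suc n)) → Set
    Reach D = Reaching.Reach (move g) (Region D)

    Reach-mono : ∀ {P P′ : ∀ {n} → Vec Entry n → Set} → (∀ {n} (l : Vec Entry n) → P l → P′ l) →
                 ∀ n {c} → Reaching.Reach (move g) P n c → Reaching.Reach (move g) P′ n c
    Reach-mono h zero    (sp , r)                = All.map (h _) sp , r
    Reach-mono h (suc n) (sp , c′ , ρ , nz , r , e) = All.map (h _) sp , c′ , ρ , nz , Reach-mono h n r , e

    module CE (D : Fin N → Set) = Cycles K (move {N} g) (move-comm {g = g} g-comm) (move-period {g = g} (suc p₁) g-period) (Region D)

    -- Rooks on a board with rows S and all the colours as columns
    private
      module Chess (S : List (Fin N)) (uniq : AllPairs _≢_ S) (size : length S ≡ p₁) where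

        support : ∀ {n} {c : Chain (Vec Colour n)} → Support Simplex c → Support (Region (_∈ S)) (bind c (spread S))
        support sp = bind-support sp λ l cl → All.map (λ (a , b , _) → a , b) (spread-support conf S uniq l cl)

        ev-chess : ∀ {n} (c : Chain (Vec Colour n)) φ → ev (bind c (spread S)) φ ≈ ev c (Sp S φ)
        ev-chess c φ = trans (ev-bind c (spread S) φ) (ev-cong c (λ l → ev-spread S l φ))

        ev-chess-d : ∀ {n} t → n ℕ.+ t ≡ p₁ → (c : Chain (Vec Colour (suc n))) (φ : Vec Entry n → Carrier) →
                     ev (bind c (spread S)) (d φ) ≈ (t ⊠ 1#) * ev c (d (Sp S φ))
        ev-chess-d t e c φ = trans (ev-chess c (d φ)) (trans (ev-cong c (λ l → Sp-d S t φ l (≡.trans size (≡.sym e)))) (ev-* c _ _))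

        T-chess : ∀ {n} m (c : Chain (Vec Colour n)) (φ : Vec Entry n → Carrier) → ev c (app (T RC.gV m) (Sp S φ)) ≈ ev (bind c (spread S)) (app (T gE m) φ)
        T-chess {n} m c φ = trans (ev-cong c (λ l → sym (Natural.X^-natural RC.gV gE (Sp S) (λ _ → ⊤) (λ _ _ _ → tt) (λ _ → ⊤) (λ _ → tt)
            (λ w _ → trans (Sp-cong S (λ _ → sym (zeroˡ 0#)) w) (trans (Sp-* S 0# (λ _ → 0#) w) (zeroˡ _)))
            (λ e w _ → Sp-cong S e w) (λ φ ψ w _ → Sp-+ S φ ψ w) (λ r φ w _ → Sp-* S r φ w) (λ i {φ} _ w _ → Sp-move (g i) S φ w) (expo p₁ m) {φ} tt l tt)))
          (sym (ev-chess c _))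

        -- Passing from columns to placements multiplies boundaries by the number of rows left free.
        -- This number lies between 1 and `p - 1`, so it is non-zero in characteristic `p`; here the
        -- size of the cliques enters.
        chess : ∀ n t → n ℕ.+ suc t ≡ p₁ → ∀ {c} → RC.Reach n c → Reach (_∈ S) n (bind c (spread S))
        chess n t e r = go n t e r
          where
          NZ-t : ∀ {n} t → n ℕ.+ suc t ≡ p₁ → NZ (suc t ⊠ 1#)
          NZ-t {n} t e = NZ-ℕ (suc t) (s≤s z≤n) (s≤s (≡.subst (suc t ≤_) e (ℕₚ.m≤n+m (suc t) n)))
          go : ∀ n t → n ℕ.+ suc t ≡ p₁ → ∀ {c} → RC.Reach n c → Reach (_∈ S) n (bind c (spread S))
          go zero t e {c} (sp , ρ , nz , eq) = support sp , (suc t ⊠ 1#) * ρ , NZ-* (NZ-t {0} t e) nz ,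
            λ φ → trans (ev-chess-d (suc t) e c φ) (trans (*-congˡ (eq (Sp S φ))) (sym (*-assoc _ _ _)))
          go (suc n) t e {c} (sp , c′ , ρ , nz , r , eq) = support sp , bind c′ (spread S) , (suc t ⊠ 1#) * ρ , NZ-* (NZ-t {suc n} t e) nz ,
            go n (suc t) (≡.trans (ℕₚ.+-suc n (suc t)) e) r ,
            λ {φ} alt → trans (ev-chess-d (suc t) e c φ) (trans (*-congˡ (trans (eq (Sp-Alt S alt)) (*-congˡ (T-chess (suc n) c′ φ)))) (sym (*-assoc _ _ _)))

        top : Chain (Vec Entry p₁)
        top = bind (proj₁ (simplex p₂)) (spread S)

        top-Reach : Reach (_∈ S) p₂ top
        top-Reach = chess p₂ 0 (ℕₚ.+-comm p₂ 1) (proj₂ (simplex p₂))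

        -- By `expo-shift` the operator with index `p - 1` is `X^(p-1)`, the one whose image `X`
        -- annihilates.
        z : Chain (Vec Entry p₁)
        z = CE.T-chain (_∈ S) p₁ top

        ev-z : ∀ φ → ev z φ ≈ ev top (app (T gE p₁) φ)
        ev-z = CE.ev-T (_∈ S) p₁ top

        z-support : Support (Region (_∈ S)) z
        z-support = ChainAction.X^-support gE (Region-move (_∈ S)) (expo p₁ p₁) (Reaching.Reach⇒Support (move g) (Region (_∈ S)) p₂ top-Reach)

        z-cycle : ∀ {φ : Vec Entry p₂ → Carrier} → Alt φ → ev z (d φ) ≈ 0#
        z-cycle = CE.reach-cycle (_∈ S) p₂ top-Reach

        private
          opaque
            unfolding diffOp
            X-unit : ∀ {n} (φ : Vec Entry n → Carrier) l → app (X gE) φ l ≈ φ (gE zero l) - φ l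
            X-unit φ l = trans (+-identityʳ _) (+-cong (trans (*-congʳ (ω₀ zero ≡.refl)) (*-identityˡ _)) (trans (*-congʳ (-‿cong (ω₀ zero ≡.refl))) (-1*x≈-x _)))
              where open import Algebra.Properties.Ring (CommutativeRing.ring ring) using (-1*x≈-x)

        -- With a single generator and `ω = 1`, X is `g - 1`, and applying it to `z` gives `X^p`,
        -- hence zero.
        z-invariant : ∀ i (φ : Vec Entry p₁ → Carrier) → ev z (φ ∘ gE i) ≈ ev z φ
        z-invariant zero φ = begin
          ev z (φ ∘ gE zero)                             ≈⟨ ev-cong z (λ l → solve 2 (λ a b → a := (a :- b) :+ b) refl _ (φ l)) ⟩
          ev z (λ l → (φ (gE zero l) - φ l) + φ l)       ≈⟨ ev-+ z _ _ ⟩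
          ev z (λ l → φ (gE zero l) - φ l) + ev z φ      ≈⟨ +-congʳ (ev-cong z (λ l → sym (X-unit φ l))) ⟩
          ev z (app (X gE) φ) + ev z φ                   ≈⟨ +-congʳ vanish ⟩
          0# + ev z φ                                    ≈⟨ +-identityˡ _ ⟩
          ev z φ                                         ∎
          where
          vanish : ev z (app (X gE) φ) ≈ 0#
          vanish = trans (ev-z _) (ev-0 top λ l → trans (reflexive (≡.cong (λ e → app (X gE ^ₒ e) (app (X gE) φ) l) (expo-shift isPrime 0)))
            (trans (^ₒ-shift (X gE) p₁ φ l) (Action.X^p≈0 gE (λ i j → map-comm (move-comm {g = g} g-comm i j)) (λ i → iter-map (suc p₁) (move-period {g = g} (suc p₁) g-period i)) φ l)))

        -- The slant product with `z`, dual to the join with `z`.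
        slant : ∀ {n} → (Vec Entry (n ℕ.+ p₁) → Carrier) → Vec Entry n → Carrier
        slant φ u = ev z (λ w → φ (u Vec.++ w))

        slant-Alt : ∀ {n} {φ : Vec Entry (n ℕ.+ p₁) → Carrier} → Alt φ → Alt (slant φ)
        slant-Alt {φ = φ} alt s = trans (ev-cong z (λ w → alt (Swap-++ s w))) (ev-neg z _)
          where
          Swap-++ : ∀ {n} {u v : Vec Entry n} → Swap u v → ∀ {m} (w : Vec Entry m) → Swap (u Vec.++ w) (v Vec.++ w)
          Swap-++ here      w = here
          Swap-++ (there s) w = there (Swap-++ s w)

        -- The deletions inside the second factor contribute the boundary of `z`, which vanishes.
        slant-d : ∀ {n} {φ : Vec Entry (n ℕ.+ p₁) → Carrier} → Alt φ → ∀ (u : Vec Entry (suc n)) → slant {suc n} (d φ) u ≈ d (slant {n} φ) u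
        slant-d {zero} {φ} alt (a ∷ []) = begin
          ev z (λ w → 1# * φ w - d (φ ∘ (a ∷_)) w)   ≈⟨ trans (ev-+ z _ _) (+-cong (ev-* z 1# φ) (ev-neg z _)) ⟩
          1# * ev z φ - ev z (d (φ ∘ (a ∷_)))        ≈⟨ +-congˡ (trans (-‿cong (z-cycle (Alt-∷ a alt))) -0#≈0#) ⟩
          1# * ev z φ + 0#                           ≈⟨ +-identityʳ _ ⟩
          1# * ev z φ                                ∎
          where open import Algebra.Properties.Ring (CommutativeRing.ring ring) using (-0#≈0#)
        slant-d {suc n} {φ} alt (a ∷ u) = trans (ev-+ z _ _) (+-cong (ev-* z 1# _) (trans (ev-neg z _) (-‿cong (slant-d (Alt-∷ a alt) u))))

        join : ∀ {n} → Chain (Vec Entry n) → Chain (Vec Entry (n ℕ.+ p₁))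
        join h = bind h (λ u → push (u Vec.++_) z)

        ev-join : ∀ {n} (h : Chain (Vec Entry n)) φ → ev (join h) φ ≈ ev h (slant φ)
        ev-join h φ = trans (ev-bind h _ φ) (ev-cong h (λ u → ev-push _ z φ))

        T-slant : ∀ {n} m (φ : Vec Entry (n ℕ.+ p₁) → Carrier) u → app (T gE m) (slant φ) u ≈ slant (app (T gE m) φ) u
        T-slant {n} m φ u = sym (Natural.X^-natural gE gE slant (λ _ → ⊤) (λ _ _ _ → tt) (λ _ → ⊤) (λ _ → tt)
          (λ u _ → ev-0 z (λ _ → refl)) (λ e u _ → ev-cong z (λ w → e _)) (λ φ ψ u _ → ev-+ z _ _) (λ r φ u _ → ev-* z r _)
          (λ i {φ} _ u _ → trans (ev-cong z (λ w → reflexive (≡.cong φ (Vecₚ.map-++ (move g i) u w)))) (z-invariant i (λ w → φ (gE i u Vec.++ w))))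
          (expo p₁ m) {φ} tt u tt)

        module _ {D D′ : Fin N → Set} (D⊆ : ∀ {v} → D v → D′ v) (S⊆ : ∀ {v} → v ∈ S → D′ v)
                 (apart : ∀ {v w} → D v → w ∈ S → v ≢ w × conf v w ≡ false) where

          join-support : ∀ {n} {h : Chain (Vec Entry n)} → Support (Region D) h → Support (Region D′) (join h)
          join-support sp = bind-support sp λ u (cu , du) → push-support (u Vec.++_) (λ w (cw , dw) →
            ≡.subst (λ x → AllPairs (Compatible conf) x × All (D′ ∘ proj₁) x) (≡.sym (Vecₚ.toList-++ u w))
              (AllPairsₚ.++⁺ cu cw (All.map (λ dv → All.map (λ sw → proj₁ (apart dv sw) , λ cf → ⊥-elim (true≢false cf (proj₂ (apart dv sw)))) dw) du) ,
               Allₚ.++⁺ (All.map D⊆ du) (All.map S⊆ dw))) z-support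

          -- The boundary of `h * z` is `∂h * z`. In degree zero `∂h` is a multiple of the empty
          -- simplex, leaving a multiple of `z`, that is, of T applied to `top`; so the sequence for
          -- the clique continues below that for `h`. Higher up, invariance of `z` lets T act on the
          -- whole join.
          Reach-join : ∀ n {h} → Reach D n h → Reach D′ (n ℕ.+ p₁) (join h)
          Reach-join zero {h} (sp , ρ , nz , e) = join-support sp , top , ρ , nz , Reach-mono (Region-mono S⊆) p₂ top-Reach ,
            λ {φ} alt → trans (ev-join h (d φ)) (trans (ev-cong h (slant-d {0} alt)) (trans (e (slant φ)) (*-congˡ (ev-z φ))))
          Reach-join (suc n) {h} (sp , h′ , ρ , nz , r , e) = join-support sp , join h′ , ρ , nz , Reach-join n r ,
            λ {φ} alt → begin
              ev (join h) (d φ)                                    ≈⟨ ev-join h (d φ) ⟩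
              ev h (slant (d φ))                                   ≈⟨ ev-cong h (slant-d {suc n} alt) ⟩
              ev h (d (slant φ))                                   ≈⟨ e (slant-Alt {suc n} alt) ⟩
              ρ * ev h′ (app (T gE (suc n)) (slant φ))             ≈⟨ *-congˡ (ev-cong h′ (T-slant (suc n) φ)) ⟩
              ρ * ev h′ (slant (app (T gE (suc n)) φ))             ≈⟨ *-congˡ (ev-join h′ _) ⟨
              -- The degree has risen by `p - 1`, which does not disturb the alternation of the
              -- operators.
              ρ * ev (join h′) (app (T gE (suc n)) φ)              ≡⟨ ≡.cong (λ m → ρ * ev (join h′) (app (X gE ^ₒ m) φ)) (expo-shift isPrime (suc n)) ⟨
              ρ * ev (join h′) (app (T gE (suc (n ℕ.+ p₁))) φ)     ∎

    -- A vertex without conflicts is the apex of a cone over T applied to `c`; since that chain is a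
    -- cycle, it is the whole boundary of the cone.
    Reach-cone : ∀ {D D′ : Fin N → Set} v → (∀ {w} → D w → D′ w) → D′ v → (∀ {w} → D w → v ≢ w × conf v w ≡ false) →
                 ∀ n {c} → Reach D n c → Reach D′ (suc n) (push ((v , base) ∷_) (CE.T-chain D (suc n) c))
    Reach-cone {D} {D′} v D⊆ dv apart n {c} r =
        push-support ((v , base) ∷_) (λ l (cl , dl) → (All.map (λ dw → proj₁ (apart dw) , λ cf → ⊥-elim (true≢false cf (proj₂ (apart dw)))) dl ∷ cl) , (dv ∷ All.map D⊆ dl))
          (ChainAction.X^-support gE (Region-move D) (expo p₁ (suc n)) (Reaching.Reach⇒Support (move g) (Region D) n r)) ,
        c , 1# , NZ-1 , Reach-mono (Region-mono D⊆) n r ,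
        λ {φ} alt → begin
          ev (push ((v , base) ∷_) t) (d φ)                     ≈⟨ ev-push _ t (d φ) ⟩
          ev t (λ l → 1# * φ l - d (φ ∘ ((v , base) ∷_)) l)     ≈⟨ trans (ev-+ t _ _) (+-cong (ev-* t 1# φ) (ev-neg t _)) ⟩
          1# * ev t φ - ev t (d (φ ∘ ((v , base) ∷_)))          ≈⟨ +-cong (*-congˡ (CE.ev-T D (suc n) c φ)) (trans (-‿cong (CE.reach-cycle D n r (Alt-∷ _ alt))) -0#≈0#) ⟩
          1# * ev c (app (T gE (suc n)) φ) + 0#                 ≈⟨ +-identityʳ _ ⟩
          1# * ev c (app (T gE (suc n)) φ)                      ∎
      where
      open import Algebra.Properties.Ring (CommutativeRing.ring ring) using (-0#≈0#)
      t = CE.T-chain D (suc n) c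

    -- With no vertex there is no chain to start from; otherwise the top chain uses every vertex of
    -- the list, so its degree is one less than the length.
    Reached : List (Fin N) → Set
    Reached L = L ≡ [] ⊎ ∃ λ n → ∃ λ c → suc n ≡ length L × Reach (_∈ L) n c

    add-vertex : ∀ v L → (∀ {w} → w ∈ L → v ≢ w × conf v w ≡ false) → Reached L → Reached (v ∷ L)
    add-vertex v L apart (inj₁ ≡.refl) = inj₂ (0 , ((1# , (v , base) ∷ []) ∷ []) , ≡.refl ,
      ((([] ∷ []) , (here ≡.refl ∷ [])) ∷ []) , 1# , NZ-1 , λ φ → trans (+-identityʳ _) (*-congˡ (*-identityˡ _)))
    add-vertex v L apart (inj₂ (n , c , e , r)) = inj₂ (suc n , _ , ≡.cong suc e , Reach-cone v there (here ≡.refl) apart n r)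

    add-clique : ∀ S L → AllPairs _≢_ S → length S ≡ p₁ → (∀ {v w} → v ∈ L → w ∈ S → v ≢ w × conf v w ≡ false) → Reached L → Reached (S ++ L)
    add-clique S L u e apart (inj₁ ≡.refl) = inj₂ (p₂ , top , ≡.trans (≡.sym e) (≡.cong length (≡.sym (Listₚ.++-identityʳ S))) , Reach-mono (Region-mono ∈-++⁺ˡ) p₂ top-Reach)
      where open Chess S u e
    add-clique S L u e apart (inj₂ (n , c , eq , r)) = inj₂ (n ℕ.+ p₁ , join c ,
        ≡.trans (ℕₚ.+-comm (suc n) p₁) (≡.trans (≡.cong₂ ℕ._+_ (≡.sym e) eq) (≡.sym (Listₚ.length-++ S))) , Reach-join (∈-++⁺ʳ S) ∈-++⁺ˡ apart n r)
      where open Chess S u e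

    module _ {t : ℕ} (clique : Fin t → Fin N → Bool) (clique-size : ∀ c → count (clique c) ≡ p₁)
             (disjoint : ∀ {c c′ v} → clique c v ≡ true → clique c′ v ≡ true → c ≡ c′)
             (conf-clique : ∀ {v w} → conf v w ≡ true → ∃ λ c → clique c v ≡ true × clique c w ≡ true) where

      private
        members : Fin t → List (Fin N)
        members c = List.filter (λ v → clique c v Bool.≟ true) (List.allFin N)

        ∈-members : ∀ {c v} → v ∈ members c → clique c v ≡ true
        ∈-members {c} m = proj₂ (∈-filter⁻ (λ v → clique c v Bool.≟ true) {xs = List.allFin N} m)

        outside : Fin N → Bool
        outside v = not (anyFin (λ c → clique c v))

        free : List (Fin N)
        free = List.filter (λ v → outside v Bool.≟ true) (List.allFin N)

        ∈-free : ∀ {v} → v ∈ free → ∀ c → clique c v ≡ true → ⊥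
        ∈-free {v} m c h = true≢false (anyFin-intro (λ c → clique c v) c h) (not-true (proj₂ (∈-filter⁻ (λ v → outside v Bool.≟ true) {xs = List.allFin N} m)))

        apart-free : ∀ {v w} → v ∈ free → conf v w ≡ false
        apart-free m = ¬true⇒false λ cf → let c , h , _ = conf-clique cf in ∈-free m c h

        stack : List (Fin t) → List (Fin N)
        stack []       = free
        stack (c ∷ cs) = members c ++ stack cs

        ∈-stack : ∀ cs {v} → v ∈ stack cs → v ∈ free ⊎ ∃ λ c → c ∈ cs × v ∈ members c
        ∈-stack []       m = inj₁ m
        ∈-stack (c ∷ cs) m = case ∈-++⁻ (members c) m of λ
          { (inj₁ h) → inj₂ (c , here ≡.refl , h)
          ; (inj₂ h) → case ∈-stack cs h of λ { (inj₁ f) → inj₁ f ; (inj₂ (c′ , i , h′)) → inj₂ (c′ , there i , h′) } }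

        stack-∈ : ∀ cs {c v} → c ∈ cs → v ∈ members c → v ∈ stack cs
        stack-∈ (c ∷ cs) (here ≡.refl) h = ∈-++⁺ˡ h
        stack-∈ (c ∷ cs) (there m)     h = ∈-++⁺ʳ (members c) (stack-∈ cs m h)

        free-stack : ∀ cs {v} → v ∈ free → v ∈ stack cs
        free-stack []       h = h
        free-stack (c ∷ cs) h = ∈-++⁺ʳ (members c) (free-stack cs h)

        apart-stack : ∀ {c cs} → All (c ≢_) cs → ∀ {v w} → v ∈ stack cs → w ∈ members c → v ≢ w × conf v w ≡ false
        apart-stack {c} {cs} new {v} {w} mv mw = case ∈-stack cs mv of λ
          { (inj₁ f) → (λ { ≡.refl → ∈-free f c (∈-members mw) }) , apart-free f
          ; (inj₂ (c′ , i , h)) → (λ { ≡.refl → All.lookup new i (disjoint (∈-members mw) (∈-members h)) }) ,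
              ¬true⇒false λ cf → let c″ , hv , hw = conf-clique cf in
                All.lookup new i (≡.trans (disjoint (∈-members mw) hw) (disjoint hv (∈-members h))) }

        unique-stack : ∀ cs → AllPairs _≢_ cs → AllPairs _≢_ (stack cs)
        unique-stack []       _        = Uniqueₚ.filter⁺ _ (Uniqueₚ.allFin⁺ N)
        unique-stack (c ∷ cs) (p ∷ ps) = AllPairsₚ.++⁺ (Uniqueₚ.filter⁺ _ (Uniqueₚ.allFin⁺ N)) (unique-stack cs ps)
          (All.tabulate λ mw → All.tabulate λ mv e → proj₁ (apart-stack p mv mw) (≡.sym e))

        reached-free : ∀ L → AllPairs _≢_ L → (∀ {v} → v ∈ L → v ∈ free) → Reached L
        reached-free []      _        h = inj₁ ≡.refl
        reached-free (v ∷ L) (p ∷ ps) h = add-vertex v L (λ m → All.lookup p m , apart-free (h (here ≡.refl))) (reached-free L ps (h ∘ there))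

        reached-stack : ∀ cs → AllPairs _≢_ cs → Reached (stack cs)
        reached-stack []       _        = reached-free free (Uniqueₚ.filter⁺ _ (Uniqueₚ.allFin⁺ N)) (λ m → m)
        reached-stack (c ∷ cs) (p ∷ ps) = add-clique (members c) (stack cs) (Uniqueₚ.filter⁺ _ (Uniqueₚ.allFin⁺ N))
          (≡.trans (length-filter (clique c) (λ v → v)) (clique-size c)) (apart-stack p) (reached-stack cs ps)

        complete : ∀ v → v ∈ stack (List.allFin t)
        complete v = case bool (anyFin (λ c → clique c v)) of λ
          { (inj₁ h) → let c , hc = anyFin-true {f = λ c → clique c v} h in stack-∈ (List.allFin t) (∈-allFin c) (∈-filter⁺ (λ v → clique c v Bool.≟ true) (∈-allFin v) hc)
          ; (inj₂ h) → free-stack (List.allFin t) (∈-filter⁺ (λ v → outside v Bool.≟ true) (∈-allFin v) (not-intro h)) }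

      reach-cliques : 0 < N → ∃ λ n → suc n ≡ N × ∃ λ c → Reaching.Reach (move {N} g) (Colouring conf) n c
      reach-cliques N>0 = case reached-stack (List.allFin t) (Uniqueₚ.allFin⁺ t) of λ
          { (inj₁ e) → ⊥-elim (ℕₚ.<⇒≢ N>0 (≡.trans (≡.sym (≡.cong length e)) size))
          ; (inj₂ (n , c , e , r)) → n , ≡.trans e size , c , Reach-mono (λ l → proj₁) n r }
        where
        size : length (stack (List.allFin t)) ≡ N
        size = enumeration-length _ (unique-stack (List.allFin t) (Uniqueₚ.allFin⁺ t)) complete

-- Ordering along the path, translation into subsets, and the two cases.

open import Defs hiding (sym)
open OperatorAlgebra
open AlternatingCochains
open Obstructions
open ChainPairings
open Counting
open TranslationLabels
open RankComparison
open Colourings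
open SparseConflicts
open SeriesCoefficients
open CliqueJoins
open import Data.Bool.Properties using (∧-comm; ∨-comm)
open import Data.Nat using (_+_; _*_; NonZero)
open ℕD using (m/n*n≤m; m≥n⇒m/n>0)
open import Data.Nat.Primality using (prime⇒nonTrivial; ¬prime[0])
open import Data.Fin.Permutation using (_⟨$⟩ʳ_; _⟨$⟩ˡ_; _∘ₚ_; transpose; inverseʳ; inverseˡ)
open import Data.Fin.Subset using (Subset; _∈_; _∉_; _─_; _∩_; ⋃; ∣_∣)
open import Data.Fin.Subset.Properties using (p⊆q⇒∣p∣≤∣q∣; x∈p∩q⁺; p─q⊆p; p⊆p∪q; q⊆p∪q)
open import Data.Vec using (tabulate; here; there)
open import Function using (Injective)
open import Relation.Nullary.Decidable using (dec-true; dec-false)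
open ≡ using (refl; sym; trans)

-- One transposition per path vertex: it exchanges the present position of the next vertex with its
-- target, and neither of these is a position already settled.
arrange : ∀ {n N} (f : Fin n → Fin N) → Injective _≡_ _≡_ f → Σ (Permutation′ N) λ π → ∀ i → toℕ (π ⟨$⟩ˡ f i) ≡ toℕ i
arrange {n} {N} f f-inj = let π , h = go n ≤-refl in π , λ i → h i (Finₚ.toℕ<n i)
  where
  n≤N : n ≤ N
  n≤N = Finₚ.injective⇒≤ f-inj
  transpose-left : ∀ (a b : Fin N) → PC.transpose a b a ≡ b
  transpose-left a b rewrite dec-true (a Fin.≟ a) refl = refl
  transpose-other : ∀ (a b c : Fin N) → c ≢ a → c ≢ b → PC.transpose a b c ≡ c
  transpose-other a b c na nb rewrite dec-false (c Fin.≟ a) na | dec-false (c Fin.≟ b) nb = refl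
  go : ∀ k → k ≤ n → Σ (Permutation′ N) λ π → ∀ i → toℕ i < k → toℕ (π ⟨$⟩ˡ f i) ≡ toℕ i
  go zero    _   = Perm.id , λ _ ()
  go (suc k) k<n = transpose a b ∘ₚ π , place
    where
    π = proj₁ (go k (ℕₚ.<⇒≤ k<n))
    x : Fin N
    x = f (fromℕ< k<n)
    a b : Fin N
    a = fromℕ< (≤-trans k<n n≤N)
    b = π ⟨$⟩ˡ x
    a≡k : toℕ a ≡ k
    a≡k = Finₚ.toℕ-fromℕ< (≤-trans k<n n≤N)
    place : ∀ i → toℕ i < suc k → toℕ (PC.transpose b a (π ⟨$⟩ˡ f i)) ≡ toℕ i
    place i (s≤s le) with toℕ i ℕ.≟ k
    ... | yes e = trans (cong toℕ (trans (cong (λ j → PC.transpose b a (π ⟨$⟩ˡ f j)) i≡) (transpose-left b a))) (trans a≡k (sym e))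
      where
      i≡ : i ≡ fromℕ< k<n
      i≡ = Finₚ.toℕ-injective (trans e (sym (Finₚ.toℕ-fromℕ< k<n)))
    ... | no ne = trans (cong toℕ (transpose-other b a (π ⟨$⟩ˡ f i) ≢b ≢a)) at-i
      where
      at-i : toℕ (π ⟨$⟩ˡ f i) ≡ toℕ i
      at-i = proj₂ (go k (ℕₚ.<⇒≤ k<n)) i (ℕₚ.≤∧≢⇒< le ne)
      ≢a : π ⟨$⟩ˡ f i ≢ a
      ≢a e = ne (trans (sym at-i) (trans (cong toℕ e) a≡k))
      ≢b : π ⟨$⟩ˡ f i ≢ b
      ≢b e = ne (trans (cong toℕ (f-inj (trans (sym (inverseʳ π)) (trans (cong (π ⟨$⟩ʳ_) e) (inverseʳ π))))) (Finₚ.toℕ-fromℕ< k<n))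

∣∣-count : ∀ {n} (p : Subset n) → ∣ p ∣ ≡ count (lookup p)
∣∣-count []          = refl
∣∣-count (true ∷ p)  = cong suc (∣∣-count p)
∣∣-count (false ∷ p) = ∣∣-count p

∣tabulate∣ : ∀ {n} (f : Fin n → Bool) → ∣ tabulate f ∣ ≡ count f
∣tabulate∣ f = trans (∣∣-count (tabulate f)) (count-cong (Vecₚ.lookup∘tabulate f))

∈-tabulate⁺ : ∀ {n} (f : Fin n → Bool) {v} → f v ≡ true → v ∈ tabulate f
∈-tabulate⁺ f {v} e = Vecₚ.lookup⇒[]= v (tabulate f) (trans (Vecₚ.lookup∘tabulate f v) e)

∈-tabulate⁻ : ∀ {n} (f : Fin n → Bool) {v} → v ∈ tabulate f → f v ≡ true
∈-tabulate⁻ f {v} m = trans (sym (Vecₚ.lookup∘tabulate f v)) (Vecₚ.[]=⇒lookup m)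

x∈p─q⇒x∉q : ∀ {n} (p q : Subset n) {x} → x ∈ p ─ q → x ∉ q
x∈p─q⇒x∉q (_ ∷ p) (false ∷ q) here      ()
x∈p─q⇒x∉q (_ ∷ p) (b ∷ q)     (there m) (there m′) = x∈p─q⇒x∉q p q m m′

∈-⋃-tabulate : ∀ {n q} (S : Fin q → Subset n) i {x} → x ∈ S i → x ∈ ⋃ (List.tabulate S)
∈-⋃-tabulate S zero    m = p⊆p∪q _ m
∈-⋃-tabulate S (suc i) m = q⊆p∪q (S zero) _ (∈-⋃-tabulate (S ∘ suc) i m)

eqB-comm : ∀ {N} (u v : Fin N) → eqB u v ≡ eqB v u
eqB-comm {N} = Distinct.eqB-comm {N} {1}

pathEdge-sym : ∀ {N} {G : Graph N} (P : SimplePath G) u v → pathEdge P u v ≡ pathEdge P v u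
pathEdge-sym P u v = anyFin-cong λ i → ∨-comm (eqB u (vtx P (inject₁ i)) ∧ eqB v (vtx P (suc i))) _

module Splitting {p₁ k₁ q₁ : ℕ} (K : Coefficients p₁ (suc k₁)) (TR : Translations p₁ (suc k₁) (suc q₁))
  {N m : ℕ} (G : Graph N) (part : Fin N → Fin m) (P : SimplePath G) (conf : Fin N → Fin N → Bool)
  (conf-sym : ∀ u v → conf u v ≡ conf v u) (conf-irr : ∀ v → conf v v ≡ false)
  (edge : ∀ u v → adj G u v ≡ true → conf u v ≡ true ⊎ pathEdge P u v ≡ true)
  (large : ∀ j → q₁ ≤ ∣ partSet part j ∣) (many : suc (m * q₁) ≤ N) where

  open Coefficients K using (isPrime)

  private
    π : Permutation′ N
    π = proj₁ (arrange (vtx P) (inj P))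

  to from : Fin N → Fin N
  to   = π ⟨$⟩ʳ_
  from = π ⟨$⟩ˡ_

  to-from : ∀ v → to (from v) ≡ v
  to-from v = inverseʳ π

  from-to : ∀ v → from (to v) ≡ v
  from-to v = inverseˡ π

  to-injective : ∀ {u v} → to u ≡ to v → u ≡ v
  to-injective {u} {v} e = trans (sym (from-to u)) (trans (cong from e) (from-to v))

  count-to : ∀ f → count (f ∘ to) ≡ count f
  count-to = count-permute to from to-from from-to

  -- Conflicts are transported to positions, where the path edges join consecutive numbers and
  -- colours are read in path order.
  conf′ : Fin N → Fin N → Bool
  conf′ u v = conf (to u) (to v)

  conf′-sym : ∀ u v → conf′ u v ≡ conf′ v u
  conf′-sym u v = conf-sym (to u) (to v)

  conf′-irr : ∀ v → conf′ v v ≡ false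
  conf′-irr v = conf-irr (to v)

  private
    thr : Fin m → ℕ
    thr j = (∣ partSet part j ∣ + 1) / suc q₁

    -- What is left of `N` after `q - 1` vertices for each class and one more: the largest number of
    -- runs that does not yet force a good colouring.
    α : ℕ
    α = N ∸ suc (m * q₁)

    N≡ : N ≡ suc (α + m * q₁)
    N≡ = trans (sym (ℕₚ.m∸n+n≡m many)) (ℕₚ.+-suc α (m * q₁))

    thr≥1 : ∀ j → 1 ≤ thr j
    thr≥1 j = m≥n⇒m/n>0 (≤-trans (s≤s (large j)) (≤-reflexive (ℕₚ.+-comm 1 _)))

    thr≤ : ∀ j → suc q₁ * thr j ≤ suc (count (λ v → eqB (part (to v)) j))
    thr≤ j = ≤-trans (≤-reflexive (ℕₚ.*-comm (suc q₁) (thr j))) (≤-trans (m/n*n≤m (∣ partSet part j ∣ + 1) (suc q₁))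
      (≤-reflexive (trans (ℕₚ.+-comm _ 1) (cong suc (trans (∣tabulate∣ (λ v → eqB (part v) j)) (sym (count-to (λ v → eqB (part v) j))))))))

    module A = Assemble K TR (part ∘ to) thr conf′ conf′-sym conf′-irr α N≡ thr≥1 thr≤
    module R = Ranks isPrime TR (part ∘ to) thr conf′ α N≡ thr≥1 thr≤

    admits : R.Good → AdmitsAFSIndep G part (suc q₁)
    admits good = S , (disjoint , balanced , leftover) , independent
      where
      module Z = R.Good good
      κ : Fin N → Maybe (Fin (suc q₁))
      κ v = Z.z (from v)
      S : Fin (suc q₁) → Subset N
      S i = tabulate (λ v → hasCol i (κ v))
      colour : ∀ {i v} → v ∈ S i → κ v ≡ just i
      colour {i} {v} m = hasCol-just {m = κ v} (∈-tabulate⁻ (λ v → hasCol i (κ v)) m)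
      disjoint : PairwiseDisjoint S
      disjoint i i′ v m m′ = just-injective (trans (sym (colour m)) (colour m′))
      transport : ∀ j (f : Maybe (Fin (suc q₁)) → Bool) → count (λ v → eqB (part (to v)) j ∧ f (Z.z v)) ≡ count (λ v → eqB (part v) j ∧ f (κ v))
      transport j f = trans (count-cong (λ v → cong (λ u → eqB (part (to v)) j ∧ f (Z.z u)) (sym (from-to v)))) (count-to (λ v → eqB (part v) j ∧ f (κ v)))
      balanced : ∀ i j → thr j ≤ ∣ S i ∩ partSet part j ∣ + 1
      balanced i j = ≤-trans (Z.fair j i) (≤-trans (s≤s (≤-trans (≤-reflexive (trans (transport j (hasCol i)) (sym (∣tabulate∣ (λ v → eqB (part v) j ∧ hasCol i (κ v))))))
        (p⊆q⇒∣p∣≤∣q∣ {p = tabulate (λ v → eqB (part v) j ∧ hasCol i (κ v))} {q = S i ∩ partSet part j} λ {v} m →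
          let pj , ci = ∧-true {eqB (part v) j} (∈-tabulate⁻ (λ v → eqB (part v) j ∧ hasCol i (κ v)) m) in
          x∈p∩q⁺ (∈-tabulate⁺ (λ v → hasCol i (κ v)) ci , ∈-tabulate⁺ (λ v → eqB (part v) j) pj)))) (≤-reflexive (ℕₚ.+-comm 1 _)))
      leftover : ∀ j → ∣ partSet part j ─ ⋃ (List.tabulate S) ∣ ≤ q₁
      leftover j = ≤-trans (p⊆q⇒∣p∣≤∣q∣ {p = partSet part j ─ ⋃ (List.tabulate S)} {q = tabulate (λ v → eqB (part v) j ∧ not (is-just (κ v)))} λ {v} m →
          ∈-tabulate⁺ (λ v → eqB (part v) j ∧ not (is-just (κ v))) (∧-intro (∈-tabulate⁻ (λ v → eqB (part v) j) (p─q⊆p (partSet part j) _ m))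
            (not-intro (¬true⇒false λ h → let a , ka = is-just-elim {m = κ v} h in
              x∈p─q⇒x∉q (partSet part j) _ m (∈-⋃-tabulate S a (∈-tabulate⁺ (λ v → hasCol a (κ v)) (just-hasCol {m = κ v} ka)))))))
        (≤-trans (≤-reflexive (trans (∣tabulate∣ (λ v → eqB (part v) j ∧ not (is-just (κ v)))) (sym (transport j (λ c → not (is-just c)))))) (Z.missing j))
      -- The two ends of a path edge occupy consecutive positions, so the separation of consecutive
      -- vertices takes care of the path edges.
      step : ∀ i → toℕ (from (vtx P (suc i))) ≡ suc (toℕ (from (vtx P (inject₁ i))))
      step i = trans (proj₂ (arrange (vtx P) (inj P)) (suc i)) (cong suc (sym (trans (proj₂ (arrange (vtx P) (inj P)) (inject₁ i)) (Finₚ.toℕ-inject₁ i))))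
      path-apart : ∀ {a u v} i → eqB u (vtx P (inject₁ i)) ∧ eqB v (vtx P (suc i)) ≡ true → κ u ≡ just a → κ v ≡ just a → ⊥
      path-apart {a} {u} {v} i e ku kv with ∧-true {eqB u (vtx P (inject₁ i))} e
      ... | eu , ev = Z.consecutive (from u) (from v) (subst₂ (λ x y → toℕ (from y) ≡ suc (toℕ (from x))) (sym (eqB-true eu)) (sym (eqB-true ev)) (step i)) ku kv
      independent : ∀ i → IndependentSet G (S i)
      independent i u v mu mv = ¬true⇒false λ e → case edge u v e of λ
        { (inj₁ c) → Z.independent (from u) (from v) (trans (cong₂ conf (to-from u) (to-from v)) c) (colour mu) (colour mv)
        ; (inj₂ pe) → let j , h = anyFin-true pe in
            case ∨-true {eqB u (vtx P (inject₁ j)) ∧ eqB v (vtx P (suc j))} h of λ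
              { (inj₁ h₁) → path-apart j h₁ (colour mu) (colour mv)
              ; (inj₂ h₂) → path-apart j h₂ (colour mv) (colour mu) } }

  splitting : ∀ {n} → suc n ≡ N → ∀ {c} → Chains.Reaching.Reach K (move {N} (Translations.g TR)) (Colouring conf′) n c → AdmitsAFSIndep G part (suc q₁)
  splitting e r = admits (A.good-from-chain e r)

sumF-𝟙 : ∀ {n} (f : Fin n → Bool) → sumF (𝟙 ∘ f) ≡ count f
sumF-𝟙 {zero}  f = refl
sumF-𝟙 {suc n} f = cong (𝟙 (f zero) +_) (sumF-𝟙 (f ∘ suc))

2≤prime : ∀ {p} → Prime p → 2 ≤ p
2≤prime {p} pr = ℕ.nonTrivial⇒n>1 p {{prime⇒nonTrivial pr}}

part-a : ∀ {N m : ℕ} (G : Graph N) (part : Fin N → Fin m) (q₁ : ℕ) → IsPrimePower (suc q₁)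
       → (∀ j → q₁ ≤ ∣ partSet part j ∣) → q₁ * (m + 2) + 1 ≤ N
       → (P : SimplePath G)
       → (∀ v → 2 * nbrCount (deletePath G P) v + dist2Count (deletePath G P) v < suc q₁)
       → AdmitsAFSIndep G part (suc q₁)
part-a G part q₁ (zero , k , pr , e) large many P sparse = ⊥-elim (¬prime[0] pr)
part-a {N} {m} G part q₁ (suc p₁ , k , pr , e) large many P sparse = finish N refl
  where
  K : Coefficients p₁ (suc k)
  K = coefficients pr (suc k)
  TR : Translations p₁ (suc k) (suc q₁)
  TR = subst (Translations p₁ (suc k)) (sym e) (translations p₁ (suc k) (2≤prime pr))
  conf : Fin N → Fin N → Bool
  conf = deletePath G P
  conf-sym : ∀ u v → conf u v ≡ conf v u
  conf-sym u v = cong₂ (λ a b → a ∧ not b) (Graph.sym G u v) (pathEdge-sym P u v)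
  conf-irr : ∀ v → conf v v ≡ false
  conf-irr v = cong (_∧ not (pathEdge P v v)) (irrefl G v)
  edge : ∀ u v → adj G u v ≡ true → conf u v ≡ true ⊎ pathEdge P u v ≡ true
  edge u v h = case bool (pathEdge P u v) of λ { (inj₁ pe) → inj₂ pe ; (inj₂ np) → inj₁ (∧-intro h (not-intro np)) }
  enough : suc (m * q₁) ≤ N
  enough = ≤-trans (≤-trans (s≤s (≤-trans (≤-reflexive (ℕₚ.*-comm m q₁)) (ℕₚ.*-monoʳ-≤ q₁ (ℕₚ.m≤m+n m 2)))) (≤-reflexive (ℕₚ.+-comm 1 _))) many
  open Splitting K TR G part P conf conf-sym conf-irr edge large enough
  near : Fin N → Fin N → Bool
  near v u = not (eqB u v) ∧ not (conf v u) ∧ anyFin (λ w → conf v w ∧ conf w u)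
  -- Neighbours count twice and vertices at distance two once, so the weights at `v` add up to the
  -- quantity bounded by the hypothesis.
  wt : Fin N → Fin N → ℕ
  wt v u = (𝟙 (conf (to v) (to u)) + 𝟙 (conf (to v) (to u))) + 𝟙 (near (to v) (to u))
  wt-adj : ∀ u v → conf′ u v ≡ true → 2 ≤ wt u v
  wt-adj u v h = ≤-trans (≤-reflexive (cong (λ b → 𝟙 b + 𝟙 b) (sym h))) (ℕₚ.m≤m+n _ _)
  wt-dist2 : ∀ u w v → conf′ u w ≡ true → conf′ w v ≡ true → u ≢ v → 1 ≤ wt u v
  wt-dist2 u w v h h′ ne = case bool (conf′ u v) of λ
    { (inj₁ c) → ≤-trans (s≤s z≤n) (wt-adj u v c)
    ; (inj₂ c) → ≤-trans (≤-reflexive (cong 𝟙 (sym (∧-intro (not-intro (eqB-false λ e′ → ne (sym (to-injective e′))))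
        (∧-intro (not-intro c) (anyFin-intro (λ w → conf (to u) w ∧ conf w (to v)) (to w) (∧-intro h h′))))))) (ℕₚ.m≤n+m _ _) }
  total : ∀ v → sumF (λ u → if not (eqB u v) then wt v u else 0) < suc q₁
  total v = ≤-trans (s≤s (≤-trans (sumF-mono (λ u → drop-if (not (eqB u v)) (wt v u))) (≤-reflexive sums))) (sparse (to v))
    where
    drop-if : ∀ b n → (if b then n else 0) ≤ n
    drop-if true  n = ≤-refl
    drop-if false n = z≤n
    c₁ : sumF (λ u → 𝟙 (conf (to v) (to u))) ≡ nbrCount conf (to v)
    c₁ = trans (sumF-𝟙 (λ u → conf (to v) (to u))) (count-to (conf (to v)))
    sums : sumF (wt v) ≡ 2 * nbrCount conf (to v) + dist2Count conf (to v)
    sums = trans (sumF-+ (λ u → 𝟙 (conf (to v) (to u)) + 𝟙 (conf (to v) (to u))) (λ u → 𝟙 (near (to v) (to u))))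
      (cong₂ _+_ (trans (sumF-+ (λ u → 𝟙 (conf (to v) (to u))) (λ u → 𝟙 (conf (to v) (to u)))) (trans (cong₂ _+_ c₁ c₁) (cong (nbrCount conf (to v) +_) (sym (ℕₚ.+-identityʳ _)))))
        (trans (sumF-𝟙 (λ u → near (to v) (to u))) (count-to (near (to v)))))
  finish : ∀ n → n ≡ N → AdmitsAFSIndep G part (suc q₁)
  finish zero    e′ = ⊥-elim (ℕₚ.n≮0 (subst (suc (m * q₁) ≤_) (sym e′) enough))
  finish (suc n) e′ = splitting e′ (proj₂ (Greedy.reach K conf′ conf′-sym conf′-irr wt wt-adj wt-dist2 TR total (subst Fin e′ zero) zero n (≤-reflexive e′)))

part-b : ∀ {N m : ℕ} (G : Graph N) (part : Fin N → Fin m) (p₂ : ℕ) → Prime (suc (suc p₂))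
       → (∀ j → suc p₂ ≤ ∣ partSet part j ∣)
       → (n : ℕ) → N ≡ suc p₂ * n + 1 → m + 1 ≤ n
       → (P : SimplePath G) (t : ℕ) (C : Fin t → Subset N)
       → IsPathPlusCliques G P (suc p₂) t C
       → AdmitsAFSIndep G part (suc (suc p₂))
part-b {N} {m} G part p₂ pr large n N≡ m<n P t C (size , disjoint , edges , _) =
    let _ , e , _ , r = Joins.reach-cliques K TR conf′ clique (λ c → trans (count-to (lookup (C c))) (trans (sym (∣∣-count (C c))) (size c)))
          (λ {c} {c′} {v} h h′ → disjoint c c′ (to v) (Vecₚ.lookup⇒[]= (to v) (C c) h) (Vecₚ.lookup⇒[]= (to v) (C c′) h′))
          (λ {u} {v} h → let c , hc = anyFin-true {f = λ c → lookup (C c) (to u) ∧ lookup (C c) (to v)} (proj₂ (∧-true {not (eqB (to u) (to v))} h))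
                         in c , ∧-true {lookup (C c) (to u)} hc)
          (≤-trans (s≤s z≤n) enough)
    in splitting e r
  where
  K : Coefficients (suc p₂) 1
  K = coefficients pr 1
  TR : Translations (suc p₂) 1 (suc (suc p₂))
  TR = subst (Translations (suc p₂) 1) (ℕₚ.*-identityʳ (suc (suc p₂))) (translations (suc p₂) 1 (2≤prime pr))
  conf : Fin N → Fin N → Bool
  conf u v = not (eqB u v) ∧ anyFin (λ c → lookup (C c) u ∧ lookup (C c) v)
  conf-sym : ∀ u v → conf u v ≡ conf v u
  conf-sym u v = cong₂ (λ a b → not a ∧ b) (eqB-comm u v) (anyFin-cong λ c → ∧-comm (lookup (C c) u) (lookup (C c) v))
  conf-irr : ∀ v → conf v v ≡ false
  conf-irr v = cong (λ b → not b ∧ anyFin (λ c → lookup (C c) v ∧ lookup (C c) v)) (eqB-refl v)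
  edge : ∀ u v → adj G u v ≡ true → conf u v ≡ true ⊎ pathEdge P u v ≡ true
  edge u v h = case ∨-true {pathEdge P u v} (trans (sym (edges u v)) h) of λ { (inj₁ x) → inj₂ x ; (inj₂ x) → inj₁ x }
  enough : suc (m * suc p₂) ≤ N
  enough = ≤-trans (s≤s (≤-trans (≤-reflexive (ℕₚ.*-comm m (suc p₂))) (ℕₚ.*-monoʳ-≤ (suc p₂) (≤-trans (ℕₚ.m≤m+n m 1) m<n)))) (≤-reflexive (trans (ℕₚ.+-comm 1 _) (sym N≡)))
  open Splitting K TR G part P conf conf-sym conf-irr edge large enough
  clique : Fin t → Fin N → Bool
  clique c v = lookup (C c) (to v)

theorem5p3 : (∀ {N m : ℕ} (G : Graph N) (part : Fin N → Fin m) (q : ℕ) .{{_ : NonZero q}}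
    → IsPrimePower q → 2 ≤ q
    → (∀ j → q ∸ 1 ≤ ∣ partSet part j ∣)
    → (q ∸ 1) * (m + 2) + 1 ≤ N
    → (P : SimplePath G)
    → (∀ v → 2 * nbrCount (deletePath G P) v + dist2Count (deletePath G P) v < q)
    → AdmitsAFSIndep G part q)
    ×
    (∀ {N m : ℕ} (G : Graph N) (part : Fin N → Fin m) (q : ℕ) .{{_ : NonZero q}}
    → Prime q → 2 ≤ q
    → (∀ j → q ∸ 1 ≤ ∣ partSet part j ∣)
    → (n : ℕ) → N ≡ (q ∸ 1) * n + 1 → m + 1 ≤ n
    → (P : SimplePath G) (t : ℕ) (C : Fin t → Subset N)
    → IsPathPlusCliques G P (q ∸ 1) t C
    → AdmitsAFSIndep G part q)
theorem5p3 =
  (λ { G part (suc q₁) pp _ large many P sparse → part-a G part q₁ pp large many P sparse }) ,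
  (λ { G part (suc (suc p₂)) pr _ large n N≡ m<n P t C h → part-b G part p₂ pr large n N≡ m<n P t C h
     ; G part (suc zero) pr (s≤s ()) })
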